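{- A topological sorting of a directed acyclic input graph $G=(V,E)$ with $n$ vertices and $m$ edges can be computed in $O(n+m)$ time with at most any of the following numbers of bits: (a) $\bigl(2n+2L_0^{\mathrm{in}}(G)\bigr)\bigl(1+O\bigl(\frac{\log\log n}{\log n}\bigr)\bigr)$; (b) $\bigl(2n+\frac{4}{3}m\bigr)\bigl(1+O\bigl(\frac{\log\log n}{\log n}\bigr)\bigr)$; (c) $2n\log\bigl(2+\frac{4m}{n}\bigr)\bigl(1+O\bigl(\frac{\log\log n}{\log n}\bigr)\bigr)$.
   Context: $\log$ denotes $\log_2$. $L_0^{\mathrm{in}}(G)=\sum_{v\in V,\ d_v\ge 2}\lceil\log_2 d_v\rceil$, where $d_v$ is the indegree of $v$ in $G$. Topologically sorting $G$ means outputting the vertices of $G$ in an order such that for each $(u,v)\in E$, $u$ is output before $v$. Model of computation: word RAM with word length $\Omega(\log n)$ bits and constant-time standard word operations; the input is read-only, the output is write-only, and space is the number of bits of working memory, not counting input and output. Input representation: the vertex set is $V=\{1,\ldots,n\}$ for a known integer $n\ge 1$. The directed graph is represented with in/out adjacency arrays, i.e., the in- and outdegree of each vertex are available and the inneighbors as well as the outneighbors of each vertex can be accessed by index in constant time, and there are cross links: for each edge $(u,v)$, a function $\mathrm{mate}$ maps in constant time the position of $v$ in the adjacency array of $u$ to that of $u$ in the adjacency array of $v$ and vice versa. -}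

module Defs where

open import Data.Bool using (Bool; true; false; _∧_; _∨_; _xor_; if_then_else_)
open import Data.Fin using (Fin; toℕ; fromℕ<) renaming (_<_ to _<ᶠ_)
open import Data.Fin.Permutation using (Permutation′; _⟨$⟩ʳ_; _⟨$⟩ˡ_)
open import Data.List as List using (List; []; _∷_; _∷ʳ_; tabulate)
open import Data.Maybe using (Maybe; just; nothing; _>>=_)
open import Data.Nat
open import Data.Nat.DivMod using (_mod_)
open import Data.Nat.Logarithm using (⌊log₂_⌋; ⌈log₂_⌉)
open import Data.Nat.Properties using (m^n≢0; +-0-commutativeMonoid)
open import Data.Product using (Σ; ∃-syntax; _×_; _,_)
open import Data.Vec as Vec using (Vec; lookup; _[_]≔_)
open import Function.Definitions using (Injective)
open import Relation.Binary.Construct.Closure.Transitive using (TransClosure)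
open import Relation.Binary.PropositionalEquality using (_≡_)
open import Relation.Nullary using (¬_)
open import Relation.Nullary.Decidable using (dec⇒maybe)
open import Algebra.Properties.CommutativeMonoid.Sum +-0-commutativeMonoid
  using (sum)

------------------------------------------------------------------------
-- Directed graphs with vertex set {1,…,n}, the element v of Fin n standing
-- for the vertex 1 + toℕ v, given by adjacency arrays with cross links.

record Digraph (n : ℕ) : Set where
  field
    outdeg indeg : Fin n → ℕ
    outNbr : (u : Fin n) → Fin (outdeg u) → Fin n
    inNbr  : (v : Fin n) → Fin (indeg v) → Fin n

    -- E is a set: there are no parallel edges.
    outNbr-injective : ∀ u → Injective _≡_ _≡_ (outNbr u)
    inNbr-injective  : ∀ v → Injective _≡_ _≡_ (inNbr v)

    -- The two halves of the function mate.  Their existence makes the in-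
    -- and out-arrays describe the same edge set, and by injectivity they
    -- are mutually inverse.
    outMate : (u : Fin n) (i : Fin (outdeg u)) → Fin (indeg (outNbr u i))
    inMate  : (v : Fin n) (j : Fin (indeg v)) → Fin (outdeg (inNbr v j))
    outMate-correct : ∀ u i → inNbr (outNbr u i) (outMate u i) ≡ u
    inMate-correct  : ∀ v j → outNbr (inNbr v j) (inMate v j) ≡ v

  Edge : Fin n → Fin n → Set
  Edge u v = ∃[ i ] outNbr u i ≡ v

  Acyclic : Set
  Acyclic = ∀ v → ¬ TransClosure Edge v v

  edgeCount : ℕ
  edgeCount = sum outdeg

  L₀ⁱⁿ : ℕ
  L₀ⁱⁿ = sum λ v → if 2 ≤ᵇ indeg v then ⌈log₂ indeg v ⌉ else 0

  -- π ⟨$⟩ʳ t is the vertex output at time t, π ⟨$⟩ˡ v the time at which v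
  -- is output.
  IsTopologicalOrder : Permutation′ n → Set
  IsTopologicalOrder π = ∀ {u v} → Edge u v → π ⟨$⟩ˡ u <ᶠ π ⟨$⟩ˡ v

open Digraph

------------------------------------------------------------------------
-- Word RAM programs using k registers.  A program does not depend on the
-- input or on the word length.

data Op : Set where
  add sub mul div shl shr and or xor less equal : Op

data Instr (k : ℕ) : Set where
  const      : (d : Fin k) → ℕ → Instr k
  wordLength : (d : Fin k) → Instr k
  arith      : Op → (d x y : Fin k) → Instr k
  jumpIfZero : (x : Fin k) → ℕ → Instr k
  load       : (d addr : Fin k) → Instr k
  store      : (addr x : Fin k) → Instr k
  -- Access to the read-only input; indices into adjacency arrays start at 0.
  vertexCount                     : (d : Fin k) → Instr k
  getOutdeg getIndeg              : (d v : Fin k) → Instr k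
  getOutNbr getInNbr              : (d v i : Fin k) → Instr k
  getOutMate getInMate            : (d v i : Fin k) → Instr k
  output     : (x : Fin k) → Instr k

Program : ℕ → Set
Program k = List (Instr k)

fetch : ∀ {k} → Program k → ℕ → Maybe (Instr k)
fetch []      _       = nothing
fetch (i ∷ _) zero    = just i
fetch (_ ∷ P) (suc p) = fetch P p

bool→ℕ : Bool → ℕ
bool→ℕ b = if b then 1 else 0

bitwise : (Bool → Bool → Bool) → ℕ → ℕ → ℕ → ℕ
bitwise f zero    x y = 0
bitwise f (suc b) x y =
  bool→ℕ (f (x % 2 ≡ᵇ 1) (y % 2 ≡ᵇ 1)) + 2 * bitwise f b (x / 2) (y / 2)

-- The results are subsequently reduced modulo 2 ^ w.
evalOp : (w : ℕ) → Op → ℕ → ℕ → ℕ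
evalOp w add   x y       = x + y
evalOp w sub   x y       = x + (2 ^ w ∸ y)
evalOp w mul   x y       = x * y
evalOp w div   x zero    = 0
evalOp w div   x (suc y) = x / suc y
evalOp w shl   x y       = x * 2 ^ y
evalOp w shr   x y       = _/_ x (2 ^ y) {{m^n≢0 2 y}}
evalOp w and   x y       = bitwise _∧_ w x y
evalOp w or    x y       = bitwise _∨_ w x y
evalOp w xor   x y       = bitwise _xor_ w x y
evalOp w less  x y       = bool→ℕ (x <ᵇ y)
evalOp w equal x y       = bool→ℕ (x ≡ᵇ y)

Word : ℕ → Set
Word w = Fin (2 ^ w)

toWord : (w : ℕ) → ℕ → Word w
toWord w x = _mod_ x (2 ^ w) {{m^n≢0 2 w}}

-- A machine with word length w and a working memory of M words.
record Config (w k M : ℕ) : Set where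
  constructor config
  field
    pc      : ℕ
    regs    : Vec (Word w) k
    mem     : Vec (Word w) M
    written : List (Word w)

open Config

index : (b x : ℕ) → Maybe (Fin b)
index b x = dec⇒maybe (x <? b) >>= λ x<b → just (fromℕ< x<b)

vertex : (n x : ℕ) → Maybe (Fin n)
vertex n zero    = nothing
vertex n (suc x) = index n x

label : ∀ {n} → Fin n → ℕ
label v = suc (toℕ v)

-- The result nothing is a fault: an access outside the working memory, to a
-- nonexistent vertex or beyond the end of an adjacency array.
execute : ∀ {n w k M} → Digraph n → Instr k → Config w k M → Maybe (Config w k M)
execute {n} {w} {k} {M} G instr (config p r μ o) = go instr
  where
  val : Fin k → ℕ
  val x = toℕ (lookup r x)

  set : Fin k → ℕ → Maybe (Config w k M)
  set d x = just (config (suc p) (r [ d ]≔ toWord w x) μ o)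

  go : Instr k → Maybe (Config w k M)
  go (const d c)      = set d c
  go (wordLength d)   = set d w
  go (arith f d x y)  = set d (evalOp w f (val x) (val y))
  go (jumpIfZero x q) = just (config (if val x ≡ᵇ 0 then q else suc p) r μ o)
  go (load d a)       = index M (val a) >>= λ a′ → set d (toℕ (lookup μ a′))
  go (store a x)      = index M (val a) >>= λ a′ →
                        just (config (suc p) r (μ [ a′ ]≔ lookup r x) o)
  go (vertexCount d)  = set d n
  go (getOutdeg d v)  = vertex n (val v) >>= λ v′ → set d (outdeg G v′)
  go (getIndeg d v)   = vertex n (val v) >>= λ v′ → set d (indeg G v′)
  go (getOutNbr d v i) = vertex n (val v) >>= λ v′ →
    index (outdeg G v′) (val i) >>= λ i′ → set d (label (outNbr G v′ i′))
  go (getInNbr d v i) = vertex n (val v) >>= λ v′ →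
    index (indeg G v′) (val i) >>= λ i′ → set d (label (inNbr G v′ i′))
  go (getOutMate d v i) = vertex n (val v) >>= λ v′ →
    index (outdeg G v′) (val i) >>= λ i′ → set d (toℕ (outMate G v′ i′))
  go (getInMate d v i) = vertex n (val v) >>= λ v′ →
    index (indeg G v′) (val i) >>= λ i′ → set d (toℕ (inMate G v′ i′))
  go (output x)       = just (config (suc p) r μ (o ∷ʳ lookup r x))

-- Halts G P s t o: started in s, the program executes exactly t
-- instructions without a fault and then stops by leaving the program text,
-- having written o in total.
data Halts {n w k M : ℕ} (G : Digraph n) (P : Program k) :
           Config w k M → ℕ → List (Word w) → Set where
  stop : ∀ {s : Config w k M} → fetch P (pc s) ≡ nothing → Halts G P s 0 (written s)
  next : ∀ {s s′ : Config w k M} {i t o} → fetch P (pc s) ≡ just i → execute G i s ≡ just s′ →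
         Halts G P s′ t o → Halts G P s (suc t) o

------------------------------------------------------------------------
-- Time O(n + m) and space at most a given bound.

-- A bound B c G s says that s is at most X · (1 + c · log log n / log n) for
-- some quantity X that depends on G.
Bound : Set₁
Bound = ℕ → ∀ {n} → Digraph n → ℕ → Set

-- The memory and the registers initially hold arbitrary values.  The space
-- is the M * w bits of the memory; the k registers, k being a constant, are
-- part of the processor.  (For w = O(log n) counting them would add
-- O(log n) bits, which only affects the constant c.)
--
-- The condition n + m < 2 ^ w is that words are large enough to address the
-- input; since m ≤ n², it holds for some w = O(log n).
--
-- Below n = 4 the error term log log n / log n is undefined or degenerate,
-- so that the space bound is required only from there on.
TopologicalSortingIn : Bound → Set
TopologicalSortingIn B =
  ∃[ k ] Σ (Program k) λ P → ∃[ c ] ∃[ c′ ]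
  (∀ n → 1 ≤ n → (G : Digraph n) → Acyclic G →
   ∀ w → n + edgeCount G < 2 ^ w →
   ∃[ M ]
     (4 ≤ n → B c G (M * w)) ×
     (∀ (r : Vec (Word w) k) (μ : Vec (Word w) M) →
      ∃[ t ] ∃[ o ] ∃[ π ]
        Halts {w = w} G P (config 0 r μ []) t o ×
        t ≤ c′ * (n + edgeCount G) ×
        List.map toℕ o ≡ tabulate (λ i → label (π ⟨$⟩ʳ i)) ×
        IsTopologicalOrder G π))

-- In the bounds below log n and log log n inside the O-term are replaced by
-- lg n and lglg n; for n ≥ 4 this changes their quotient by at most a
-- constant factor.
lg lglg : ℕ → ℕ
lg n   = ⌊log₂ n ⌋
lglg n = ⌊log₂ lg n ⌋

-- s ≤ (2n + 2L) (1 + c · lglg n / lg n), multiplied by lg n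
BoundA : Bound
BoundA c {n} G s = s * lg n ≤ (2 * n + 2 * L₀ⁱⁿ G) * (lg n + c * lglg n)

-- s ≤ (2n + 4/3 m) (1 + c · lglg n / lg n), multiplied by 3 · lg n
BoundB : Bound
BoundB c {n} G s =
  3 * (s * lg n) ≤ (6 * n + 4 * edgeCount G) * (lg n + c * lglg n)

-- s ≤ 2n log₂(2 + 4m/n) (1 + c · lglg n / lg n).  Multiplied by lg n this is
-- s · lg n ≤ e · log₂((2n + 4m) / n); exponentiate and multiply by n ^ e.
BoundC : Bound
BoundC c {n} G s = 2 ^ (s * lg n) * n ^ e ≤ (2 * n + 4 * edgeCount G) ^ e
  where
  e : ℕ
  e = 2 * n * (lg n + c * lglg n)

{-# OPTIONS --safe #-}
-- Depth-first search with Kahn's counters.  As long as a vertex v has not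
-- been output, a field of v holds the number of its in-edges still to be
-- examined, minus one.  The search descends along the last one, after which
-- the field stores the position of this edge in the in-array of v; this is all
-- that is needed to return.  So v needs b = ⌈log₂ indeg v⌉ bits only, and none
-- if indeg v ≤ 1.
--
-- The fields are stored in bit planes: plane k holds, for every v with at least
-- k bits, the k-th bit of its field and a flag that tells whether there is
-- another one, altogether 2(1 + b) bits per vertex.  The position of v on plane
-- k + 1 is the number of flags before its position on plane k, and a rank
-- structure with table lookup provides it in constant time.  To decrement a
-- counter from the lowest bit upwards takes amortised constant time; a stored
-- position is read or written at most twice, at a cost of O(1 + b) each.
--
-- Slots of Θ(log n) bits are packed into the words, and w = O(log n) is not
-- assumed.  For w < 128 one word per vertex is good enough.
--
-- With N = Σ (1 + b) the space bound is 2N (1 + O(log log n / log n)); then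
-- (b) follows from 3b ≤ 2 indeg v and (c) from 2 ^ (1 + b) ≤ 2 + 4 indeg v
-- together with the inequality of arithmetic and geometric means.

module Submission where

open import Data.Bool using (Bool; true; false; _∧_; _∨_; not; if_then_else_; T)
open import Data.Empty using (⊥; ⊥-elim)
open import Data.Fin as Fin using (Fin; zero; suc; toℕ; fromℕ; fromℕ<; inject₁; _↑ˡ_; _↑ʳ_; #_)
open import Data.Fin.Induction using (spo-wellFounded)
open import Data.Fin.Permutation using (Permutation; permutation; ↔⇒≡; _⟨$⟩ʳ_; _⟨$⟩ˡ_)
import Data.Fin.Properties as Fin
open import Data.Fin.Relation.Unary.Top using (view; ‵fromℕ; ‵inject₁; view-fromℕ; view-inject₁)
open import Data.List as List using (List; []; _∷_; _++_; length; _∷ʳ_)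
open import Data.List.Membership.Propositional using (_∈_; _∉_)
import Data.List.Properties as List
open import Data.List.Relation.Unary.Any as Any using (Any)
open import Data.Maybe using (just; nothing)
open import Data.Nat
open import Data.Nat.DivMod hiding (_div_; _mod_; result)
open import Data.Nat.Divisibility using (divides)
open import Data.Nat.Logarithm
open import Data.Nat.Properties
open import Data.Nat.Tactic.RingSolver using (solve-∀)
open import Data.Product using (∃; ∃-syntax; _×_; _,_; proj₁; proj₂)
open import Data.Sum using (_⊎_; inj₁; inj₂)
open import Data.Unit using (⊤; tt)
open import Data.Vec as Vec using (Vec; lookup; _[_]≔_)
import Data.Vec.Properties as Vec
open import Function using (_∘_; case_of_)
open import Induction.WellFounded as WF using (WellFounded; Acc)
open import Relation.Binary.Construct.Closure.Transitive as TransClosure using (TransClosure)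
open import Relation.Binary.Definitions using (tri<; tri≈; tri>)
open import Relation.Binary.PropositionalEquality
open import Relation.Nullary using (¬_; yes; no)
open import Relation.Nullary.Decidable using (does; dec-yes-irr)
open import Algebra.Properties.CommutativeMonoid.Sum +-0-commutativeMonoid using (sum; ∑-comm; ∑-distrib-+)
open import Defs

-- A structured language with named variables

-- The word length w is not bounded in terms of n, so a single word can exceed the whole space
-- bound, and then M has to be 0. This shapes the memory. Slot sizes depend on n, except that a slot
-- is a whole word if two slots do not fit into it; and one word of slots lives in a register, so
-- that rounding to whole words goes down. The rank structure must not cost a constant factor. A
-- slot of flags therefore carries a rank relative to a block, O(log log n) bits, and only one slot
-- per block holds a full rank; these few bits produce the leading part of the error term. The end
-- of a field is found by halving indeg - 1, so the flags serve the ranks alone. A decrement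
-- recognises 0 by a borrow that runs off the end. The digits are garbage afterwards, but at this
-- very moment the counter is replaced by the return position. The potential of a counter is its
-- number of zero digits, because a decrement turns zeros into ones and creates at most one zero.
-- Programs are written in a small structured language whose cost is the number of loop iterations;
-- compilation multiplies it by a constant.

-- $q and $β are the number and the length of the slots of a word, and $gi, …,
-- $sv serve the access to a slot.  $λ, …, $W are the parameters of the bit
-- planes, $bT, …, $bA the addresses of their parts and $ci, …, $cy belong to
-- the current cell.  $root, …, $nbr are used by the search only.
data Var : Set where
  $q $β $w₀ $gi $gw $go $gy $sv : Var
  $λ $τ $2τ $t $W $bT $bF $bD $bA : Var
  $ci $co $cf $cy $acc $x $e $u $j $z $res $k $v $px $tmp : Var
  $root $cur $idx $run $nbr : Var

#vars #temps #regs : ℕ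
#vars  = 37
#temps = 8
#regs  = #vars + suc #temps

code : Var → Fin #vars
code $q    = # 0
code $β    = # 1
code $w₀   = # 2
code $gi   = # 3
code $gw   = # 4
code $go   = # 5
code $gy   = # 6
code $sv   = # 7
code $λ    = # 8
code $τ    = # 9
code $2τ   = # 10
code $t    = # 11
code $W    = # 12
code $bT   = # 13
code $bF   = # 14
code $bD   = # 15
code $bA   = # 16
code $ci   = # 17
code $co   = # 18
code $cf   = # 19
code $cy   = # 20
code $acc  = # 21
code $x    = # 22
code $e    = # 23
code $u    = # 24
code $j    = # 25
code $z    = # 26
code $res  = # 27
code $k    = # 28
code $v    = # 29
code $px   = # 30
code $tmp  = # 31
code $root = # 32
code $cur  = # 33
code $idx  = # 34
code $run  = # 35
code $nbr  = # 36

allVars : Vec Var #vars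
allVars =
  $q Vec.∷ $β Vec.∷ $w₀ Vec.∷ $gi Vec.∷ $gw Vec.∷ $go Vec.∷ $gy Vec.∷ $sv Vec.∷
  $λ Vec.∷ $τ Vec.∷ $2τ Vec.∷ $t Vec.∷ $W Vec.∷ $bT Vec.∷ $bF Vec.∷ $bD Vec.∷ $bA Vec.∷
  $ci Vec.∷ $co Vec.∷ $cf Vec.∷ $cy Vec.∷ $acc Vec.∷ $x Vec.∷ $e Vec.∷ $u Vec.∷ $j Vec.∷
  $z Vec.∷ $res Vec.∷ $k Vec.∷ $v Vec.∷ $px Vec.∷ $tmp Vec.∷
  $root Vec.∷ $cur Vec.∷ $idx Vec.∷ $run Vec.∷ $nbr Vec.∷ Vec.[]

decode-code : ∀ x → lookup allVars (code x) ≡ x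
decode-code $q    = refl
decode-code $β    = refl
decode-code $w₀   = refl
decode-code $gi   = refl
decode-code $gw   = refl
decode-code $go   = refl
decode-code $gy   = refl
decode-code $sv   = refl
decode-code $λ    = refl
decode-code $τ    = refl
decode-code $2τ   = refl
decode-code $t    = refl
decode-code $W    = refl
decode-code $bT   = refl
decode-code $bF   = refl
decode-code $bD   = refl
decode-code $bA   = refl
decode-code $ci   = refl
decode-code $co   = refl
decode-code $cf   = refl
decode-code $cy   = refl
decode-code $acc  = refl
decode-code $x    = refl
decode-code $e    = refl
decode-code $u    = refl
decode-code $j    = refl
decode-code $z    = refl
decode-code $res  = refl
decode-code $k    = refl
decode-code $v    = refl
decode-code $px   = refl
decode-code $tmp  = refl
decode-code $root = refl
decode-code $cur  = refl
decode-code $idx  = refl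
decode-code $run  = refl
decode-code $nbr  = refl

code-injective : ∀ {x y} → code x ≡ code y → x ≡ y
code-injective {x} {y} eq =
  trans (sym (decode-code x)) (trans (cong (lookup allVars) eq) (decode-code y))

_==_ : Var → Var → Bool
x == y = toℕ (code x) ≡ᵇ toℕ (code y)

==-sound : ∀ {x y} → (x == y) ≡ true → x ≡ y
==-sound {x} {y} eq = code-injective (Fin.toℕ-injective (≡ᵇ⇒≡ _ _ (subst T (sym eq) tt)))

==-refl : ∀ x → (x == x) ≡ true
==-refl x = T⇒true (≡⇒≡ᵇ (toℕ (code x)) _ refl)
  where
  T⇒true : ∀ {b} → T b → b ≡ true
  T⇒true {true} _ = refl

-- An expression of type Expr i is evaluated into the i-th temporary register,
-- using only temporaries up to the i-th.
data Query₁ : Set where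
  outdegree indegree : Query₁

data Query₂ : Set where
  outNeighbour inNeighbour outMateOf inMateOf : Query₂

data Expr : Fin #temps → Set where
  lit        : ∀ {i} → ℕ → Expr i
  !_         : ∀ {i} → Var → Expr i
  wordLen    : ∀ {i} → Expr i
  vertices   : ∀ {i} → Expr i
  _⟪_⟫_      : ∀ {i : Fin 7} → Expr (suc i) → Op → Expr (inject₁ i) → Expr (suc i)
  _mod_     : ∀ {i : Fin 7} → Expr (suc i) → Expr (inject₁ i) → Expr (suc i)
  query₁     : ∀ {i} → Query₁ → Expr i → Expr i
  query₂     : ∀ {i : Fin 7} → Query₂ → Expr (suc i) → Expr (inject₁ i) → Expr (suc i)

infix 10 !_
infixl 6 _⟪_⟫_ _mod_

top : Fin 7
top = # 6

TopExpr : Set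
TopExpr = Expr (suc top)

infix  4 _≔_ _≔mem_ mem_≔_
infixr 3 _⨾_

data Stmt : Set where
  skip    : Stmt
  _≔_     : Var → TopExpr → Stmt
  _≔mem_  : Var → TopExpr → Stmt
  mem_≔_  : TopExpr → Expr (inject₁ top) → Stmt
  emit    : TopExpr → Stmt
  _⨾_     : Stmt → Stmt → Stmt
  if_then_else′_ : TopExpr → Stmt → Stmt → Stmt
  while_loop_    : TopExpr → Stmt → Stmt

reg : Var → Fin #regs
reg x = code x ↑ˡ suc #temps

scratch : Fin #regs
scratch = #vars ↑ʳ zero

tmp : Fin #temps → Fin #regs
tmp i = #vars ↑ʳ suc i

compileQuery₁ : Query₁ → (d v : Fin #regs) → Instr #regs
compileQuery₁ outdegree = getOutdeg
compileQuery₁ indegree  = getIndeg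

compileQuery₂ : Query₂ → (d v i : Fin #regs) → Instr #regs
compileQuery₂ outNeighbour = getOutNbr
compileQuery₂ inNeighbour  = getInNbr
compileQuery₂ outMateOf    = getOutMate
compileQuery₂ inMateOf     = getInMate

compileE : ∀ {i} → Expr i → Program #regs
compileE {i} (lit c)  = const (tmp i) c ∷ []
-- The machine has no move instruction: a register is copied by adding a fresh 0 from `scratch`.
-- Unconditional jumps likewise test a fresh 0.
compileE {i} (! x)    = const scratch 0 ∷ arith add (tmp i) (reg x) scratch ∷ []
compileE {i} wordLen  = wordLength (tmp i) ∷ []
compileE {i} vertices = vertexCount (tmp i) ∷ []
compileE {suc i} (a ⟪ f ⟫ b) =
  compileE a ++ compileE b ++ arith f (tmp (suc i)) (tmp (suc i)) (tmp (inject₁ i)) ∷ []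
compileE {suc i} (a mod b) =
  compileE a ++ compileE b ++
  arith div scratch (tmp (suc i)) (tmp (inject₁ i)) ∷
  arith mul scratch scratch (tmp (inject₁ i)) ∷
  arith sub (tmp (suc i)) (tmp (suc i)) scratch ∷ []
compileE {i} (query₁ g a) = compileE a ++ compileQuery₁ g (tmp i) (tmp i) ∷ []
compileE {suc i} (query₂ g a b) =
  compileE a ++ compileE b ++ compileQuery₂ g (tmp (suc i)) (tmp (suc i)) (tmp (inject₁ i)) ∷ []

-- The first argument is the address at which the code is placed.
compile : ℕ → Stmt → Program #regs
compile p skip = []
compile p (x ≔ e) =
  compileE e ++ const scratch 0 ∷ arith add (reg x) (tmp (suc top)) scratch ∷ []
compile p (x ≔mem e) = compileE e ++ load (reg x) (tmp (suc top)) ∷ []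
compile p (mem a ≔ e) = compileE a ++ compileE e ++ store (tmp (suc top)) (tmp (inject₁ top)) ∷ []
compile p (emit e) = compileE e ++ output (tmp (suc top)) ∷ []
compile p (s₁ ⨾ s₂) = code₁ ++ compile (p + length code₁) s₂
  where
  code₁ = compile p s₁
compile p (if e then s₁ else′ s₂) =
  compileE e ++ jumpIfZero (tmp (suc top)) (2 + p₁ + length code₁) ∷
  code₁ ++ const scratch 0 ∷ jumpIfZero scratch (p₂ + length code₂) ∷ code₂
  where
  p₁    = 1 + (p + length (compileE e))
  code₁ = compile p₁ s₁
  p₂    = 2 + p₁ + length code₁
  code₂ = compile p₂ s₂
compile p (while e loop s) =
  compileE e ++ jumpIfZero (tmp (suc top)) (2 + p₁ + length code₁) ∷
  code₁ ++ const scratch 0 ∷ jumpIfZero scratch p ∷ []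
  where
  p₁    = 1 + (p + length (compileE e))
  code₁ = compile p₁ s

-- Semantics

Env : Set
Env = Var → ℕ

_[_↦_] : Env → Var → ℕ → Env
(ρ [ x ↦ a ]) y = if x == y then a else ρ y

_[_↦′_] : (ℕ → ℕ) → ℕ → ℕ → ℕ → ℕ
(f [ i ↦′ a ]) j = if i ≡ᵇ j then a else f j

record State : Set where
  constructor state
  field
    env     : Env
    memory  : ℕ → ℕ
    emitted : List ℕ

open State public

infixl 7 _/2^_ _%2^_

_/2^_ _%2^_ : ℕ → ℕ → ℕ
x /2^ y = _/_ x (2 ^ y) {{m^n≢0 2 y}}
x %2^ y = _%_ x (2 ^ y) {{m^n≢0 2 y}}

%2^-< : ∀ x y → x %2^ y < 2 ^ y
%2^-< x y = m%n<n x (2 ^ y) {{m^n≢0 2 y}}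

<⇒%2^≡ : ∀ {x} y → x < 2 ^ y → x %2^ y ≡ x
<⇒%2^≡ y = m<n⇒m%n≡m {{m^n≢0 2 y}}

/2^-≤ : ∀ x y → x /2^ y ≤ x
/2^-≤ x y = m/n≤m x (2 ^ y) {{m^n≢0 2 y}}

n<2^n : ∀ n → n < 2 ^ n
n<2^n zero    = s≤s z≤n
n<2^n (suc n) = +-mono-≤ (m^n>0 2 n) (subst (n <_) (sym (+-identityʳ (2 ^ n))) (n<2^n n))

toℕ-toWord : ∀ w x → toℕ (toWord w x) ≡ x %2^ w
toℕ-toWord w x = Fin.toℕ-fromℕ< (%2^-< x w)

index-just : ∀ {b x} (x<b : x < b) → index b x ≡ just (fromℕ< x<b)
index-just {b} {x} x<b
  rewrite dec-yes-irr (x <? b) <-irrelevant x<b = refl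

index-toℕ : ∀ {b} (i : Fin b) → index b (toℕ i) ≡ just i
index-toℕ i = trans (index-just (Fin.toℕ<n i)) (cong just (Fin.fromℕ<-toℕ i _))

reg-injective : ∀ {x y} → reg x ≡ reg y → x ≡ y
reg-injective eq = code-injective (Fin.↑ˡ-injective _ _ _ eq)

reg≢↑ʳ : ∀ x i → reg x ≢ #vars ↑ʳ i
reg≢↑ʳ x i eq = <⇒≢ (≤-trans (Fin.toℕ<n (code x)) (m≤m+n #vars (toℕ i)))
  (trans (sym (Fin.toℕ-↑ˡ (code x) _)) (trans (cong toℕ eq) (Fin.toℕ-↑ʳ #vars i)))

tmp-injective : ∀ {i j} → tmp i ≡ tmp j → i ≡ j
tmp-injective eq = Fin.suc-injective (Fin.↑ʳ-injective #vars _ _ eq)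

tmp≢scratch : ∀ i → tmp i ≢ scratch
tmp≢scratch i eq with () ← Fin.↑ʳ-injective #vars _ _ eq

suc≢inject₁ : ∀ {m} {i : Fin m} {j : Fin (suc m)} → toℕ j ≤ toℕ (inject₁ i) → suc i ≢ j
suc≢inject₁ {i = i} j≤i refl = 1+n≰n (≤-trans j≤i (≤-reflexive (Fin.toℕ-inject₁ i)))

-- One pass through the text of a statement, tests and jumps included, takes at most `weight` steps,
-- and every counted iteration causes at most one more pass; hence the factor `suc t` in
-- `Simulates`.
weight : Stmt → ℕ
weight (s₁ ⨾ s₂)                = weight s₁ + weight s₂
weight (if e then s₁ else′ s₂) = 3 + length (compileE e) + (weight s₁ + weight s₂)
weight (while e loop s)         = 3 + length (compileE e) + weight s
weight s                        = length (compile 0 s)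

record Input : Set where
  constructor input
  field
    {n}   : ℕ
    G     : Digraph n
    w M   : ℕ
    0<w   : 0 < w
    n<2^w : n < 2 ^ w

module Semantics (𝕀 : Input) where

  open Input 𝕀
  open Digraph G

  infix 4 _⊢_⇓_

  -- All rules but `shl⇓` exclude wrap-around, so that a derivation computes in ℕ, and the input
  -- accesses carry witnesses that they are valid. `shl⇓` keeps the reduction modulo 2 ^ w, by which
  -- a shift discards the bits above a slot.
  data _⊢_⇓_ (ρ : Env) : ∀ {i} → Expr i → ℕ → Set where
    lit⇓ : ∀ {i c} → c < 2 ^ w → ρ ⊢ lit {i} c ⇓ c
    var⇓ : ∀ {i x a} → ρ x ≡ a → ρ ⊢ !_ {i} x ⇓ a
    wordLen⇓ : ∀ {i} → ρ ⊢ wordLen {i} ⇓ w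
    vertices⇓ : ∀ {i} → ρ ⊢ vertices {i} ⇓ n
    add⇓ : ∀ {i a b} {e : Expr (suc i)} {e′} → ρ ⊢ e ⇓ a → ρ ⊢ e′ ⇓ b →
           a + b < 2 ^ w → ρ ⊢ e ⟪ add ⟫ e′ ⇓ a + b
    sub⇓ : ∀ {i a b} {e : Expr (suc i)} {e′} → ρ ⊢ e ⇓ a → ρ ⊢ e′ ⇓ b →
           b ≤ a → ρ ⊢ e ⟪ sub ⟫ e′ ⇓ a ∸ b
    mul⇓ : ∀ {i a b} {e : Expr (suc i)} {e′} → ρ ⊢ e ⇓ a → ρ ⊢ e′ ⇓ b →
           a * b < 2 ^ w → ρ ⊢ e ⟪ mul ⟫ e′ ⇓ a * b
    div⇓ : ∀ {i a b} {e : Expr (suc i)} {e′} → ρ ⊢ e ⇓ a → ρ ⊢ e′ ⇓ b →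
           .{{_ : NonZero b}} → ρ ⊢ e ⟪ div ⟫ e′ ⇓ a / b
    mod⇓ : ∀ {i a b} {e : Expr (suc i)} {e′} → ρ ⊢ e ⇓ a → ρ ⊢ e′ ⇓ b →
           .{{_ : NonZero b}} → ρ ⊢ e mod e′ ⇓ a % b
    shl⇓ : ∀ {i a b} {e : Expr (suc i)} {e′} → ρ ⊢ e ⇓ a → ρ ⊢ e′ ⇓ b →
           ρ ⊢ e ⟪ shl ⟫ e′ ⇓ (a * 2 ^ b) %2^ w
    shr⇓ : ∀ {i a b} {e : Expr (suc i)} {e′} → ρ ⊢ e ⇓ a → ρ ⊢ e′ ⇓ b →
           ρ ⊢ e ⟪ shr ⟫ e′ ⇓ a /2^ b
    less⇓ : ∀ {i a b} {e : Expr (suc i)} {e′} → ρ ⊢ e ⇓ a → ρ ⊢ e′ ⇓ b →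
            ρ ⊢ e ⟪ less ⟫ e′ ⇓ bool→ℕ (a <ᵇ b)
    outdeg⇓ : ∀ {i v} {e : Expr i} → ρ ⊢ e ⇓ label v → ρ ⊢ query₁ outdegree e ⇓ outdeg v
    indeg⇓  : ∀ {i v} {e : Expr i} → ρ ⊢ e ⇓ label v → ρ ⊢ query₁ indegree e ⇓ indeg v
    outNbr⇓ : ∀ {i v j} {e : Expr (suc i)} {e′} → ρ ⊢ e ⇓ label v → ρ ⊢ e′ ⇓ toℕ j →
              ρ ⊢ query₂ outNeighbour e e′ ⇓ label (outNbr v j)
    inNbr⇓ : ∀ {i v j} {e : Expr (suc i)} {e′} → ρ ⊢ e ⇓ label v → ρ ⊢ e′ ⇓ toℕ j →
             ρ ⊢ query₂ inNeighbour e e′ ⇓ label (inNbr v j)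
    outMate⇓ : ∀ {i v j} {e : Expr (suc i)} {e′} → ρ ⊢ e ⇓ label v → ρ ⊢ e′ ⇓ toℕ j →
               ρ ⊢ query₂ outMateOf e e′ ⇓ toℕ (outMate v j)
    inMate⇓ : ∀ {i v j} {e : Expr (suc i)} {e′} → ρ ⊢ e ⇓ label v → ρ ⊢ e′ ⇓ toℕ j →
              ρ ⊢ query₂ inMateOf e e′ ⇓ toℕ (inMate v j)

  value≡ : ∀ {ρ i a b} {e : Expr i} → a ≡ b → ρ ⊢ e ⇓ a → ρ ⊢ e ⇓ b
  value≡ refl d = d

  assign : State → Var → ℕ → State
  assign σ x a = record σ { env = env σ [ x ↦ a ] }

  -- The cost counts loop iterations only; straight-line code is free.
  data Exec : Stmt → State → ℕ → State → Set where
    skip : ∀ {σ} → Exec skip σ 0 σ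
    asg  : ∀ {σ x e a} → env σ ⊢ e ⇓ a → Exec (x ≔ e) σ 0 (assign σ x a)
    ldm  : ∀ {σ x e a} → env σ ⊢ e ⇓ a → a < M → Exec (x ≔mem e) σ 0 (assign σ x (memory σ a))
    stm  : ∀ {σ e e′ a b} → env σ ⊢ e ⇓ a → a < M → env σ ⊢ e′ ⇓ b →
           Exec (mem e ≔ e′) σ 0 (record σ { memory = memory σ [ a ↦′ b ] })
    emt  : ∀ {σ e a} → env σ ⊢ e ⇓ a →
           Exec (emit e) σ 0 (record σ { emitted = emitted σ ∷ʳ a })
    _⨾_  : ∀ {s₁ s₂ σ σ₁ σ₂ t₁ t₂} → Exec s₁ σ t₁ σ₁ → Exec s₂ σ₁ t₂ σ₂ →
           Exec (s₁ ⨾ s₂) σ (t₁ + t₂) σ₂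
    ifT  : ∀ {e s₁ s₂ σ a t σ′} → env σ ⊢ e ⇓ suc a → Exec s₁ σ t σ′ →
           Exec (if e then s₁ else′ s₂) σ t σ′
    ifF  : ∀ {e s₁ s₂ σ t σ′} → env σ ⊢ e ⇓ 0 → Exec s₂ σ t σ′ →
           Exec (if e then s₁ else′ s₂) σ t σ′
    end  : ∀ {e s σ} → env σ ⊢ e ⇓ 0 → Exec (while e loop s) σ 0 σ
    iter : ∀ {e s σ a σ₁ σ₂ t₁ t₂} → env σ ⊢ e ⇓ suc a → Exec s σ t₁ σ₁ →
           Exec (while e loop s) σ₁ t₂ σ₂ → Exec (while e loop s) σ (suc (t₁ + t₂)) σ₂

  -- Correctness of the compiler

  module Simulation (P : Program #regs) where

    Machine : Set
    Machine = Vec (Word w) #regs × Vec (Word w) M × List (Word w)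

    at : ℕ → Machine → Config w #regs M
    at p (r , μ , o) = config p r μ o

    infix 4 _⟶[_]_

    data _⟶[_]_ : Config w #regs M → ℕ → Config w #regs M → Set where
      done : ∀ {c} → c ⟶[ 0 ] c
      step : ∀ {c c′ c″ i t} → fetch P (Config.pc c) ≡ just i → execute G i c ≡ just c′ →
             c′ ⟶[ t ] c″ → c ⟶[ suc t ] c″

    _▹▹_ : ∀ {c c′ c″ t t′} → c ⟶[ t ] c′ → c′ ⟶[ t′ ] c″ → c ⟶[ t + t′ ] c″
    done       ▹▹ q = q
    step f x p ▹▹ q = step f x (p ▹▹ q)

    steps⇒halts : ∀ {c t c′} → c ⟶[ t ] c′ → fetch P (Config.pc c′) ≡ nothing →
                  Halts G P c t (Config.written c′)
    steps⇒halts done         h = stop h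
    steps⇒halts (step f x p) h = next f x (steps⇒halts p h)

    At : ℕ → Program #regs → Set
    At p []       = ⊤
    At p (i ∷ is) = fetch P p ≡ just i × At (suc p) is

    At-++ : ∀ {p} is {js} → At p (is ++ js) → At p is × At (p + length is) js
    At-++ {p} []       {js} h       = tt , subst (λ q → At q js) (sym (+-identityʳ p)) h
    At-++ {p} (i ∷ is) {js} (f , h) =
      let h₁ , h₂ = At-++ is h
      in  (f , h₁) , subst (λ q → At q js) (sym (+-suc p (length is))) h₂

    record Block (is : Program #regs) (m m′ : Machine) : Set where
      constructor block
      field run : ∀ p → At p is → at p m ⟶[ length is ] at (p + length is) m′

    open Block

    infixr 5 _++ᵇ_ _▹▹_

    _++ᵇ_ : ∀ {is js m m′ m″} → Block is m m′ → Block js m′ m″ → Block (is ++ js) m m″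
    _++ᵇ_ {is} {js} {m} {m′} {m″} b c = block λ p h →
      subst₂ (λ l q → at p m ⟶[ l ] at q m″) (sym (List.length-++ is))
        (trans (+-assoc p _ _) (cong (p +_) (sym (List.length-++ is))))
        (run b p (proj₁ (At-++ is h)) ▹▹ run c (p + length is) (proj₂ (At-++ is h)))

    instr : ∀ {i m m′} → (∀ p → execute G i (at p m) ≡ just (at (suc p) m′)) → Block (i ∷ []) m m′
    instr {i} {m} {m′} x = block λ { p (f , _) →
      step f (trans (x p) (cong (λ q → just (at q m′)) (+-comm 1 p))) done }

    Regs : Env → Vec (Word w) #regs → Set
    Regs ρ r = ∀ x → toℕ (lookup r (reg x)) ≡ ρ x

    record Keep (i : Fin #temps) (r r′ : Vec (Word w) #regs) : Set where
      constructor keep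
      field kept : ∀ y → y ≢ scratch → (∀ j → toℕ j ≤ toℕ i → y ≢ tmp j) →
                   lookup r′ y ≡ lookup r y

    open Keep

    Keep-trans : ∀ {i j r r′ r″} → toℕ i ≤ toℕ j → Keep i r r′ → Keep j r′ r″ → Keep j r r″
    Keep-trans i≤j k k′ = keep λ y ≢s ≢t →
      trans (kept k′ y ≢s ≢t) (kept k y ≢s λ l l≤i → ≢t l (≤-trans l≤i i≤j))

    Keep-trans′ : ∀ {i j r r′ r″} → toℕ j ≤ toℕ i → Keep i r r′ → Keep j r′ r″ → Keep i r r″
    Keep-trans′ j≤i k k′ = keep λ y ≢s ≢t →
      trans (kept k′ y ≢s λ l l≤j → ≢t l (≤-trans l≤j j≤i)) (kept k y ≢s ≢t)

    Keep-set : ∀ {i} r a → Keep i r (r [ tmp i ]≔ a)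
    Keep-set {i} r a = keep λ y ≢s ≢t → Vec.lookup∘update′ (≢t i ≤-refl) r a

    Keep-scratch : ∀ {i} r a → Keep i r (r [ scratch ]≔ a)
    Keep-scratch r a = keep λ y ≢s ≢t → Vec.lookup∘update′ ≢s r a

    Keep-regs : ∀ {i ρ r r′} → Keep i r r′ → Regs ρ r → Regs ρ r′
    Keep-regs k h x =
      trans (cong toℕ (kept k (reg x) (reg≢↑ʳ x zero) (λ j _ → reg≢↑ʳ x (suc j)))) (h x)

    lookup-set : ∀ (r : Vec (Word w) #regs) d x → toℕ (lookup (r [ d ]≔ toWord w x) d) ≡ x %2^ w
    lookup-set r d x = trans (cong toℕ (Vec.lookup∘update d r _)) (toℕ-toWord w x)

    degree-< : ∀ {d} {f : Fin d → Fin n} → (∀ {i j} → f i ≡ f j → i ≡ j) → d < 2 ^ w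
    degree-< inj = ≤-<-trans (Fin.injective⇒≤ inj) n<2^w

    record Evaluates {i} (e : Expr i) (a : ℕ) (r : Vec (Word w) #regs) : Set where
      constructor evaluates
      field
        {result} : Vec (Word w) #regs
        code-run : ∀ μ o → Block (compileE e) (r , μ , o) (result , μ , o)
        value    : toℕ (lookup result (tmp i)) ≡ a
        keeps    : Keep i r result

    -- The second operand is evaluated with temporaries up to `inject₁ i`, so the first one, waiting
    -- in `tmp (suc i)`, survives.
    Keep-next : ∀ {i : Fin 7} {r r′} → Keep (inject₁ i) r r′ →
                lookup r′ (tmp (suc i)) ≡ lookup r (tmp (suc i))
    Keep-next {i} k = kept k (tmp (suc i)) (tmp≢scratch (suc i))
      λ j j≤i eq → suc≢inject₁ {i = i} j≤i (tmp-injective eq)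

    inject₁≤suc : ∀ {m} (i : Fin m) → toℕ (inject₁ i) ≤ suc (toℕ i)
    inject₁≤suc i = ≤-trans (≤-reflexive (Fin.toℕ-inject₁ i)) (n≤1+n _)

    label-< : ∀ (v : Fin n) → label v < 2 ^ w
    label-< v = ≤-<-trans (Fin.toℕ<n v) n<2^w

    record Operands {i : Fin 7} (e : Expr (suc i)) (e′ : Expr (inject₁ i)) (a b : ℕ)
                    (r : Vec (Word w) #regs) : Set where
      field
        r₁ r₂  : Vec (Word w) #regs
        block₁ : ∀ μ o → Block (compileE e) (r , μ , o) (r₁ , μ , o)
        block₂ : ∀ μ o → Block (compileE e′) (r₁ , μ , o) (r₂ , μ , o)
        value₁ : toℕ (lookup r₂ (tmp (suc i))) ≡ a
        value₂ : toℕ (lookup r₂ (tmp (inject₁ i))) ≡ b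
        keepsᵒ : Keep (suc i) r r₂

    open Operands

    ret : ∀ {i} {e : Expr i} {a x r} r₁ →
          (∀ μ o → Block (compileE e) (r , μ , o) (r₁ [ tmp i ]≔ toWord w x , μ , o)) →
          Keep i r r₁ → x < 2 ^ w → x ≡ a → Evaluates e a r
    ret {i} {x = x} r₁ b k x< eq =
      evaluates b (trans (lookup-set r₁ (tmp i) x) (trans (<⇒%2^≡ w x<) eq))
        (Keep-trans ≤-refl k (Keep-set r₁ _))

    simulateE : ∀ {i ρ a} {e : Expr i} → ρ ⊢ e ⇓ a → ∀ r → Regs ρ r → Evaluates e a r

    operands : ∀ {i : Fin 7} {ρ a b} {e : Expr (suc i)} {e′ : Expr (inject₁ i)} →
               ρ ⊢ e ⇓ a → ρ ⊢ e′ ⇓ b → ∀ r → Regs ρ r → Operands e e′ a b r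
    operands {i} p q r h =
      let evaluates {r₁} b₁ v₁ k₁ = simulateE p r h
          evaluates {r₂} b₂ v₂ k₂ = simulateE q r₁ (Keep-regs k₁ h)
      in record { r₁ = r₁ ; r₂ = r₂ ; block₁ = b₁ ; block₂ = b₂
                ; value₁ = trans (cong toℕ (Keep-next {i} k₂)) v₁ ; value₂ = v₂
                ; keepsᵒ = Keep-trans′ (inject₁≤suc i) k₁ k₂ }

    binary : ∀ {i : Fin 7} {ρ a b c} {e : Expr (suc i)} {e′ : Expr (inject₁ i)} f →
             ρ ⊢ e ⇓ a → ρ ⊢ e′ ⇓ b → (a < 2 ^ w → evalOp w f a b %2^ w ≡ c) →
             ∀ r → Regs ρ r → Evaluates (e ⟪ f ⟫ e′) c r
    binary {i} {a = a} {b} {c} f p q eq r h = evaluates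
      (λ μ o → block₁ Δ μ o ++ᵇ block₂ Δ μ o ++ᵇ instr (λ _ → refl))
      (trans (lookup-set (r₂ Δ) _ x)
        (trans (cong₂ (λ a b → evalOp w f a b %2^ w) (value₁ Δ) (value₂ Δ))
               (eq (subst (_< 2 ^ w) (value₁ Δ) (Fin.toℕ<n _)))))
      (Keep-trans ≤-refl (keepsᵒ Δ) (Keep-set (r₂ Δ) _))
      where
      Δ = operands p q r h
      x = evalOp w f (toℕ (lookup (r₂ Δ) (tmp (suc i)))) (toℕ (lookup (r₂ Δ) (tmp (inject₁ i))))

    sub-exact : ∀ {a b} → b ≤ a → a < 2 ^ w → (a + (2 ^ w ∸ b)) %2^ w ≡ a ∸ b
    sub-exact {a} {b} b≤a a<2^w = begin
      (a + (2 ^ w ∸ b)) %2^ w     ≡⟨ cong (_%2^ w) (+-∸-assoc a (≤-trans b≤a (<⇒≤ a<2^w))) ⟨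
      (a + 2 ^ w ∸ b) %2^ w       ≡⟨ cong (_%2^ w) (+-∸-comm (2 ^ w) b≤a) ⟩
      ((a ∸ b) + 2 ^ w) %2^ w     ≡⟨ [m+n]%n≡m%n (a ∸ b) (2 ^ w) {{m^n≢0 2 w}} ⟩
      (a ∸ b) %2^ w               ≡⟨ <⇒%2^≡ w (≤-<-trans (m∸n≤m a b) a<2^w) ⟩
      a ∸ b                       ∎
      where open ≡-Reasoning

    evalOp-div : ∀ a b .{{_ : NonZero b}} → evalOp w div a b ≡ a / b
    evalOp-div a (suc b) = refl

    modulo : ∀ {i : Fin 7} {ρ a b} {e : Expr (suc i)} {e′ : Expr (inject₁ i)} .{{_ : NonZero b}} →
             ρ ⊢ e ⇓ a → ρ ⊢ e′ ⇓ b → ∀ r → Regs ρ r → Evaluates (e mod e′) (a % b) r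
    modulo {i} {a = a} {b} p q r h = evaluates
      (λ μ o → block₁ Δ μ o ++ᵇ block₂ Δ μ o ++ᵇ
               (instr (λ _ → refl) ++ᵇ instr (λ _ → refl) ++ᵇ instr (λ _ → refl)))
      (trans (lookup-set r₄ _ x₃) x₃-value)
      (Keep-trans ≤-refl (Keep-trans ≤-refl (keepsᵒ Δ)
        (Keep-trans ≤-refl (Keep-scratch (r₂ Δ) _) (Keep-scratch r₃ _))) (Keep-set r₄ _))
      where
      Δ = operands p q r h
      A B : Fin #regs
      A = tmp (suc i)
      B = tmp (inject₁ i)
      x₁ = evalOp w div (toℕ (lookup (r₂ Δ) A)) (toℕ (lookup (r₂ Δ) B))
      r₃ = r₂ Δ [ scratch ]≔ toWord w x₁
      x₂ = evalOp w mul (toℕ (lookup r₃ scratch)) (toℕ (lookup r₃ B))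
      r₄ = r₃ [ scratch ]≔ toWord w x₂
      x₃ = evalOp w sub (toℕ (lookup r₄ A)) (toℕ (lookup r₄ scratch))

      a<2^w : a < 2 ^ w
      a<2^w = subst (_< 2 ^ w) (value₁ Δ) (Fin.toℕ<n _)

      unscratched : ∀ (s : Vec (Word w) #regs) v i →
                    lookup (s [ scratch ]≔ v) (tmp i) ≡ lookup s (tmp i)
      unscratched s v i = Vec.lookup∘update′ (tmp≢scratch i) s v

      quotient : toℕ (lookup r₃ scratch) ≡ a / b
      quotient = trans (lookup-set (r₂ Δ) _ x₁)
        (trans (cong (_%2^ w) (trans (cong₂ (evalOp w div) (value₁ Δ) (value₂ Δ)) (evalOp-div a b)))
               (<⇒%2^≡ w (≤-<-trans (m/n≤m a b) a<2^w)))

      multiple : toℕ (lookup r₄ scratch) ≡ a / b * b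
      multiple = trans (lookup-set r₃ _ x₂)
        (trans (cong (_%2^ w) (cong₂ _*_ quotient (trans (cong toℕ (unscratched (r₂ Δ) _ (inject₁ i))) (value₂ Δ))))
               (<⇒%2^≡ w (≤-<-trans (m/n*n≤m a b) a<2^w)))

      x₃-value : x₃ %2^ w ≡ a % b
      x₃-value = trans
        (cong₂ (λ a b → (a + (2 ^ w ∸ b)) %2^ w)
          (trans (cong toℕ (trans (unscratched r₃ _ (suc i)) (unscratched (r₂ Δ) _ (suc i)))) (value₁ Δ)) multiple)
        (trans (sub-exact (m/n*n≤m a b) a<2^w) (sym (m%n≡m∸m/n*n a b)))

    vertex-label : ∀ {x} {v : Fin n} → x ≡ label v → vertex n x ≡ just v
    vertex-label {v = v} refl = index-toℕ v

    index-value : ∀ {b x} {i : Fin b} → x ≡ toℕ i → index b x ≡ just i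
    index-value {i = i} refl = index-toℕ i

    Answers₁ : Query₁ → Fin n → ℕ → Set
    Answers₁ g v y = ∀ {d x r μ o} p → toℕ (lookup r x) ≡ label v →
      execute G (compileQuery₁ g d x) (at p (r , μ , o)) ≡
      just (at (suc p) (r [ d ]≔ toWord w y , μ , o))

    Answers₂ : Query₂ → Fin n → ℕ → ℕ → Set
    Answers₂ g v j y = ∀ {d x x′ r μ o} p →
      toℕ (lookup r x) ≡ label v → toℕ (lookup r x′) ≡ j →
      execute G (compileQuery₂ g d x x′) (at p (r , μ , o)) ≡
      just (at (suc p) (r [ d ]≔ toWord w y , μ , o))

    unaryQuery : ∀ {i ρ v} {e : Expr i} g (f : Fin n → ℕ) → Answers₁ g v (f v) → f v < 2 ^ w →
      ρ ⊢ e ⇓ label v → ∀ r → Regs ρ r → Evaluates (query₁ g e) (f v) r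
    unaryQuery {i} {v = v} g f x f< p r h =
      let evaluates {r₁} b₁ v₁ k₁ = simulateE p r h
      in ret {x = f v} r₁ (λ μ o → b₁ μ o ++ᵇ instr λ q → x q v₁) k₁ f< refl

    binaryQuery : ∀ {i : Fin 7} {ρ v j y} {e : Expr (suc i)} {e′ : Expr (inject₁ i)} g →
      Answers₂ g v j y → y < 2 ^ w →
      ρ ⊢ e ⇓ label v → ρ ⊢ e′ ⇓ j → ∀ r → Regs ρ r → Evaluates (query₂ g e e′) y r
    binaryQuery {y = y} g x y< p q r h =
      let Δ = operands p q r h
      in ret {x = y} (r₂ Δ)
           (λ μ o → block₁ Δ μ o ++ᵇ block₂ Δ μ o ++ᵇ instr λ l → x l (value₁ Δ) (value₂ Δ))
           (keepsᵒ Δ) y< refl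

    simulateE (lit⇓ {c = c} c<) r h =
      ret {x = c} r (λ μ o → instr λ _ → refl) (keep λ _ _ _ → refl) c< refl
    simulateE {i} (var⇓ {x = x} eq) r h =
      ret (r [ scratch ]≔ toWord w 0) (λ μ o → instr (λ _ → refl) ++ᵇ instr (λ _ → refl))
        (Keep-scratch r _) (subst (_< 2 ^ w) (sym sum≡) (Fin.toℕ<n (lookup r (reg x))))
        (trans sum≡ (trans (h x) eq))
      where
      sum≡ : toℕ (lookup (r [ scratch ]≔ toWord w 0) (reg x)) +
             toℕ (lookup (r [ scratch ]≔ toWord w 0) scratch) ≡ toℕ (lookup r (reg x))
      sum≡ = trans (cong₂ _+_ (cong toℕ (Vec.lookup∘update′ (reg≢↑ʳ x zero) r _))
                     (trans (lookup-set r scratch 0) (<⇒%2^≡ w (m^n>0 2 w))))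
                   (+-identityʳ _)
    simulateE wordLen⇓ r h =
      ret {x = w} r (λ μ o → instr λ _ → refl) (keep λ _ _ _ → refl) (n<2^n w) refl
    simulateE vertices⇓ r h =
      ret {x = n} r (λ μ o → instr λ _ → refl) (keep λ _ _ _ → refl) n<2^w refl
    simulateE (add⇓ p q s<)   = binary add p q λ _ → <⇒%2^≡ w s<
    simulateE (sub⇓ p q b≤a)  = binary sub p q (sub-exact b≤a)
    simulateE (mul⇓ p q s<)   = binary mul p q λ _ → <⇒%2^≡ w s<
    simulateE (div⇓ {a = a} {b} p q) = binary div p q λ a< →
      trans (cong (_%2^ w) (evalOp-div a b)) (<⇒%2^≡ w (≤-<-trans (m/n≤m a b) a<))
    simulateE (mod⇓ p q) = modulo p q
    simulateE (shl⇓ p q) = binary shl p q λ _ → refl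
    simulateE (shr⇓ {a = a} {b} p q) = binary shr p q λ a< → <⇒%2^≡ w (≤-<-trans (/2^-≤ a b) a<)
    simulateE (less⇓ {a = a} {b} p q) = binary less p q λ a< → <⇒%2^≡ w (bool< (a <ᵇ b))
      where
      bool< : ∀ c → bool→ℕ c < 2 ^ w
      bool< true  = ≤-<-trans 0<w (n<2^n w)
      bool< false = m^n>0 2 w
    simulateE (outdeg⇓ {v = v} p) =
      unaryQuery outdegree outdeg exec (degree-< (outNbr-injective v)) p
      where
      exec : Answers₁ outdegree v (outdeg v)
      exec p eq rewrite vertex-label {v = v} eq = refl
    simulateE (indeg⇓ {v = v} p) =
      unaryQuery indegree indeg exec (degree-< (inNbr-injective v)) p
      where
      exec : Answers₁ indegree v (indeg v)
      exec p eq rewrite vertex-label {v = v} eq = refl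
    simulateE (outNbr⇓ {v = v} {j} p q) =
      binaryQuery outNeighbour exec (label-< _) p q
      where
      exec : Answers₂ outNeighbour v (toℕ j) (label (outNbr v j))
      exec p eq eq′ rewrite vertex-label {v = v} eq | index-value {i = j} eq′ = refl
    simulateE (inNbr⇓ {v = v} {j} p q) =
      binaryQuery inNeighbour exec (label-< _) p q
      where
      exec : Answers₂ inNeighbour v (toℕ j) (label (inNbr v j))
      exec p eq eq′ rewrite vertex-label {v = v} eq | index-value {i = j} eq′ = refl
    simulateE (outMate⇓ {v = v} {j} p q) =
      binaryQuery outMateOf exec (<-trans (Fin.toℕ<n _) (degree-< (inNbr-injective (outNbr v j)))) p q
      where
      exec : Answers₂ outMateOf v (toℕ j) (toℕ (outMate v j))
      exec p eq eq′ rewrite vertex-label {v = v} eq | index-value {i = j} eq′ = refl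
    simulateE (inMate⇓ {v = v} {j} p q) =
      binaryQuery inMateOf exec (<-trans (Fin.toℕ<n _) (degree-< (outNbr-injective (inNbr v j)))) p q
      where
      exec : Answers₂ inMateOf v (toℕ j) (toℕ (inMate v j))
      exec p eq eq′ rewrite vertex-label {v = v} eq | index-value {i = j} eq′ = refl

    record Represents (σ : State) (m : Machine) : Set where
      constructor rep
      field
        registers : Regs (env σ) (proj₁ m)
        cells     : ∀ j → toℕ (lookup (proj₁ (proj₂ m)) j) ≡ memory σ (toℕ j)
        outputs   : List.map toℕ (proj₂ (proj₂ m)) ≡ emitted σ

    open Represents

    record Simulates (p : ℕ) (s : Stmt) (t : ℕ) (σ′ : State) (m : Machine) : Set where
      constructor sim
      field
        {steps} : ℕ
        {final} : Machine
        run     : at p m ⟶[ steps ] at (p + length (compile p s)) final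
        bound   : steps ≤ weight s * suc t
        finally : Represents σ′ final

    Regs-assign : ∀ {ρ} r x {a v} → Regs ρ r → toℕ v ≡ a → Regs (ρ [ x ↦ a ]) (r [ reg x ]≔ v)
    Regs-assign {ρ} r x {a} {v} h eq y with x == y in x≡?y
    ... | true  rewrite ==-sound {x} {y} x≡?y = trans (cong toℕ (Vec.lookup∘update (reg y) r v)) eq
    ... | false = trans (cong toℕ (Vec.lookup∘update′ (reg≢ ∘ sym) r v)) (h y)
      where
      reg≢ : reg x ≢ reg y
      reg≢ eq with refl ← reg-injective {x} {y} eq with () ← trans (sym x≡?y) (==-refl x)

    jump : ∀ {e : TopExpr} {a ρ r} → ρ ⊢ e ⇓ a → Regs ρ r → ∀ q →
           ∃[ r′ ] Regs ρ r′ × (∀ p μ o → At p (compileE e) →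
             fetch P (p + length (compileE e)) ≡ just (jumpIfZero (tmp (suc top)) q) →
             at p (r , μ , o) ⟶[ length (compileE e) + 1 ]
             at (if a ≡ᵇ 0 then q else suc (p + length (compileE e))) (r′ , μ , o))
    jump {e} {a} {r = r} d h q =
      let evaluates {rᵉ} b v k = simulateE d r h
      in rᵉ , Keep-regs k h , λ p μ o A f →
           run (b μ o) p A ▹▹ step f
             (cong (λ x → just (at (if x ≡ᵇ 0 then q else suc (p + length (compileE e)))
                                   (rᵉ , μ , o))) v) done

    goto : ∀ {p q r μ o} → At p (const scratch 0 ∷ jumpIfZero scratch q ∷ []) →
           at p (r , μ , o) ⟶[ 2 ] at q (r [ scratch ]≔ toWord w 0 , μ , o)
    goto {p} {q} {r} {μ} {o} (f₁ , f₂ , _) = step f₁ refl (step f₂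
      (cong (λ x → just (at (if x ≡ᵇ 0 then q else 2 + p) (r [ scratch ]≔ toWord w 0 , μ , o)))
        (trans (lookup-set r scratch 0) (<⇒%2^≡ w (m^n>0 2 w)))) done)

    goto-regs : ∀ {ρ} r → Regs ρ r → Regs ρ (r [ scratch ]≔ toWord w 0)
    goto-regs r = Keep-regs {suc top} (Keep-scratch r (toWord w 0))

    relocate : ∀ {c t q q′ m} → q ≡ q′ → c ⟶[ t ] at q m → c ⟶[ t ] at q′ m
    relocate refl x = x

    address : ∀ p l c → p + (l + suc (c + 2)) ≡ 2 + (suc (p + l) + c)
    address = solve-∀

    -- Induction on the execution. Loop-free code has cost 0, so the induction hypothesis charges
    -- one pass over the text even to an execution of cost 0.
    simulate : ∀ {s σ t σ′} → Exec s σ t σ′ → ∀ p → At p (compile p s) → ∀ m →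
               Represents σ m → Simulates p s t σ′ m
    simulate skip p A m R = sim (relocate (sym (+-identityʳ p)) done) z≤n R
    simulate (asg {x = x} {e} {a} d) p A (r , μ , o) R =
      sim (run b p A) (≤-reflexive (sym (*-identityʳ _))) (rep R₁ (cells R) (outputs R))
      where
      E = simulateE d r (registers R)
      rᵉ = Evaluates.result E
      rˢ = rᵉ [ scratch ]≔ toWord w 0
      y = toℕ (lookup rˢ (tmp (suc top))) + toℕ (lookup rˢ scratch)
      b : Block (compile p (x ≔ e)) (r , μ , o) (rˢ [ reg x ]≔ toWord w y , μ , o)
      b = Evaluates.code-run E μ o ++ᵇ (instr (λ _ → refl) ++ᵇ instr (λ _ → refl))
      eq : y ≡ a
      eq = trans (cong₂ _+_ (cong toℕ (Vec.lookup∘update′ (tmp≢scratch (suc top)) rᵉ _))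
                            (trans (lookup-set rᵉ scratch 0) (<⇒%2^≡ w (m^n>0 2 w))))
             (trans (+-identityʳ _) (Evaluates.value E))
      R₁ = Regs-assign rˢ x (goto-regs rᵉ (Keep-regs (Evaluates.keeps E) (registers R)))
        (trans (toℕ-toWord w y) (trans (cong (_%2^ w) eq)
          (<⇒%2^≡ w (subst (_< 2 ^ w) (Evaluates.value E) (Fin.toℕ<n _)))))
    simulate {σ = σ} (ldm {x = x} {e} {a} d a<M) p A (r , μ , o) R =
      sim (run b p A) (≤-reflexive (sym (*-identityʳ _))) (rep R₁ (cells R) (outputs R))
      where
      E = simulateE d r (registers R)
      rᵉ = Evaluates.result E
      v = toℕ (lookup μ (fromℕ< a<M))
      b : Block (compile p (x ≔mem e)) (r , μ , o) (rᵉ [ reg x ]≔ toWord w v , μ , o)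
      b = Evaluates.code-run E μ o ++ᵇ instr exec
        where
        exec : ∀ p → execute G (load (reg x) (tmp (suc top))) (at p (rᵉ , μ , o)) ≡
                     just (at (suc p) (rᵉ [ reg x ]≔ toWord w v , μ , o))
        exec p rewrite Evaluates.value E | index-just a<M = refl
      R₁ = Regs-assign rᵉ x (Keep-regs (Evaluates.keeps E) (registers R))
        (trans (toℕ-toWord w v) (trans (<⇒%2^≡ w (Fin.toℕ<n (lookup μ (fromℕ< a<M))))
          (trans (cells R (fromℕ< a<M)) (cong (memory σ) (Fin.toℕ-fromℕ< a<M)))))
    simulate {σ = σ} (stm {e = e} {e′} {a} {b} d a<M d′) p A (r , μ , o) R =
      sim (run blk p A) (≤-reflexive (sym (*-identityʳ _)))
        (rep (Keep-regs (keepsᵒ Δ) (registers R)) cells′ (outputs R))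
      where
      Δ = operands d d′ r (registers R)
      μ′ = μ [ fromℕ< a<M ]≔ lookup (r₂ Δ) (tmp (inject₁ top))
      blk : Block (compile p (mem e ≔ e′)) (r , μ , o) (r₂ Δ , μ′ , o)
      blk = block₁ Δ μ o ++ᵇ block₂ Δ μ o ++ᵇ instr exec
        where
        exec : ∀ p → execute G (store (tmp (suc top)) (tmp (inject₁ top))) (at p (r₂ Δ , μ , o)) ≡
                     just (at (suc p) (r₂ Δ , μ′ , o))
        exec p rewrite value₁ Δ | index-just a<M = refl
      cells′ : ∀ j → toℕ (lookup μ′ j) ≡ (memory σ [ a ↦′ b ]) (toℕ j)
      cells′ j with a ≡ᵇ toℕ j in eq
      ... | true  = trans (cong toℕ (trans (cong (lookup μ′) j≡) (Vec.lookup∘update (fromℕ< a<M) μ _)))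
                      (value₂ Δ)
        where
        j≡ : j ≡ fromℕ< a<M
        j≡ = Fin.toℕ-injective (trans (sym (≡ᵇ⇒≡ a _ (subst T (sym eq) tt)))
                                      (sym (Fin.toℕ-fromℕ< a<M)))
      ... | false = trans (cong toℕ (Vec.lookup∘update′ j≢ μ _)) (cells R j)
        where
        j≢ : j ≢ fromℕ< a<M
        j≢ refl = subst T (trans (cong (a ≡ᵇ_) (sym (Fin.toℕ-fromℕ< a<M))) eq) (≡⇒≡ᵇ a a refl)
    simulate (emt {e = e} {a} d) p A (r , μ , o) R =
      sim (run b p A) (≤-reflexive (sym (*-identityʳ _)))
        (rep (Keep-regs (Evaluates.keeps E) (registers R)) (cells R)
          (trans (List.map-++ toℕ o _)
            (cong₂ _++_ (outputs R) (cong (_∷ []) (Evaluates.value E)))))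
      where
      E = simulateE d r (registers R)
      rᵉ = Evaluates.result E
      b : Block (compile p (emit e)) (r , μ , o) (rᵉ , μ , o ∷ʳ lookup rᵉ (tmp (suc top)))
      b = Evaluates.code-run E μ o ++ᵇ instr (λ _ → refl)
    simulate {s = s₁ ⨾ s₂} (_⨾_ {t₁ = t₁} {t₂} X Y) p A m R =
      let A₁ , A₂ = At-++ (compile p s₁) A
          sim x b₁ R₁ = simulate X p A₁ m R
          sim y b₂ R₂ = simulate Y (p + length (compile p s₁)) A₂ _ R₁
      in sim (relocate (trans (+-assoc p _ _) (cong (p +_) (sym (List.length-++ (compile p s₁))))) (x ▹▹ y))
           (≤-trans (+-mono-≤ b₁ b₂) (≤-trans (m≤m+n _ (weight s₁ * t₂ + weight s₂ * t₁))
             (≤-reflexive (regroup (weight s₁) (weight s₂) t₁ t₂))))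
           R₂
      where
      regroup : ∀ w₁ w₂ t₁ t₂ → w₁ * suc t₁ + w₂ * suc t₂ + (w₁ * t₂ + w₂ * t₁) ≡
                (w₁ + w₂) * suc (t₁ + t₂)
      regroup = solve-∀
    simulate {s = if e then s₁ else′ s₂} (ifT {t = t} d X) p A (r , μ , o) R =
      let A₁ , f , A₂ = At-++ (compileE e) A
          A₃ , A₄ , A₅ , _ = At-++ code₁ A₂
          rᵉ , R₁ , j = jump d (registers R) (2 + p₁ + length code₁)
          sim {final = rˢ , μ₂ , o₂} x b (rep R₂ c out) =
            simulate X p₁ A₃ (rᵉ , μ , o) (rep R₁ (cells R) (outputs R))
      in sim (relocate end-address (j p μ o A₁ f ▹▹ x ▹▹ goto (A₄ , A₅ , tt)))
           (≤-trans (+-monoʳ-≤ (l + 1) (+-monoˡ-≤ 2 b))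
             (≤-trans (m≤m+n _ _) (≤-reflexive (bound l (weight s₁) (weight s₂) t))))
           (rep (goto-regs rˢ R₂) c out)
      where
      l     = length (compileE e)
      p₁    = 1 + (p + l)
      code₁ = compile p₁ s₁
      p₂    = 2 + p₁ + length code₁
      code₂ = compile p₂ s₂
      bound : ∀ l a b t → l + 1 + (a * suc t + 2) + (b * suc t + (3 + l) * t) ≡ (3 + l + (a + b)) * suc t
      bound = solve-∀
      shift : ∀ p l c d → 2 + (1 + (p + l)) + c + d ≡ p + (l + suc (c + suc (suc d)))
      shift = solve-∀
      end-address : p₂ + length code₂ ≡ p + length (compile p (if e then s₁ else′ s₂))
      end-address = trans (shift p l (length code₁) (length code₂)) (cong (p +_)
        (sym (trans (List.length-++ (compileE e)) (cong (λ x → l + suc x) (List.length-++ code₁)))))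
    simulate {s = if e then s₁ else′ s₂} (ifF {t = t} d X) p A (r , μ , o) R =
      let A₁ , f , A₂ = At-++ (compileE e) A
          A₃ , A₄ , A₅ , A₆ = At-++ code₁ A₂
          rᵉ , R₁ , j = jump d (registers R) (2 + p₁ + length code₁)
          sim {final = m} x b R₂ =
            simulate X p₂ A₆ (rᵉ , μ , o) (rep R₁ (cells R) (outputs R))
      in sim (relocate end-address (j p μ o A₁ f ▹▹ x))
           (≤-trans (+-monoʳ-≤ (l + 1) b)
             (≤-trans (m≤m+n _ _) (≤-reflexive (bound l (weight s₁) (weight s₂) t))))
           R₂
      where
      l     = length (compileE e)
      p₁    = 1 + (p + l)
      code₁ = compile p₁ s₁
      p₂    = 2 + p₁ + length code₁
      code₂ = compile p₂ s₂
      bound : ∀ l a b t → l + 1 + b * suc t + (2 + a * suc t + (3 + l) * t) ≡ (3 + l + (a + b)) * suc t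
      bound = solve-∀
      shift : ∀ p l c d → 2 + (1 + (p + l)) + c + d ≡ p + (l + suc (c + suc (suc d)))
      shift = solve-∀
      end-address : p₂ + length code₂ ≡ p + length (compile p (if e then s₁ else′ s₂))
      end-address = trans (shift p l (length code₁) (length code₂)) (cong (p +_)
        (sym (trans (List.length-++ (compileE e)) (cong (λ x → l + suc x) (List.length-++ code₁)))))
    simulate {s = while e loop s} (end d) p A (r , μ , o) R =
      let A₁ , f , A₂ = At-++ (compileE e) A
          rᵉ , R₁ , j = jump d (registers R) (2 + p₁ + length code₁)
      in sim (relocate end-address (j p μ o A₁ f))
           (≤-trans (m≤m+n _ _) (≤-reflexive (bound l (weight s))))
           (rep R₁ (cells R) (outputs R))
      where
      l     = length (compileE e)
      p₁    = 1 + (p + l)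
      code₁ = compile p₁ s
      bound : ∀ l b → l + 1 + (2 + b) ≡ (3 + l + b) * 1
      bound = solve-∀
      end-address : 2 + p₁ + length code₁ ≡ p + length (compile p (while e loop s))
      end-address = trans (sym (address p l (length code₁))) (cong (p +_)
        (sym (trans (List.length-++ (compileE e)) (cong (λ x → l + suc x) (List.length-++ code₁)))))
    simulate {s = while e loop s} (iter {t₁ = t₁} {t₂} d X Y) p A (r , μ , o) R =
      let A₁ , f , A₂ = At-++ (compileE e) A
          A₃ , A₄ , A₅ , _ = At-++ code₁ A₂
          rᵉ , R₁ , j = jump d (registers R) (2 + p₁ + length code₁)
          sim {final = rˢ , μ₂ , o₂} x b₁ (rep R₂ c out) =
            simulate X p₁ A₃ (rᵉ , μ , o) (rep R₁ (cells R) (outputs R))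
          sim y b₂ R₃ =
            simulate Y p A (rˢ [ scratch ]≔ toWord w 0 , μ₂ , o₂) (rep (goto-regs rˢ R₂) c out)
      in sim (j p μ o A₁ f ▹▹ x ▹▹ goto (A₄ , A₅ , tt) ▹▹ y)
           (≤-trans (+-monoʳ-≤ (l + 1) (+-mono-≤ b₁ (+-monoʳ-≤ 2 b₂)))
             (≤-trans (m≤m+n _ _) (≤-reflexive (bound l (weight s) t₁ t₂))))
           R₃
      where
      l     = length (compileE e)
      p₁    = 1 + (p + l)
      code₁ = compile p₁ s
      bound : ∀ l b t₁ t₂ → l + 1 + (b * suc t₁ + (2 + (3 + l + b) * suc t₂)) +
        ((l + 3) * t₁) ≡ (3 + l + b) * suc (suc (t₁ + t₂))
      bound = solve-∀

  At-self : ∀ P is {pre} → P ≡ pre ++ is → Simulation.At P (length pre) is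
  At-self P [] eq = tt
  At-self P (i ∷ is) {pre} refl =
    fetch-++ pre , subst (λ l → Simulation.At P l is) (trans (List.length-++ pre) (+-comm _ 1))
      (At-self P is {pre ++ i ∷ []} (sym (List.++-assoc pre (i ∷ []) is)))
    where
    fetch-++ : ∀ pre → fetch (pre ++ i ∷ is) (length pre) ≡ just i
    fetch-++ []        = refl
    fetch-++ (_ ∷ pre) = fetch-++ pre

  fetch-end : ∀ (P : Program #regs) → fetch P (length P) ≡ nothing
  fetch-end []      = refl
  fetch-end (_ ∷ P) = fetch-end P

  -- The memory of a `State` is total. Addresses from M on, which no execution can access, are given
  -- 0, so that every word is below 2 ^ w as `VM` demands.
  readCell : Vec (Word w) M → ℕ → ℕ
  readCell μ j with j <? M
  ... | yes j<M = toℕ (lookup μ (fromℕ< j<M))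
  ... | no  _   = 0

  readCell-toℕ : ∀ μ j → toℕ (lookup μ j) ≡ readCell μ (toℕ j)
  readCell-toℕ μ j with toℕ j <? M
  ... | yes j<M = cong (toℕ ∘ lookup μ) (sym (Fin.fromℕ<-toℕ j j<M))
  ... | no  j≮M = ⊥-elim (j≮M (Fin.toℕ<n j))

  readCell-< : ∀ μ j → readCell μ j < 2 ^ w
  readCell-< μ j with j <? M
  ... | yes j<M = Fin.toℕ<n (lookup μ (fromℕ< j<M))
  ... | no  _   = m^n>0 2 w

  initial : Vec (Word w) #regs → Vec (Word w) M → State
  initial r μ = state (λ x → toℕ (lookup r (reg x))) (readCell μ) []

  compile-correct : ∀ {s t σ′} r μ → Exec s (initial r μ) t σ′ →
    ∃[ N ] ∃[ o ] Halts G (compile 0 s) (config 0 r μ []) N o ×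
                  N ≤ weight s * suc t × List.map toℕ o ≡ emitted σ′
  compile-correct {s} r μ X =
    let open Simulation (compile 0 s)
        sim run bound R = simulate X 0 (At-self _ (compile 0 s) {[]} refl) (r , μ , [])
                            (rep (λ _ → refl) (readCell-toℕ μ) refl)
    in _ , _ , steps⇒halts run (fetch-end (compile 0 s)) , bound , Represents.outputs R

-- Farkas certificates: y − x is the sum of the nonnegative b − a and s.
certify : ∀ {x y a b} s → a ≤ b → y + a ≡ x + b + s → x ≤ y
certify {x} {y} {a} {b} s a≤b eq = +-cancelʳ-≤ b x y
  (≤-trans (m≤m+n (x + b) s) (≤-trans (≤-reflexive (sym eq)) (+-monoʳ-≤ y a≤b)))

≢0⇒suc : ∀ {v} → v ≢ 0 → ∃[ u ] v ≡ suc u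
≢0⇒suc {zero}  v≢0 = ⊥-elim (v≢0 refl)
≢0⇒suc {suc u} _   = u , refl

-- Total correctness with amortised cost and syntactic frame conditions

sumBelow : (ℕ → ℕ) → ℕ → ℕ
sumBelow f zero    = 0
sumBelow f (suc k) = sumBelow f k + f k

-- These tests over-approximate the effects of a statement by inspecting its text. As they compute,
-- a claim that something is preserved is proved by `refl` wherever a frame is used.
writes : Stmt → Var → Bool
writes (y ≔ _)                 x = y == x
writes (y ≔mem _)              x = y == x
writes (s₁ ⨾ s₂)               x = writes s₁ x ∨ writes s₂ x
writes (if _ then s₁ else′ s₂) x = writes s₁ x ∨ writes s₂ x
writes (while _ loop s)        x = writes s x
writes _                       x = false

stores : Stmt → Bool
stores (mem _ ≔ _)             = true
stores (s₁ ⨾ s₂)               = stores s₁ ∨ stores s₂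
stores (if _ then s₁ else′ s₂) = stores s₁ ∨ stores s₂
stores (while _ loop s)        = stores s
stores _                       = false

emits : Stmt → Bool
emits (emit _)                = true
emits (s₁ ⨾ s₂)               = emits s₁ ∨ emits s₂
emits (if _ then s₁ else′ s₂) = emits s₁ ∨ emits s₂
emits (while _ loop s)        = emits s
emits _                       = false

record Frame (s : Stmt) (σ σ′ : State) : Set where
  field
    var≡ : ∀ x → writes s x ≡ false → env σ′ x ≡ env σ x
    mem≡ : stores s ≡ false → memory σ′ ≡ memory σ
    out≡ : emits s ≡ false → emitted σ′ ≡ emitted σ

open Frame public

∨-falseˡ : ∀ {a b} → (a ∨ b) ≡ false → a ≡ false
∨-falseˡ {false} _ = refl

∨-falseʳ : ∀ {a b} → (a ∨ b) ≡ false → b ≡ false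
∨-falseʳ {false} eq = eq

frame-refl : ∀ {s σ} → Frame s σ σ
frame-refl = record { var≡ = λ _ _ → refl ; mem≡ = λ _ → refl ; out≡ = λ _ → refl }

frame-trans : ∀ {s σ₁ σ₂ σ₃} → Frame s σ₁ σ₂ → Frame s σ₂ σ₃ → Frame s σ₁ σ₃
frame-trans f g = record
  { var≡ = λ x h → trans (var≡ g x h) (var≡ f x h)
  ; mem≡ = λ h → trans (mem≡ g h) (mem≡ f h)
  ; out≡ = λ h → trans (out≡ g h) (out≡ f h) }

-- Truncated subtraction of 1: the comparison supplies a 0 to be subtracted when the degree is 0, so
-- that nothing wraps around.
degreeMinus1 : ∀ {i : Fin 6} → Var → Expr (suc (suc i))
degreeMinus1 u = query₁ indegree (! u) ⟪ sub ⟫ (lit 0 ⟪ less ⟫ query₁ indegree (! u))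

module Hoare (𝕀 : Input) where

  open Input 𝕀
  open Semantics 𝕀

  frame : ∀ {s σ t σ′} → Exec s σ t σ′ → Frame s σ σ′
  frame skip = frame-refl
  frame (asg {σ} {x} {a = a} _) = record
    { var≡ = λ y h → cong (if_then a else env σ y) h ; mem≡ = λ _ → refl ; out≡ = λ _ → refl }
  frame (ldm {σ} {x} {a = a} _ _) = record
    { var≡ = λ y h → cong (if_then memory σ a else env σ y) h
    ; mem≡ = λ _ → refl ; out≡ = λ _ → refl }
  frame (stm _ _ _) = record { var≡ = λ _ _ → refl ; mem≡ = λ () ; out≡ = λ _ → refl }
  frame (emt _) = record { var≡ = λ _ _ → refl ; mem≡ = λ _ → refl ; out≡ = λ () }
  frame (_⨾_ {s₁} {s₂} X Y) = record
    { var≡ = λ x h → trans (var≡ g x (∨-falseʳ {writes s₁ x} h)) (var≡ f x (∨-falseˡ h))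
    ; mem≡ = λ h → trans (mem≡ g (∨-falseʳ {stores s₁} h)) (mem≡ f (∨-falseˡ h))
    ; out≡ = λ h → trans (out≡ g (∨-falseʳ {emits s₁} h)) (out≡ f (∨-falseˡ h)) }
    where
    f = frame X
    g = frame Y
  frame (ifT _ X) = record
    { var≡ = λ x h → var≡ (frame X) x (∨-falseˡ h)
    ; mem≡ = λ h → mem≡ (frame X) (∨-falseˡ h)
    ; out≡ = λ h → out≡ (frame X) (∨-falseˡ h) }
  frame (ifF {s₁ = s₁} _ X) = record
    { var≡ = λ x h → var≡ (frame X) x (∨-falseʳ {writes s₁ x} h)
    ; mem≡ = λ h → mem≡ (frame X) (∨-falseʳ {stores s₁} h)
    ; out≡ = λ h → out≡ (frame X) (∨-falseʳ {emits s₁} h) }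
  frame (end _) = frame-refl
  frame (iter {e} {s} _ X Y) = record
    { var≡ = λ x h → trans (var≡ (frame Y) x h) (var≡ (frame X) x h)
    ; mem≡ = λ h → trans (mem≡ (frame Y) h) (mem≡ (frame X) h)
    ; out≡ = λ h → trans (out≡ (frame Y) h) (out≡ (frame X) h) }

  degreeMinus1⇓ : ∀ {ρ u} {v : Fin n} {i : Fin 6} → ρ u ≡ label v →
                  ρ ⊢ degreeMinus1 {i} u ⇓ Digraph.indeg G v ∸ 1
  degreeMinus1⇓ {v = v} u≡ = value≡ (minus d)
    (sub⇓ (indeg⇓ (var⇓ u≡)) (less⇓ (lit⇓ (m^n>0 2 w)) (indeg⇓ (var⇓ u≡))) (positive d))
    where
    d = Digraph.indeg G v
    minus : ∀ d → d ∸ bool→ℕ (0 <ᵇ d) ≡ d ∸ 1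
    minus zero    = refl
    minus (suc d) = refl
    positive : ∀ d → bool→ℕ (0 <ᵇ d) ≤ d
    positive zero    = z≤n
    positive (suc d) = s≤s z≤n

  -- Total correctness: s terminates from σ with a cost and a final state
  -- related by Q.
  record Run (s : Stmt) (σ : State) (Q : ℕ → State → Set) : Set where
    constructor run
    field
      {cost}  : ℕ
      {final} : State
      exec    : Exec s σ cost final
      post    : Q cost final

  infixr 2 _▸_ _▹_

  _▸_ : ∀ {s₁ s₂ σ Q R} → Run s₁ σ Q →
        (∀ {t σ′} → Frame s₁ σ σ′ → Q t σ′ → Run s₂ σ′ (λ t′ → R (t + t′))) →
        Run (s₁ ⨾ s₂) σ R
  run X q ▸ k = let run Y r = k (frame X) q in run (X ⨾ Y) r

  weaken : ∀ {s σ Q R} → Run s σ Q → (∀ {t σ′} → Frame s σ σ′ → Q t σ′ → R t σ′) → Run s σ R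
  weaken (run X q) k = run X (k (frame X) q)

  _▹_ : ∀ {x e s σ a R} → env σ ⊢ e ⇓ a → Run s (assign σ x a) R → Run (x ≔ e ⨾ s) σ R
  d ▹ run Y r = run (asg d ⨾ Y) r

  set : ∀ {x e σ a R} → env σ ⊢ e ⇓ a → R 0 (assign σ x a) → Run (x ≔ e) σ R
  set d r = run (asg d) r

  set₁ : ∀ {x e σ a} → env σ ⊢ e ⇓ a →
         Run (x ≔ e) σ λ t σ′ → t ≡ 0 × σ′ ≡ assign σ x a
  set₁ d = set d (refl , refl)

  set₂ : ∀ {x e y e′ σ a b} → env σ ⊢ e ⇓ a → env σ [ x ↦ a ] ⊢ e′ ⇓ b →
         Run (x ≔ e ⨾ y ≔ e′) σ λ t σ′ → t ≡ 0 × σ′ ≡ assign (assign σ x a) y b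
  set₂ d d′ = d ▹ set d′ (refl , refl)

  print : ∀ {e σ a} → env σ ⊢ e ⇓ a →
          Run (emit e) σ λ t σ′ → t ≡ 0 × σ′ ≡ record σ { emitted = emitted σ ∷ʳ a }
  print d = run (emt d) (refl , refl)

  nop : ∀ {σ R} → R 0 σ → Run skip σ R
  nop = run skip

  branch : ∀ {e s₁ s₂ σ v R} → env σ ⊢ e ⇓ v → (v ≢ 0 → Run s₁ σ R) → (v ≡ 0 → Run s₂ σ R) →
           Run (if e then s₁ else′ s₂) σ R
  branch {v = zero}  d f g = let run X r = g refl in run (ifF d X) r
  branch {v = suc v} d f g = let run X r = f (λ ()) in run (ifT d X) r

  stop-loop : ∀ {e s σ R} → env σ ⊢ e ⇓ 0 → R 0 σ → Run (while e loop s) σ R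
  stop-loop d r = run (end d) r

  step-loop : ∀ {e s σ v Q R} → env σ ⊢ e ⇓ v → v ≢ 0 → Run s σ Q →
    (∀ {t σ′} → Frame s σ σ′ → Q t σ′ → Run (while e loop s) σ′ (λ t′ → R (suc (t + t′)))) →
    Run (while e loop s) σ R
  step-loop {v = zero}  d v≢0 _ _ = ⊥-elim (v≢0 refl)
  step-loop {v = suc _} d _ (run X q) k = let run Y r = k (frame X) q in run (iter d X Y) r

  -- The potential p serves both as the variant and as the cost bound.
  amortised : ∀ {e s σ₀} (I : ℕ → State → Set) →
    (∀ {p σ} → Frame s σ₀ σ → I p σ → ∃[ v ] env σ ⊢ e ⇓ v ×
      (v ≢ 0 → Run s σ λ t σ′ → ∃[ p′ ] I p′ σ′ × suc (t + p′) ≤ p)) →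
    ∀ {p} → I p σ₀ →
    Run (while e loop s) σ₀ λ t σ′ → ∃[ p′ ] I p′ σ′ × env σ′ ⊢ e ⇓ 0 × t + p′ ≤ p
  amortised {e} {s} {σ₀} I body {p} = go p ≤-refl frame-refl
    where
    go : ∀ fuel {p σ} → p ≤ fuel → Frame s σ₀ σ → I p σ →
         Run (while e loop s) σ λ t σ′ → ∃[ p′ ] I p′ σ′ × env σ′ ⊢ e ⇓ 0 × t + p′ ≤ p
    go fuel {p} p≤ f i with body f i
    ... | zero  , d , _ = stop-loop d (p , i , d , ≤-refl)
    go zero    {p} p≤ f i | suc v , d , k with k (λ ())
    ... | run _ (_ , _ , t<p) = ⊥-elim (1+n≰n (≤-trans (s≤s z≤n) (≤-trans t<p p≤)))
    go (suc fuel) {p} p≤ f i | suc v , d , k =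
      step-loop d (λ ()) (k (λ ())) λ {t} g (p′ , i′ , t<p) →
        weaken (go fuel (≤-pred (≤-trans (s≤s (m≤n+m p′ t)) (≤-trans t<p p≤))) (frame-trans f g) i′)
          λ { {t′} _ (p″ , i″ , d″ , t′≤) → p″ , i″ , d″ ,
              ≤-trans (s≤s (≤-trans (≤-reflexive (+-assoc t t′ p″)) (+-monoʳ-≤ t t′≤))) t<p }

  -- The cost of the body may depend on the index. This keeps the sweeps linear in the number of
  -- cells, where the iteration for a vertex costs as much as its field is long.
  counting : ∀ {e s σ₀} (I : ℕ → State → Set) (c : ℕ → ℕ) N →
    (∀ {i σ} → Frame s σ₀ σ → I i σ → i ≤ N → env σ ⊢ e ⇓ bool→ℕ (i <ᵇ N)) →
    (∀ {i σ} → Frame s σ₀ σ → I i σ → i < N → Run s σ λ t σ′ → t ≤ c i × I (suc i) σ′) →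
    ∀ {a} → a ≤ N → I a σ₀ →
    Run (while e loop s) σ₀ λ t σ′ → t ≤ sumBelow (suc ∘ c) N × I N σ′
  counting {e} {s} {σ₀} I c N cond body {a} a≤N i₀ =
    weaken (go (N ∸ a) (m∸n+n≡m a≤N) frame-refl i₀)
      λ _ (t≤ , i) → ≤-trans (m≤m+n _ _) t≤ , i
    where
    go : ∀ fuel {i σ} → fuel + i ≡ N → Frame s σ₀ σ → I i σ →
         Run (while e loop s) σ λ t σ′ → t + sumBelow (suc ∘ c) i ≤ sumBelow (suc ∘ c) N × I N σ′
    go zero {i} {σ} refl f x =
      stop-loop (subst (λ b → env σ ⊢ e ⇓ bool→ℕ b) (<ᵇ-irrefl i) (cond f x ≤-refl)) (≤-refl , x)
      where
      <ᵇ-irrefl : ∀ i → (i <ᵇ i) ≡ false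
      <ᵇ-irrefl zero    = refl
      <ᵇ-irrefl (suc i) = <ᵇ-irrefl i
    go (suc fuel) {i} refl f x =
      step-loop (cond f x (<⇒≤ i<N)) (<ᵇ-true i<N) (body f x i<N) λ {t} g (t≤ , y) →
        weaken (go fuel (+-suc fuel i) (frame-trans f g) y) λ {t′} _ (t′≤ , z) →
          certify 0 (+-mono-≤ t≤ t′≤) (arith₁ t t′ (c i) (sumBelow (suc ∘ c) i) _) , z
      where
      i<N : i < suc (fuel + i)
      i<N = s≤s (m≤n+m i fuel)
      <ᵇ-true : ∀ {i j} → i < j → bool→ℕ (i <ᵇ j) ≢ 0
      <ᵇ-true {i} {j} i<j eq with i <ᵇ j | <⇒<ᵇ i<j
      ... | true | _ with () ← eq
      arith₁ : ∀ t t′ c a b → b + (t + (t′ + (a + suc c))) ≡ suc (t + t′) + a + (c + b) + 0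
      arith₁ = solve-∀

-- Bit slices of natural numbers

2^-nonZero : ∀ p → NonZero (2 ^ p)
2^-nonZero p = m^n≢0 2 p

2^-+ : ∀ p b → 2 ^ (p + b) ≡ 2 ^ p * 2 ^ b
2^-+ = ^-distribˡ-+-* 2

2^-mono : ∀ {p b} → p ≤ b → 2 ^ p ≤ 2 ^ b
2^-mono = ^-monoʳ-≤ 2

/-absorb : ∀ {lo d} X .{{_ : NonZero d}} → lo < d → (lo + X * d) / d ≡ X
/-absorb {lo} {d} X lo<d = begin
  (lo + X * d) / d     ≡⟨ +-distrib-/-∣ʳ lo (divides X refl) ⟩
  lo / d + X * d / d   ≡⟨ cong₂ _+_ (m<n⇒m/n≡0 lo<d) (m*n/n≡m X d) ⟩
  X                    ∎
  where open ≡-Reasoning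

%-absorb : ∀ {lo d} X .{{_ : NonZero d}} → lo < d → (lo + X * d) % d ≡ lo
%-absorb {lo} {d} X lo<d = trans ([m+kn]%n≡m%n lo X d) (m<n⇒m%n≡m lo<d)

/2^-absorb : ∀ {lo} p X → lo < 2 ^ p → (lo + X * 2 ^ p) /2^ p ≡ X
/2^-absorb p X = /-absorb X {{2^-nonZero p}}

%2^-absorb : ∀ {lo} p X → lo < 2 ^ p → (lo + X * 2 ^ p) %2^ p ≡ lo
%2^-absorb p X = %-absorb X {{2^-nonZero p}}

2^-divMod : ∀ y p → y ≡ y %2^ p + (y /2^ p) * 2 ^ p
2^-divMod y p = m≡m%n+[m/n]*n y (2 ^ p) {{2^-nonZero p}}

/2^-+ : ∀ y p b → y /2^ (p + b) ≡ y /2^ p /2^ b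
/2^-+ y p b = trans (/-congʳ {{2^-nonZero (p + b)}} {{nz}} (2^-+ p b))
  (sym (m/n/o≡m/[n*o] y (2 ^ p) (2 ^ b) {{2^-nonZero p}} {{2^-nonZero b}} {{nz}}))
  where
  nz : NonZero (2 ^ p * 2 ^ b)
  nz = m*n≢0 (2 ^ p) (2 ^ b) {{2^-nonZero p}} {{2^-nonZero b}}

/2^-< : ∀ {y} p b → y < 2 ^ (p + b) → y /2^ p < 2 ^ b
/2^-< p b y< = m<n*o⇒m/o<n {{2^-nonZero p}} (≤-trans y< (≤-reflexive
  (trans (2^-+ p b) (*-comm (2 ^ p) (2 ^ b)))))

low-< : ∀ {lo} p b {X} → lo < 2 ^ p → X < 2 ^ b → lo + X * 2 ^ p < 2 ^ (p + b)
low-< {lo} p b {X} lo< X< = begin-strict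
  lo + X * 2 ^ p      <⟨ +-monoˡ-< (X * 2 ^ p) lo< ⟩
  suc X * 2 ^ p       ≤⟨ *-monoˡ-≤ (2 ^ p) X< ⟩
  2 ^ b * 2 ^ p       ≡⟨ trans (*-comm (2 ^ b) (2 ^ p)) (sym (2^-+ p b)) ⟩
  2 ^ (p + b)         ∎
  where open ≤-Reasoning

slice : ℕ → ℕ → ℕ → ℕ
slice p b y = y /2^ p %2^ b

-- Replacement by arithmetic instead of masks: the old slice, shifted to its place, is a part of y
-- and can be subtracted without a borrow; `setSlice-split` shows the effect on the three parts of
-- y.
setSlice : ℕ → ℕ → ℕ → ℕ → ℕ
setSlice p b z y = (y ∸ slice p b y * 2 ^ p) + z * 2 ^ p

slice-< : ∀ p b y → slice p b y < 2 ^ b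
slice-< p b y = %2^-< (y /2^ p) b

slice-≤ : ∀ p b y → slice p b y * 2 ^ p ≤ y
slice-≤ p b y = ≤-trans
  (*-monoˡ-≤ (2 ^ p) (m%n≤m (y /2^ p) (2 ^ b) {{2^-nonZero b}}))
  (m/n*n≤m y (2 ^ p) {{2^-nonZero p}})

split₃ : ∀ p b y → y ≡ y %2^ p + (slice p b y + (y /2^ (p + b)) * 2 ^ b) * 2 ^ p
split₃ p b y = trans (2^-divMod y p) (cong (λ X → y %2^ p + X * 2 ^ p)
  (trans (2^-divMod (y /2^ p) b) (cong (λ h → slice p b y + h * 2 ^ b) (sym (/2^-+ y p b)))))

setSlice-split : ∀ p b z y → setSlice p b z y ≡ y %2^ p + (z + (y /2^ (p + b)) * 2 ^ b) * 2 ^ p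
setSlice-split p b z y = begin
  (y ∸ s * e) + z * e                     ≡⟨ cong (λ y → (y ∸ s * e) + z * e) (split₃ p b y) ⟩
  (l + (s + h) * e ∸ s * e) + z * e       ≡⟨ cong (λ y → (y ∸ s * e) + z * e) (swap l s h e) ⟩
  (l + h * e + s * e ∸ s * e) + z * e     ≡⟨ cong (_+ z * e) (m+n∸n≡m (l + h * e) (s * e)) ⟩
  l + h * e + z * e                       ≡⟨ swap l z h e ⟨
  l + (z + h) * e                         ∎
  where
  open ≡-Reasoning
  l = y %2^ p
  s = slice p b y
  h = (y /2^ (p + b)) * 2 ^ b
  e = 2 ^ p
  swap : ∀ l s h e → l + (s + h) * e ≡ l + h * e + s * e
  swap = solve-∀

slice-set : ∀ p b {z} y → z < 2 ^ b → slice p b (setSlice p b z y) ≡ z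
slice-set p b {z} y z< = begin
  slice p b (setSlice p b z y)                     ≡⟨ cong (slice p b) (setSlice-split p b z y) ⟩
  slice p b (y %2^ p + (z + h * 2 ^ b) * 2 ^ p)    ≡⟨ cong (_%2^ b) (/2^-absorb p _ (%2^-< y p)) ⟩
  (z + h * 2 ^ b) %2^ b                            ≡⟨ %2^-absorb b h z< ⟩
  z                                                ∎
  where
  open ≡-Reasoning
  h = y /2^ (p + b)

slice-low : ∀ p b {p′} lo X → p + b ≤ p′ → slice p b (lo + X * 2 ^ p′) ≡ slice p b lo
slice-low p b lo X p+b≤p′ with k , refl ← m≤n⇒∃[o]m+o≡n p+b≤p′ = begin
  slice p b (lo + X * 2 ^ (p + b + k))             ≡⟨ cong (slice p b ∘ (lo +_)) regroup ⟩
  slice p b (lo + X * 2 ^ k * 2 ^ b * 2 ^ p)       ≡⟨ cong (_%2^ b) shift ⟩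
  (lo /2^ p + X * 2 ^ k * 2 ^ b) %2^ b             ≡⟨ [m+kn]%n≡m%n (lo /2^ p) (X * 2 ^ k) (2 ^ b) {{2^-nonZero b}} ⟩
  slice p b lo                                     ∎
  where
  open ≡-Reasoning
  reorder : ∀ x a b c → x * (a * b * c) ≡ x * c * b * a
  reorder = solve-∀
  regroup : X * 2 ^ (p + b + k) ≡ X * 2 ^ k * 2 ^ b * 2 ^ p
  regroup = trans (cong (X *_) (trans (2^-+ (p + b) k) (cong (_* 2 ^ k) (2^-+ p b))))
                  (reorder X (2 ^ p) (2 ^ b) (2 ^ k))
  shift : (lo + X * 2 ^ k * 2 ^ b * 2 ^ p) /2^ p ≡ lo /2^ p + X * 2 ^ k * 2 ^ b
  shift = trans (+-distrib-/-∣ʳ lo {{2^-nonZero p}} (divides (X * 2 ^ k * 2 ^ b) refl))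
                (cong (lo /2^ p +_) (m*n/n≡m _ (2 ^ p) {{2^-nonZero p}}))

slice-high : ∀ p b {p′ b′} {z} y → p + b ≤ p′ → z < 2 ^ b →
             slice p′ b′ (setSlice p b z y) ≡ slice p′ b′ y
slice-high p b {b′ = b′} {z} y p+b≤p′ z< with k , refl ← m≤n⇒∃[o]m+o≡n p+b≤p′ =
  cong (_%2^ b′) (begin
    setSlice p b z y /2^ (p + b + k)     ≡⟨ /2^-+ (setSlice p b z y) (p + b) k ⟩
    setSlice p b z y /2^ (p + b) /2^ k   ≡⟨ cong (_/2^ k) (trans (/2^-+ (setSlice p b z y) p b) high) ⟩
    y /2^ (p + b) /2^ k                  ≡⟨ /2^-+ y (p + b) k ⟨
    y /2^ (p + b + k)                    ∎)
  where
  open ≡-Reasoning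
  high : setSlice p b z y /2^ p /2^ b ≡ y /2^ (p + b)
  high = trans (cong (_/2^ b) (trans (cong (_/2^ p) (setSlice-split p b z y))
                                     (/2^-absorb p _ (%2^-< y p))))
               (/2^-absorb b _ z<)

slice-other : ∀ p b {p′ b′} {z} y → z < 2 ^ b → p + b ≤ p′ ⊎ p′ + b′ ≤ p →
              slice p′ b′ (setSlice p b z y) ≡ slice p′ b′ y
slice-other p b {b′ = b′} y z< (inj₁ p+b≤p′) = slice-high p b {b′ = b′} y p+b≤p′ z<
slice-other p b {p′} {b′} {z} y z< (inj₂ p′+b′≤p) = begin
  slice p′ b′ (setSlice p b z y)   ≡⟨ cong (slice p′ b′) (setSlice-split p b z y) ⟩
  slice p′ b′ (y %2^ p + _)        ≡⟨ slice-low p′ b′ (y %2^ p) (z + (y /2^ (p + b)) * 2 ^ b) p′+b′≤p ⟩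
  slice p′ b′ (y %2^ p)            ≡⟨ slice-low p′ b′ (y %2^ p) (y /2^ p) p′+b′≤p ⟨
  slice p′ b′ (y %2^ p + _)        ≡⟨ cong (slice p′ b′) (2^-divMod y p) ⟨
  slice p′ b′ y                    ∎
  where open ≡-Reasoning

setSlice-< : ∀ p b {z} y {W} → z < 2 ^ b → p + b ≤ W → y < 2 ^ W → setSlice p b z y < 2 ^ W
setSlice-< p b {z} y z< p+b≤W y< with k , refl ← m≤n⇒∃[o]m+o≡n p+b≤W =
  subst₂ (λ x W → x < 2 ^ W) (sym (setSlice-split p b z y)) (sym (+-assoc p b k))
    (low-< p (b + k) (%2^-< y p) (low-< b k z< (/2^-< (p + b) k y<)))

-- Shifting left by w ∸ (p + b) discards everything above the slice.
slice-by-shifts : ∀ p b y {w} → p + b ≤ w →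
                  (y * 2 ^ (w ∸ (p + b))) %2^ w /2^ (w ∸ b) ≡ slice p b y
slice-by-shifts p b y {w} p+b≤w with k , refl ← m≤n⇒∃[o]m+o≡n p+b≤w = begin
  (y * 2 ^ (p + b + k ∸ (p + b))) %2^ (p + b + k) /2^ (p + b + k ∸ b)
    ≡⟨ cong₂ (λ i j → (y * 2 ^ i) %2^ (p + b + k) /2^ j) (m+n∸m≡n (p + b) k)
         (trans (cong (_∸ b) (perm p b k)) (m+n∸m≡n b (k + p))) ⟩
  (y * 2 ^ k) %2^ (p + b + k) /2^ (k + p)    ≡⟨ cong (_/2^ (k + p)) truncate ⟩
  (y %2^ (p + b)) * 2 ^ k /2^ (k + p)        ≡⟨ /2^-+ ((y %2^ (p + b)) * 2 ^ k) k p ⟩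
  (y %2^ (p + b)) * 2 ^ k /2^ k /2^ p        ≡⟨ cong (_/2^ p) (m*n/n≡m (y %2^ (p + b)) (2 ^ k) {{2^-nonZero k}}) ⟩
  y %2^ (p + b) /2^ p                        ≡⟨ <⇒%2^≡ b (/2^-< p b (%2^-< y (p + b))) ⟨
  slice p b (y %2^ (p + b))                  ≡⟨ slice-low p b (y %2^ (p + b)) (y /2^ (p + b)) ≤-refl ⟨
  slice p b (y %2^ (p + b) + (y /2^ (p + b)) * 2 ^ (p + b))  ≡⟨ cong (slice p b) (2^-divMod y (p + b)) ⟨
  slice p b y                                ∎
  where
  open ≡-Reasoning
  perm : ∀ p b k → p + b + k ≡ b + (k + p)
  perm = solve-∀
  distrib : ∀ a h d e → (a + h * d) * e ≡ a * e + h * (d * e)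
  distrib = solve-∀
  a = y %2^ (p + b)
  truncate : (y * 2 ^ k) %2^ (p + b + k) ≡ a * 2 ^ k
  truncate = trans (cong (_%2^ (p + b + k)) (trans (cong (_* 2 ^ k) (2^-divMod y (p + b)))
      (trans (distrib a (y /2^ (p + b)) (2 ^ (p + b)) (2 ^ k))
             (cong (λ e → a * 2 ^ k + (y /2^ (p + b)) * e) (sym (2^-+ (p + b) k))))))
    (%2^-absorb (p + b + k) (y /2^ (p + b)) (subst (a * 2 ^ k <_) (sym (2^-+ (p + b) k))
      (*-monoˡ-< (2 ^ k) {{2^-nonZero k}} (%2^-< y (p + b)))))

bit : ℕ → ℕ → ℕ
bit j = slice j 1

bit≤1 : ∀ j y → bit j y ≤ 1
bit≤1 j y = ≤-pred (slice-< j 1 y)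

ones : ℕ → ℕ → ℕ
ones o y = sumBelow (λ j → bit j y) o

sumBelow-cong : ∀ {f g} N → (∀ i → i < N → f i ≡ g i) → sumBelow f N ≡ sumBelow g N
sumBelow-cong zero    h = refl
sumBelow-cong (suc N) h = cong₂ _+_ (sumBelow-cong N λ i i< → h i (m≤n⇒m≤1+n i<)) (h N ≤-refl)

sumBelow-+ : ∀ f a b → sumBelow f (a + b) ≡ sumBelow f a + sumBelow (λ i → f (a + i)) b
sumBelow-+ f a zero    = trans (cong (sumBelow f) (+-identityʳ a)) (sym (+-identityʳ _))
sumBelow-+ f a (suc b) = trans (cong (sumBelow f) (+-suc a b))
  (trans (cong (_+ f (a + b)) (sumBelow-+ f a b)) (+-assoc (sumBelow f a) _ _))

sumBelow-mono : ∀ {f g} N → (∀ i → i < N → f i ≤ g i) → sumBelow f N ≤ sumBelow g N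
sumBelow-mono zero    h = z≤n
sumBelow-mono (suc N) h = +-mono-≤ (sumBelow-mono N λ i i< → h i (m≤n⇒m≤1+n i<)) (h N ≤-refl)

sumBelow-const : ∀ c N → sumBelow (λ _ → c) N ≡ N * c
sumBelow-const c zero    = refl
sumBelow-const c (suc N) = trans (cong (_+ c) (sumBelow-const c N)) (+-comm (N * c) c)

sumBelow-extend : ∀ f {a b} → a ≤ b → sumBelow f a ≤ sumBelow f b
sumBelow-extend f {a} a≤b with k , refl ← m≤n⇒∃[o]m+o≡n a≤b =
  ≤-trans (m≤m+n _ _) (≤-reflexive (sym (sumBelow-+ f a k)))

ones-≤ : ∀ o y → ones o y ≤ o
ones-≤ o y = ≤-trans (sumBelow-mono o λ j _ → bit≤1 j y)
  (≤-reflexive (trans (sumBelow-const 1 o) (*-identityʳ o)))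

ones-+ : ∀ a b y → ones (a + b) y ≡ ones a y + ones b (y /2^ a)
ones-+ a b y = trans (sumBelow-+ _ a b)
  (cong (ones a y +_) (sumBelow-cong b λ j _ → cong (_%2^ 1) (/2^-+ y a j)))

ones-low : ∀ {o} p lo X → o ≤ p → ones o (lo + X * 2 ^ p) ≡ ones o lo
ones-low p lo X o≤p = sumBelow-cong _ λ j j<o →
  slice-low j 1 lo X (≤-trans (≤-reflexive (+-comm j 1)) (≤-trans j<o o≤p))

ones-mod : ∀ {o} p y → o ≤ p → ones o y ≡ ones o (y %2^ p)
ones-mod {o} p y o≤p = trans (cong (ones o) (2^-divMod y p)) (ones-low p (y %2^ p) (y /2^ p) o≤p)

ones-0 : ∀ o → ones o 0 ≡ 0
ones-0 o = trans (sumBelow-cong o λ j _ → cong (_%2^ 1) (0/n≡0 (2 ^ j) {{2^-nonZero j}}))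
  (trans (sumBelow-const 0 o) (*-zeroʳ o))

ones-stable : ∀ {o p} y → y < 2 ^ o → o ≤ p → ones p y ≡ ones o y
ones-stable {o} y y< o≤p with k , refl ← m≤n⇒∃[o]m+o≡n o≤p = trans (ones-+ o k y)
  (trans (cong (λ z → ones o y + ones k z) (m<n⇒m/n≡0 {{2^-nonZero o}} y<))
         (trans (cong (ones o y +_) (ones-0 k)) (+-identityʳ _)))

ones-suc : ∀ o y → ones (suc o) y ≡ y % 2 + ones o (y / 2)
ones-suc o y = trans (ones-+ 1 o y) (cong (_+ ones o (y / 2)) (cong (_% 2) (n/1≡n y)))

-- The working memory as an array of slots of β bits, q of which share a word.
-- Word 0 is kept in the register $w₀.

fetchWord : Stmt
fetchWord =
  $gw ≔ ! $gi ⟪ div ⟫ ! $q ⨾ $go ≔ ! $β ⟪ mul ⟫ (! $gi mod ! $q) ⨾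
  if ! $gw then ($gy ≔mem ! $gw ⟪ sub ⟫ lit 1) else′ ($gy ≔ ! $w₀)

extract : ∀ {i : Fin 5} → Expr (suc (suc (suc i)))
extract = ! $gy ⟪ shl ⟫ (wordLen ⟪ sub ⟫ (! $go ⟪ add ⟫ ! $β)) ⟪ shr ⟫ (wordLen ⟪ sub ⟫ ! $β)

getSlot : Var → TopExpr → Stmt
getSlot x e = $gi ≔ e ⨾ fetchWord ⨾ x ≔ extract

setSlot : TopExpr → TopExpr → Stmt
setSlot e e′ =
  $sv ≔ e′ ⨾ $gi ≔ e ⨾ fetchWord ⨾
  $gy ≔ ! $gy ⟪ sub ⟫ (extract ⟪ shl ⟫ ! $go) ⨾
  $gy ≔ ! $gy ⟪ add ⟫ (! $sv ⟪ shl ⟫ ! $go) ⨾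
  if ! $gw then (mem (! $gw ⟪ sub ⟫ lit 1) ≔ ! $gy) else′ ($w₀ ≔ ! $gy)

quiet : Stmt → Bool
quiet s = not (writes s $q ∨ writes s $β ∨ writes s $w₀ ∨ stores s)

quiet⇒ : ∀ s → quiet s ≡ true →
         writes s $q ≡ false × writes s $β ≡ false × writes s $w₀ ≡ false × stores s ≡ false
quiet⇒ s h with writes s $q | writes s $β | writes s $w₀ | stores s
... | false | false | false | false = refl , refl , refl , refl

word : State → ℕ → ℕ
word σ zero    = env σ $w₀
word σ (suc j) = memory σ j

-- The capacity is that of `suc M` words because `$w₀` serves as one more word.
module Slots (𝕀 : Input)
             (q β cap : ℕ) (1≤q : 1 ≤ q) (βq≤w : β * q ≤ Input.w 𝕀) (cap≤ : cap ≤ suc (Input.M 𝕀) * q) where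

  open Input 𝕀
  open Semantics 𝕀
  open Hoare 𝕀

  instance
    q≢0 : NonZero q
    q≢0 = >-nonZero 1≤q

  slot : State → ℕ → ℕ
  slot σ i = slice (β * (i % q)) β (word σ (i / q))

  record VM (σ : State) : Set where
    constructor vm
    field
      q≡     : env σ $q ≡ q
      β≡     : env σ $β ≡ β
      words< : ∀ j → word σ j < 2 ^ w

  open VM public

  quiet-word : ∀ {s σ σ′} → Frame s σ σ′ → quiet s ≡ true → ∀ j → word σ′ j ≡ word σ j
  quiet-word {s} f h j with quiet⇒ s h
  quiet-word f h zero    | _ , _ , w₀ , _ = var≡ f $w₀ w₀
  quiet-word f h (suc j) | _ , _ , _ , st = cong (λ μ → μ j) (mem≡ f st)

  quiet-slot : ∀ {s σ σ′} → Frame s σ σ′ → quiet s ≡ true → ∀ i → slot σ′ i ≡ slot σ i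
  quiet-slot f h i = cong (slice (β * (i % q)) β) (quiet-word f h (i / q))

  quiet-VM : ∀ {s σ σ′} → Frame s σ σ′ → quiet s ≡ true → VM σ → VM σ′
  quiet-VM {s} f h (vm a b c) with quiet⇒ s h
  ... | q₀ , β₀ , _ = vm (trans (var≡ f $q q₀) a) (trans (var≡ f $β β₀) b)
                         (λ j → subst (_< 2 ^ w) (sym (quiet-word f h j)) (c j))

  slot-< : ∀ σ i → slot σ i < 2 ^ β
  slot-< σ i = slice-< (β * (i % q)) β (word σ (i / q))

  w<2^w : w < 2 ^ w
  w<2^w = n<2^n w

  1<2^w : 1 < 2 ^ w
  1<2^w = ≤-<-trans 0<w w<2^w

  position-≤ : ∀ i → β * (i % q) + β ≤ w
  position-≤ i = begin
    β * (i % q) + β     ≡⟨ trans (+-comm _ β) (sym (*-suc β (i % q))) ⟩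
    β * suc (i % q)     ≤⟨ *-monoʳ-≤ β (m%n<n i q) ⟩
    β * q               ≤⟨ βq≤w ⟩
    w                   ∎
    where open ≤-Reasoning

  word-address : ∀ {i j} → i < cap → i / q ≡ suc j → j < M
  word-address {i} {j} i< eq = ≤-pred (≤-trans (s≤s (≤-reflexive (sym eq)))
    (m<n*o⇒m/o<n (≤-trans i< cap≤)))

  record Located (σ : State) (i : ℕ) (σ′ : State) : Set where
    field
      gw : env σ′ $gw ≡ i / q
      go : env σ′ $go ≡ β * (i % q)
      gy : env σ′ $gy ≡ word σ (i / q)

  open Located

  fetch-run : ∀ {σ i} → VM σ → i < cap → env σ $gi ≡ i →
              Run (fetchWord) σ λ t σ′ → t ≡ 0 × Located σ i σ′
  fetch-run {σ} {i} h i< gi =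
    div⇓ (var⇓ gi) (var⇓ (q≡ h)) ▹
    mul⇓ (var⇓ (β≡ h)) (mod⇓ (var⇓ gi) (var⇓ (q≡ h)))
      (≤-<-trans (≤-trans (m≤m+n _ β) (position-≤ i)) w<2^w) ▹
    branch (var⇓ refl)
      (λ ≢0 → let j , eq = ≢0⇒suc ≢0 in
        run (ldm {a = j} (value≡ (cong (_∸ 1) eq)
               (sub⇓ (var⇓ refl) (lit⇓ 1<2^w) (subst (1 ≤_) (sym eq) (s≤s z≤n)))) (word-address i< eq))
            (refl , record { gw = refl ; go = refl ; gy = cong (word σ) (sym eq) }))
      (λ ≡0 → set (var⇓ refl) (refl , record { gw = refl ; go = refl ; gy = cong (word σ) (sym ≡0) }))

  extract⇓ : ∀ {σ σ′ i} {d : Fin 5} → VM σ → env σ′ $β ≡ β → Located σ i σ′ →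
             env σ′ ⊢ extract {d} ⇓ slot σ i
  extract⇓ {σ} {σ′} {i} h β′ l = value≡
    (slice-by-shifts (β * (i % q)) β (word σ (i / q)) (position-≤ i))
    (shr⇓ (shl⇓ (var⇓ (gy l)) (sub⇓ wordLen⇓ (add⇓ (var⇓ (go l)) (var⇓ β′)
            (≤-<-trans (position-≤ i) w<2^w)) (position-≤ i)))
          (sub⇓ wordLen⇓ (var⇓ β′) (≤-trans (m≤n+m β (β * (i % q))) (position-≤ i))))

  word-assign : ∀ {σ a} x → (x == $w₀) ≡ false → ∀ j → word (assign σ x a) j ≡ word σ j
  word-assign {σ} {a} x w₀ zero    = cong (if_then a else env σ $w₀) w₀
  word-assign x w₀ (suc j) = refl

  VM-assign : ∀ {σ a} x → (x == $q) ≡ false → (x == $β) ≡ false → (x == $w₀) ≡ false →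
              VM σ → VM (assign σ x a)
  VM-assign {σ} {a} x q₀ β₀ w₀ (vm q₁ β₁ ws) =
    vm (trans (cong (if_then a else env σ $q) q₀) q₁) (trans (cong (if_then a else env σ $β) β₀) β₁)
      λ j → subst (_< 2 ^ w) (sym (word-assign x w₀ j)) (ws j)

  get-run : ∀ {σ i e} x → VM σ → env σ ⊢ e ⇓ i → i < cap →
            Run (getSlot x e) σ λ t σ′ → t ≡ 0 × env σ′ x ≡ slot σ i
  get-run {σ} {i} {e} x h d i< =
    d ▹ (fetch-run {assign σ $gi i} h₁ i< refl ▸ λ { {σ′ = σ₂} f (refl , l) →
      set (extract⇓ h₁ (trans (var≡ f $β refl) (β≡ h)) l) (refl , trans (cong (if_then slot σ₁ i else env σ₂ x) (==-refl x))
        (cong (slice (β * (i % q)) β) (word-assign $gi refl (i / q)))) })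
    where
    σ₁ = assign σ $gi i
    h₁ : VM σ₁
    h₁ = VM-assign $gi refl refl refl h

  shl-exact : ∀ {ρ : Env} {d : Fin 7} {e : Expr (suc d)} {e′ a b} → ρ ⊢ e ⇓ a → ρ ⊢ e′ ⇓ b →
              a * 2 ^ b < 2 ^ w → ρ ⊢ e ⟪ shl ⟫ e′ ⇓ a * 2 ^ b
  shl-exact D D′ a< = value≡ (<⇒%2^≡ w a<) (shl⇓ D D′)

  record SetPost (σ : State) (i z : ℕ) (t : ℕ) (σ′ : State) : Set where
    constructor setPost
    field
      free   : t ≡ 0
      vm′    : VM σ′
      same   : slot σ′ i ≡ z
      others : ∀ j → j ≢ i → slot σ′ j ≡ slot σ j

  open SetPost public

  set-run : ∀ {σ i z e e′} → VM σ → env σ ⊢ e′ ⇓ z → env σ [ $sv ↦ z ] ⊢ e ⇓ i → i < cap → z < 2 ^ β →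
            Run (setSlot e e′) σ (SetPost σ i z)
  set-run {σ} {i} {z} {e} h d′ d i< z< =
    d′ ▹ d ▹ (fetch-run {σ₁} h₁ i< refl ▸ λ { {σ′ = σ₂} f (refl , l) →
      let old = memory σ₂ in
      sub⇓ (var⇓ (gy l)) (shl-exact (extract⇓ h₁ (trans (var≡ f $β refl) (β≡ h)) l) (var⇓ (go l))
        (≤-<-trans (slice-≤ p β y) (words< h₁ (i / q)))) (slice-≤ p β y) ▹
      add⇓ (var⇓ refl) (shl-exact (var⇓ (var≡ f $sv refl)) (var⇓ (go l)) z·<) y′< ▹
      branch (var⇓ (gw l))
        (λ ≢0 → let j , eq = ≢0⇒suc ≢0 in
          run (stm {a = j} (value≡ (cong (_∸ 1) eq)
                 (sub⇓ (var⇓ (gw l)) (lit⇓ 1<2^w) (subst (1 ≤_) (sym eq) (s≤s z≤n))))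
                 (word-address i< eq) (var⇓ refl))
            (conclude f refl refl (trans (cong (word _) eq) (cong (if_then y′ else old j) (≡ᵇ-refl j)))
              λ { zero    _  → quiet-word f refl 0
                ; (suc k) k≢ → trans (cong (if_then y′ else old k) (≡ᵇ-false {j} {k} (k≢ ∘ λ { refl → sym eq })))
                                     (quiet-word f refl (suc k)) }))
        (λ ≡0 → set (var⇓ refl) (conclude f refl refl (cong (word _) ≡0)
              λ { zero    0≢ → ⊥-elim (0≢ (sym ≡0))
                ; (suc k) _  → quiet-word f refl (suc k) })) })
    where
    σ₁ = assign (assign σ $sv z) $gi i
    h₁ : VM σ₁
    h₁ = VM-assign $gi refl refl refl (VM-assign $sv refl refl refl h)
    p = β * (i % q)
    y = word σ₁ (i / q)
    y′ = setSlice p β z y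
    y′< : y′ < 2 ^ w
    y′< = setSlice-< p β y z< (position-≤ i) (words< h₁ (i / q))
    z·< : z * 2 ^ p < 2 ^ w
    z·< = ≤-<-trans (m≤n+m (z * 2 ^ p) _) y′<
    ≡ᵇ-refl : ∀ j → (j ≡ᵇ j) ≡ true
    ≡ᵇ-refl zero    = refl
    ≡ᵇ-refl (suc j) = ≡ᵇ-refl j
    ≡ᵇ-false : ∀ {j k} → j ≢ k → (j ≡ᵇ k) ≡ false
    ≡ᵇ-false {j} {k} j≢k with j ≡ᵇ k in eq
    ... | true  = ⊥-elim (j≢k (≡ᵇ⇒≡ j k (subst T (sym eq) tt)))
    ... | false = refl
    word-σ₁ : ∀ j → word σ₁ j ≡ word σ j
    word-σ₁ j = trans (word-assign {assign σ $sv z} $gi refl j) (word-assign {σ} $sv refl j)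
    conclude : ∀ {σ₂ σ′} → Frame fetchWord σ₁ σ₂ →
               env σ′ $q ≡ env σ₂ $q → env σ′ $β ≡ env σ₂ $β → word σ′ (i / q) ≡ y′ →
               (∀ k → k ≢ i / q → word σ′ k ≡ word σ₁ k) → SetPost σ i z 0 σ′
    conclude {σ₂} {σ′} f q′ β′ here there = setPost refl
      (vm (trans q′ (trans (var≡ f $q refl) (q≡ h))) (trans β′ (trans (var≡ f $β refl) (β≡ h))) bounded)
      (trans (cong (slice p β) here) (slice-set p β y z<))
      elsewhere
      where
      bounded : ∀ k → word σ′ k < 2 ^ w
      bounded k with k ≟ i / q
      ... | yes refl = subst (_< 2 ^ w) (sym here) y′<
      ... | no  k≢   = subst (_< 2 ^ w) (sym (there k k≢)) (words< h₁ k)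
      elsewhere : ∀ j → j ≢ i → slot σ′ j ≡ slot σ j
      elsewhere j j≢i with j / q ≟ i / q
      ... | no  ≢   = cong (slice (β * (j % q)) β) (trans (there (j / q) ≢) (word-σ₁ (j / q)))
      ... | yes j/q = trans (cong (slice (β * (j % q)) β) (trans (cong (word σ′) j/q) here))
        (trans (slice-other p β {β * (j % q)} {β} y z< disjoint)
          (cong (slice (β * (j % q)) β) (trans (word-σ₁ (i / q)) (cong (word σ) (sym j/q)))))
        where
        step≤ : ∀ {a b} → a < b → β * a + β ≤ β * b
        step≤ {a} {b} a<b = ≤-trans (≤-reflexive (trans (+-comm _ β) (sym (*-suc β a)))) (*-monoʳ-≤ β a<b)
        -- Different slots of one word have different residues modulo q; otherwise division with
        -- remainder would identify their indices.
        disjoint : p + β ≤ β * (j % q) ⊎ β * (j % q) + β ≤ p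
        disjoint with <-cmp (i % q) (j % q)
        ... | tri< i<j _ _ = inj₁ (step≤ i<j)
        ... | tri> _ _ j<i = inj₂ (step≤ j<i)
        ... | tri≈ _ i≡j _ = ⊥-elim (j≢i (trans (m≡m%n+[m/n]*n j q)
            (trans (cong₂ (λ a b → a + b * q) (sym i≡j) j/q) (sym (m≡m%n+[m/n]*n i q)))))

-- Binary lengths, digits and the numbering of levels

bitlen : ℕ → ℕ
bitlen zero        = 0
bitlen e@(suc _)   = suc ⌊log₂ e ⌋

/2≡⌊/2⌋ : ∀ e → e / 2 ≡ ⌊ e /2⌋
/2≡⌊/2⌋ zero          = refl
/2≡⌊/2⌋ (suc zero)    = refl
/2≡⌊/2⌋ (suc (suc e)) = trans (+-distrib-/-∣ˡ {2} e {2} (divides 1 refl)) (cong suc (/2≡⌊/2⌋ e))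

bitlen-half : ∀ e → bitlen (e / 2) ≡ bitlen e ∸ 1
bitlen-half zero    = refl
bitlen-half (suc zero) = refl
bitlen-half e@(suc (suc e′)) = begin
  bitlen (e / 2)              ≡⟨ cong bitlen (/2≡⌊/2⌋ e) ⟩
  suc ⌊log₂ suc ⌊ e′ /2⌋ ⌋    ≡⟨ cong suc (⌊log₂⌊n/2⌋⌋≡⌊log₂n⌋∸1 e) ⟩
  suc (⌊log₂ e ⌋ ∸ 1)         ≡⟨ m+[n∸m]≡n {1} (⌊log₂⌋-mono-≤ {2} {e} (s≤s (s≤s z≤n))) ⟩
  ⌊log₂ e ⌋                   ∎
  where open ≡-Reasoning

bitlen-suc : ∀ {e m} → bitlen e ≡ suc m → e ≢ 0 × bitlen (e / 2) ≡ m
bitlen-suc {suc e} {m} eq = (λ ()) , trans (bitlen-half (suc e)) (cong (_∸ 1) eq)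

bitlen-0 : ∀ {e} → bitlen e ≡ 0 → e ≡ 0
bitlen-0 {zero} _ = refl

halves : ∀ e → e ≡ e % 2 + e / 2 * 2
halves e = m≡m%n+[m/n]*n e 2

-- The recursion of the loops that shift a number to the right until it is 0; m is the number of
-- iterations that remain.
bitlen-induction : ∀ (P : ℕ → ℕ → Set) → P 0 0 →
                   (∀ e m → e ≢ 0 → bitlen e ≡ suc m → P (e / 2) m → P e (suc m)) → ∀ e → P e (bitlen e)
bitlen-induction P p₀ pₛ e = go e (bitlen e) refl
  where
  go : ∀ e m → bitlen e ≡ m → P e m
  go e zero    eq rewrite bitlen-0 {e} eq = p₀
  go e (suc m) eq = let e≢0 , eq′ = bitlen-suc {e} eq in pₛ e m e≢0 eq (go (e / 2) m eq′)

<2^bitlen : ∀ e → e < 2 ^ bitlen e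
<2^bitlen = bitlen-induction (λ e m → e < 2 ^ m) (s≤s z≤n) λ e m _ _ ih → begin-strict
  e                   ≡⟨ halves e ⟩
  e % 2 + e / 2 * 2   <⟨ +-monoˡ-< (e / 2 * 2) (m%n<n e 2) ⟩
  suc (e / 2) * 2     ≤⟨ *-monoˡ-≤ 2 ih ⟩
  2 ^ m * 2           ≡⟨ *-comm (2 ^ m) 2 ⟩
  2 ^ suc m           ∎
  where open ≤-Reasoning

2^bitlen≤ : ∀ e → e ≢ 0 → 2 ^ bitlen e ≤ 2 * e
2^bitlen≤ = bitlen-induction (λ e m → e ≢ 0 → 2 ^ m ≤ 2 * e) (λ 0≢0 → ⊥-elim (0≢0 refl)) step
  where
  open ≤-Reasoning
  step : ∀ e m → e ≢ 0 → bitlen e ≡ suc m → (e / 2 ≢ 0 → 2 ^ m ≤ 2 * (e / 2)) → e ≢ 0 → 2 ^ suc m ≤ 2 * e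
  step e zero    e≢0 _  _  _ = *-monoʳ-≤ 2 (n≢0⇒n>0 e≢0)
  step e (suc m) _   eq ih _ = *-monoʳ-≤ 2 (begin
    2 ^ suc m           ≤⟨ ih (λ h → 0≢1+n (trans (cong bitlen (sym h)) (proj₂ (bitlen-suc {e} eq)))) ⟩
    2 * (e / 2)         ≡⟨ *-comm 2 (e / 2) ⟩
    e / 2 * 2           ≤⟨ m/n*n≤m e 2 ⟩
    e                   ∎)

bitlen-≤ : ∀ {e b} → e < 2 ^ b → bitlen e ≤ b
bitlen-≤ {e} {b} = bitlen-induction (λ e m → ∀ b → e < 2 ^ b → m ≤ b) (λ _ _ → z≤n)
  (λ e m e≢0 _ ih → λ
    { zero    e<1 → ⊥-elim (e≢0 (n<1⇒n≡0 e<1))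
    ; (suc b) e<  → s≤s (ih b (m<n*o⇒m/o<n (subst (e <_) (*-comm 2 (2 ^ b)) e<))) }) e b

bitlen-mono : ∀ {d e} → d ≤ e → bitlen d ≤ bitlen e
bitlen-mono {e = e} d≤e = bitlen-≤ (≤-<-trans d≤e (<2^bitlen e))

bitlen-id-≤ : ∀ e → bitlen e ≤ e
bitlen-id-≤ e = bitlen-≤ (n<2^n e)

-- The number with the binary digits g k, g (k + 1), …, g (k + m − 1).
value : ℕ → (ℕ → ℕ) → ℕ → ℕ
value zero    g k = 0
value (suc m) g k = g k + 2 * value m g (suc k)

value-cong : ∀ m {f g} k → (∀ i → k ≤ i → i < k + m → f i ≡ g i) → value m f k ≡ value m g k
value-cong zero    k h = refl
value-cong (suc m) k h = cong₂ (λ a b → a + 2 * b) (h k ≤-refl (m<m+n k (s≤s z≤n)))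
  (value-cong m (suc k) λ i k<i i< → h i (<⇒≤ k<i) (subst (i <_) (sym (+-suc k m)) i<))

-- The number of digits 0 among the lowest m is the potential of a counter: a borrow turns zeros
-- into ones and creates one zero where it stops.
zeros : ℕ → ℕ → ℕ
zeros m x = m ∸ ones m x

zeros-≤ : ∀ m x → zeros m x ≤ m
zeros-≤ m x = m∸n≤m m (ones m x)

digit : ∀ b X → b ≤ 1 → (b + 2 * X) % 2 ≡ b × (b + 2 * X) / 2 ≡ X
digit b X b≤1 rewrite *-comm 2 X = %-absorb X (s≤s b≤1) , /-absorb X (s≤s b≤1)

zeros-digit₁ : ∀ m X → zeros (suc m) (1 + 2 * X) ≡ zeros m X
zeros-digit₁ m X rewrite ones-suc m (1 + 2 * X) | proj₁ (digit 1 X ≤-refl) | proj₂ (digit 1 X ≤-refl) = refl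

zeros-digit₀ : ∀ m X → zeros (suc m) (2 * X) ≡ suc (zeros m X)
zeros-digit₀ m X rewrite ones-suc m (2 * X) | proj₁ (digit 0 X z≤n) | proj₂ (digit 0 X z≤n) =
  +-∸-assoc 1 (ones-≤ m X)

<ᵇ-< : ∀ {i j} → i < j → (i <ᵇ j) ≡ true
<ᵇ-< {i} {j} i<j with i <ᵇ j | <⇒<ᵇ i<j
... | true | _ = refl

<ᵇ-≮ : ∀ {i j} → ¬ i < j → (i <ᵇ j) ≡ false
<ᵇ-≮ {i} {j} i≮j with i <ᵇ j in eq
... | true  = ⊥-elim (i≮j (<ᵇ⇒< i j (subst T (sym eq) tt)))
... | false = refl

<ᵇ-suc-other : ∀ {j k} → j ≢ k → (j <ᵇ suc k) ≡ (j <ᵇ k)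
<ᵇ-suc-other {j} {k} j≢k with j <? k
... | yes j<k = trans (<ᵇ-< (m≤n⇒m≤1+n j<k)) (sym (<ᵇ-< j<k))
... | no  j≮k = trans (<ᵇ-≮ (λ j<1+k → j≮k (≤∧≢⇒< (≤-pred j<1+k) j≢k))) (sym (<ᵇ-≮ j≮k))

<ᵇ-suc≡≤ᵇ : ∀ j l → (j <ᵇ suc l) ≡ (j ≤ᵇ l)
<ᵇ-suc≡≤ᵇ zero    l = refl
<ᵇ-suc≡≤ᵇ (suc j) l = refl

-- Vertices of level at least k, for k = 0, 1, …, are numbered consecutively,
-- level after level: lin k v is the number of vertex v on level k.
module Levels (n : ℕ) (len : ℕ → ℕ) where

  reaches : ℕ → ℕ → ℕ
  reaches k v = bool→ℕ (k ≤ᵇ len v)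

  before : ℕ → ℕ → ℕ
  before k = sumBelow (reaches k)

  first : ℕ → ℕ
  first = sumBelow λ k → before k n

  lin : ℕ → ℕ → ℕ
  lin k v = first k + before k v

  reaches-yes : ∀ {k v} → k ≤ len v → reaches k v ≡ 1
  reaches-yes {k} {v} h with k ≤ᵇ len v | ≤⇒≤ᵇ h
  ... | true | _ = refl

  reaches-no : ∀ {k v} → len v < k → reaches k v ≡ 0
  reaches-no {k} {v} h with k ≤ᵇ len v in eq
  ... | true  = ⊥-elim (<⇒≱ h (≤ᵇ⇒≤ k (len v) (subst T (sym eq) tt)))
  ... | false = refl

  lin-suc : ∀ k v → lin k (suc v) ≡ lin k v + reaches k v
  lin-suc k v = sym (+-assoc (first k) (before k v) (reaches k v))

  lin-end : ∀ k → lin k n ≡ lin (suc k) 0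
  lin-end k = sym (+-identityʳ _)

  lin-mono : ∀ k {v v′} → v ≤ v′ → lin k v ≤ lin k v′
  lin-mono k v≤v′ = +-monoʳ-≤ (first k) (sumBelow-extend (reaches k) v≤v′)

  lin-<-first : ∀ {k v} → v < n → k ≤ len v → lin k v < first (suc k)
  lin-<-first {k} {v} v<n k≤ = begin
    suc (lin k v)            ≡⟨ +-comm 1 (lin k v) ⟩
    lin k v + 1              ≡⟨ cong (lin k v +_) (reaches-yes k≤) ⟨
    lin k v + reaches k v    ≡⟨ lin-suc k v ⟨
    lin k (suc v)            ≤⟨ lin-mono k v<n ⟩
    first (suc k)            ∎
    where open ≤-Reasoning

  first-≤ : ∀ {k k′} → k ≤ k′ → first k ≤ first k′
  first-≤ = sumBelow-extend _

  lin-<ᵛ : ∀ {k v v′} → v < v′ → k ≤ len v → lin k v < lin k v′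
  lin-<ᵛ {k} {v} v<v′ k≤ = ≤-trans (≤-reflexive (trans (+-comm 1 (lin k v))
    (trans (cong (lin k v +_) (sym (reaches-yes k≤))) (sym (lin-suc k v))))) (lin-mono k v<v′)

  lin-<ᵏ : ∀ {k v k′ v′} → v < n → k ≤ len v → k < k′ → lin k v < lin k′ v′
  lin-<ᵏ v<n k≤ k<k′ = ≤-trans (lin-<-first v<n k≤) (≤-trans (first-≤ k<k′) (m≤m+n _ _))

  -- On the pairs of a level and a vertex that reaches it, `lin` is strictly increasing in the
  -- lexicographic order with the level first.
  lin-injective : ∀ {k v k′ v′} → v < n → k ≤ len v → v′ < n → k′ ≤ len v′ →
                  lin k v ≡ lin k′ v′ → k ≡ k′ × v ≡ v′
  lin-injective {k} {v} {k′} {v′} v<n k≤ v′<n k′≤ eq with <-cmp k k′ | <-cmp v v′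
  ... | tri< k<k′ _ _    | _ = ⊥-elim (<⇒≢ (lin-<ᵏ {v′ = v′} v<n k≤ k<k′) eq)
  ... | tri> _ _ k′<k    | _ = ⊥-elim (<⇒≢ (lin-<ᵏ {v′ = v} v′<n k′≤ k′<k) (sym eq))
  ... | tri≈ _ refl _    | tri< v<v′ _ _ = ⊥-elim (<⇒≢ (lin-<ᵛ {k} v<v′ k≤) eq)
  ... | tri≈ _ refl _    | tri> _ _ v′<v = ⊥-elim (<⇒≢ (lin-<ᵛ {k} v′<v k′≤) (sym eq))
  ... | tri≈ _ refl _    | tri≈ _ refl _ = refl , refl

  before-0 : ∀ v → before 0 v ≡ v
  before-0 v = trans (sumBelow-const 1 v) (*-identityʳ v)

  lin-0 : ∀ v → lin 0 v ≡ v
  lin-0 = before-0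

  -- The ones of F below lin k v are the vertices that are numbered on levels
  -- 1, …, k + 1 before v is numbered on level k + 1.
  lin-child : ∀ (F : ℕ → ℕ) → (∀ {k v} → v < n → k ≤ len v → F (lin k v) ≡ reaches (suc k) v) →
              ∀ k v → v ≤ n → n + sumBelow F (lin k v) ≡ lin (suc k) v
  lin-child F h zero zero _ = trans (+-identityʳ n) (trans (sym (before-0 n)) (sym (+-identityʳ _)))
  lin-child F h (suc k) zero _ = begin
    n + sumBelow F (lin (suc k) 0)   ≡⟨ cong (λ x → n + sumBelow F x) (lin-end k) ⟨
    n + sumBelow F (lin k n)         ≡⟨ lin-child F h k n ≤-refl ⟩
    lin (suc k) n                    ≡⟨ lin-end (suc k) ⟩
    lin (suc (suc k)) 0              ∎
    where open ≡-Reasoning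
  lin-child F h k (suc v) v<n with k ≤? len v
  ... | yes k≤ = begin
    n + sumBelow F (lin k (suc v))                   ≡⟨ cong (λ x → n + sumBelow F x) after ⟩
    n + (sumBelow F (lin k v) + F (lin k v))         ≡⟨ +-assoc n _ _ ⟨
    n + sumBelow F (lin k v) + F (lin k v)           ≡⟨ cong₂ _+_ (lin-child F h k v (<⇒≤ v<n)) (h v<n k≤) ⟩
    lin (suc k) v + reaches (suc k) v                ≡⟨ lin-suc (suc k) v ⟨
    lin (suc k) (suc v)                              ∎
    where
    open ≡-Reasoning
    after : lin k (suc v) ≡ suc (lin k v)
    after = trans (lin-suc k v) (trans (cong (lin k v +_) (reaches-yes k≤)) (+-comm (lin k v) 1))
  -- A vertex missing on level k is missing on level k + 1 as well, so neither side moves.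
  ... | no  k≰ = begin
    n + sumBelow F (lin k (suc v))                   ≡⟨ cong (λ x → n + sumBelow F x) (stay (≰⇒> k≰)) ⟩
    n + sumBelow F (lin k v)                         ≡⟨ lin-child F h k v (<⇒≤ v<n) ⟩
    lin (suc k) v                                    ≡⟨ stay (m≤n⇒m≤1+n (≰⇒> k≰)) ⟨
    lin (suc k) (suc v)                              ∎
    where
    open ≡-Reasoning
    stay : ∀ {k} → len v < k → lin k (suc v) ≡ lin k v
    stay {k} h = trans (lin-suc k v) (trans (cong (lin k v +_) (reaches-no h)) (+-identityʳ _))

  -- Double counting: the pairs of a level and a vertex are summed by vertices instead of levels,
  -- and the column of v has at most `suc (len v)` of them.
  first-total : ∀ K → first K ≤ sumBelow (suc ∘ len) n
  first-total K = go n
    where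
    column : ∀ K l → sumBelow (λ k → bool→ℕ (k ≤ᵇ l)) K ≤ suc l
    column zero    l = z≤n
    column (suc K) l with K ≤ᵇ l in eq
    ... | true  = ≤-trans (≤-reflexive (+-comm _ 1)) (s≤s (≤-trans (≤-trans
                    (sumBelow-mono K λ k _ → bool≤1 (k ≤ᵇ l))
                    (≤-reflexive (trans (sumBelow-const 1 K) (*-identityʳ K))))
                    (≤ᵇ⇒≤ K l (subst T (sym eq) tt))))
      where
      bool≤1 : ∀ b → bool→ℕ b ≤ 1
      bool≤1 true  = ≤-refl
      bool≤1 false = z≤n
    ... | false = ≤-trans (≤-reflexive (+-identityʳ _)) (column K l)
    go : ∀ v → sumBelow (λ k → before k v) K ≤ sumBelow (suc ∘ len) v
    go zero    = ≤-reflexive (trans (sumBelow-const 0 K) (*-zeroʳ K))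
    go (suc v) = ≤-trans (≤-reflexive (distrib K)) (+-mono-≤ (go v) (column K (len v)))
      where
      swap : ∀ a b c d → a + b + (c + d) ≡ a + c + (b + d)
      swap = solve-∀
      distrib : ∀ K → sumBelow (λ k → before k (suc v)) K ≡
                sumBelow (λ k → before k v) K + sumBelow (λ k → reaches k v) K
      distrib zero    = refl
      distrib (suc K) = trans (cong (_+ before K (suc v)) (distrib K)) (swap (sumBelow (λ k → before k v) K) (sumBelow (λ k → reaches k v) K) (before K v) (reaches K v))

-- Memory layout and the constants known to the program

every : (Var → Bool) → Bool
every f = Vec.foldr (λ _ → Bool) (λ x b → f x ∧ b) true allVars

-- As there are finitely many variables, a property of all of them can be evaluated. The conditions
-- `untouched` and `harmless` then hold by `refl` for concrete statements.
every⇒ : ∀ f → every f ≡ true → ∀ x → f x ≡ true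
every⇒ f h x = trans (cong f (sym (decode-code x))) (go allVars h (code x))
  where
  go : ∀ {k} (xs : Vec Var k) → Vec.foldr (λ _ → Bool) (λ x b → f x ∧ b) true xs ≡ true →
       ∀ i → f (lookup xs i) ≡ true
  go (x Vec.∷ xs) h i with f x in eq
  go (x Vec.∷ xs) h zero    | true = eq
  go (x Vec.∷ xs) h (suc i) | true = go xs h i

among : List Var → Var → Bool
among []       x = false
among (y ∷ ys) x = (x == y) ∨ among ys x

untouched : List Var → Stmt → Bool
untouched xs s = every λ x → not (among xs x ∧ writes s x)

untouched⇒ : ∀ xs s → untouched xs s ≡ true → ∀ x → among xs x ≡ true → writes s x ≡ false
untouched⇒ xs s h x x∈ = not-∧ x∈ (every⇒ (λ x → not (among xs x ∧ writes s x)) h x)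
  where
  not-∧ : ∀ {a b} → a ≡ true → not (a ∧ b) ≡ true → b ≡ false
  not-∧ {true} {false} _ _ = refl

harmless : List Var → Stmt → Bool
harmless xs s = quiet s ∧ untouched xs s

∧-left : ∀ {a b} → (a ∧ b) ≡ true → a ≡ true
∧-left {true} _ = refl

∧-right : ∀ {a b} → (a ∧ b) ≡ true → b ≡ true
∧-right {true} h = h

-- The regions 0, …, 4 of the memory: level pointers, popcount table, flags
-- with relative ranks, data bits and absolute ranks.
regionSize : (λ′ τ W V : ℕ) → ℕ → ℕ
regionSize λ′ τ W V 0 = λ′
regionSize λ′ τ W V 1 = 2 ^ τ
regionSize λ′ τ W V 2 = W
regionSize λ′ τ W V 3 = W
regionSize λ′ τ W V 4 = V
regionSize λ′ τ W V _ = 0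

pattern pointers = 0
pattern table = 1
pattern flags = 2
pattern digits = 3
pattern ranks = 4

-- `λ′` bounds the number of levels, is the number of flag words that share an absolute rank and, in
-- `Parameters`, sets the scale of the slot length `β`. By `N<`, level pointers and absolute ranks
-- fit into a slot.
record Layout (n w M N : ℕ) : Set where
  field
    λ′ q β τ t W V chunks : ℕ
  size : ℕ → ℕ
  size = regionSize λ′ τ W V
  base : ℕ → ℕ
  base = sumBelow size
  cap : ℕ
  cap = base 5
  field
    1≤λ′   : 1 ≤ λ′
    1≤q    : 1 ≤ q
    1≤t    : 1 ≤ t
    1≤τ    : 1 ≤ τ
    t≤β    : t ≤ β
    βq≤w   : β * q ≤ w
    cap≤   : cap ≤ suc M * q
    cap<   : cap < 2 ^ w
    N<     : N < 2 ^ β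
    W≡     : W ≡ suc (_/_ N t {{>-nonZero 1≤t}})
    V>     : ∀ {i} → i < W → _/_ i λ′ {{>-nonZero 1≤λ′}} < V
    -- A block of `λ′` words contains at most `λ′ * t` ones, so a rank relative to the block fits
    -- above the t flags of a slot.
    λ′t<   : λ′ * t < 2 ^ (β ∸ t)
    τ<     : τ < 2 ^ β
    -- The flags of a word are counted with at most `chunks` table lookups of τ bits.
    t≤     : t ≤ τ * chunks

  instance
    λ′≢0 : NonZero λ′
    λ′≢0 = >-nonZero 1≤λ′
    t≢0 : NonZero t
    t≢0 = >-nonZero 1≤t

  constant : Var → ℕ
  constant $λ  = λ′
  constant $τ  = τ
  constant $2τ = 2 ^ τ
  constant $t  = t
  constant $W  = W
  constant $bT = base table
  constant $bF = base flags
  constant $bD = base digits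
  constant $bA = base ranks
  constant _   = 0

-- The `early` constants come from n and w alone. Those added in `late` are set after a sweep has
-- determined N, on which the region length W depends.
early late : List Var
early = $λ ∷ $τ ∷ $2τ ∷ $t ∷ $bT ∷ []
late  = $bA ∷ $bD ∷ $bF ∷ $W ∷ early

module Degrees {n : ℕ} (G : Digraph n) where

  open Digraph G public

  degree : ℕ → ℕ
  degree i with i <? n
  ... | yes i<n = indeg (fromℕ< i<n)
  ... | no  _   = 0

  degree-toℕ : ∀ v → degree (toℕ v) ≡ indeg v
  degree-toℕ v with toℕ v <? n
  ... | yes v<n = cong indeg (Fin.fromℕ<-toℕ v v<n)
  ... | no  v≮n = ⊥-elim (v≮n (Fin.toℕ<n v))

  len : ℕ → ℕ
  len i = bitlen (degree i ∸ 1)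

  degree-≤ : ∀ i → degree i ≤ n
  degree-≤ i with i <? n
  ... | yes i<n = Fin.injective⇒≤ (inNbr-injective (fromℕ< i<n))
  ... | no  _   = z≤n

record Planes : Set where
  field
    𝕀 : Input
  open Input 𝕀 public
  field
    {N} : ℕ
    L   : Layout n w M N
    1≤n : 1 ≤ n
    len< : ∀ {v} → v < n → Degrees.len G v < Layout.λ′ L
    N≡  : N ≡ Levels.first n (Degrees.len G) (Layout.λ′ L)

module Regions (ℙ : Planes) where

  open Planes ℙ
  open Layout L public
  open Semantics 𝕀 public
  open Hoare 𝕀 public
  open Slots 𝕀 q β cap 1≤q βq≤w cap≤ public

  record Knows (xs : List Var) (σ : State) : Set where
    constructor knows
    field known : ∀ x → among xs x ≡ true → env σ x ≡ constant x

  open Knows public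

  keep-known : ∀ {xs s σ σ′} → Frame s σ σ′ → untouched xs s ≡ true → Knows xs σ → Knows xs σ′
  keep-known {xs} {s} f h k = knows λ x x∈ →
    trans (var≡ f x (untouched⇒ xs s h x x∈)) (known k x x∈)

  record Context (xs : List Var) (σ : State) : Set where
    constructor _,ᶜ_
    field
      vm-of    : VM σ
      knows-of : Knows xs σ

  open Context public

  keep : ∀ {xs s σ σ′} → Frame s σ σ′ → harmless xs s ≡ true → Context xs σ → Context xs σ′
  keep {xs} {s} f h (v ,ᶜ k) = quiet-VM f (∧-left h) v ,ᶜ keep-known f (∧-right {quiet s} h) k

  const-of : ∀ {xs σ} → Context xs σ → ∀ x → among xs x ≡ true → env σ x ≡ constant x
  const-of c = known (knows-of c)

  late⇒early : ∀ {σ} → Context late σ → Context early σ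
  late⇒early (v ,ᶜ k) = v ,ᶜ knows λ x x∈ → known k x (implies x∈ (every⇒ (λ x → not (among early x) ∨ among late x) refl x))
    where
    implies : ∀ {a b} → a ≡ true → (not a ∨ b) ≡ true → b ≡ true
    implies {true} _ h = h

  learn : ∀ {x xs σ} → env σ x ≡ constant x → Knows xs σ → Knows (x ∷ xs) σ
  learn {x} {xs} {σ} x≡ k = knows λ y y∈ → go y (y == x) refl y∈
    where
    go : ∀ y b → (y == x) ≡ b → (b ∨ among xs y) ≡ true → env σ y ≡ constant y
    go y true  eq y∈ = subst (λ z → env σ z ≡ constant z) (sym (==-sound {y} {x} eq)) x≡
    go y false eq y∈ = known k y y∈

  address : ℕ → ℕ → ℕ
  address R i = base R + i

  arr : State → ℕ → ℕ → ℕ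
  arr σ R i = slot σ (address R i)

  arr-< : ∀ σ R i → arr σ R i < 2 ^ β
  arr-< σ R i = slot-< σ (address R i)

  address-< : ∀ {R i} → R < 5 → i < size R → address R i < cap
  address-< {R} {i} R<5 i< = ≤-trans (+-monoʳ-< (base R) i<) (sumBelow-extend size R<5)

  address-injective : ∀ {R i R′ i′} → i < size R → i′ < size R′ →
                      address R i ≡ address R′ i′ → R ≡ R′ × i ≡ i′
  address-injective {R} {i} {R′} {i′} i< i′< eq with <-cmp R R′
  ... | tri< R<R′ _ _ = ⊥-elim (<⇒≢ (≤-trans (+-monoʳ-< (base R) i<)
                          (≤-trans (sumBelow-extend size R<R′) (m≤m+n (base R′) i′))) eq)
  ... | tri> _ _ R′<R = ⊥-elim (<⇒≢ (≤-trans (+-monoʳ-< (base R′) i′<)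
                          (≤-trans (sumBelow-extend size R′<R) (m≤m+n (base R) i))) (sym eq))
  ... | tri≈ _ refl _ = refl , +-cancelˡ-≡ (base R) i i′ eq

  quiet-arr : ∀ {s σ σ′} → Frame s σ σ′ → quiet s ≡ true → ∀ R i → arr σ′ R i ≡ arr σ R i
  quiet-arr f h R i = quiet-slot f h (address R i)

  small : ∀ {i} → i < cap → i < 2 ^ w
  small i< = <-trans i< cap<

  lit-1 : ∀ {ρ i} → ρ ⊢ lit {i} 1 ⇓ 1
  lit-1 = lit⇓ 1<2^w

  lit-0 : ∀ {ρ i} → ρ ⊢ lit {i} 0 ⇓ 0
  lit-0 = lit⇓ (m^n>0 2 w)

  at⇓ : ∀ {ρ R i x} {d : Fin 7} {e : Expr (inject₁ d)} → R < 5 → ρ x ≡ base R → ρ ⊢ e ⇓ i →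
        i < size R → ρ ⊢ ! x ⟪ add ⟫ e ⇓ address R i
  at⇓ {R = R} R<5 b d i< = add⇓ (var⇓ b) d (small (address-< {R} R<5 i<))

  record Stored (σ : State) (R i z : ℕ) (t : ℕ) (σ′ : State) : Set where
    constructor stored
    field
      at-no-cost : t ≡ 0
      vm-after   : VM σ′
      here       : arr σ′ R i ≡ z
      elsewhere  : ∀ R′ i′ → i′ < size R′ → R′ ≢ R ⊎ i′ ≢ i → arr σ′ R′ i′ ≡ arr σ R′ i′

  open Stored public

  store-run : ∀ {σ R i z e e′} → R < 5 → i < size R → VM σ → env σ ⊢ e′ ⇓ z →
              env σ [ $sv ↦ z ] ⊢ e ⇓ address R i → z < 2 ^ β →
              Run (setSlot e e′) σ (Stored σ R i z)
  store-run {R = R} {i} R<5 i< h d′ d z< =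
    weaken (set-run h d′ d (address-< R<5 i<) z<) λ _ p →
      stored (free p) (vm′ p) (same p) λ R′ i′ i′< ≢ → others p (address R′ i′) λ eq →
        let R≡ , i≡ = address-injective {R′} {i′} {R} {i} i′< i< eq
        in case ≢ of λ { (inj₁ R≢) → R≢ R≡ ; (inj₂ i≢) → i≢ i≡ }

  load-run : ∀ {σ e} R i x → R < 5 → i < size R → VM σ → env σ ⊢ e ⇓ address R i →
             Run (getSlot x e) σ λ t σ′ → t ≡ 0 × env σ′ x ≡ arr σ R i
  load-run R i x R<5 i< h d = get-run x h d (address-< R<5 i<)

  N/t<W : N / t < W
  N/t<W = ≤-reflexive (sym W≡)

  cell-< : ∀ {y} → y < N → y / t < W
  cell-< y< = ≤-<-trans (/-monoˡ-≤ t (<⇒≤ y<)) N/t<W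

-- Single cells, popcount and the position on the next plane

locateCell : Stmt
locateCell = $ci ≔ ! $x ⟪ div ⟫ ! $t ⨾ $co ≔ ! $x mod ! $t

loadCell : Var → Stmt
loadCell b = locateCell ⨾ getSlot $cf (! b ⟪ add ⟫ ! $ci)

-- The position on the next plane is n plus the number of flags before the current one. That number
-- has three parts: the absolute rank of the block, the relative rank above the t flags of the word,
-- and the ones below the cell in its own word, which the reduction modulo 2 to the power `$co`
-- isolates.
popcount child : Stmt
popcount = while ! $cy loop
  (getSlot $tmp (! $bT ⟪ add ⟫ (! $cy mod ! $2τ)) ⨾
   $acc ≔ ! $acc ⟪ add ⟫ ! $tmp ⨾
   $cy ≔ ! $cy ⟪ shr ⟫ ! $τ)
child =
  loadCell $bF ⨾
  getSlot $acc (! $bA ⟪ add ⟫ (! $ci ⟪ div ⟫ ! $λ)) ⨾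
  ($acc ≔ ! $acc ⟪ add ⟫ (! $cf ⟪ shr ⟫ ! $t) ⨾
   $cy ≔ ! $cf mod (lit 1 ⟪ shl ⟫ ! $co)) ⨾
  popcount ⨾
  $x ≔ vertices ⟪ add ⟫ ! $acc

cellBit : ∀ {i : Fin 7} → Expr (suc i)
cellBit = ! $cf ⟪ shr ⟫ ! $co mod lit 2

putCell : Var → (∀ {i} → Expr i) → Stmt
putCell b e = setSlot (! b ⟪ add ⟫ ! $ci)
  (! $cf ⟪ sub ⟫ (cellBit ⟪ shl ⟫ ! $co) ⟪ add ⟫ (e ⟪ shl ⟫ ! $co))

module Cells (ℙ : Planes) where

  open Planes ℙ
  open Regions ℙ public

  Table : State → Set
  Table σ = ∀ z → z < 2 ^ τ → arr σ table z ≡ ones τ z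

  t≤w : t ≤ w
  t≤w = ≤-trans t≤β (≤-trans (m≤m*n β q) βq≤w)

  %t< : ∀ y → y % t < t
  %t< y = m%n<n y t

  2^τ<2^w : 2 ^ τ < 2 ^ w
  2^τ<2^w = ≤-<-trans (≤-trans (m≤n+m (2 ^ τ) (base table)) (sumBelow-extend size {2} {5} (s≤s (s≤s z≤n)))) cap<

  2<2^w : 2 < 2 ^ w
  2<2^w = ≤-<-trans (2^-mono 1≤τ) 2^τ<2^w

  quiet-table : ∀ {s σ σ′} → Frame s σ σ′ → quiet s ≡ true → Table σ → Table σ′
  quiet-table f h tab z z< = trans (quiet-arr f h table z) (tab z z<)

  popcount-run : ∀ c {σ a y} → Context early σ → Table σ → env σ $acc ≡ a → env σ $cy ≡ y →
    y < 2 ^ (τ * c) → a + ones (τ * c) y < 2 ^ w →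
    Run popcount σ λ cost σ′ → cost ≤ c × env σ′ $acc ≡ a + ones (τ * c) y
  popcount-run c {a = a} {zero} h tab a≡ y≡ y< a< =
    stop-loop (var⇓ y≡) (z≤n , trans a≡ (sym (trans (cong (a +_) (ones-0 (τ * c))) (+-identityʳ a))))
  popcount-run zero {y = suc y} h tab a≡ y≡ y< a< with () ← n<1⇒n≡0 (subst (λ x → suc y < 2 ^ x) (*-zeroʳ τ) y<)
  popcount-run (suc c) {σ} {a} {y@(suc _)} h tab a≡ y≡ y< a< =
    step-loop {Q = λ cost σ′ → cost ≡ 0 × env σ′ $acc ≡ a + ones τ y × env σ′ $cy ≡ y /2^ τ}
      (var⇓ y≡) (λ ())
      (load-run table (y %2^ τ) $tmp (s≤s (s≤s z≤n)) (%2^-< y τ) (vm-of h)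
         (at⇓ {R = table} (s≤s (s≤s z≤n)) (const-of h $bT refl)
           (mod⇓ (var⇓ y≡) (var⇓ (const-of h $2τ refl)) {{2^-nonZero τ}}) (%2^-< y τ))
       ▸ λ { f (refl , tmp≡) →
         let tmp≡′ = trans tmp≡ (trans (tab _ (%2^-< y τ)) (sym (ones-mod τ y ≤-refl))) in
         add⇓ (var⇓ (trans (var≡ f $acc refl) a≡)) (var⇓ tmp≡′) (≤-<-trans (≤-trans (m≤m+n _ _) (≤-reflexive (sym total))) a<) ▹
         set (shr⇓ (var⇓ (trans (var≡ f $cy refl) y≡)) (var⇓ (trans (var≡ f $τ refl) (const-of h $τ refl))))
             (refl , refl , refl) })
      λ { f (refl , a′ , y′) → weaken
          (popcount-run c (keep f refl h) (quiet-table f refl tab) a′ y′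
            (/2^-< τ (τ * c) (subst (λ e → y < 2 ^ e) (*-suc τ c) y<)) (subst (_< 2 ^ w) total a<))
          λ { _ (cost , acc) → s≤s cost , trans acc (sym total) } }
    where
    total : a + ones (τ * suc c) y ≡ a + ones τ y + ones (τ * c) (y /2^ τ)
    total = trans (cong (a +_) (trans (cong (λ e → ones e y) (*-suc τ c)) (ones-+ τ (τ * c) y)))
                  (sym (+-assoc a _ _))

  childOf : State → ℕ → ℕ
  childOf σ y = n + (arr σ ranks (y / t / λ′) + arr σ flags (y / t) /2^ t + ones (y % t) (arr σ flags (y / t)))

  flags<5 : flags < 5
  flags<5 = s≤s (s≤s (s≤s z≤n))

  digits<5 : digits < 5
  digits<5 = s≤s (s≤s (s≤s (s≤s z≤n)))

  record Loaded (R : ℕ) (σ : State) (y cost : ℕ) (σ′ : State) : Set where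
    constructor loaded
    field
      no-cost : cost ≡ 0
      ci≡     : env σ′ $ci ≡ y / t
      co≡     : env σ′ $co ≡ y % t
      cf≡     : env σ′ $cf ≡ arr σ R (y / t)

  open Loaded public

  loadCell-run : ∀ {xs σ y} R b → R < 5 → size R ≡ W → writes locateCell b ≡ false →
    Context xs σ → among xs $t ≡ true → env σ b ≡ base R → env σ $x ≡ y → y < N →
    Run (loadCell b) σ (Loaded R σ y)
  loadCell-run {xs} {σ} {y} R b R<5 sz b-kept ctx t∈ b≡ x≡ y< =
    set₂ (div⇓ (var⇓ x≡) (var⇓ (const-of ctx $t t∈))) (mod⇓ (var⇓ x≡) (var⇓ (const-of ctx $t t∈)))
    ▸ λ { f (refl , refl) →
      weaken (load-run R (y / t) $cf R<5 i< (quiet-VM f refl (vm-of ctx))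
               (at⇓ {R = R} R<5 (trans (var≡ f b b-kept) b≡) (var⇓ refl) i<))
        λ { g (refl , cf) → loaded refl (var≡ g $ci refl) (var≡ g $co refl)
                              (trans cf (quiet-arr f refl R (y / t))) } }
    where
    i< : y / t < size R
    i< = subst (y / t <_) (sym sz) (cell-< y<)

  child-run : ∀ {σ y} → Context late σ → Table σ → env σ $x ≡ y → y < N → childOf σ y < 2 ^ w →
              Run child σ λ cost σ′ → cost ≤ chunks × env σ′ $x ≡ childOf σ y
  child-run {σ} {y} ctx tab x≡ y< c< =
    loadCell-run flags $bF flags<5 refl refl ctx refl (const-of ctx $bF refl) x≡ y<
    ▸ λ { f (loaded refl ci co cf) → let ctx₁ = keep f refl ctx in
    load-run ranks (i / λ′) $acc ≤-refl i/λ′< (vm-of ctx₁)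
      (at⇓ {R = ranks} ≤-refl (const-of ctx₁ $bA refl)
        (div⇓ (var⇓ ci) (var⇓ (const-of ctx₁ $λ refl))) i/λ′<)
    ▸ λ { g (refl , acc) →
      let ctx₂ = keep g refl ctx₁
          cf′  = trans (var≡ g $cf refl) cf in
    set₂ (add⇓ (var⇓ (trans acc (quiet-arr f refl ranks (i / λ′)))) (shr⇓ (var⇓ cf′) (var⇓ (const-of ctx₂ $t refl)))
            (≤-<-trans (≤-trans (m≤m+n _ _) (m≤n+m _ n)) c<))
         (mod⇓ (var⇓ cf′) (value≡ (*-identityˡ (2 ^ o)) (shl-exact lit-1
            (var⇓ (trans (var≡ g $co refl) co)) (subst (_< 2 ^ w) (sym (*-identityˡ (2 ^ o))) (^-monoʳ-< 2 ≤-refl o<w))))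
            {{2^-nonZero o}})
    ▸ λ { k (refl , refl) →
      let ctx₃ = keep k refl ctx₂ in
    popcount-run chunks (late⇒early ctx₃)
      (quiet-table k refl (quiet-table g refl (quiet-table f refl tab))) refl refl
      (≤-trans (%2^-< fl o) (2^-mono o≤))
      (subst (_< 2 ^ w) (cong (r +_) (sym ones≡)) (≤-<-trans (m≤n+m _ n) c<))
    ▸ λ { {cost} p (cost≤ , acc₄) →
    set (add⇓ vertices⇓ (var⇓ acc₄) (subst (_< 2 ^ w) total c<))
        (≤-trans (≤-reflexive (+-identityʳ cost)) cost≤ , sym total) } } } }
    where
    i = y / t
    o = y % t
    fl = arr σ flags i
    r = arr σ ranks (i / λ′) + fl /2^ t
    i/λ′< : i / λ′ < V
    i/λ′< = V> (cell-< y<)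
    o<w : o < w
    o<w = ≤-trans (%t< y) t≤w
    o≤ : o ≤ τ * chunks
    o≤ = ≤-trans (<⇒≤ (%t< y)) t≤
    ones≡ : ones (τ * chunks) (fl %2^ o) ≡ ones o fl
    ones≡ = trans (ones-stable (fl %2^ o) (%2^-< fl o) o≤) (sym (ones-mod o fl ≤-refl))
    total : childOf σ y ≡ n + (r + ones (τ * chunks) (fl %2^ o))
    total = cong (λ z → n + (r + z)) (sym ones≡)

  cell : State → ℕ → ℕ → ℕ
  cell σ R y = bit (y % t) (arr σ R (y / t))

  cellBit⇓ : ∀ {ρ o f} {i : Fin 7} → ρ $cf ≡ f → ρ $co ≡ o → ρ ⊢ cellBit {i} ⇓ bit o f
  cellBit⇓ cf co = mod⇓ (shr⇓ (var⇓ cf) (var⇓ co)) (lit⇓ 2<2^w)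

  putCell-run : ∀ {σ y z R b} {e : ∀ {i} → Expr i} → R < 5 → size R ≡ W → VM σ → y < N →
    env σ b ≡ base R → ($sv == b) ≡ false →
    env σ $ci ≡ y / t → env σ $co ≡ y % t → env σ $cf ≡ arr σ R (y / t) →
    (∀ {i} → env σ ⊢ e {i} ⇓ z) → z < 2 →
    Run (putCell b e) σ (Stored σ R (y / t) (setSlice (y % t) 1 z (arr σ R (y / t))))
  putCell-run {σ} {y} {z} {R} {b} {e} R<5 sz h y< b≡ b≢ ci co cf d z< =
    store-run {R = R} R<5 i< h
      (add⇓ (sub⇓ (var⇓ cf) (shl-exact (cellBit⇓ cf co) (var⇓ co) (≤-<-trans (slice-≤ o 1 f) f<2^w)) (slice-≤ o 1 f))
            (shl-exact (d {suc (# 5)}) (var⇓ co) (≤-<-trans (m≤n+m _ _) z′<2^w)) z′<2^w)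
      (at⇓ {R = R} R<5 (trans (cong (if_then z′ else env σ b) b≢) b≡) (var⇓ ci) i<)
      z′<
    where
    o = y % t
    f = arr σ R (y / t)
    z′ = setSlice o 1 z f
    i< : y / t < size R
    i< = subst (y / t <_) (sym sz) (cell-< y<)
    z′< : z′ < 2 ^ β
    z′< = setSlice-< o 1 f z< (≤-trans (≤-reflexive (+-comm o 1)) (≤-trans (%t< y) t≤β)) (arr-< σ R (y / t))
    2^β≤2^w : 2 ^ β ≤ 2 ^ w
    2^β≤2^w = 2^-mono (≤-trans (m≤m*n β q) βq≤w)
    z′<2^w : z′ < 2 ^ w
    z′<2^w = ≤-trans z′< 2^β≤2^w
    f<2^w : f < 2 ^ w
    f<2^w = ≤-trans (arr-< σ R (y / t)) 2^β≤2^w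

  -- What putCell does, seen on single cells.
  cell-set : ∀ {σ R y z cost σ′} → z < 2 →
    Stored σ R (y / t) (setSlice (y % t) 1 z (arr σ R (y / t))) cost σ′ → cell σ′ R y ≡ z
  cell-set {σ} {R} {y} z< s = trans (cong (bit (y % t)) (here s)) (slice-set (y % t) 1 (arr σ R (y / t)) z<)

  cell-unset : ∀ {σ R y y′ z cost σ′} → size R ≡ W → y′ / t < W → y′ ≢ y → z < 2 →
    Stored σ R (y / t) (setSlice (y % t) 1 z (arr σ R (y / t))) cost σ′ → cell σ′ R y′ ≡ cell σ R y′
  cell-unset {σ} {R} {y} {y′} {z} {σ′ = σ′} sz y′< y′≢y z< s with y′ / t ≟ y / t
  ... | no  ≢ = cong (bit (y′ % t)) (elsewhere s R (y′ / t) (subst (y′ / t <_) (sym sz) y′<) (inj₂ ≢))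
  ... | yes ≡ = trans (cong (bit (y′ % t)) (trans (cong (arr σ′ R) ≡) (here s)))
    (trans (slice-other (y % t) 1 {y′ % t} {1} (arr σ R (y / t)) z< disjoint)
           (cong (λ i → bit (y′ % t) (arr σ R i)) (sym ≡)))
    where
    disjoint : y % t + 1 ≤ y′ % t ⊎ y′ % t + 1 ≤ y % t
    disjoint with <-cmp (y % t) (y′ % t)
    ... | tri< a _ _ = inj₁ (≤-trans (≤-reflexive (+-comm _ 1)) a)
    ... | tri> _ _ b = inj₂ (≤-trans (≤-reflexive (+-comm _ 1)) b)
    ... | tri≈ _ e _ = ⊥-elim (y′≢y (trans (m≡m%n+[m/n]*n y′ t)
        (trans (cong₂ (λ a b → a + b * t) (sym e) ≡) (sym (m≡m%n+[m/n]*n y t)))))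

-- Walks along the digits of a field

startWalk advance decrementStep decrement exchangeStep exchange : Stmt
-- `$e` is halved on each plane and so becomes 0 after exactly as many planes as the field has
-- digits; no flag is consulted to find the end.
startWalk = $x ≔ ! $u ⟪ sub ⟫ lit 1 ⨾ $e ≔ degreeMinus1 $u
advance   = $e ≔ ! $e ⟪ shr ⟫ lit 1 ⨾ child ⨾ loadCell $bD
decrementStep =
  advance ⨾
  -- The lowest digit 1 absorbs the borrow, and clearing `$e` ends the loop. `$z` keeps its initial
  -- 1 only if there is no such digit, that is, if the field is 0.
  if cellBit then (putCell $bD (lit 0) ⨾ $z ≔ lit 0 ⨾ $e ≔ lit 0)
  else′ putCell $bD (lit 1)
decrement = startWalk ⨾ $z ≔ lit 1 ⨾ while ! $e loop decrementStep
exchangeStep =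
  advance ⨾
  $res ≔ ! $res ⟪ add ⟫ (cellBit ⟪ shl ⟫ ! $k) ⨾
  ($tmp ≔ ! $j mod lit 2 ⨾ $j ≔ ! $j ⟪ shr ⟫ lit 1) ⨾
  $k ≔ ! $k ⟪ add ⟫ lit 1 ⨾
  putCell $bD (! $tmp)
exchange = startWalk ⨾ ($res ≔ lit 0 ⨾ $k ≔ lit 0) ⨾ while ! $e loop exchangeStep

module Fields (ℙ : Planes) where

  open Planes ℙ
  open Degrees G public
  open Levels n len public
  open Cells ℙ public

  lin< : ∀ {v k} → v < n → k ≤ len v → lin k v < N
  lin< {v} {k} v< k≤ = ≤-trans (lin-<-first v< k≤)
    (≤-trans (first-≤ (≤-trans (s≤s k≤) (len< v<))) (≤-reflexive (sym N≡)))

  N<2^w : N < 2 ^ w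
  N<2^w = ≤-trans N< (2^-mono (≤-trans (m≤m*n β q) βq≤w))

  -- The part of the memory that walks only read; `kid` is all that they learn about the rank
  -- structure.
  record Static (σ : State) : Set where
    constructor static
    field
      ctx : Context late σ
      tab : Table σ
      kid : ∀ {v k} → v < n → k < len v → childOf σ (lin k v) ≡ lin (suc k) v

  open Static public

  quiet-static : ∀ {s σ σ′} → Frame s σ σ′ → harmless late s ≡ true → Static σ → Static σ′
  quiet-static {s} {σ} {σ′} f h (static c tb kd) =
    static (keep f h c) (quiet-table f hq tb) λ {v} {k} v< k< → trans (unmoved (lin k v)) (kd v< k<)
    where
    hq = ∧-left {quiet s} h
    unmoved : ∀ y → childOf σ′ y ≡ childOf σ y
    unmoved y rewrite quiet-arr f hq ranks (y / t / λ′) | quiet-arr f hq flags (y / t) = refl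

  quiet-cell : ∀ {s σ σ′} → Frame s σ σ′ → quiet s ≡ true → ∀ R y → cell σ′ R y ≡ cell σ R y
  quiet-cell f h R y = cong (bit (y % t)) (quiet-arr f h R (y / t))

  digits-static : ∀ {s σ σ′ i z cost} → Frame s σ σ′ → untouched late s ≡ true → Static σ →
                  Stored σ digits i z cost σ′ → Static σ′
  digits-static {σ = σ} {σ′} f h (static (_ ,ᶜ c) tb kd) st =
    static (vm-after st ,ᶜ keep-known f h c)
      (λ z z< → trans (elsewhere st table z z< (inj₁ λ ())) (tb z z<))
      λ {v} {k} v< k< → trans (unmoved (lin k v) (lin< v< (<⇒≤ k<))) (kd v< k<)
    where
    unmoved : ∀ y → y < N → childOf σ′ y ≡ childOf σ y
    unmoved y y< rewrite
      elsewhere st ranks (y / t / λ′) (V> (cell-< y<)) (inj₁ λ ()) |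
      elsewhere st flags (y / t) (cell-< y<) (inj₁ λ ()) = refl

  -- Digit k lies on level k + 1, so that it is the flag on level k that announces it; a vertex with
  -- an empty field reaches level 0 only.
  dig : State → ℕ → ℕ → ℕ
  dig σ v k = cell σ digits (lin (suc k) v)

  dig≤1 : ∀ σ v k → dig σ v k ≤ 1
  dig≤1 σ v k = bit≤1 (lin (suc k) v % t) _

  tail : State → ℕ → ℕ → ℕ → ℕ
  tail σ v m k = value m (dig σ v) k

  -- The walk for vertex v has changed digits of level k + 1 and higher only.
  record Touched (v k : ℕ) (σ σ′ : State) : Set where
    constructor touched
    field
      static′ : Static σ′
      digits≡ : ∀ {v′ k′} → v′ < n → k′ < len v′ → v′ ≢ v ⊎ k′ < k → dig σ′ v′ k′ ≡ dig σ v′ k′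

  open Touched public

  record Advanced (v k e : ℕ) (σ : State) (cost : ℕ) (σ′ : State) : Set where
    constructor advanced
    field
      cost≤ : cost ≤ chunks
      x≡    : env σ′ $x ≡ lin (suc k) v
      e≡    : env σ′ $e ≡ e / 2
      st    : Static σ′
      dig≡  : ∀ v k → dig σ′ v k ≡ dig σ v k
      ci    : env σ′ $ci ≡ lin (suc k) v / t
      co    : env σ′ $co ≡ lin (suc k) v % t
      cf    : env σ′ $cf ≡ arr σ′ digits (lin (suc k) v / t)

  advance-run : ∀ {σ v k e} → Static σ → v < n → k < len v → env σ $x ≡ lin k v → env σ $e ≡ e →
                Run advance σ (Advanced v k e σ)
  advance-run {σ} {v} {k} {e} s v< k< x≡ e≡ =
    set₁ (shr⇓ (var⇓ e≡) lit-1) ▸ λ { f (refl , refl) →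
    let s₁ = quiet-static f refl s in
    child-run (ctx s₁) (tab s₁) x≡ (lin< v< (<⇒≤ k<))
      (subst (_< 2 ^ w) (sym (kid s₁ v< k<)) (<-trans (lin< v< k<) N<2^w))
    ▸ λ { {c} g (c≤ , x≡₂) →
    let s₂ = quiet-static g refl s₁
        x≡₃ = trans x≡₂ (kid s₁ v< k<) in
    weaken (loadCell-run digits $bD digits<5 refl refl (ctx s₂) refl (const-of (ctx s₂) $bD refl) x≡₃ (lin< v< k<))
      λ { h (loaded refl ci co cf) → advanced (≤-trans (≤-reflexive (+-identityʳ c)) c≤)
            (trans (var≡ h $x refl) x≡₃) (trans (var≡ h $e refl) (var≡ g $e refl))
            (quiet-static h refl s₂)
            (λ v k → trans (quiet-cell h refl digits (lin (suc k) v)) (trans (quiet-cell g refl digits (lin (suc k) v)) (quiet-cell f refl digits (lin (suc k) v))))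
            ci co (trans cf (sym (quiet-arr h refl digits (lin (suc k) v / t)))) } } }

  record Put (v k z : ℕ) (σ : State) (cost : ℕ) (σ′ : State) : Set where
    constructor put
    field
      free′ : cost ≡ 0
      st    : Static σ′
      new   : dig σ′ v k ≡ z
      old   : ∀ {v′ k′} → v′ < n → k′ < len v′ → v′ ≢ v ⊎ k′ ≢ k → dig σ′ v′ k′ ≡ dig σ v′ k′

  put-run : ∀ {σ v k z} {e : ∀ {i} → Expr i} → Static σ → v < n → k < len v →
    env σ $ci ≡ lin (suc k) v / t → env σ $co ≡ lin (suc k) v % t →
    env σ $cf ≡ arr σ digits (lin (suc k) v / t) → (∀ {i} → env σ ⊢ e {i} ⇓ z) → z < 2 →
    untouched late (putCell $bD e) ≡ true →
    Run (putCell $bD e) σ (Put v k z σ)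
  put-run {σ} {v} {k} {z} {e} s v< k< ci co cf d z< h =
    weaken (putCell-run {R = digits} {e = e} digits<5 refl (vm-of (ctx s)) (lin< v< k<) (const-of (ctx s) $bD refl) refl
              ci co cf d z<)
      λ f p → put (at-no-cost p) (digits-static f h s p) (cell-set {R = digits} {lin (suc k) v} z< p)
        λ {v′} {k′} v′< k′< ≢ → cell-unset {R = digits} {lin (suc k) v} refl (cell-< (lin< v′< k′<))
          (λ eq → let k≡ , v≡ = lin-injective {suc k′} {v′} {suc k} {v} v′< k′< v< k< eq
                  in case ≢ of λ { (inj₁ v≢) → v≢ v≡ ; (inj₂ k≢) → k≢ (suc-injective k≡) })
          z< p

module Walks (ℙ : Planes) where

  open Planes ℙ
  open Fields ℙ public

  ≢0⇒1 : ∀ {b} → b ≤ 1 → b ≢ 0 → b ≡ 1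
  ≢0⇒1 z≤n       b≢0 = ⊥-elim (b≢0 refl)
  ≢0⇒1 (s≤s z≤n) _   = refl

  record Step (v k : ℕ) (Outcome : State → Set) (σ : State) (cost : ℕ) (σ′ : State) : Set where
    constructor step
    field
      cost≤   : cost ≤ chunks
      st      : Static σ′
      old     : ∀ {v′ k′} → v′ < n → k′ < len v′ → v′ ≢ v ⊎ k′ ≢ k → dig σ′ v′ k′ ≡ dig σ v′ k′
      outcome : Outcome σ′

  tail-old : ∀ {v k m σ σ′} → v < n → suc k + m ≤ len v →
    (∀ {v′ k′} → v′ < n → k′ < len v′ → v′ ≢ v ⊎ k′ ≢ k → dig σ′ v′ k′ ≡ dig σ v′ k′) →
    tail σ′ v m (suc k) ≡ tail σ v m (suc k)
  tail-old {m = m} v< k≤ old = value-cong m _ λ i k<i i< →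
    old v< (≤-trans i< k≤) (inj₂ (>⇒≢ k<i))

  record Cleared (v k : ℕ) (σ σ′ : State) : Set where
    constructor cleared
    field
      was : dig σ v k ≡ 1
      now : dig σ′ v k ≡ 0
      z≡  : env σ′ $z ≡ 0
      e≡  : env σ′ $e ≡ 0

  record Borrowed (v k e : ℕ) (σ σ′ : State) : Set where
    constructor borrowed
    field
      was : dig σ v k ≡ 0
      now : dig σ′ v k ≡ 1
      z≡  : env σ′ $z ≡ env σ $z
      e≡  : env σ′ $e ≡ e / 2
      x≡  : env σ′ $x ≡ lin (suc k) v

  decrementStep-run : ∀ {σ v k e} → Static σ → v < n → k < len v → env σ $x ≡ lin k v → env σ $e ≡ e →
    Run decrementStep σ (Step v k (λ σ′ → Cleared v k σ σ′ ⊎ Borrowed v k e σ σ′) σ)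
  decrementStep-run {σ} {v} {k} {e} s v< k< x≡ e≡ =
    advance-run s v< k< x≡ e≡ ▸ λ { {c} {σ₁} f (advanced c≤ x₁ e₁ s₁ d₁ ci co cf) →
    branch (cellBit⇓ cf co)
      (λ ≢0 →
        put-run {z = 0} {e = lit 0} s₁ v< k< ci co cf lit-0 (s≤s z≤n) refl ▸ λ { g (put refl s₂ new old) →
        weaken (set₂ lit-0 lit-0) λ { h (refl , refl) →
          step (≤-trans (≤-reflexive (+-identityʳ c)) c≤) (quiet-static h refl s₂)
            (λ {v′} {k′} v′< k′< ≢ → trans (quiet-cell h refl digits (lin (suc k′) v′)) (trans (old v′< k′< ≢) (d₁ v′ k′)))
            (inj₁ (cleared (trans (sym (d₁ v k)) (≢0⇒1 (dig≤1 σ₁ v k) ≢0))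
                     (trans (quiet-cell h refl digits (lin (suc k) v)) new) refl refl)) } })
      (λ ≡0 → weaken (put-run {z = 1} {e = lit 1} s₁ v< k< ci co cf lit-1 ≤-refl refl)
        λ { g (put refl s₂ new old) →
          step (≤-trans (≤-reflexive (+-identityʳ c)) c≤) s₂
            (λ {v′} {k′} v′< k′< ≢ → trans (old v′< k′< ≢) (d₁ v′ k′))
            (inj₂ (borrowed (trans (sym (d₁ v k)) ≡0) new (trans (var≡ g $z refl) (var≡ f $z refl))
                     (trans (var≡ g $e refl) e₁) (trans (var≡ g $x refl) x₁))) }) }

  C : ℕ
  C = suc chunks

  -- If the field is 0, the borrow runs off its end.
  data Decremented (m old new : ℕ) (cost : ℕ) (z : ℕ) : Set where
    was-0   : old ≡ 0 → z ≡ 1 → cost ≤ C * m → Decremented m old new cost z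
    was-suc : old ≡ suc new → z ≡ 0 → cost + C * zeros m new ≤ C * zeros m old + (C + C) →
              Decremented m old new cost z

  touched-step : ∀ {v k σ σ₁} → Static σ₁ →
    (∀ {v′ k′} → v′ < n → k′ < len v′ → v′ ≢ v ⊎ k′ ≢ k → dig σ₁ v′ k′ ≡ dig σ v′ k′) →
    Touched v k σ σ₁
  touched-step s old = touched s λ v′< k′< → λ
    { (inj₁ v≢) → old v′< k′< (inj₁ v≢) ; (inj₂ k′<k) → old v′< k′< (inj₂ (<⇒≢ k′<k)) }

  touched-trans : ∀ {v k σ σ₁ σ₂} → Touched v k σ σ₁ → Touched v (suc k) σ₁ σ₂ → Touched v k σ σ₂
  touched-trans (touched _ a) (touched s b) = touched s λ v′< k′< → λ
    { (inj₁ v≢)   → trans (b v′< k′< (inj₁ v≢)) (a v′< k′< (inj₁ v≢))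
    ; (inj₂ k′<k) → trans (b v′< k′< (inj₂ (m≤n⇒m≤1+n k′<k))) (a v′< k′< (inj₂ k′<k)) }

  -- Induction on the number of digits left. At a digit 1 the borrow ends; of the two units `C + C`,
  -- one pays for this step and one for the zero that it creates. At a digit 0, which becomes 1, the
  -- zero that disappears pays for the step.
  decrement-loop : ∀ m {σ v k e} → Static σ → v < n → k + m ≡ len v → env σ $x ≡ lin k v →
    env σ $e ≡ e → bitlen e ≡ m → env σ $z ≡ 1 →
    Run (while ! $e loop decrementStep) σ λ cost σ′ →
      Touched v k σ σ′ × Decremented m (tail σ v m k) (tail σ′ v m k) cost (env σ′ $z)
  decrement-loop zero {e = e} s v< km x≡ e≡ be z≡ =
    stop-loop (var⇓ (trans e≡ (bitlen-0 {e} be))) (touched s (λ _ _ _ → refl) , was-0 refl z≡ z≤n)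
  decrement-loop (suc m) {σ} {v} {k} {e} s v< km x≡ e≡ be z≡ =
    step-loop (var⇓ e≡) (proj₁ (bitlen-suc {e} be)) (decrementStep-run s v< k< x≡ e≡) λ
      { {c} {σ₁} f (step c≤ s₁ old (inj₁ (cleared was now z₁ e₁))) →
          stop-loop (var⇓ e₁) (touched-step s₁ old , was-suc
            (trans (cong (_+ 2 * tail σ v m (suc k)) was)
              (cong suc (sym (trans (cong (_+ 2 * tail σ₁ v m (suc k)) now) (cong (2 *_) (tail-old v< k≤ old))))))
            z₁ (cleared-cost c≤ was now (tail-old v< k≤ old)))
      ; {c} {σ₁} f (step c≤ s₁ old (inj₂ (borrowed was now z₁ e₁ x₁))) →
          weaken (decrement-loop m s₁ v< (trans (sym (+-suc k m)) km) x₁ e₁ (proj₂ (bitlen-suc {e} be)) (trans z₁ z≡))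
            λ { {c₂} {σ₂} g (tch , dec) → touched-trans (touched-step s₁ old) tch ,
                borrow {c = c} {c₂} {σ₁} {σ₂} c≤ was (trans (digits≡ tch v< k< (inj₂ ≤-refl)) now) (tail-old v< k≤ old) dec } }
    where
    k< : k < len v
    k< = ≤-trans (m<m+n k (s≤s z≤n)) (≤-reflexive km)
    k≤ : suc k + m ≤ len v
    k≤ = ≤-reflexive (trans (sym (+-suc k m)) km)
    digits+ : ℕ → ℕ → ℕ
    digits+ a b = a + 2 * b
    cleared-cost : ∀ {c σ₁} → c ≤ chunks → dig σ v k ≡ 1 → dig σ₁ v k ≡ 0 → tail σ₁ v m (suc k) ≡ tail σ v m (suc k) →
      suc (c + 0) + C * zeros (suc m) (tail σ₁ v (suc m) k) ≤ C * zeros (suc m) (tail σ v (suc m) k) + (C + C)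
    cleared-cost {c} c≤ was now tl = subst₂ (λ a b → suc (c + 0) + C * a ≤ C * b + (C + C))
      (sym (trans (cong (zeros (suc m)) (cong₂ digits+ now tl)) (zeros-digit₀ m X)))
      (sym (trans (cong (zeros (suc m)) (cong (_+ 2 * X) was)) (zeros-digit₁ m X)))
      (certify 0 c≤ (lemma c chunks (zeros m X)))
      where
      X = tail σ v m (suc k)
      lemma : ∀ c d z → suc d * z + (suc d + suc d) + c ≡ suc (c + 0) + suc d * suc z + d + 0
      lemma = solve-∀
    borrow : ∀ {c c₂ σ₁ σ₂} → c ≤ chunks → dig σ v k ≡ 0 → dig σ₂ v k ≡ 1 → tail σ₁ v m (suc k) ≡ tail σ v m (suc k) →
      Decremented m (tail σ₁ v m (suc k)) (tail σ₂ v m (suc k)) c₂ (env σ₂ $z) →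
      Decremented (suc m) (tail σ v (suc m) k) (tail σ₂ v (suc m) k) (suc (c + c₂)) (env σ₂ $z)
    borrow {c} {c₂} c≤ was now tl (was-0 o≡ z₂ c₂≤) =
      was-0 (cong₂ digits+ was (trans (sym tl) o≡)) z₂ (certify 0 (+-mono-≤ c≤ c₂≤) (lemma c c₂ chunks m))
      where
      lemma : ∀ c c₂ d m → suc d * suc m + (c + c₂) ≡ suc (c + c₂) + (d + suc d * m) + 0
      lemma = solve-∀
    borrow {c} {c₂} {σ₁} {σ₂} c≤ was now tl (was-suc o≡ z₂ c₂≤) =
      was-suc (trans old≡ (trans (*-suc 2 X) (cong suc (sym new≡)))) z₂
        (subst₂ (λ a b → suc (c + c₂) + C * a ≤ C * b + (C + C))
          (sym (trans (cong (zeros (suc m)) new≡) (zeros-digit₁ m X)))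
          (sym (trans (cong (zeros (suc m)) old≡) (zeros-digit₀ m (suc X))))
          (certify 0 (+-mono-≤ c≤ (subst (λ y → c₂ + C * zeros m X ≤ C * zeros m y + (C + C)) o≡ c₂≤))
            (lemma c c₂ chunks (zeros m X) (zeros m (suc X)))))
      where
      X = tail σ₂ v m (suc k)
      old≡ : tail σ v (suc m) k ≡ 2 * suc X
      old≡ = cong₂ digits+ was (trans (sym tl) o≡)
      new≡ : tail σ₂ v (suc m) k ≡ 1 + 2 * X
      new≡ = cong (_+ 2 * X) now
      lemma : ∀ c c₂ d z z′ → suc d * suc z′ + (suc d + suc d) + (c + (c₂ + suc d * z)) ≡
              suc (c + c₂) + suc d * z + (d + (suc d * z′ + (suc d + suc d))) + 0
      lemma = solve-∀

module Exchange (ℙ : Planes) where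

  open Planes ℙ
  open Walks ℙ public

  record Exchanged (v k J r e : ℕ) (σ σ′ : State) : Set where
    constructor exchanged
    field
      now  : dig σ′ v k ≡ J % 2
      res≡ : env σ′ $res ≡ r + dig σ v k * 2 ^ k
      j≡   : env σ′ $j ≡ J / 2
      k≡   : env σ′ $k ≡ suc k
      e≡   : env σ′ $e ≡ e / 2
      x≡   : env σ′ $x ≡ lin (suc k) v

  len-≤ : ∀ v → len v ≤ w
  len-≤ v = bitlen-≤ (≤-<-trans (≤-trans (m∸n≤m (degree v) 1) (degree-≤ v)) n<2^w)

  bit-sum : ∀ {r b} k → r < 2 ^ k → b ≤ 1 → r + b * 2 ^ k < 2 ^ suc k
  bit-sum {r} {b} k r< b≤1 = ≤-trans (+-monoˡ-< (b * 2 ^ k) r<)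
    (≤-trans (≤-reflexive (+-comm (2 ^ k) (b * 2 ^ k)))
      (≤-trans (+-mono-≤ (*-monoˡ-≤ (2 ^ k) b≤1) ≤-refl)
        (≤-reflexive (cong (_+ 2 ^ k) (*-identityˡ (2 ^ k))) ⟨≤⟩ ≤-reflexive (cong (2 ^ k +_) (sym (+-identityʳ _))))))
    where
    _⟨≤⟩_ : ∀ {a b c : ℕ} → a ≤ b → b ≤ c → a ≤ c
    _⟨≤⟩_ = ≤-trans

  exchangeStep-run : ∀ {σ v k e J r} → Static σ → v < n → k < len v → env σ $x ≡ lin k v → env σ $e ≡ e →
    env σ $j ≡ J → env σ $k ≡ k → env σ $res ≡ r → r < 2 ^ k →
    Run exchangeStep σ (Step v k (Exchanged v k J r e σ) σ)
  exchangeStep-run {σ} {v} {k} {e} {J} {r} s v< k< x≡ e≡ j≡ k≡ r≡ r< =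
    advance-run s v< k< x≡ e≡ ▸ λ { {c} {σ₁} f (advanced c≤ x₁ e₁ s₁ d₁ ci co cf) →
    set₁ (add⇓ (var⇓ (trans (var≡ f $res refl) r≡))
           (shl-exact (cellBit⇓ cf co) (var⇓ (trans (var≡ f $k refl) k≡))
             (≤-<-trans (m≤n+m _ r) (sum< σ₁))) (sum< σ₁))
    ▸ λ { g (refl , refl) →
    set₂ (mod⇓ (var⇓ (trans (var≡ f $j refl) j≡)) (lit⇓ 2<2^w)) (shr⇓ (var⇓ (trans (var≡ f $j refl) j≡)) lit-1)
    ▸ λ { h (refl , refl) →
    set₁ (add⇓ (var⇓ (trans (var≡ f $k refl) k≡)) lit-1 k+1<)
    ▸ λ { {σ′ = σ₄} i (refl , refl) →
    let s₂ = quiet-static g refl s₁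
        s₃ = quiet-static h refl s₂
        s₄ = quiet-static i refl s₃
        arr₄ = λ j → trans (quiet-arr i refl digits j) (trans (quiet-arr h refl digits j) (quiet-arr g refl digits j))
        dig₄ = λ v′ k′ → trans (cong (bit (lin (suc k′) v′ % t)) (arr₄ (lin (suc k′) v′ / t))) (d₁ v′ k′)
    in
    weaken (put-run {z = J % 2} {e = ! $tmp} s₄ v< k< ci co (trans cf (sym (arr₄ _))) (var⇓ refl) (m%n<n J 2) refl)
      λ { p (put refl s₅ new old) → step (≤-trans (≤-reflexive (+-identityʳ c)) c≤) s₅
            (λ {v′} {k′} v′< k′< ≢ → trans (old v′< k′< ≢) (dig₄ v′ k′))
            (exchanged new (trans (var≡ p $res refl) (cong (λ b → r + b * 2 ^ k) (d₁ v k)))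
              (trans (var≡ p $j refl) refl)
              (trans (var≡ p $k refl) (+-comm k 1)) (trans (var≡ p $e refl) e₁) (trans (var≡ p $x refl) x₁)) } } } } }
    where
    2^k≤ : 2 ^ suc k ≤ 2 ^ w
    2^k≤ = 2^-mono (≤-trans k< (len-≤ v))
    sum< : ∀ σ₁ → r + dig σ₁ v k * 2 ^ k < 2 ^ w
    sum< σ₁ = ≤-trans (bit-sum k r< (dig≤1 σ₁ v k)) 2^k≤
    k+1< : k + 1 < 2 ^ w
    k+1< = ≤-<-trans (≤-trans (≤-reflexive (+-comm k 1)) (≤-trans k< (len-≤ v))) (n<2^n w)

  -- J is what remains to be written and loses its lowest digit in each step, while r collects the
  -- digits read so far. The bound r < 2 ^ k makes adding the next digit at place k safe from
  -- overflow.
  exchange-loop : ∀ m {σ v k e J r} → Static σ → v < n → k + m ≡ len v → env σ $x ≡ lin k v →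
    env σ $e ≡ e → bitlen e ≡ m → env σ $j ≡ J → J < 2 ^ m → env σ $k ≡ k → env σ $res ≡ r → r < 2 ^ k →
    Run (while ! $e loop exchangeStep) σ λ cost σ′ →
      Touched v k σ σ′ × tail σ′ v m k ≡ J × env σ′ $res ≡ r + tail σ v m k * 2 ^ k × cost ≤ C * m
  exchange-loop zero {e = e} {J = J} {r} s v< km x≡ e≡ be j≡ J< k≡ r≡ r< =
    stop-loop (var⇓ (trans e≡ (bitlen-0 {e} be)))
      (touched s (λ _ _ _ → refl) , sym (n<1⇒n≡0 J<) , trans r≡ (sym (+-identityʳ r)) , z≤n)
  exchange-loop (suc m) {σ} {v} {k} {e} {J} {r} s v< km x≡ e≡ be j≡ J< k≡ r≡ r< =
    step-loop (var⇓ e≡) (proj₁ (bitlen-suc {e} be)) (exchangeStep-run s v< k< x≡ e≡ j≡ k≡ r≡ r<) λ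
      { {c} {σ₁} f (step c≤ s₁ old (exchanged now r₁ j₁ k₁ e₁ x₁)) →
        weaken (exchange-loop m s₁ v< (trans (sym (+-suc k m)) km) x₁ e₁ (proj₂ (bitlen-suc {e} be)) j₁
                  (m<n*o⇒m/o<n (subst (J <_) (*-comm 2 (2 ^ m)) J<)) k₁ r₁ (bit-sum k r< (dig≤1 σ v k)))
          λ { {c₂} {σ₂} g (tch , val , r₂ , c₂≤) → touched-trans (touched-step s₁ old) tch ,
              trans (cong₂ (λ a b → a + 2 * b) (trans (digits≡ tch v< k< (inj₂ ≤-refl)) now) val)
                    (trans (cong (J % 2 +_) (*-comm 2 (J / 2))) (sym (halves J))) ,
              trans r₂ (trans (cong (λ X → r + dig σ v k * 2 ^ k + X * 2 ^ suc k) (tail-old v< k≤ old))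
                              (regroup r (dig σ v k) (tail σ v m (suc k)) (2 ^ k))) ,
              certify 0 (+-mono-≤ c≤ c₂≤) (account c c₂ chunks m) } }
    where
    k< : k < len v
    k< = ≤-trans (m<m+n k (s≤s z≤n)) (≤-reflexive km)
    k≤ : suc k + m ≤ len v
    k≤ = ≤-reflexive (trans (sym (+-suc k m)) km)
    regroup : ∀ r b X p → r + b * p + X * (2 * p) ≡ r + (b + 2 * X) * p
    regroup = solve-∀
    account : ∀ c c₂ d m → suc d * suc m + (c + c₂) ≡ suc (c + c₂) + (d + suc d * m) + 0
    account = solve-∀

  field-of : State → ℕ → ℕ
  field-of σ i = tail σ i (len i) 0

  others-kept : ∀ {v σ σ′} → Touched v 0 σ σ′ → ∀ {i} → i < n → i ≢ v → field-of σ′ i ≡ field-of σ i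
  others-kept tch {i} i< i≢ = value-cong (len i) 0 λ k _ k< → digits≡ tch i< k< (inj₁ i≢)

  len-toℕ : ∀ v → bitlen (indeg v ∸ 1) ≡ len (toℕ v)
  len-toℕ v = cong (λ d → bitlen (d ∸ 1)) (sym (degree-toℕ v))

  startWalk-run : ∀ {σ v} → env σ $u ≡ label v → Run startWalk σ λ cost σ′ →
    cost ≡ 0 × σ′ ≡ assign (assign σ $x (toℕ v)) $e (indeg v ∸ 1)
  startWalk-run u≡ = set₂ (sub⇓ (var⇓ u≡) lit-1 (s≤s z≤n)) (degreeMinus1⇓ u≡)

  decrement-run : ∀ {σ v} → Static σ → env σ $u ≡ label v → Run decrement σ λ cost σ′ →
    Touched (toℕ v) 0 σ σ′ ×
    Decremented (len (toℕ v)) (field-of σ (toℕ v)) (field-of σ′ (toℕ v)) cost (env σ′ $z)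
  decrement-run {σ} {v} s u≡ =
    startWalk-run u≡ ▸ λ { f (refl , refl) →
    set₁ lit-1 ▸ λ { g (refl , refl) →
    let same-dig : ∀ v k → dig _ v k ≡ dig σ v k
        same-dig = λ v k → trans (quiet-cell g refl digits (lin (suc k) v)) (quiet-cell f refl digits (lin (suc k) v)) in
    weaken (decrement-loop (len (toℕ v)) (quiet-static g refl (quiet-static f refl s)) (Fin.toℕ<n v) refl
              (sym (lin-0 (toℕ v))) refl (len-toℕ v) refl)
      λ { {c} {σ′} h (touched s′ d , dec) → touched s′ (λ {v′} {k′} v′< k′< ≢ → trans (d v′< k′< ≢) (same-dig v′ k′)) ,
            subst (λ x → Decremented (len (toℕ v)) x (field-of σ′ (toℕ v)) c (env σ′ $z))
              (value-cong (len (toℕ v)) 0 λ k _ _ → same-dig (toℕ v) k) dec } } }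

  exchange-run : ∀ {σ v J} → Static σ → env σ $u ≡ label v → env σ $j ≡ J → J < 2 ^ len (toℕ v) →
    Run exchange σ λ cost σ′ → Touched (toℕ v) 0 σ σ′ × field-of σ′ (toℕ v) ≡ J ×
      env σ′ $res ≡ field-of σ (toℕ v) × cost ≤ C * len (toℕ v)
  exchange-run {σ} {v} {J} s u≡ j≡ J< =
    startWalk-run u≡ ▸ λ { f (refl , refl) →
    set₂ lit-0 lit-0 ▸ λ { g (refl , refl) →
    let same-dig : ∀ v k → dig _ v k ≡ dig σ v k
        same-dig = λ v k → trans (quiet-cell g refl digits (lin (suc k) v)) (quiet-cell f refl digits (lin (suc k) v)) in
    weaken (exchange-loop (len (toℕ v)) {r = 0} (quiet-static g refl (quiet-static f refl s)) (Fin.toℕ<n v) refl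
              (sym (lin-0 (toℕ v))) refl (len-toℕ v) j≡ J< refl refl (s≤s z≤n))
      λ { {c} {σ′} h (touched s′ d , val , res , c≤) →
            touched s′ (λ {v′} {k′} v′< k′< ≢ → trans (d v′< k′< ≢) (same-dig v′ k′)) , val ,
            trans res (trans (*-identityʳ _) (value-cong (len (toℕ v)) 0 λ k _ _ → same-dig (toℕ v) k)) , c≤ } } }

-- Construction of the structure

buildTable clearPointers take prefixSums : Stmt
buildTable =
  setSlot (! $bT) (lit 0) ⨾ $z ≔ lit 1 ⨾
  while ! $z ⟪ less ⟫ ! $2τ loop
    (getSlot $tmp (! $bT ⟪ add ⟫ (! $z ⟪ shr ⟫ lit 1)) ⨾
     setSlot (! $bT ⟪ add ⟫ ! $z) ((! $z mod lit 2) ⟪ add ⟫ ! $tmp) ⨾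
     $z ≔ ! $z ⟪ add ⟫ lit 1)
clearPointers =
  $k ≔ lit 0 ⨾
  while ! $k ⟪ less ⟫ ! $λ loop (setSlot (! $k) (lit 0) ⨾ $k ≔ ! $k ⟪ add ⟫ lit 1)
take = getSlot $x (! $k) ⨾ setSlot (! $k) (! $x ⟪ add ⟫ lit 1)
prefixSums =
  ($k ≔ lit 0 ⨾ $acc ≔ lit 0) ⨾
  while ! $k ⟪ less ⟫ ! $λ loop
    (getSlot $px (! $k) ⨾ setSlot (! $k) (! $acc) ⨾
     ($acc ≔ ! $acc ⟪ add ⟫ ! $px ⨾ $k ≔ ! $k ⟪ add ⟫ lit 1))

-- The same sweep is run twice. With pointers that start from 0 and `skip` as the extra statement it
-- leaves the size of every level in the pointers; after `prefixSums` it hands out the numbers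
-- `lin k v`, and `setFlag` marks the levels that have a successor. The `take` after the inner loop
-- belongs to the last level of the vertex, which gets no flag.
sweepLevel sweepVertex sweep : Stmt → Stmt
sweepLevel extra = take ⨾ extra ⨾ ($e ≔ ! $e ⟪ shr ⟫ lit 1 ⨾ $k ≔ ! $k ⟪ add ⟫ lit 1)
sweepVertex extra =
  $u ≔ ! $v ⟪ add ⟫ lit 1 ⨾
  ($e ≔ degreeMinus1 $u ⨾ $k ≔ lit 0) ⨾
  (while ! $e loop sweepLevel extra) ⨾
  take ⨾
  $v ≔ ! $v ⟪ add ⟫ lit 1
sweep extra = $v ≔ lit 0 ⨾ while ! $v ⟪ less ⟫ vertices loop sweepVertex extra

module Construction (ℙ : Planes) where

  open Planes ℙ
  open Exchange ℙ public

  2^β≤2^w : 2 ^ β ≤ 2 ^ w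
  2^β≤2^w = 2^-mono (≤-trans (m≤m*n β q) βq≤w)

  size<2^w : ∀ R → R < 5 → size R < 2 ^ w
  size<2^w R R<5 = ≤-<-trans (≤-trans (m≤n+m (size R) (base R)) (sumBelow-extend size R<5)) cap<

  pointers<5 : pointers < 5
  pointers<5 = s≤s z≤n
  table<5 : table < 5
  table<5 = s≤s (s≤s z≤n)

  suc⇓ : ∀ {ρ x k b} {i : Fin 7} → ρ x ≡ k → k < b → b < 2 ^ w → ρ ⊢ _⟪_⟫_ {i} (! x) add (lit 1) ⇓ suc k
  suc⇓ {k = k} x≡ k<b b< = value≡ (+-comm k 1) (add⇓ (var⇓ x≡) lit-1 (≤-<-trans (≤-trans (≤-reflexive (+-comm k 1)) k<b) b<))

  -- The recurrence by which the table is filled: in increasing order of z, the entry for z / 2 is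
  -- already there.
  ones-half : ∀ z → z < 2 ^ τ → ones τ z ≡ z % 2 + ones τ (z / 2)
  ones-half z z< with τ | 1≤τ
  ... | suc τ′ | _ = trans (ones-suc τ′ z) (cong (z % 2 +_)
          (sym (ones-stable (z / 2) (m<n*o⇒m/o<n (subst (z <_) (*-comm 2 (2 ^ τ′)) z<)) (n≤1+n τ′))))

  ones<2^β : ∀ z → ones τ z < 2 ^ β
  ones<2^β z = ≤-<-trans (ones-≤ τ z) τ<

  assign-arr : ∀ {σ a} x → (x == $w₀) ≡ false → ∀ R i → arr (assign σ x a) R i ≡ arr σ R i
  assign-arr x h R i = cong (slice (β * (address R i % q)) β) (word-assign x h (address R i / q))

  buildTable-run : ∀ {σ} → Context early σ → Run buildTable σ λ cost σ′ →
    cost ≤ 2 ^ τ × VM σ′ × Table σ′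
  buildTable-run {σ} ctx₀ =
    store-run {R = table} {i = 0} table<5 (m^n>0 2 τ) (vm-of ctx₀) lit-0
      (value≡ (sym (+-identityʳ (base table))) (var⇓ (const-of ctx₀ $bT refl))) (m^n>0 2 β)
    ▸ λ { f s →
    set₁ lit-1 ▸ λ { {σ′ = σ₁} g (refl , refl) →
    let know₁ = keep-known g refl (keep-known f refl (knows-of ctx₀)) in
    weaken (counting (λ z σ → 1 ≤ z × env σ $z ≡ z × VM σ × (∀ y → y < z → arr σ table y ≡ ones τ y)) (λ _ → 0) (2 ^ τ)
      (λ h (_ , z≡ , _) _ → less⇓ (var⇓ z≡) (var⇓ (trans (var≡ h $2τ refl) (known know₁ $2τ refl))))
      (λ { {z} {σ} h (1≤z , z≡ , v , done) z< →
        let know = keep-known h refl know₁ in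
        load-run table (z / 2) $tmp table<5 (≤-<-trans (m/n≤m z 2) z<) v
          (at⇓ {R = table} table<5 (known know $bT refl) (shr⇓ (var⇓ z≡) lit-1) (≤-<-trans (m/n≤m z 2) z<))
        ▸ λ { i (refl , tmp≡) →
        let tmp≡′ = trans tmp≡ (done (z / 2) (m/n<m z 2 {{>-nonZero 1≤z}} ≤-refl))
            z≡₂ = trans (var≡ i $z refl) z≡
            half = ones-half z z< in
        store-run {R = table} {i = z} table<5 z< (quiet-VM i refl v)
          (value≡ (sym half) (add⇓ (mod⇓ (var⇓ z≡₂) (lit⇓ 2<2^w)) (var⇓ tmp≡′)
            (subst (_< 2 ^ w) half (≤-trans (ones<2^β z) 2^β≤2^w))))
          (at⇓ {R = table} table<5 (trans (var≡ i $bT refl) (known know $bT refl)) (var⇓ z≡₂) z<)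
          (ones<2^β z)
        ▸ λ { j st → set (suc⇓ (trans (var≡ j $z refl) z≡₂) z< 2^τ<2^w)
            (≤-trans (≤-reflexive (+-identityʳ _)) (≤-reflexive (at-no-cost st)) , (s≤s z≤n , refl , VM-assign $z refl refl refl (vm-after st) ,
             λ y y< → trans (assign-arr $z refl table y) (extended z< done i st y y<))) } } })
      (m^n>0 2 τ)
      (≤-refl , refl , quiet-VM g refl (vm-after s) ,
        λ { zero _ → trans (quiet-arr g refl table 0) (trans (here s) (sym (ones-0 τ))) ; (suc y) (s≤s ()) }))
      λ { k (c≤ , _ , _ , v , done) →
        ≤-trans (≤-reflexive (cong (_+ _) (at-no-cost s))) (≤-trans c≤ (≤-reflexive (trans (sumBelow-const 1 (2 ^ τ)) (*-identityʳ _)))) , v , done } } }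
    where
    extended : ∀ {σ σ₁ σ₂ z e cost} → z < 2 ^ τ → (∀ y → y < z → arr σ table y ≡ ones τ y) →
      Frame (getSlot $tmp e) σ σ₁ → Stored σ₁ table z (ones τ z) cost σ₂ →
      ∀ y → y < suc z → arr σ₂ table y ≡ ones τ y
    extended {z = z} z< done i st y y≤z with y ≟ z
    ... | yes refl = here st
    ... | no  y≢z  = trans (elsewhere st table y (≤-<-trans (≤-pred y≤z) z<) (inj₂ y≢z))
                       (trans (quiet-arr i refl table y) (done y (≤∧≢⇒< (≤-pred y≤z) y≢z)))

  record Base (σ : State) : Set where
    constructor _,ᵇ_
    field
      context : Context early σ
      tabled  : Table σ

  open Base public

  base-quiet : ∀ {s σ σ′} → Frame s σ σ′ → harmless early s ≡ true → Base σ → Base σ′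
  base-quiet {s} f h (c ,ᵇ tb) = keep f h c ,ᵇ quiet-table f (∧-left {quiet s} h) tb

  base-stored : ∀ {s σ σ′ R i z cost} → Frame s σ σ′ → untouched early s ≡ true → Stored σ R i z cost σ′ →
                table ≢ R → Base σ → Base σ′
  base-stored f h st ≢ ((_ ,ᶜ k) ,ᵇ tb) = (vm-after st ,ᶜ keep-known f h k) ,ᵇ
    λ z z< → trans (elsewhere st table z z< (inj₁ ≢)) (tb z z<)

  pointer⇓ : ∀ {ρ k} {i} → ρ $k ≡ k → ρ ⊢ !_ {i} $k ⇓ address pointers k
  pointer⇓ k≡ = var⇓ k≡

  clearPointers-run : ∀ {σ} → Base σ → Run clearPointers σ λ cost σ′ →
    cost ≤ λ′ × Base σ′ × (∀ {j} → j < λ′ → arr σ′ pointers j ≡ 0)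
  clearPointers-run {σ} b₀ =
    set₁ lit-0 ▸ λ { {σ′ = σ₁} f (refl , refl) →
    weaken (counting (λ k σ → env σ $k ≡ k × Base σ × (∀ {j} → j < k → j < λ′ → arr σ pointers j ≡ 0)) (λ _ → 0) λ′
      (λ g (k≡ , b , _) _ → less⇓ (var⇓ k≡) (var⇓ (const-of (context b) $λ refl)))
      (λ { {k} g (k≡ , b , zs) k< →
        store-run {R = pointers} pointers<5 k< (vm-of (context b)) lit-0 (pointer⇓ k≡) (m^n>0 2 β)
        ▸ λ { h st →
        weaken (set₁ (suc⇓ (trans (var≡ h $k refl) k≡) k< (size<2^w pointers pointers<5)))
          λ { i (refl , refl) → ≤-reflexive (trans (+-identityʳ _) (at-no-cost st)) , refl ,
              base-quiet i refl (base-stored h refl st (λ ()) b) ,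
              λ {j} j<k j< → trans (quiet-arr i refl pointers j) (cleared-so-far zs st j<k j<) } } })
      {0} z≤n (refl , base-quiet f refl b₀ , λ ()))
      λ { _ (c≤ , _ , b , zs) → ≤-trans c≤ (≤-reflexive (trans (sumBelow-const 1 λ′) (*-identityʳ λ′))) , b , λ j< → zs j< j< } }
    where
    cleared-so-far : ∀ {σ σ₁ k cost} → (∀ {j} → j < k → j < λ′ → arr σ pointers j ≡ 0) →
      Stored σ pointers k 0 cost σ₁ → ∀ {j} → j < suc k → j < λ′ → arr σ₁ pointers j ≡ 0
    cleared-so-far {k = k} zs st {j} j≤k j< with j ≟ k
    ... | yes refl = here st
    ... | no  j≢k  = trans (elsewhere st pointers j j< (inj₂ j≢k)) (zs (≤∧≢⇒< (≤-pred j≤k) j≢k) j<)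

  record Taken (k : ℕ) (σ : State) (cost : ℕ) (σ′ : State) : Set where
    constructor taken
    field
      no-cost : cost ≡ 0
      base′   : Base σ′
      x≡      : env σ′ $x ≡ arr σ pointers k
      bumped  : arr σ′ pointers k ≡ suc (arr σ pointers k)
      rest    : ∀ R i → i < size R → R ≢ pointers ⊎ i ≢ k → arr σ′ R i ≡ arr σ R i

  take-run : ∀ {σ k} → Base σ → env σ $k ≡ k → k < λ′ → suc (arr σ pointers k) < 2 ^ β → Run take σ (Taken k σ)
  take-run {σ} {k} b k≡ k< bound =
    load-run pointers k $x pointers<5 k< (vm-of (context b)) (pointer⇓ k≡)
    ▸ λ { f (refl , x≡) →
    let b₁ = base-quiet f refl b in
    weaken (store-run {R = pointers} {i = k} pointers<5 k< (vm-of (context b₁))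
      (suc⇓ x≡ ≤-refl (≤-trans bound 2^β≤2^w)) (pointer⇓ (trans (var≡ f $k refl) k≡)) bound)
      λ { g st → taken (at-no-cost st) (base-stored g refl st (λ ()) b₁) (trans (var≡ g $x refl) x≡) (here st)
            λ R i i< ≢ → trans (elsewhere st R i i< ≢) (quiet-arr f refl R i) } }

  -- A sweep takes, for every vertex and each of its levels, the next number
  -- on that level; f k is the first one.
  module Sweep (extra : Stmt) (f : ℕ → ℕ) (J : ℕ → ℕ → State → Set)
    (f≤ : ∀ {k} → k < λ′ → f k + before k n ≤ N)
    (e∉ : writes extra $e ≡ false) (k∉ : writes extra $k ≡ false) (v∉ : writes extra $v ≡ false)
    (extra-run : ∀ {σ v k} → Base σ → v < n → k < len v → env σ $x ≡ f k + before k v → J v k σ →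
      Run extra σ λ cost σ′ → cost ≡ 0 × Base σ′ × (∀ {j} → j < λ′ → arr σ′ pointers j ≡ arr σ pointers j) × J v (suc k) σ′)
    (J-keep : ∀ {s σ σ′ v k} → Frame s σ σ′ → untouched late s ≡ true →
      (∀ i → i < W → arr σ′ flags i ≡ arr σ flags i) → J v k σ → J v k σ′)
    (J-next : ∀ {σ v} → v < n → J v (len v) σ → J (suc v) 0 σ)
    where

    -- In the middle of vertex v, its own numbers have been taken on the levels below k; this is the
    -- last summand.
    record Ptr (v k : ℕ) (σ : State) : Set where
      constructor ptr
      field ptr≡ : ∀ {j} → j < λ′ → arr σ pointers j ≡ f j + before j v + bool→ℕ (j <ᵇ k)

    open Ptr

    at-k : ∀ {v k σ} → k < λ′ → Ptr v k σ → arr σ pointers k ≡ f k + before k v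
    at-k {v} {k} k< p = trans (ptr≡ p k<) (trans (cong (λ b → f k + before k v + bool→ℕ b) (<ᵇ-≮ {k} {k} 1+n≰n)) (+-identityʳ _))

    bump-bound : ∀ {v k σ} → v < n → k ≤ len v → k < λ′ → Ptr v k σ → suc (arr σ pointers k) < 2 ^ β
    bump-bound {v} {k} v< k≤ k< p = ≤-<-trans (begin
      suc (arr _ pointers k)               ≡⟨ cong suc (at-k k< p) ⟩
      suc (f k + before k v)               ≡⟨ +-comm 1 _ ⟩
      f k + before k v + 1                 ≡⟨ cong (f k + before k v +_) (reaches-yes k≤) ⟨
      f k + before k v + reaches k v       ≡⟨ +-assoc (f k) _ _ ⟩
      f k + before k (suc v)               ≤⟨ +-monoʳ-≤ (f k) (sumBelow-extend (reaches k) v<) ⟩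
      f k + before k n                     ≤⟨ f≤ k< ⟩
      N                                    ∎) N<
      where open ≤-Reasoning

    bumped-ptr : ∀ {v k σ cost σ′} → k < λ′ → Ptr v k σ → Taken k σ cost σ′ → Ptr v (suc k) σ′
    bumped-ptr {v} {k} {σ} {σ′ = σ′} k< p tk = ptr bumped-at
      where
      bumped-at : ∀ {j} → j < λ′ → arr σ′ pointers j ≡ f j + before j v + bool→ℕ (j <ᵇ suc k)
      bumped-at {j} j< with j ≟ k
      ... | yes refl = trans (Taken.bumped tk) (trans (cong suc (at-k k< p)) (trans (+-comm 1 _)
                       (cong (λ b → f k + before k v + bool→ℕ b) (sym (<ᵇ-< {k} {suc k} ≤-refl)))))
      ... | no  j≢k  = trans (Taken.rest tk pointers j j< (inj₂ j≢k)) (trans (ptr≡ p j<)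
                       (cong (λ b → f j + before j v + bool→ℕ b) (sym (<ᵇ-suc-other j≢k))))

    flags-kept : ∀ {k σ cost σ′} → Taken k σ cost σ′ → ∀ i → i < W → arr σ′ flags i ≡ arr σ flags i
    flags-kept tk i i< = Taken.rest tk flags i i< (inj₁ λ ())

    levels-run : ∀ m {σ v k e} → Base σ → v < n → k + m ≡ len v → env σ $e ≡ e → bitlen e ≡ m →
      env σ $k ≡ k → env σ $v ≡ v → Ptr v k σ → J v k σ →
      Run (while ! $e loop sweepLevel extra) σ λ cost σ′ →
        cost ≤ m × Base σ′ × env σ′ $v ≡ v × env σ′ $k ≡ len v × Ptr v (len v) σ′ × J v (len v) σ′
    levels-run zero {σ} {v} {k} {e} b v< km e≡ be k≡ v≡ p jv with refl ← trans (sym (+-identityʳ k)) km =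
      stop-loop (var⇓ (trans e≡ (bitlen-0 {e} be))) (z≤n , b , v≡ , k≡ , p , jv)
    levels-run (suc m) {σ} {v} {k} {e} b v< km e≡ be k≡ v≡ p jv =
      step-loop {Q = λ cost σ′ → cost ≡ 0 × Base σ′ × env σ′ $e ≡ e / 2 × env σ′ $k ≡ suc k × env σ′ $v ≡ v × Ptr v (suc k) σ′ × J v (suc k) σ′}
        (var⇓ e≡) (proj₁ (bitlen-suc {e} be))
        (take-run b k≡ k<λ′ (bump-bound v< (<⇒≤ k<) k<λ′ p) ▸ λ { g tk@(taken refl b₁ x₁ _ _) →
         extra-run b₁ v< k< (trans x₁ (at-k k<λ′ p)) (J-keep g refl (flags-kept tk) jv) ▸ λ { {σ′ = σ₂} h (refl , b₂ , same-ptr , j₂) →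
         weaken (set₂ (shr⇓ (var⇓ (trans (var≡ h $e e∉) (trans (var≡ g $e refl) e≡))) lit-1)
                      (suc⇓ (trans (var≡ h $k k∉) (trans (var≡ g $k refl) k≡)) k<λ′ (size<2^w pointers pointers<5)))
           λ { i (refl , refl) → refl , base-quiet i refl b₂ , refl , refl , trans (var≡ h $v v∉) (trans (var≡ g $v refl) v≡) ,
               ptr (λ {j} j< → trans (quiet-arr i refl pointers j) (trans (same-ptr j<) (ptr≡ (bumped-ptr k<λ′ p tk) j<))) ,
               J-keep i refl (λ l _ → quiet-arr i refl flags l) j₂ } } })
        λ { g (refl , b₁ , e₁ , k₁ , v₁ , p₁ , j₁) →
          weaken (levels-run m b₁ v< (trans (sym (+-suc k m)) km) e₁ (proj₂ (bitlen-suc {e} be)) k₁ v₁ p₁ j₁)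
            λ _ (c≤ , rest) → s≤s c≤ , rest }
      where
      k< : k < len v
      k< = ≤-trans (m<m+n k (s≤s z≤n)) (≤-reflexive km)
      k<λ′ : k < λ′
      k<λ′ = <-trans k< (len< v<)

    sweep-run : ∀ {σ} → Base σ → (∀ {j} → j < λ′ → arr σ pointers j ≡ f j) → J 0 0 σ →
      Run (sweep extra) σ λ cost σ′ → cost ≤ sumBelow (suc ∘ len) n × Base σ′ ×
        (∀ {j} → j < λ′ → arr σ′ pointers j ≡ f j + before j n) × J n 0 σ′
    sweep-run {σ} b₀ p₀ j₀ =
      set₁ lit-0 ▸ λ { g (refl , refl) →
      weaken (counting I len n (λ _ (v≡ , _) _ → less⇓ (var⇓ v≡) vertices⇓) body {0} z≤n
          (refl , base-quiet g refl b₀ ,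
           (λ {j} j< → trans (quiet-arr g refl pointers j) (trans (p₀ j<) (sym (+-identityʳ (f j))))) ,
           J-keep g refl (λ i _ → quiet-arr g refl flags i) j₀))
        λ _ (c≤ , _ , rest) → c≤ , rest }
      where
      I : ℕ → State → Set
      I v σ = env σ $v ≡ v × Base σ × (∀ {j} → j < λ′ → arr σ pointers j ≡ f j + before j v) × J v 0 σ
      body : ∀ {s σ₀ v σ} → Frame s σ₀ σ → I v σ → v < n →
             Run (sweepVertex extra) σ λ cost σ′ → cost ≤ len v × I (suc v) σ′
      body {v = v} {σ} _ (v≡ , b , p , jv) v< =
        set₁ (suc⇓ v≡ v< n<2^w) ▸ λ { g (refl , refl) →
        set₂ (degreeMinus1⇓ {v = fromℕ< v<} (cong suc (sym (Fin.toℕ-fromℕ< v<)))) lit-0 ▸ λ { h (refl , refl) →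
        levels-run (len v) {k = 0} (base-quiet h refl (base-quiet g refl b)) v< refl refl
          (trans (len-toℕ (fromℕ< v<)) (cong len (Fin.toℕ-fromℕ< v<))) refl v≡
          (ptr λ {j} j< → trans (quiet-arr h refl pointers j) (trans (quiet-arr g refl pointers j)
             (trans (p j<) (sym (+-identityʳ _)))))
          (J-keep h refl (λ i _ → quiet-arr h refl flags i) (J-keep g refl (λ i _ → quiet-arr g refl flags i) jv))
        ▸ λ { {c} i (c≤ , b₃ , v₃ , k₃ , p₃ , j₃) →
        take-run b₃ k₃ (len< v<) (bump-bound v< ≤-refl (len< v<) p₃) ▸ λ { l tk@(taken refl b₄ _ _ _) →
        weaken (set₁ (suc⇓ (trans (var≡ l $v refl) v₃) v< n<2^w))
          λ { r (refl , refl) → ≤-trans (≤-reflexive (+-identityʳ c)) c≤ , refl , base-quiet r refl b₄ ,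
              (λ {j} j< → trans (quiet-arr r refl pointers j) (trans (ptr≡ (bumped-ptr (len< v<) p₃ tk) j<)
                 (trans (+-assoc (f j) (before j v) _) (cong (λ b → f j + (before j v + bool→ℕ b)) (<ᵇ-suc≡≤ᵇ j (len v)))))) ,
              J-keep r refl (λ i _ → quiet-arr r refl flags i) (J-next v< (J-keep l refl (flags-kept tk) j₃)) } } } } }

setBases clearFlags setFlag rankWord fillRanks fillFields buildFields : Stmt
setBases =
  $W ≔ (! $acc ⟪ div ⟫ ! $t) ⟪ add ⟫ lit 1 ⨾ $bF ≔ ! $bT ⟪ add ⟫ ! $2τ ⨾
  $bD ≔ ! $bF ⟪ add ⟫ ! $W ⨾ $bA ≔ ! $bD ⟪ add ⟫ ! $W
clearFlags =
  $k ≔ lit 0 ⨾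
  while ! $k ⟪ less ⟫ ! $W loop (setSlot (! $bF ⟪ add ⟫ ! $k) (lit 0) ⨾ $k ≔ ! $k ⟪ add ⟫ lit 1)
setFlag = loadCell $bF ⨾ putCell $bF (lit 1)
-- The first word of a block stores the absolute rank, and every word of the block reads it back to
-- form its relative rank. Adding the latter shifted by t is a concatenation, since the word still
-- consists of t flags only.
rankWord =
  (if ! $k mod ! $λ then skip else′ setSlot (! $bA ⟪ add ⟫ (! $k ⟪ div ⟫ ! $λ)) (! $acc)) ⨾
  getSlot $px (! $bA ⟪ add ⟫ (! $k ⟪ div ⟫ ! $λ)) ⨾
  getSlot $cy (! $bF ⟪ add ⟫ ! $k) ⨾
  setSlot (! $bF ⟪ add ⟫ ! $k) (! $cy ⟪ add ⟫ (! $acc ⟪ sub ⟫ ! $px ⟪ shl ⟫ ! $t)) ⨾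
  popcount ⨾
  $k ≔ ! $k ⟪ add ⟫ lit 1
fillRanks = ($acc ≔ lit 0 ⨾ $k ≔ lit 0) ⨾ while ! $k ⟪ less ⟫ ! $W loop rankWord
-- `exchange` serves as the initial write, so that the digits need no clearing; what it returns here
-- is arbitrary.
fillFields =
  $v ≔ lit 0 ⨾
  while ! $v ⟪ less ⟫ vertices loop
    (($u ≔ ! $v ⟪ add ⟫ lit 1 ⨾ $j ≔ degreeMinus1 $u) ⨾ exchange ⨾ $v ≔ ! $v ⟪ add ⟫ lit 1)
buildFields =
  buildTable ⨾ clearPointers ⨾ sweep skip ⨾ prefixSums ⨾ setBases ⨾ clearFlags ⨾
  sweep setFlag ⨾ fillRanks ⨾ fillFields

module Building (ℙ : Planes) where

  open Planes ℙ
  open Construction ℙ public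

  first≤N : ∀ {k} → k ≤ λ′ → first k ≤ N
  first≤N k≤ = ≤-trans (first-≤ k≤) (≤-reflexive (sym N≡))

  before≤N : ∀ {k} → k < λ′ → 0 + before k n ≤ N
  before≤N {k} k< = ≤-trans (m≤n+m _ (first k)) (first≤N k<)

  λ′<2^w : λ′ < 2 ^ w
  λ′<2^w = size<2^w pointers pointers<5

  W<2^w : W < 2 ^ w
  W<2^w = size<2^w flags flags<5

  countLevels-run : ∀ {σ} → Base σ → (∀ {j} → j < λ′ → arr σ pointers j ≡ 0) →
    Run (sweep skip) σ λ cost σ′ → cost ≤ sumBelow (suc ∘ len) n × Base σ′ ×
      (∀ {j} → j < λ′ → arr σ′ pointers j ≡ before j n)
  countLevels-run b p = weaken (sweep-run b p tt) λ { _ (c , b , p , _) → c , b , p }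
    where
    open Sweep skip (λ _ → 0) (λ _ _ _ → ⊤) before≤N refl refl refl
      (λ b _ _ _ _ → nop (refl , b , (λ _ → refl) , tt)) (λ _ _ _ _ → tt) (λ _ _ → tt)

  prefixSums-run : ∀ {σ} → Base σ → (∀ {j} → j < λ′ → arr σ pointers j ≡ before j n) →
    Run prefixSums σ λ cost σ′ → cost ≤ λ′ × Base σ′ × env σ′ $acc ≡ N ×
      (∀ {j} → j < λ′ → arr σ′ pointers j ≡ first j)
  prefixSums-run {σ} b₀ p₀ =
    set₂ lit-0 lit-0 ▸ λ { f (refl , refl) →
    weaken (counting I (λ _ → 0) λ′
      (λ g (k≡ , _ , b , _) _ → less⇓ (var⇓ k≡) (var⇓ (const-of (context b) $λ refl)))
      (λ { {k} g (k≡ , acc≡ , b , lo , hi) k< →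
        load-run pointers k $px pointers<5 k< (vm-of (context b)) (pointer⇓ k≡)
        ▸ λ { h (refl , px≡) →
        let b₁ = base-quiet h refl b in
        store-run {R = pointers} {i = k} pointers<5 k< (vm-of (context b₁)) (var⇓ (trans (var≡ h $acc refl) acc≡))
          (pointer⇓ (trans (var≡ h $k refl) k≡)) (≤-<-trans (first≤N (<⇒≤ k<)) N<)
        ▸ λ { i st →
        weaken (set₂ (add⇓ (var⇓ (trans (var≡ i $acc refl) (trans (var≡ h $acc refl) acc≡)))
                           (var⇓ (trans (var≡ i $px refl) (trans px≡ (hi k< ≤-refl))))
                           (≤-<-trans (first≤N k<) N<2^w))
                     (suc⇓ (trans (var≡ i $k refl) (trans (var≡ h $k refl) k≡)) k< λ′<2^w))
          λ { l (refl , refl) → ≤-reflexive (trans (+-identityʳ _) (at-no-cost st)) , refl , refl ,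
            base-quiet l refl (base-stored i refl st (λ ()) b₁) ,
            (λ {j} j< j≤k → trans (quiet-arr l refl pointers j) (lower k< lo h st j< j≤k)) ,
            (λ {j} j< k<j → trans (quiet-arr l refl pointers j) (trans (elsewhere st pointers j j< (inj₂ (>⇒≢ k<j)))
               (trans (quiet-arr h refl pointers j) (hi j< (<⇒≤ k<j))))) } } } })
      {0} z≤n (refl , refl , base-quiet f refl b₀ , (λ _ ()) , λ {j} j< _ → trans (quiet-arr f refl pointers j) (p₀ j<)))
      λ _ (c≤ , _ , acc≡ , b , lo , _) → ≤-trans c≤ (≤-reflexive (trans (sumBelow-const 1 λ′) (*-identityʳ λ′))) , b ,
        trans acc≡ (sym N≡) , λ j< → lo j< j< }
    where
    I : ℕ → State → Set
    I k σ = env σ $k ≡ k × env σ $acc ≡ first k × Base σ ×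
      (∀ {j} → j < λ′ → j < k → arr σ pointers j ≡ first j) ×
      (∀ {j} → j < λ′ → k ≤ j → arr σ pointers j ≡ before j n)
    lower : ∀ {σ σ₁ σ₂ k e cost} → k < λ′ → (∀ {j} → j < λ′ → j < k → arr σ pointers j ≡ first j) →
      Frame (getSlot $px e) σ σ₁ → Stored σ₁ pointers k (first k) cost σ₂ →
      ∀ {j} → j < λ′ → j < suc k → arr σ₂ pointers j ≡ first j
    lower {k = k} k< lo h st {j} j< j≤k with j ≟ k
    ... | yes refl = here st
    ... | no  j≢k  = trans (elsewhere st pointers j j< (inj₂ j≢k))
                       (trans (quiet-arr h refl pointers j) (lo j< (≤∧≢⇒< (≤-pred j≤k) j≢k)))

  setBases-run : ∀ {σ} → Base σ → env σ $acc ≡ N → Run setBases σ λ cost σ′ → cost ≡ 0 × Context late σ′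
  setBases-run {σ} b acc≡ =
    set₁ (value≡ (trans (+-comm (N / t) 1) (sym W≡)) (add⇓ (div⇓ (var⇓ acc≡) (var⇓ (const-of (context b) $t refl))) lit-1
           (subst (_< 2 ^ w) (trans W≡ (+-comm 1 (N / t))) W<2^w)))
    ▸ λ { f (refl , refl) →
    let k₁ = learn refl (keep-known f refl (knows-of (context b))) in
    set₁ (add⇓ (var⇓ (known k₁ $bT refl)) (var⇓ (known k₁ $2τ refl)) (base< (s≤s (s≤s z≤n))))
    ▸ λ { g (refl , refl) →
    let k₂ = learn refl (keep-known g refl k₁) in
    set₁ (add⇓ (var⇓ (known k₂ $bF refl)) (var⇓ (known k₂ $W refl)) (base< flags<5))
    ▸ λ { h (refl , refl) →
    let k₃ = learn refl (keep-known h refl k₂) in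
    weaken (set₁ (add⇓ (var⇓ (known k₃ $bD refl)) (var⇓ (known k₃ $W refl)) (base< digits<5)))
    λ { i (refl , refl) → refl ,
        (quiet-VM i refl (quiet-VM h refl (quiet-VM g refl (quiet-VM f refl (vm-of (context b))))) ,ᶜ
         learn refl (keep-known i refl k₃)) } } } }
    where
    base< : ∀ {R} → R < 5 → base (suc R) < 2 ^ w
    base< R<5 = ≤-<-trans (sumBelow-extend size R<5) cap<

  clearFlags-run : ∀ {σ} → Base σ → Context late σ → Run clearFlags σ λ cost σ′ →
    cost ≤ W × Base σ′ × Context late σ′ × (∀ {j} → j < λ′ → arr σ′ pointers j ≡ arr σ pointers j) ×
    (∀ {i} → i < W → arr σ′ flags i ≡ 0)
  clearFlags-run {σ} b₀ c₀ =
    set₁ lit-0 ▸ λ { f (refl , refl) →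
    weaken (counting I (λ _ → 0) W
      (λ g (k≡ , _ , c , _) _ → less⇓ (var⇓ k≡) (var⇓ (const-of c $W refl)))
      (λ { {k} g (k≡ , b , c , ps , zs) k< →
        store-run {R = flags} flags<5 k< (vm-of c) lit-0
          (at⇓ {R = flags} flags<5 (const-of c $bF refl) (var⇓ k≡) k<) (m^n>0 2 β)
        ▸ λ { h st →
        weaken (set₁ (suc⇓ (trans (var≡ h $k refl) k≡) k< W<2^w))
          λ { i (refl , refl) → ≤-reflexive (trans (+-identityʳ _) (at-no-cost st)) , refl ,
              base-quiet i refl (base-stored h refl st (λ ()) b) ,
              keep i refl (vm-after st ,ᶜ keep-known h refl (knows-of c)) ,
              (λ {j} j< → trans (quiet-arr i refl pointers j) (trans (elsewhere st pointers j j< (inj₁ λ ())) (ps j<))) ,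
              λ {j} j<k j< → trans (quiet-arr i refl flags j) (so-far zs st j<k j<) } } })
      {0} z≤n (refl , base-quiet f refl b₀ , keep f refl c₀ , (λ {j} _ → quiet-arr f refl pointers j) , λ ()))
      λ _ (c≤ , _ , b , c , ps , zs) →
        ≤-trans c≤ (≤-reflexive (trans (sumBelow-const 1 W) (*-identityʳ W))) , b , c , ps , λ j< → zs j< j< }
    where
    I : ℕ → State → Set
    I k σ′ = env σ′ $k ≡ k × Base σ′ × Context late σ′ ×
      (∀ {j} → j < λ′ → arr σ′ pointers j ≡ arr σ pointers j) × (∀ {j} → j < k → j < W → arr σ′ flags j ≡ 0)
    so-far : ∀ {σ σ₁ k cost} → (∀ {j} → j < k → j < W → arr σ flags j ≡ 0) →
      Stored σ flags k 0 cost σ₁ → ∀ {j} → j < suc k → j < W → arr σ₁ flags j ≡ 0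
    so-far {k = k} zs st {j} j≤k j< with j ≟ k
    ... | yes refl = here st
    ... | no  j≢k  = trans (elsewhere st flags j j< (inj₂ j≢k)) (zs (≤∧≢⇒< (≤-pred j≤k) j≢k) j<)

  -- The flags below (v, k) in the order of the sweep are set.
  record Flagged (v k : ℕ) (σ : State) : Set where
    constructor flagged
    field
      fresh   : Knows late σ
      small′  : ∀ {i} → i < W → arr σ flags i < 2 ^ t
      done    : ∀ {v′ k′} → v′ < v → v′ < n → k′ ≤ len v′ → cell σ flags (lin k′ v′) ≡ reaches (suc k′) v′
      partial : ∀ {k′} → k′ < k → v < n → k′ ≤ len v → cell σ flags (lin k′ v) ≡ 1
      todo    : ∀ {v′ k′} → v′ < n → k′ ≤ len v′ → v < v′ ⊎ (v ≡ v′ × k ≤ k′) → cell σ flags (lin k′ v′) ≡ 0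
      -- The padding of the last word must be 0 for the ranks to stay at most N.
      beyond  : ∀ {y} → N ≤ y → y / t < W → cell σ flags y ≡ 0

  open Flagged

  setFlags-run : ∀ {σ} → Base σ → Flagged 0 0 σ → (∀ {j} → j < λ′ → arr σ pointers j ≡ first j) →
    Run (sweep setFlag) σ λ cost σ′ → cost ≤ sumBelow (suc ∘ len) n × Base σ′ × Flagged n 0 σ′
  setFlags-run b fl p = weaken (sweep-run b p fl) λ { _ (c , b , _ , fl) → c , b , fl }
    where
    flag-run : ∀ {σ v k} → Base σ → v < n → k < len v → env σ $x ≡ lin k v → Flagged v k σ →
      Run setFlag σ λ cost σ′ → cost ≡ 0 × Base σ′ ×
        (∀ {j} → j < λ′ → arr σ′ pointers j ≡ arr σ pointers j) × Flagged v (suc k) σ′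
    flag-run {σ} {v} {k} b v< k< x≡ (flagged fr sm dn pt td by) =
      loadCell-run flags $bF flags<5 refl refl (context b) refl (known fr $bF refl) x≡ y<
      ▸ λ { {σ′ = σ₁} f (loaded refl ci co cf) →
      let b₁ = base-quiet f refl b
          cells₁ : ∀ y → cell σ₁ flags y ≡ cell σ flags y
          cells₁ = quiet-cell f refl flags
      in
      weaken (putCell-run {R = flags} {e = lit 1} flags<5 refl (vm-of (context b₁)) y<
               (trans (var≡ f $bF refl) (known fr $bF refl)) refl ci co
               (trans cf (sym (quiet-arr f refl flags (y / t)))) lit-1 ≤-refl)
        λ { {σ′ = σ₂} g st →
          let unset : ∀ {y′} → y′ / t < W → y′ ≢ y → cell σ₂ flags y′ ≡ cell σ flags y′
              unset {y′} y′< y′≢ = trans (cell-unset {R = flags} {y} refl y′< y′≢ ≤-refl st) (cells₁ y′)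
              unset-lin : ∀ {v′ k′} → v′ < n → k′ ≤ len v′ → v′ ≢ v ⊎ k′ ≢ k →
                          cell σ₂ flags (lin k′ v′) ≡ cell σ flags (lin k′ v′)
              unset-lin {v′} {k′} v′< k′≤ ≢ = unset (cell-< (lin< v′< k′≤)) λ eq →
                let k≡ , v≡ = lin-injective {k′} {v′} {k} {v} v′< k′≤ v< (<⇒≤ k<) eq
                in case ≢ of λ { (inj₁ v≢) → v≢ v≡ ; (inj₂ k≢) → k≢ k≡ }
          in
          at-no-cost st , base-stored g refl st (λ ()) b₁ ,
          (λ {j} j< → trans (elsewhere st pointers j j< (inj₁ λ ())) (quiet-arr f refl pointers j)) ,
          flagged (keep-known g refl (keep-known f refl fr))
            (λ {i} i< → small-after {σ₁} (λ {i} i< → subst (_< 2 ^ t) (sym (quiet-arr f refl flags i)) (sm i<)) st i<)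
            (λ {v′} {k′} v′<v v′< k′≤ → trans (unset-lin v′< k′≤ (inj₁ (<⇒≢ v′<v))) (dn v′<v v′< k′≤))
            (λ {k′} k′≤k _ k′≤ → case k′ ≟ k of λ
              { (yes refl) → cell-set {R = flags} {y} ≤-refl st
              ; (no k′≢k)  → trans (unset-lin v< k′≤ (inj₂ k′≢k)) (pt (≤∧≢⇒< (≤-pred k′≤k) k′≢k) v< k′≤) })
            (λ { {v′} {k′} v′< k′≤ (inj₁ v<v′)         → trans (unset-lin v′< k′≤ (inj₁ (>⇒≢ v<v′))) (td v′< k′≤ (inj₁ v<v′))
               ; {v′} {k′} v′< k′≤ (inj₂ (refl , k<k′)) → trans (unset-lin v′< k′≤ (inj₂ (>⇒≢ k<k′))) (td v′< k′≤ (inj₂ (refl , <⇒≤ k<k′))) })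
            λ {y′} N≤ y′< → trans (unset y′< (λ { refl → <⇒≱ y< N≤ })) (by N≤ y′<) } }
      where
      y = lin k v
      y< : y < N
      y< = lin< v< (<⇒≤ k<)
      small-after : ∀ {σ₁ cost σ₂} → (∀ {i} → i < W → arr σ₁ flags i < 2 ^ t) →
        Stored σ₁ flags (y / t) (setSlice (y % t) 1 1 (arr σ₁ flags (y / t))) cost σ₂ →
        ∀ {i} → i < W → arr σ₂ flags i < 2 ^ t
      small-after {σ₁} sm st {i} i< with i ≟ y / t
      ... | yes refl = subst (_< 2 ^ t) (sym (here st)) (setSlice-< (y % t) 1 (arr σ₁ flags (y / t)) ≤-refl
                         (≤-trans (≤-reflexive (+-comm (y % t) 1)) (%t< y)) (sm i<))
      ... | no  i≢   = subst (_< 2 ^ t) (sym (elsewhere st flags i i< (inj₂ i≢))) (sm i<)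

    kept : ∀ {s σ σ′ v k} → Frame s σ σ′ → untouched late s ≡ true →
      (∀ i → i < W → arr σ′ flags i ≡ arr σ flags i) → Flagged v k σ → Flagged v k σ′
    kept {σ = σ} {σ′} f h eq (flagged fr sm dn pt td by) = flagged (keep-known f h fr)
      (λ {i} i< → subst (_< 2 ^ t) (sym (eq i i<)) (sm i<))
      (λ v′<v v′< k′≤ → trans (cells (cell-< (lin< v′< k′≤))) (dn v′<v v′< k′≤))
      (λ k′<k v< k′≤ → trans (cells (cell-< (lin< v< k′≤))) (pt k′<k v< k′≤))
      (λ v′< k′≤ p → trans (cells (cell-< (lin< v′< k′≤))) (td v′< k′≤ p))
      (λ N≤ y< → trans (cells y<) (by N≤ y<))
      where
      cells : ∀ {y} → y / t < W → cell σ′ flags y ≡ cell σ flags y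
      cells {y} y< = cong (bit (y % t)) (eq (y / t) y<)

    next-vertex : ∀ {σ v} → v < n → Flagged v (len v) σ → Flagged (suc v) 0 σ
    next-vertex {σ} {v} v< (flagged fr sm dn pt td by) = flagged fr sm done′ (λ ()) todo′ by
      where
      done′ : ∀ {v′ k′} → v′ < suc v → v′ < n → k′ ≤ len v′ → cell σ flags (lin k′ v′) ≡ reaches (suc k′) v′
      done′ {v′} {k′} v′≤v v′< k′≤ with v′ ≟ v | k′ ≟ len v′
      ... | no  v′≢v | _        = dn (≤∧≢⇒< (≤-pred v′≤v) v′≢v) v′< k′≤
      -- The last level of a vertex has no successor, so its correct flag is the 0 left by the
      -- clearing.
      ... | yes refl | yes refl = trans (td v′< k′≤ (inj₂ (refl , ≤-refl))) (sym (reaches-no {suc (len v)} {v} ≤-refl))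
      ... | yes refl | no  k′≢  = trans (pt (≤∧≢⇒< k′≤ k′≢) v′< k′≤) (sym (reaches-yes {suc k′} {v} (≤∧≢⇒< k′≤ k′≢)))
      todo′ : ∀ {v′ k′} → v′ < n → k′ ≤ len v′ → suc v < v′ ⊎ (suc v ≡ v′ × 0 ≤ k′) → cell σ flags (lin k′ v′) ≡ 0
      todo′ v′< k′≤ (inj₁ v<v′)     = td v′< k′≤ (inj₁ (<⇒≤ v<v′))
      todo′ v′< k′≤ (inj₂ (refl , _)) = td v′< k′≤ (inj₁ ≤-refl)

    open Sweep setFlag first Flagged (λ k< → first≤N k<) refl refl refl flag-run kept next-vertex

-- Ranks of the flag words and initial contents of the fields

module Ranking (ℙ : Planes) where

  open Planes ℙ
  open Building ℙ public

  module _ (fl : ℕ → ℕ) (small : ∀ {i} → i < W → fl i < 2 ^ t) where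

    flagAt : ℕ → ℕ
    flagAt y = bit (y % t) (fl (y / t))

    rank : ℕ → ℕ
    rank = sumBelow λ i → ones t (fl i)

    module _ (done : ∀ {v k} → v < n → k ≤ len v → flagAt (lin k v) ≡ reaches (suc k) v)
             (beyond : ∀ {y} → N ≤ y → y / t < W → flagAt y ≡ 0) where

      rank-block : ∀ i → sumBelow flagAt (i * t) ≡ rank i

      rank-cells : ∀ i {o} → o ≤ t → sumBelow flagAt (i * t + o) ≡ rank i + ones o (fl i)
      rank-cells i {o} o≤t = trans (sumBelow-+ flagAt (i * t) o) (cong₂ _+_ (rank-block i)
        (sumBelow-cong o λ j j<o → let j<t = ≤-trans j<o o≤t in
          cong₂ (λ a b → bit a (fl b)) (trans (cong (_% t) (+-comm (i * t) j)) (%-absorb i j<t))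
                                      (trans (cong (_/ t) (+-comm (i * t) j)) (/-absorb i j<t))))

      rank-block zero    = refl
      rank-block (suc i) = trans (cong (sumBelow flagAt) (+-comm t (i * t))) (rank-cells i ≤-refl)

      rank-mono : ∀ {i j} → i ≤ j → rank i ≤ rank j
      rank-mono = sumBelow-extend _

      N≤Wt : N ≤ W * t
      N≤Wt = <⇒≤ (begin-strict
        N                    ≡⟨ m≡m%n+[m/n]*n N t ⟩
        N % t + N / t * t    <⟨ +-monoˡ-< (N / t * t) (%t< N) ⟩
        suc (N / t) * t      ≡⟨ cong (_* t) W≡ ⟨
        W * t                ∎)
        where open ≤-Reasoning

      -- The rank after the last word counts the ones of all `W * t` positions. Those from N on are
      -- padding, and each of the first N contributes at most 1.
      rank≤N : ∀ {i} → i ≤ W → rank i ≤ N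
      rank≤N {i} i≤ with k , N+k ← m≤n⇒∃[o]m+o≡n N≤Wt = begin
        rank i                                                    ≤⟨ rank-mono i≤ ⟩
        rank W                                                    ≡⟨ rank-block W ⟨
        sumBelow flagAt (W * t)                                   ≡⟨ cong (sumBelow flagAt) N+k ⟨
        sumBelow flagAt (N + k)                                   ≡⟨ sumBelow-+ flagAt N k ⟩
        sumBelow flagAt N + sumBelow (λ j → flagAt (N + j)) k     ≡⟨ cong (sumBelow flagAt N +_) rest ⟩
        sumBelow flagAt N + 0                                     ≡⟨ +-identityʳ _ ⟩
        sumBelow flagAt N                                         ≤⟨ sumBelow-mono N (λ y _ → bit≤1 (y % t) (fl (y / t))) ⟩
        sumBelow (λ _ → 1) N                                      ≡⟨ trans (sumBelow-const 1 N) (*-identityʳ N) ⟩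
        N                                                         ∎
        where
        open ≤-Reasoning
        rest : sumBelow (λ j → flagAt (N + j)) k ≡ 0
        rest = trans (sumBelow-cong k λ j j<k → beyond (m≤m+n N j)
                 (m<n*o⇒m/o<n (≤-trans (+-monoʳ-< N j<k) (≤-reflexive N+k))))
               (trans (sumBelow-const 0 k) (*-zeroʳ k))

      relative : ℕ → ℕ
      relative i = rank i ∸ rank (i / λ′ * λ′)

      relative-< : ∀ i → relative i < 2 ^ (β ∸ t)
      relative-< i = ≤-<-trans (begin
        rank i ∸ rank a                                             ≡⟨ cong (λ j → rank j ∸ rank a) (trans (m≡m%n+[m/n]*n i λ′) (+-comm (i % λ′) a)) ⟩
        rank (a + i % λ′) ∸ rank a                                  ≡⟨ cong (_∸ rank a) (sumBelow-+ _ a (i % λ′)) ⟩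
        rank a + sumBelow (λ j → ones t (fl (a + j))) (i % λ′) ∸ rank a ≡⟨ m+n∸m≡n (rank a) _ ⟩
        sumBelow (λ j → ones t (fl (a + j))) (i % λ′)               ≤⟨ sumBelow-mono (i % λ′) (λ j _ → ones-≤ t (fl (a + j))) ⟩
        sumBelow (λ _ → t) (i % λ′)                                 ≡⟨ sumBelow-const t (i % λ′) ⟩
        (i % λ′) * t                                                ≤⟨ *-monoˡ-≤ t (<⇒≤ (m%n<n i λ′)) ⟩
        λ′ * t                                                      ∎) λ′t<
        where
        open ≤-Reasoning
        a = i / λ′ * λ′

      ranked : ℕ → ℕ
      ranked i = fl i + relative i * 2 ^ t

      ranked-< : ∀ {i} → i < W → ranked i < 2 ^ β
      ranked-< {i} i< = subst (λ b → ranked i < 2 ^ b) (m+[n∸m]≡n t≤β) (low-< t (β ∸ t) (small i<) (relative-< i))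

      record Ranked (i : ℕ) (σ : State) : Set where
        constructor rankedᶜ
        field
          k≡    : env σ $k ≡ i
          acc≡  : env σ $acc ≡ rank i
          ctxʳ  : Context late σ
          tabʳ  : Table σ
          above : ∀ {j} → j * λ′ < i → arr σ ranks j ≡ rank (j * λ′)
          past  : ∀ {j} → j < i → j < W → arr σ flags j ≡ ranked j
          ahead : ∀ {j} → i ≤ j → j < W → arr σ flags j ≡ fl j

      A-size : ∀ {i} → i < W → i / λ′ < V
      A-size = V>

      A-multiple : ∀ {i j} → i < W → j * λ′ ≤ i → j < V
      A-multiple {i} {j} i< j≤ = subst (_< V) (m*n/n≡m j λ′) (V> (≤-<-trans j≤ i<))

      record Absolute (i : ℕ) (σ : State) (cost : ℕ) (σ′ : State) : Set where
        constructor absolute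
        field
          no-cost : cost ≡ 0
          ctxᵃ    : Context late σ′
          tabᵃ    : Table σ′
          above′  : ∀ {j} → j * λ′ ≤ i → arr σ′ ranks j ≡ rank (j * λ′)
          flags′  : ∀ {j} → j < W → arr σ′ flags j ≡ arr σ flags j

      absolute-run : ∀ {σ i} → Ranked i σ → i < W →
        Run (if ! $k mod ! $λ then skip else′ setSlot (! $bA ⟪ add ⟫ (! $k ⟪ div ⟫ ! $λ)) (! $acc)) σ (Absolute i σ)
      absolute-run {σ} {i} (rankedᶜ k≡ acc≡ c tb ab _ _) i< =
        branch (mod⇓ (var⇓ k≡) (var⇓ (const-of c $λ refl)))
          (λ ≢0 → nop (absolute refl c tb
             (λ {j} j≤ → ab (≤∧≢⇒< j≤ λ { refl → ≢0 (m*n%n≡0 j λ′) })) λ _ → refl))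
          (λ ≡0 → weaken (store-run {R = ranks} {i = i / λ′} ≤-refl (A-size i<) (vm-of c) (var⇓ acc≡)
               (at⇓ {R = ranks} ≤-refl (const-of c $bA refl) (div⇓ (var⇓ k≡) (var⇓ (const-of c $λ refl))) (A-size i<))
               (≤-<-trans (rank≤N (<⇒≤ i<)) N<))
             λ f st → absolute (at-no-cost st) (vm-after st ,ᶜ keep-known f refl (knows-of c))
               (λ z z< → trans (elsewhere st table z z< (inj₁ λ ())) (tb z z<))
               (λ {j} j≤ → new st (aligned ≡0) j≤)
               (λ {j} j< → elsewhere st flags j j< (inj₁ λ ())))
        where
        aligned : i % λ′ ≡ 0 → i / λ′ * λ′ ≡ i
        aligned ≡0 = sym (trans (m≡m%n+[m/n]*n i λ′) (cong (_+ i / λ′ * λ′) ≡0))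
        new : ∀ {cost σ′} → Stored σ ranks (i / λ′) (rank i) cost σ′ → i / λ′ * λ′ ≡ i →
              ∀ {j} → j * λ′ ≤ i → arr σ′ ranks j ≡ rank (j * λ′)
        new st al {j} j≤ with j ≟ i / λ′
        ... | yes refl = trans (here st) (cong rank (sym al))
        ... | no  j≢   = trans (elsewhere st ranks j (A-multiple i< j≤) (inj₂ j≢))
                           (ab (≤∧≢⇒< j≤ λ j≡ → j≢ (*-cancelʳ-≡ j (i / λ′) λ′ (trans j≡ (sym al)))))

      ones-word : ∀ {i} → i < W → ones (τ * chunks) (fl i) ≡ ones t (fl i)
      ones-word i< = ones-stable (fl _) (small i<) t≤

      rankWord-run : ∀ {σ i} → Ranked i σ → i < W → Run rankWord σ λ cost σ′ → cost ≤ chunks × Ranked (suc i) σ′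
      rankWord-run {σ} {i} r@(rankedᶜ k≡ acc≡ _ _ _ past ahead) i< =
        absolute-run r i< ▸ λ { f (absolute refl c tb ab fl≡) →
        let k₁ = trans (var≡ f $k refl) k≡
            a₁ = trans (var≡ f $acc refl) acc≡ in
        load-run ranks (i / λ′) $px ≤-refl (A-size i<) (vm-of c)
          (at⇓ {R = ranks} ≤-refl (const-of c $bA refl) (div⇓ (var⇓ k₁) (var⇓ (const-of c $λ refl))) (A-size i<))
        ▸ λ { g (refl , px≡) →
        let c₂ = keep g refl c
            k₂ = trans (var≡ g $k refl) k₁ in
        load-run flags i $cy flags<5 i< (vm-of c₂) (at⇓ {R = flags} flags<5 (const-of c₂ $bF refl) (var⇓ k₂) i<)
        ▸ λ { {σ′ = σ₃} h (refl , cy≡) →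
        let c₃  = keep h refl c₂
            k₃  = trans (var≡ h $k refl) k₂
            a₃  = trans (var≡ h $acc refl) (trans (var≡ g $acc refl) a₁)
            px₃ = trans (var≡ h $px refl) (trans px≡ (ab (m/n*n≤m i λ′)))
            cy₃ = trans cy≡ (trans (quiet-arr g refl flags i) (trans (fl≡ i<) (ahead ≤-refl i<)))
            arr₃ = λ R j → trans (quiet-arr h refl R j) (quiet-arr g refl R j) in
        store-run {R = flags} {i = i} flags<5 i< (vm-of c₃)
          (add⇓ (var⇓ cy₃) (shl-exact (sub⇓ (var⇓ a₃) (var⇓ px₃) (rank-mono (m/n*n≤m i λ′))) (var⇓ (const-of c₃ $t refl))
             (≤-<-trans (m≤n+m _ (fl i)) ranked<2^w)) ranked<2^w)
          (at⇓ {R = flags} flags<5 (const-of c₃ $bF refl) (var⇓ k₃) i<) (ranked-< i<)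
        ▸ λ { {cost₄} l st →
        let c₄ : Context late _
            c₄ = vm-after st ,ᶜ keep-known l refl (knows-of c₃)
            tb₄ = λ z z< → trans (elsewhere st table z z< (inj₁ λ ())) (trans (arr₃ table z) (tb z z<)) in
        popcount-run chunks (late⇒early c₄) tb₄ (trans (var≡ l $acc refl) a₃) (trans (var≡ l $cy refl) cy₃)
          (≤-trans (small i<) (2^-mono t≤))
          (subst (λ o → rank i + o < 2 ^ w) (sym (ones-word i<)) (≤-<-trans (rank≤N i<) N<2^w))
        ▸ λ { {cost₅} p (c≤ , acc′) →
        weaken (set₁ (suc⇓ (trans (var≡ p $k refl) (trans (var≡ l $k refl) k₃)) i< W<2^w))
          λ { u (refl , refl) →
            ≤-trans (≤-reflexive (trans (cong (_+ (cost₅ + 0)) (at-no-cost st)) (+-identityʳ cost₅))) c≤ ,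
            rankedᶜ refl (trans acc′ (cong (rank i +_) (ones-word i<))) (keep u refl (keep p refl c₄))
              (quiet-table u refl (quiet-table p refl tb₄))
              (λ {j} j< → trans (quiet-arr u refl ranks j) (trans (quiet-arr p refl ranks j)
                 (trans (elsewhere st ranks j (A-multiple i< (≤-pred j<)) (inj₁ λ ()))
                   (trans (arr₃ ranks j) (ab (≤-pred j<))))))
              (λ {j} j≤i j< → trans (quiet-arr u refl flags j) (trans (quiet-arr p refl flags j)
                 (now st (λ j<i → trans (arr₃ flags j) (trans (fl≡ j<) (past j<i j<))) j≤i j<)))
              (λ {j} i<j j< → trans (quiet-arr u refl flags j) (trans (quiet-arr p refl flags j)
                 (trans (elsewhere st flags j j< (inj₂ (>⇒≢ i<j)))
                   (trans (arr₃ flags j) (trans (fl≡ j<) (ahead (<⇒≤ i<j) j<)))))) } } } } } }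
        where
        ranked<2^w : ranked i < 2 ^ w
        ranked<2^w = ≤-trans (ranked-< i<) 2^β≤2^w
        now : ∀ {σ cost σ′} → Stored σ flags i (ranked i) cost σ′ → ∀ {j} → (j < i → arr σ flags j ≡ ranked j) →
              j < suc i → j < W → arr σ′ flags j ≡ ranked j
        now st {j} p j≤i j< with j ≟ i
        ... | yes refl = here st
        ... | no  j≢i  = trans (elsewhere st flags j j< (inj₂ j≢i)) (p (≤∧≢⇒< (≤-pred j≤i) j≢i))

      fillRanks-run : ∀ {σ} → Context late σ → Table σ → (∀ {j} → j < W → arr σ flags j ≡ fl j) →
        Run fillRanks σ λ cost σ′ → cost ≤ W * suc chunks × Static σ′
      fillRanks-run {σ} c tb fl≡ =
        set₂ lit-0 lit-0 ▸ λ { f (refl , refl) →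
        weaken (counting Ranked (λ _ → chunks) W
          (λ _ r _ → less⇓ (var⇓ (Ranked.k≡ r)) (var⇓ (const-of (Ranked.ctxʳ r) $W refl)))
          (λ _ → rankWord-run) {0} z≤n
          (rankedᶜ refl refl (keep f refl c) (quiet-table f refl tb) (λ ()) (λ ())
             λ {j} _ j< → trans (quiet-arr f refl flags j) (fl≡ j<)))
          λ { _ (c≤ , rankedᶜ _ _ c′ tb′ ab past _) →
            ≤-trans c≤ (≤-reflexive (sumBelow-const (suc chunks) W)) ,
            static c′ tb′ λ {v} {k} v< k< → child-correct ab past v< k< } }
        where
        child-correct : ∀ {σ v k} → (∀ {j} → j * λ′ < W → arr σ ranks j ≡ rank (j * λ′)) →
          (∀ {j} → j < W → j < W → arr σ flags j ≡ ranked j) → v < n → k < len v → childOf σ (lin k v) ≡ lin (suc k) v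
        child-correct {σ} {v} {k} ab past v< k< = begin
          n + (arr σ ranks (i / λ′) + arr σ flags i /2^ t + ones o (arr σ flags i))
            ≡⟨ cong₂ (λ a f → n + (a + f /2^ t + ones o f)) (ab (≤-<-trans (m/n*n≤m i λ′) i<)) (past i< i<) ⟩
          n + (rank (i / λ′ * λ′) + ranked i /2^ t + ones o (ranked i))
            ≡⟨ cong₂ (λ r c → n + (rank (i / λ′ * λ′) + r + c)) (/2^-absorb t (relative i) (small i<))
                     (ones-low t (fl i) (relative i) (<⇒≤ (%t< y))) ⟩
          n + (rank (i / λ′ * λ′) + relative i + ones o (fl i))
            ≡⟨ cong (λ r → n + (r + ones o (fl i))) (m+[n∸m]≡n (rank-mono (m/n*n≤m i λ′))) ⟩
          n + (rank i + ones o (fl i))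
            ≡⟨ cong (n +_) (rank-cells i (<⇒≤ (%t< y))) ⟨
          n + sumBelow flagAt (i * t + o)
            ≡⟨ cong (λ y → n + sumBelow flagAt y) (trans (+-comm (i * t) o) (sym (m≡m%n+[m/n]*n y t))) ⟩
          n + sumBelow flagAt y
            ≡⟨ lin-child flagAt (λ {k} {v} → done {v} {k}) k v (<⇒≤ v<) ⟩
          lin (suc k) v ∎
          where
          open ≡-Reasoning
          y = lin k v
          i = y / t
          o = y % t
          i< : i < W
          i< = cell-< (lin< v< (<⇒≤ k<))

  fillFields-run : ∀ {σ} → Static σ → Run fillFields σ λ cost σ′ →
    cost ≤ sumBelow (λ v → suc (C * len v)) n × Static σ′ × (∀ {i} → i < n → field-of σ′ i ≡ degree i ∸ 1)
  fillFields-run {σ} s₀ =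
    set₁ lit-0 ▸ λ { f (refl , refl) →
    weaken (counting (λ v σ → env σ $v ≡ v × Static σ × (∀ {i} → i < v → i < n → field-of σ i ≡ degree i ∸ 1))
      (λ v → C * len v) n
      (λ _ (v≡ , _) _ → less⇓ (var⇓ v≡) vertices⇓)
      (λ { {v} {σ} _ (v≡ , s , fs) v< →
        let x = fromℕ< v<
            x≡ : toℕ x ≡ v
            x≡ = Fin.toℕ-fromℕ< v<
            u≡ : suc v ≡ label x
            u≡ = cong suc (sym x≡) in
        set₂ (suc⇓ v≡ v< n<2^w) (degreeMinus1⇓ {v = x} u≡) ▸ λ { g (refl , refl) →
        exchange-run {v = x} (quiet-static g refl s) u≡ refl
          (subst (λ l → indeg x ∸ 1 < 2 ^ l) (len-toℕ x) (<2^bitlen (indeg x ∸ 1)))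
        ▸ λ { {c} {σ₂} h (tch , val , _ , c≤) →
        weaken (set₁ (suc⇓ (trans (var≡ h $v refl) v≡) v< n<2^w))
          λ { i (refl , refl) → ≤-trans (≤-reflexive (+-identityʳ c)) (subst (λ v → c ≤ C * len v) x≡ c≤) , refl ,
            quiet-static i refl (static′ tch) ,
            (λ {j} j≤v j< → trans (quiet-field i refl j) (fields fs (quiet-field g refl) tch val x≡ j≤v j<)) } } } })
      {0} z≤n (refl , quiet-static f refl s₀ , λ ()))
      λ { _ (c≤ , _ , s , fs) → c≤ , s , λ i< → fs i< i< } }
    where
    quiet-field : ∀ {s σ σ′} → Frame s σ σ′ → quiet s ≡ true → ∀ i → field-of σ′ i ≡ field-of σ i
    quiet-field f h i = value-cong (len i) 0 λ k _ _ → quiet-cell f h digits (lin (suc k) i)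
    fields : ∀ {σ σ₁ σ₂ v} {x : Fin n} → (∀ {i} → i < v → i < n → field-of σ i ≡ degree i ∸ 1) →
      (∀ i → field-of σ₁ i ≡ field-of σ i) → Touched (toℕ x) 0 σ₁ σ₂ → field-of σ₂ (toℕ x) ≡ indeg x ∸ 1 →
      toℕ x ≡ v → ∀ {j} → j < suc v → j < n → field-of σ₂ j ≡ degree j ∸ 1
    fields {x = x} fs same₁ tch val refl {j} j≤v j< with j ≟ toℕ x
    ... | yes refl = trans val (cong (_∸ 1) (sym (degree-toℕ x)))
    ... | no  j≢   = trans (others-kept tch j< j≢) (trans (same₁ j) (fs (≤∧≢⇒< (≤-pred j≤v) j≢) j<))

  buildCost : ℕ
  buildCost = 2 ^ τ + (λ′ + (sumBelow (suc ∘ len) n + (λ′ + (W + (sumBelow (suc ∘ len) n +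
    (W * suc chunks + sumBelow (λ v → suc (C * len v)) n))))))

  build-run : ∀ {σ} → Context early σ → Run buildFields σ λ cost σ′ →
    cost ≤ buildCost × Static σ′ × (∀ {i} → i < n → field-of σ′ i ≡ degree i ∸ 1)
  build-run c₀ =
    buildTable-run c₀ ▸ λ { f (c₁ , v₁ , t₁) →
    clearPointers-run ((v₁ ,ᶜ keep-known f refl (knows-of c₀)) ,ᵇ t₁) ▸ λ { _ (c₂ , b₂ , p₂) →
    countLevels-run b₂ p₂ ▸ λ { _ (c₃ , b₃ , p₃) →
    prefixSums-run b₃ p₃ ▸ λ { _ (c₄ , b₄ , a₄ , p₄) →
    setBases-run b₄ a₄ ▸ λ { h (refl , l₅) →
    clearFlags-run (base-quiet h refl b₄) l₅ ▸ λ { {σ′ = σ₆} _ (c₆ , b₆ , l₆ , p₆ , z₆) →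
    let zero-cell : ∀ {y} → y / t < W → cell σ₆ flags y ≡ 0
        zero-cell {y} y< = trans (cong (bit (y % t)) (z₆ y<)) (cong (_%2^ 1) (0/n≡0 (2 ^ (y % t)) {{2^-nonZero (y % t)}}))
    in
    setFlags-run b₆ (flagged (knows-of l₆) (λ i< → subst (_< 2 ^ t) (sym (z₆ i<)) (m^n>0 2 t)) (λ ()) (λ ())
        (λ v< k≤ _ → zero-cell (cell-< (lin< v< k≤))) (λ _ y< → zero-cell y<))
      (λ {j} j< → trans (p₆ j<) (trans (quiet-arr h refl pointers j) (p₄ j<)))
    ▸ λ { {σ′ = σ₇} _ (c₇ , b₇ , flagged k₇ s₇ d₇ _ _ by₇) →
    fillRanks-run (arr σ₇ flags) s₇ (λ {v} {k} v< k≤ → d₇ v< v< k≤) by₇ (vm-of (context b₇) ,ᶜ k₇) (tabled b₇) (λ _ → refl)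
    ▸ λ { _ (c₈ , s₈) →
    weaken (fillFields-run s₈) λ { _ (c₉ , s₉ , f₉) →
      +-mono-≤ c₁ (+-mono-≤ c₂ (+-mono-≤ c₃ (+-mono-≤ c₄ (+-mono-≤ c₆ (+-mono-≤ c₇ (+-mono-≤ c₈ c₉)))))) , s₉ , f₉ } } } } } } } } }

-- Finite sums, edges and topological orders

sum-cong : ∀ {m} {f g : Fin m → ℕ} → (∀ i → f i ≡ g i) → sum f ≡ sum g
sum-cong {zero}  h = refl
sum-cong {suc m} h = cong₂ _+_ (h zero) (sum-cong (h ∘ suc))

sum-mono : ∀ {m} {f g : Fin m → ℕ} → (∀ i → f i ≤ g i) → sum f ≤ sum g
sum-mono {zero}  h = z≤n
sum-mono {suc m} h = +-mono-≤ (h zero) (sum-mono (h ∘ suc))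

sum-const : ∀ m c → sum {m} (λ _ → c) ≡ m * c
sum-const zero    c = refl
sum-const (suc m) c = cong (c +_) (sum-const m c)

sum-*ˡ : ∀ {m} c (f : Fin m → ℕ) → sum (λ i → c * f i) ≡ c * sum f
sum-*ˡ {zero}  c f = sym (*-zeroʳ c)
sum-*ˡ {suc m} c f = trans (cong (c * f zero +_) (sum-*ˡ c (f ∘ suc))) (sym (*-distribˡ-+ c (f zero) _))

term≤sum : ∀ {m} (f : Fin m → ℕ) i → f i ≤ sum f
term≤sum f zero    = m≤m+n _ _
term≤sum f (suc i) = ≤-trans (term≤sum (f ∘ suc) i) (m≤n+m _ _)

-- Changing the term at i changes the sum by the same amount.
sum-update : ∀ {m} {f g : Fin m → ℕ} i → (∀ j → j ≢ i → f j ≡ g j) → sum f + g i ≡ sum g + f i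
sum-update {suc m} {f} {g} zero h = trans (cong (λ s → f zero + s + g zero) (sum-cong λ j → h (suc j) λ ()))
  (swap (f zero) _ (g zero))
  where
  swap : ∀ a s b → a + s + b ≡ b + s + a
  swap = solve-∀
sum-update {suc m} {f} {g} (suc i) h = trans (cong (λ x → x + sum (f ∘ suc) + g (suc i)) (h zero λ ()))
  (trans (+-assoc (g zero) _ _) (trans (cong (g zero +_) (sum-update i λ j j≢ → h (suc j) (j≢ ∘ Fin.suc-injective)))
    (sym (+-assoc (g zero) _ _))))

sum≡⇒all-1 : ∀ {m} {f : Fin m → ℕ} → (∀ i → f i ≤ 1) → sum f ≡ m → ∀ i → f i ≡ 1
sum≡⇒all-1 {suc m} {f} h eq i with f zero in eq₀ | h zero
... | zero  | _ = ⊥-elim (1+n≰n (≤-trans (≤-reflexive (sym eq))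
                    (≤-trans (sum-mono (h ∘ suc)) (≤-reflexive (trans (sum-const m 1) (*-identityʳ m))))))
sum≡⇒all-1 {suc m} {f} h eq zero    | suc zero | _ = eq₀
sum≡⇒all-1 {suc m} {f} h eq (suc i) | suc zero | _ = sum≡⇒all-1 (h ∘ suc) (suc-injective eq) i
sum≡⇒all-1 {suc m} {f} h eq i       | suc (suc _) | s≤s ()

sum<⇒some-0 : ∀ {m} {f : Fin m → ℕ} → sum f < m → ∃[ i ] f i ≡ 0
sum<⇒some-0 {suc m} {f} lt with f zero in eq₀
... | zero  = zero , eq₀
... | suc a = let i , eq = sum<⇒some-0 {m} {f ∘ suc} (≤-trans (s≤s (m≤n+m _ a)) (≤-pred lt)) in suc i , eq

[_≡?_] : ∀ {m} → Fin m → Fin m → ℕ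
[ i ≡? j ] = if does (i Fin.≟ j) then 1 else 0

≡?-refl : ∀ {m} (i : Fin m) → [ i ≡? i ] ≡ 1
≡?-refl i with i Fin.≟ i
... | yes _ = refl
... | no  ≢ = ⊥-elim (≢ refl)

≡?-≢ : ∀ {m} {i j : Fin m} → i ≢ j → [ i ≡? j ] ≡ 0
≡?-≢ {i = i} {j} i≢j with i Fin.≟ j
... | yes i≡j = ⊥-elim (i≢j i≡j)
... | no  _   = refl

sum-≡? : ∀ {m} (i : Fin m) → sum [ i ≡?_] ≡ 1
sum-≡? {m} i = trans (sym (+-identityʳ _)) (trans (sum-update {g = λ _ → 0} i λ j j≢i → ≡?-≢ (j≢i ∘ sym))
  (cong₂ _+_ (trans (sum-const m 0) (*-zeroʳ m)) (≡?-refl i)))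

module Edges {n : ℕ} (G : Digraph n) where

  open Digraph G

  outNbr-toℕ : ∀ {u v} → u ≡ v → ∀ i j → outNbr u i ≡ outNbr v j → toℕ i ≡ toℕ j
  outNbr-toℕ refl i j eq = cong toℕ (outNbr-injective _ eq)

  inMate-outMate : ∀ u i → toℕ (inMate (outNbr u i) (outMate u i)) ≡ toℕ i
  inMate-outMate u i = outNbr-toℕ (outMate-correct u i) _ i (inMate-correct _ _)

  edge-head : ∀ {u v} j i → inNbr v j ≡ u → toℕ (inMate v j) ≡ toℕ i → v ≡ outNbr u i
  edge-head {v = v} j i refl eq =
    trans (sym (inMate-correct v j)) (cong (outNbr (inNbr v j)) (Fin.toℕ-injective eq))

  edge-index : ∀ {u} i j → inNbr (outNbr u i) j ≡ u → j ≡ outMate u i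
  edge-index {u} i j eq = inNbr-injective _ (trans eq (sym (outMate-correct u i)))

  -- Both sides are rewritten as sums over pairs of vertices. For a pair (u, v), injectivity leaves
  -- at most one position of u in the in-array of v, and `inMate` turns it into a position of v in
  -- the out-array of u.
  sum-indeg≤edgeCount : sum indeg ≤ edgeCount
  sum-indeg≤edgeCount = begin
    sum indeg                                                          ≡⟨ sum-cong (λ v → trans (sym (trans (sum-const (indeg v) 1) (*-identityʳ _))) (sum-cong λ j → sym (sum-≡? (inNbr v j)))) ⟩
    sum (λ v → sum (λ j → sum (λ u → [ inNbr v j ≡? u ])))             ≡⟨ sum-cong (λ v → ∑-comm (λ j u → [ inNbr v j ≡? u ])) ⟩
    sum (λ v → sum (λ u → sum (λ j → [ inNbr v j ≡? u ])))             ≤⟨ sum-mono (λ v → sum-mono λ u → adjacent u v) ⟩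
    sum (λ v → sum (λ u → sum (λ i → [ outNbr u i ≡? v ])))            ≡⟨ ∑-comm (λ v u → sum (λ i → [ outNbr u i ≡? v ])) ⟩
    sum (λ u → sum (λ v → sum (λ i → [ outNbr u i ≡? v ])))            ≡⟨ sum-cong (λ u → ∑-comm (λ v i → [ outNbr u i ≡? v ])) ⟩
    sum (λ u → sum (λ i → sum (λ v → [ outNbr u i ≡? v ])))            ≡⟨ sum-cong (λ u → trans (sum-cong λ i → sum-≡? (outNbr u i)) (trans (sum-const (outdeg u) 1) (*-identityʳ _))) ⟩
    edgeCount                                                          ∎
    where
    open ≤-Reasoning
    adjacent : ∀ u v → sum (λ j → [ inNbr v j ≡? u ]) ≤ sum (λ i → [ outNbr u i ≡? v ])
    adjacent u v with Fin.any? (λ j → inNbr v j Fin.≟ u)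
    ... | no  none = ≤-trans (≤-reflexive (trans (sum-cong λ j → ≡?-≢ λ eq → none (j , eq))
                       (trans (sum-const (indeg v) 0) (*-zeroʳ (indeg v))))) z≤n
    ... | yes (j , refl) = ≤-trans (≤-reflexive (trans (sym (+-identityʳ _))
      (trans (sum-update {g = λ _ → 0} j λ l l≢j → ≡?-≢ (l≢j ∘ inNbr-injective v))
        (cong₂ _+_ (trans (sum-const (indeg v) 0) (*-zeroʳ (indeg v))) (≡?-refl (inNbr v j))))))
      (≤-trans (≤-reflexive (sym (subst (λ x → [ x ≡? v ] ≡ 1) (sym (inMate-correct v j)) (≡?-refl v))))
        (term≤sum (λ i → [ outNbr (inNbr v j) i ≡? v ]) (inMate v j)))

  Edge-wellFounded : Acyclic → WellFounded (TransClosure Edge)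
  Edge-wellFounded acyclic = spo-wellFounded {_≈_ = _≡_} record
    { isEquivalence = isEquivalence
    ; irrefl        = λ { refl p → acyclic _ p }
    ; trans         = TransClosure._++_
    ; <-resp-≈      = (λ { refl p → p }) , λ { refl p → p } }

  -- Lists of vertices, most recent first, in which every vertex comes after
  -- its in-neighbours.
  data Sorted : List (Fin n) → Set where
    []  : Sorted []
    add : ∀ {vs} v → Sorted vs → v ∉ vs → (∀ j → inNbr v j ∈ vs) → Sorted (v ∷ vs)

  time : ∀ {vs : List (Fin n)} {v} → v ∈ vs → Fin (length vs)
  time {_ ∷ vs} (Any.here _)  = fromℕ (length vs)
  time {_ ∷ vs} (Any.there p) = inject₁ (time p)

  at-time : ∀ vs → Fin (length vs) → Fin n
  at-time (v ∷ vs) i with view i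
  ... | ‵fromℕ     = v
  ... | ‵inject₁ j = at-time vs j

  at-time-time : ∀ {vs v} (p : v ∈ vs) → at-time vs (time p) ≡ v
  at-time-time {_ ∷ vs} (Any.here refl) rewrite view-fromℕ (length vs) = refl
  at-time-time {_ ∷ vs} (Any.there p) rewrite view-inject₁ (time p) = at-time-time p

  at-time-∈ : ∀ vs i → at-time vs i ∈ vs
  at-time-∈ (v ∷ vs) i with view i
  ... | ‵fromℕ     = Any.here refl
  ... | ‵inject₁ j = Any.there (at-time-∈ vs j)

  time-at-time : ∀ {vs} → Sorted vs → ∀ i (p : at-time vs i ∈ vs) → time p ≡ i
  time-at-time (add v s v∉ _) i p with view i
  time-at-time (add v s v∉ _) _ (Any.here _)   | ‵fromℕ     = refl
  time-at-time (add v s v∉ _) _ (Any.there p)  | ‵fromℕ     = ⊥-elim (v∉ p)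
  time-at-time {v ∷ vs} (add v s v∉ _) _ (Any.here eq)  | ‵inject₁ j = ⊥-elim (v∉ (subst (_∈ vs) eq (at-time-∈ vs j)))
  time-at-time (add v s v∉ _) _ (Any.there p)  | ‵inject₁ j = cong inject₁ (time-at-time s j p)

  time-< : ∀ {vs v} → Sorted vs → ∀ j (p : inNbr v j ∈ vs) (p′ : v ∈ vs) → time p Fin.< time p′
  time-< (add {vs} v s v∉ ins) j (Any.here eq) (Any.here refl) = ⊥-elim (v∉ (subst (_∈ vs) eq (ins j)))
  time-< (add {vs} v s v∉ ins) j (Any.there p) (Any.here refl) =
    subst₂ _<_ (sym (Fin.toℕ-inject₁ (time p))) (sym (Fin.toℕ-fromℕ (length vs))) (Fin.toℕ<n (time p))
  -- The newest vertex cannot be an in-neighbour of an older one: all in-neighbours of that one were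
  -- listed when it was added.
  time-< (add {vs} v s v∉ ins) j (Any.here eq) (Any.there p′) = ⊥-elim (v∉ (subst (_∈ vs) eq (earlier s p′ j)))
    where
    earlier : ∀ {vs v} → Sorted vs → v ∈ vs → ∀ j → inNbr v j ∈ vs
    earlier (add v s _ ins) (Any.here refl) j = Any.there (ins j)
    earlier (add _ s _ _)   (Any.there p)   j = Any.there (earlier s p j)
  time-< (add v s v∉ ins) j (Any.there p) (Any.there p′) =
    subst₂ _<_ (sym (Fin.toℕ-inject₁ (time p))) (sym (Fin.toℕ-inject₁ (time p′))) (time-< s j p p′)

  trace : List (Fin n) → List ℕ
  trace []       = []
  trace (v ∷ vs) = trace vs ∷ʳ label v

  tabulate-∷ʳ : ∀ {m} (f : Fin (suc m) → ℕ) → List.tabulate f ≡ List.tabulate (f ∘ inject₁) ∷ʳ f (fromℕ m)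
  tabulate-∷ʳ {zero}  f = refl
  tabulate-∷ʳ {suc m} f = cong (f zero ∷_) (tabulate-∷ʳ (f ∘ suc))

  trace-tabulate : ∀ vs → trace vs ≡ List.tabulate (label ∘ at-time vs)
  trace-tabulate []       = refl
  trace-tabulate (v ∷ vs) = sym (trans (tabulate-∷ʳ (label ∘ at-time (v ∷ vs)))
    (cong₂ _∷ʳ_ (trans (List.tabulate-cong earlier) (sym (trace-tabulate vs))) latest))
    where
    latest : label (at-time (v ∷ vs) (fromℕ (length vs))) ≡ label v
    latest rewrite view-fromℕ (length vs) = refl
    earlier : ∀ i → label (at-time (v ∷ vs) (inject₁ i)) ≡ label (at-time vs i)
    earlier i rewrite view-inject₁ i = refl

  -- `time` and `at-time` are inverse bijections between the positions in the list and the vertices,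
  -- which forces the length to be n. The length is generalised in `resize` so that this equation
  -- can be matched on.
  sorted⇒order : ∀ {vs} → Sorted vs → (∀ v → v ∈ vs) →
                 ∃[ π ] trace vs ≡ List.tabulate (λ i → label (π ⟨$⟩ʳ i)) × IsTopologicalOrder π
  sorted⇒order {vs} s all = resize (↔⇒≡ π) π (trace-tabulate vs) λ {u} {v} → λ
    { (i , refl) → subst (λ x → time (all x) Fin.< time (all v)) (outMate-correct u i)
        (time-< s (outMate u i) (all _) (all v)) }
    where
    π : Permutation (length vs) n
    π = permutation (at-time vs) (λ v → time (all v)) (λ v → at-time-time (all v)) (λ i → time-at-time s i (all _))
    resize : ∀ {m} → m ≡ n → (π : Permutation m n) → trace vs ≡ List.tabulate (λ i → label (π ⟨$⟩ʳ i)) →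
             (∀ {u v} → Edge u v → π ⟨$⟩ˡ u Fin.< π ⟨$⟩ˡ v) →
             ∃[ π ] trace vs ≡ List.tabulate (λ i → label (π ⟨$⟩ʳ i)) × IsTopologicalOrder π
    resize refl π eq order = π , eq , order

-- The invariant of the search

data Status : Set where
  fresh active finished : Status

_[_↦ᶠ_] : ∀ {n} {X : Set} → (Fin n → X) → Fin n → X → Fin n → X
(f [ v ↦ᶠ a ]) u = if does (u Fin.≟ v) then a else f u

↦ᶠ-same : ∀ {n} {X : Set} (f : Fin n → X) v {a} → (f [ v ↦ᶠ a ]) v ≡ a
↦ᶠ-same f v with v Fin.≟ v
... | yes _   = refl
... | no  v≢v = ⊥-elim (v≢v refl)

↦ᶠ-other : ∀ {n} {X : Set} (f : Fin n → X) {v u a} → u ≢ v → (f [ v ↦ᶠ a ]) u ≡ f u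
↦ᶠ-other f {v} {u} u≢v with u Fin.≟ v
... | yes u≡v = ⊥-elim (u≢v u≡v)
... | no  _   = refl

sum-shift : ∀ {m} {f g : Fin m → ℕ} v {a b} → (∀ u → u ≢ v → f u ≡ g u) → f v + a ≡ g v + b →
            sum f + a ≡ sum g + b
sum-shift {f = f} {g} v {a} {b} h eq = +-cancelʳ-≡ (g v) _ _ (begin
  sum f + a + g v       ≡⟨ swap (sum f) a (g v) ⟩
  sum f + g v + a       ≡⟨ cong (_+ a) (sum-update v h) ⟩
  sum g + f v + a       ≡⟨ +-assoc (sum g) (f v) a ⟩
  sum g + (f v + a)     ≡⟨ cong (sum g +_) eq ⟩
  sum g + (g v + b)     ≡⟨ rearrange (sum g) (g v) b ⟩
  sum g + b + g v       ∎)
  where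
  open ≡-Reasoning
  swap : ∀ a b c → a + b + c ≡ a + c + b
  swap = solve-∀
  rearrange : ∀ a b c → a + (b + c) ≡ a + c + b
  rearrange = solve-∀

module Search {n : ℕ} (G : Digraph n) where

  open Digraph G
  open Edges G public

  -- prog v is the number of out-edges of v that have been examined.
  processed : (Fin n → ℕ) → (v : Fin n) → Fin (indeg v) → ℕ
  processed prog v j = bool→ℕ (toℕ (inMate v j) <ᵇ prog (inNbr v j))

  seen : (Fin n → ℕ) → Fin n → ℕ
  seen prog v = sum (processed prog v)

  -- The path from the current vertex to the root: φ v is the in-index of the
  -- edge over which v was reached, the last one examined at its tail.
  data Chain (φ prog : Fin n → ℕ) : List (Fin n) → Set where
    empty  : Chain φ prog []
    source : ∀ {v} → indeg v ≡ 0 → Chain φ prog (v ∷ [])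
    link   : ∀ {v vs} (j : Fin (indeg v)) → φ v ≡ toℕ j → prog (inNbr v j) ≡ suc (toℕ (inMate v j)) →
             Chain φ prog (inNbr v j ∷ vs) → Chain φ prog (v ∷ inNbr v j ∷ vs)

  data Unique : List (Fin n) → Set where
    []  : Unique []
    _∷_ : ∀ {v vs} → v ∉ vs → Unique vs → Unique (v ∷ vs)

  Chain-cong : ∀ {φ φ′ prog prog′ v vs} → (∀ {u} → u ∈ v ∷ vs → φ′ u ≡ φ u) → (∀ {u} → u ∈ vs → prog′ u ≡ prog u) →
               Chain φ prog (v ∷ vs) → Chain φ′ prog′ (v ∷ vs)
  Chain-cong h g (source d)     = source d
  Chain-cong h g (link j e f c) = link j (trans (h (Any.here refl)) e) (trans (g (Any.here refl)) f)
    (Chain-cong (h ∘ Any.there) (g ∘ Any.there) c)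

  -- `prog` is not stored as a whole. `$idx` holds it for the current vertex; it is 0 at fresh and
  -- `outdeg` at finished vertices; and further down the stack `link` recovers it from the mate of
  -- the edge to the next vertex of the path. The meaning of φ changes with the status: a counter by
  -- `count` at fresh vertices, a return edge by `chain` on the stack.
  record Core (φ prog : Fin n → ℕ) (status : Fin n → Status) (vs stack : List (Fin n)) : Set where
    field
      sorted   : Sorted vs
      done⇒    : ∀ {v} → v ∈ vs → status v ≢ fresh
      done⇐    : ∀ {v} → status v ≢ fresh → v ∈ vs
      prog≤    : ∀ v → prog v ≤ outdeg v
      prog-0   : ∀ {v} → status v ≡ fresh → prog v ≡ 0
      prog-end : ∀ {v} → status v ≡ finished → prog v ≡ outdeg v
      count    : ∀ {v} → status v ≡ fresh → 1 ≤ indeg v → suc (φ v) + seen prog v ≡ indeg v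
      all-seen : ∀ {v} → status v ≢ fresh → ∀ j → toℕ (inMate v j) < prog (inNbr v j)
      chain    : Chain φ prog stack
      unique   : Unique stack
      stack⇒   : ∀ {v} → v ∈ stack → status v ≡ active
      stack⇐   : ∀ {v} → status v ≡ active → v ∈ stack

  open Core public

  initial-core : Core (λ v → indeg v ∸ 1) (λ _ → 0) (λ _ → fresh) [] []
  initial-core = record
    { sorted = [] ; done⇒ = λ () ; done⇐ = λ ≢ → ⊥-elim (≢ refl) ; prog≤ = λ _ → z≤n
    ; prog-0 = λ _ → refl ; prog-end = λ ()
    ; count = λ {v} _ d≥1 → trans (cong (λ s → suc (indeg v ∸ 1) + s) (trans (sum-const (indeg v) 0) (*-zeroʳ (indeg v))))
        (trans (+-identityʳ _) (m+[n∸m]≡n d≥1))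
    ; all-seen = λ ≢ → ⊥-elim (≢ refl) ; chain = empty ; unique = [] ; stack⇒ = λ () ; stack⇐ = λ () }

  module Examine {φ prog status vs v stack} (c : Core φ prog status vs (v ∷ stack))
                 (i : Fin (outdeg v)) (at-i : prog v ≡ toℕ i) where

    u : Fin n
    u = outNbr v i

    j : Fin (indeg u)
    j = outMate v i

    prog′ : Fin n → ℕ
    prog′ = prog [ v ↦ᶠ suc (toℕ i) ]

    prog′-v : prog′ v ≡ suc (toℕ i)
    prog′-v = ↦ᶠ-same prog v

    prog≤prog′ : ∀ x → prog x ≤ prog′ x
    prog≤prog′ x with x Fin.≟ v
    ... | yes refl = ≤-trans (≤-reflexive at-i) (n≤1+n _)
    ... | no  _    = ≤-refl

    v-active : status v ≡ active
    v-active = stack⇒ c (Any.here refl)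

    -- If u had been started, `all-seen` would make the current edge an examined one, that is, put
    -- its index i below `prog v`; but `prog v` is i.
    u-fresh : status u ≡ fresh
    u-fresh with status u in eq
    ... | fresh    = refl
    ... | active   = ⊥-elim (absurd λ h → case trans (sym eq) h of λ ())
      where
      absurd : status u ≢ fresh → ⊥
      absurd s≢ = <-irrefl (trans (inMate-outMate v i) (trans (sym at-i) (cong prog (sym (outMate-correct v i))))) (all-seen c s≢ j)
    ... | finished = ⊥-elim (absurd λ h → case trans (sym eq) h of λ ())
      where
      absurd : status u ≢ fresh → ⊥
      absurd s≢ = <-irrefl (trans (inMate-outMate v i) (trans (sym at-i) (cong prog (sym (outMate-correct v i))))) (all-seen c s≢ j)

    u≢v : u ≢ v
    u≢v eq = case trans (sym u-fresh) (trans (cong status eq) v-active) of λ ()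

    u∉stack : ∀ {x} → x ∈ v ∷ stack → x ≢ u
    u∉stack x∈ refl = case trans (sym u-fresh) (stack⇒ c x∈) of λ ()

    d≥1 : 1 ≤ indeg u
    d≥1 = ≤-trans (s≤s z≤n) (Fin.toℕ<n j)

    processed-other : ∀ {x} l → (inNbr x l ≡ v → toℕ (inMate x l) ≢ toℕ i) → processed prog′ x l ≡ processed prog x l
    processed-other {x} l ≢ with inNbr x l Fin.≟ v
    ... | yes eq = cong bool→ℕ (trans (<ᵇ-suc-other (≢ eq)) (cong (toℕ (inMate x l) <ᵇ_) (sym (trans (cong prog eq) at-i))))
    ... | no  _  = refl

    seen-other : ∀ {x} → x ≢ u → seen prog′ x ≡ seen prog x
    seen-other x≢u = sum-cong λ l → processed-other l λ eq eq′ → x≢u (edge-head l i eq eq′)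

    -- The adjacency arrays are injective, so the current edge occupies exactly one position in the
    -- in-array of u, and only this summand changes.
    seen-u : seen prog′ u ≡ suc (seen prog u)
    seen-u = trans (sym (+-identityʳ _)) (trans (sum-shift {f = processed prog′ u} {processed prog u} j {0} {1}
        (λ l l≢j → processed-other l λ eq _ → l≢j (edge-index i l eq))
        (trans (+-identityʳ _) (trans after (cong (_+ 1) (sym before)))))
      (+-comm _ 1))
      where
      after : processed prog′ u j ≡ 1
      after = cong bool→ℕ (<ᵇ-< (≤-reflexive (trans (cong suc (inMate-outMate v i)) (sym (trans (cong prog′ (outMate-correct v i)) prog′-v)))))
      before : processed prog u j ≡ 0
      before = cong bool→ℕ (<ᵇ-≮ λ lt → <-irrefl (trans (inMate-outMate v i) (sym (trans (cong prog (outMate-correct v i)) at-i))) lt)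

    prog′≤ : ∀ x → prog′ x ≤ outdeg x
    prog′≤ x with x Fin.≟ v
    ... | yes refl = Fin.toℕ<n i
    ... | no  _    = prog≤ c x

    prog′-other : ∀ {x} → status x ≢ active → prog′ x ≡ prog x
    prog′-other ≢ = ↦ᶠ-other prog λ { refl → ≢ v-active }

    chain′ : ∀ {φ′} → (∀ x → x ≢ u → φ′ x ≡ φ x) → Chain φ′ prog′ (v ∷ stack)
    chain′ same = Chain-cong (λ x∈ → same _ (u∉stack x∈)) (λ x∈ → ↦ᶠ-other prog λ { refl → v∉ (unique c) x∈ }) (chain c)
      where
      v∉ : ∀ {v stack} → Unique (v ∷ stack) → v ∉ stack
      v∉ (v∉ ∷ _) = v∉

    miss : ∀ {φ′} → (∀ x → x ≢ u → φ′ x ≡ φ x) → φ u ≡ suc (φ′ u) → Core φ′ prog′ status vs (v ∷ stack)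
    miss {φ′} same dec = record
      { sorted = sorted c ; done⇒ = done⇒ c ; done⇐ = done⇐ c ; prog≤ = prog′≤
      ; prog-0 = λ eq → trans (prog′-other (λ eq′ → case trans (sym eq) eq′ of λ ())) (prog-0 c eq)
      ; prog-end = λ eq → trans (prog′-other (λ eq′ → case trans (sym eq) eq′ of λ ())) (prog-end c eq)
      ; count = count′ ; all-seen = λ s≢ l → ≤-trans (all-seen c s≢ l) (prog≤prog′ _)
      ; chain = chain′ same ; unique = unique c ; stack⇒ = stack⇒ c ; stack⇐ = stack⇐ c }
      where
      count′ : ∀ {x} → status x ≡ fresh → 1 ≤ indeg x → suc (φ′ x) + seen prog′ x ≡ indeg x
      count′ {x} eq d with x Fin.≟ u
      ... | yes refl = trans (cong (suc (φ′ u) +_) seen-u) (trans (+-suc (suc (φ′ u)) _)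
                         (trans (cong (λ y → suc (y + seen prog u)) (sym dec)) (count c u-fresh d≥1)))
      ... | no  x≢u  = trans (cong₂ (λ a b → suc a + b) (same x x≢u) (seen-other x≢u)) (count c eq d)

    -- By `count`, a counter 0 means that the current edge was the last unexamined one into u. Hence
    -- every in-neighbour has positive `prog`, is no longer fresh and has therefore been output, as
    -- `Sorted` requires before u may follow.
    hit : ∀ {φ′} → (∀ x → x ≢ u → φ′ x ≡ φ x) → φ u ≡ 0 → φ′ u ≡ toℕ j →
          Core φ′ prog′ (status [ u ↦ᶠ active ]) (u ∷ vs) (u ∷ v ∷ stack)
    hit {φ′} same z put = record
      { sorted = add u (sorted c) (λ u∈ → done⇒ c u∈ u-fresh) (λ l → done⇐ c (started l))
      ; done⇒ = λ { (Any.here refl) eq → case trans (sym (↦ᶠ-same status u)) eq of λ ()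
                  ; {x} (Any.there x∈) eq → done⇒ c x∈ (trans (sym (↦ᶠ-other status λ { refl → done⇒ c x∈ u-fresh })) eq) }
      ; done⇐ = done⇐′ ; prog≤ = prog′≤
      ; prog-0 = λ {x} eq → let x≢u , eq′ = stays (λ ()) eq in trans (prog′-other (λ e → case trans (sym eq′) e of λ ())) (prog-0 c eq′)
      ; prog-end = λ {x} eq → let x≢u , eq′ = stays (λ ()) eq in trans (prog′-other (λ e → case trans (sym eq′) e of λ ())) (prog-end c eq′)
      ; count = λ {x} eq d → let x≢u , eq′ = stays (λ ()) eq in
          trans (cong₂ (λ a b → suc a + b) (same x x≢u) (seen-other x≢u)) (count c eq′ d)
      ; all-seen = all-seen′
      ; chain = subst (λ w → Chain φ′ prog′ (u ∷ w ∷ stack)) (outMate-correct v i)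
          (link j put (trans (cong prog′ (outMate-correct v i)) (trans prog′-v (cong suc (sym (inMate-outMate v i)))))
            (subst (λ w → Chain φ′ prog′ (w ∷ stack)) (sym (outMate-correct v i)) (chain′ same)))
      ; unique = (λ u∈ → u∉stack u∈ refl) ∷ unique c
      ; stack⇒ = λ { (Any.here refl) → ↦ᶠ-same status u
                   ; (Any.there x∈) → trans (↦ᶠ-other status (u∉stack x∈)) (stack⇒ c x∈) }
      ; stack⇐ = stack⇐′ }
      where
      all-in : ∀ l → processed prog′ u l ≡ 1
      all-in = sum≡⇒all-1 (λ l → bool≤1 _) (trans seen-u (trans (cong (λ x → suc (x + seen prog u)) (sym z)) (count c u-fresh d≥1)))
        where
        bool≤1 : ∀ b → bool→ℕ b ≤ 1
        bool≤1 true  = ≤-refl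
        bool≤1 false = z≤n
      processed⇒< : ∀ {a b} → bool→ℕ (a <ᵇ b) ≡ 1 → a < b
      processed⇒< {a} {b} eq with a <ᵇ b in lt
      ... | true = <ᵇ⇒< a b (subst T (sym lt) tt)
      in-seen : ∀ l → toℕ (inMate u l) < prog′ (inNbr u l)
      in-seen l = processed⇒< (all-in l)
      started : ∀ l → status (inNbr u l) ≢ fresh
      started l eq = case ≤-trans (in-seen l) (≤-reflexive
        (trans (prog′-other (λ e → case trans (sym eq) e of λ ())) (prog-0 c eq))) of λ ()
      stays : ∀ {x s} → active ≢ s → (status [ u ↦ᶠ active ]) x ≡ s → x ≢ u × status x ≡ s
      stays {x} a≢ eq with x Fin.≟ u
      ... | yes refl = ⊥-elim (a≢ eq)
      ... | no  x≢u  = x≢u , eq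
      done⇐′ : ∀ {x} → (status [ u ↦ᶠ active ]) x ≢ fresh → x ∈ u ∷ vs
      done⇐′ {x} s≢ with x Fin.≟ u
      ... | yes refl = Any.here refl
      ... | no  _    = Any.there (done⇐ c s≢)
      stack⇐′ : ∀ {x} → (status [ u ↦ᶠ active ]) x ≡ active → x ∈ u ∷ v ∷ stack
      stack⇐′ {x} eq with x Fin.≟ u
      ... | yes refl = Any.here refl
      ... | no  _    = Any.there (stack⇐ c eq)
      all-seen′ : ∀ {x} → (status [ u ↦ᶠ active ]) x ≢ fresh → ∀ l → toℕ (inMate x l) < prog′ (inNbr x l)
      all-seen′ {x} s≢ l with x Fin.≟ u
      ... | yes refl = in-seen l
      ... | no  _    = ≤-trans (all-seen c s≢ l) (prog≤prog′ _)

  -- The field of v may become anything: φ matters only at fresh vertices and on the remaining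
  -- stack, and v is on neither side, since the stack has no repetitions.
  retreat : ∀ {φ φ′ prog status vs v stack} → Core φ prog status vs (v ∷ stack) → prog v ≡ outdeg v →
            (∀ x → x ≢ v → φ′ x ≡ φ x) → Core φ′ prog (status [ v ↦ᶠ finished ]) vs stack
  retreat {φ} {φ′} {prog} {status} {vs} {v} {stack} c end same = record
    { sorted = sorted c
    ; done⇒ = λ {x} x∈ eq → let x≢v , eq′ = stays (λ ()) eq in done⇒ c x∈ eq′
    ; done⇐ = done⇐′ ; prog≤ = prog≤ c
    ; prog-0 = λ eq → let _ , eq′ = stays (λ ()) eq in prog-0 c eq′
    ; prog-end = prog-end′
    ; count = λ {x} eq d → let x≢v , eq′ = stays (λ ()) eq in trans (cong (λ a → suc a + seen prog x) (same x x≢v)) (count c eq′ d)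
    ; all-seen = all-seen′
    ; chain = tail-chain (chain c) (unique c)
    ; unique = tail-unique (unique c)
    ; stack⇒ = λ x∈ → trans (↦ᶠ-other status (λ { refl → head∉ (unique c) x∈ })) (stack⇒ c (Any.there x∈))
    ; stack⇐ = λ eq → let x≢v , eq′ = stays (λ ()) eq in tail∈ x≢v (stack⇐ c eq′) }
    where
    v-active : status v ≡ active
    v-active = stack⇒ c (Any.here refl)
    stays : ∀ {x s} → finished ≢ s → (status [ v ↦ᶠ finished ]) x ≡ s → x ≢ v × status x ≡ s
    stays {x} f≢ eq with x Fin.≟ v
    ... | yes refl = ⊥-elim (f≢ eq)
    ... | no  x≢v  = x≢v , eq
    not-fresh : ∀ {x} → (status [ v ↦ᶠ finished ]) x ≢ fresh → status x ≢ fresh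
    not-fresh {x} ≢ eq with x Fin.≟ v
    ... | yes refl = case trans (sym v-active) eq of λ ()
    ... | no  _    = ≢ eq
    done⇐′ : ∀ {x} → (status [ v ↦ᶠ finished ]) x ≢ fresh → x ∈ vs
    done⇐′ ≢ = done⇐ c (not-fresh ≢)
    all-seen′ : ∀ {x} → (status [ v ↦ᶠ finished ]) x ≢ fresh → ∀ l → toℕ (inMate x l) < prog (inNbr x l)
    all-seen′ ≢ = all-seen c (not-fresh ≢)
    prog-end′ : ∀ {x} → (status [ v ↦ᶠ finished ]) x ≡ finished → prog x ≡ outdeg x
    prog-end′ {x} eq with x Fin.≟ v
    ... | yes refl = end
    ... | no  _    = prog-end c eq
    head∉ : ∀ {v stack} → Unique (v ∷ stack) → v ∉ stack
    head∉ (v∉ ∷ _) = v∉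
    tail-unique : ∀ {v stack} → Unique (v ∷ stack) → Unique stack
    tail-unique (_ ∷ un) = un
    tail∈ : ∀ {x} → x ≢ v → x ∈ v ∷ stack → x ∈ stack
    tail∈ x≢v (Any.here x≡v) = ⊥-elim (x≢v x≡v)
    tail∈ x≢v (Any.there x∈) = x∈
    tail-chain : ∀ {stack} → Chain φ prog (v ∷ stack) → Unique (v ∷ stack) → Chain φ′ prog stack
    tail-chain (source _)      _        = empty
    tail-chain (link j e f ch) (v∉ ∷ _) = Chain-cong (λ x∈ → same _ λ { refl → v∉ x∈ }) (λ _ → refl) ch

  start : ∀ {φ prog status vs v} → Core φ prog status vs [] → status v ≡ fresh → indeg v ≡ 0 →
          Core φ prog (status [ v ↦ᶠ active ]) (v ∷ vs) (v ∷ [])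
  start {φ} {prog} {status} {vs} {v} c v-fresh d≡0 = record
    { sorted = add v (sorted c) (λ v∈ → done⇒ c v∈ v-fresh) (λ l → ⊥-elim (no-in l))
    ; done⇒ = λ { (Any.here refl) eq → case trans (sym (↦ᶠ-same status v)) eq of λ ()
                ; (Any.there x∈) eq → let _ , eq′ = stays (λ ()) eq in done⇒ c x∈ eq′ }
    ; done⇐ = done⇐′ ; prog≤ = prog≤ c
    ; prog-0 = λ eq → let _ , eq′ = stays (λ ()) eq in prog-0 c eq′
    ; prog-end = λ eq → let _ , eq′ = stays (λ ()) eq in prog-end c eq′
    ; count = λ eq d → let _ , eq′ = stays (λ ()) eq in count c eq′ d
    ; all-seen = all-seen′
    ; chain = source d≡0 ; unique = (λ ()) ∷ []
    ; stack⇒ = λ { (Any.here refl) → ↦ᶠ-same status v }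
    ; stack⇐ = stack⇐′ }
    where
    no-in : Fin (indeg v) → ⊥
    no-in l = case subst Fin d≡0 l of λ ()
    stays : ∀ {x s} → active ≢ s → (status [ v ↦ᶠ active ]) x ≡ s → x ≢ v × status x ≡ s
    stays {x} a≢ eq with x Fin.≟ v
    ... | yes refl = ⊥-elim (a≢ eq)
    ... | no  x≢v  = x≢v , eq
    done⇐′ : ∀ {x} → (status [ v ↦ᶠ active ]) x ≢ fresh → x ∈ v ∷ vs
    done⇐′ {x} s≢ with x Fin.≟ v
    ... | yes refl = Any.here refl
    ... | no  _    = Any.there (done⇐ c s≢)
    all-seen′ : ∀ {x} → (status [ v ↦ᶠ active ]) x ≢ fresh → ∀ l → toℕ (inMate x l) < prog (inNbr x l)
    all-seen′ {x} s≢ l with x Fin.≟ v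
    ... | yes refl = ⊥-elim (no-in l)
    ... | no  _    = all-seen c s≢ l
    stack⇐′ : ∀ {x} → (status [ v ↦ᶠ active ]) x ≡ active → x ∈ v ∷ []
    stack⇐′ {x} eq with x Fin.≟ v
    ... | yes refl = Any.here refl
    ... | no  _    = case stack⇐ c eq of λ ()

  -- A fresh vertex that is no source has a fresh in-neighbour.
  complete : Acyclic → ∀ {φ prog status vs} → Core φ prog status vs [] →
             (∀ v → indeg v ≡ 0 → status v ≢ fresh) → ∀ v → v ∈ vs
  complete acyclic {φ} {prog} {status} c sources v = done⇐ c (never v (Edge-wellFounded acyclic v))
    where
    never : ∀ v → Acc (TransClosure Edge) v → status v ≢ fresh
    never v (WF.acc below) v-fresh with indeg v in d
    ... | zero    = sources v d v-fresh
    ... | suc d-1 =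
      -- By `count` some in-edge is unexamined. Its tail cannot be finished, as then all its
      -- out-edges would have been examined, nor active, as the stack is empty; so it is fresh and
      -- well-founded recursion applies.
      let l , unseen = sum<⇒some-0 {f = processed prog v} (subst (seen prog v <_) (count c v-fresh (subst (1 ≤_) (sym d) (s≤s z≤n)))
                         (s≤s (m≤n+m _ _)))
      in never (inNbr v l) (below (TransClosure.[ inMate v l , inMate-correct v l ])) (unfinished l unseen)
      where
      unfinished : ∀ l → processed prog v l ≡ 0 → status (inNbr v l) ≡ fresh
      unfinished l unseen with status (inNbr v l) in eq
      ... | fresh    = refl
      ... | active   = case stack⇐ c eq of λ ()
      ... | finished = case trans (sym (cong bool→ℕ (<ᵇ-< (subst (toℕ (inMate v l) <_) (sym (prog-end c eq)) (Fin.toℕ<n _))))) unseen of λ ()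

-- The search program and its amortised cost

mains : List Var
mains = $root ∷ $cur ∷ $idx ∷ $run ∷ $nbr ∷ []

isolated : Stmt → Bool
isolated s = untouched mains s ∧ not (emits s)

-- The two counter operations are parameters because the same search runs on bit fields and on whole
-- words. Only the variables in `mains` are guaranteed to survive them; therefore `$nbr` keeps the
-- neighbour and `$u` is set again before `xch`.
examine : Stmt → Stmt → Stmt
examine dec xch =
  ($nbr ≔ query₂ outNeighbour (! $cur) (! $idx) ⨾ $u ≔ ! $nbr) ⨾
  dec ⨾
  if ! $z
  then (($u ≔ ! $nbr ⨾ $j ≔ query₂ outMateOf (! $cur) (! $idx)) ⨾
        xch ⨾
        emit (! $nbr) ⨾
        ($cur ≔ ! $nbr ⨾ $idx ≔ lit 0))
  else′ ($idx ≔ ! $idx ⟪ add ⟫ lit 1)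

-- The exchange is used here to read the return edge. The 0 that it writes is a legal value because
-- the vertex is not a source.
backtrack : Stmt → Stmt
backtrack xch =
  if query₁ indegree (! $cur)
  then (($u ≔ ! $cur ⨾ $j ≔ lit 0) ⨾
        xch ⨾
        ($idx ≔ query₂ inMateOf (! $cur) (! $res) ⟪ add ⟫ lit 1 ⨾
         $cur ≔ query₂ inNeighbour (! $cur) (! $res)))
  else′ ($run ≔ lit 0)

traverse sortVertices : Stmt → Stmt → Stmt
traverse dec xch = while ! $run loop
  (if ! $idx ⟪ less ⟫ query₁ outdegree (! $cur) then examine dec xch else′ backtrack xch)
sortVertices dec xch =
  $root ≔ vertices ⨾
  while ! $root loop
    (($cur ≔ ! $root ⨾ $root ≔ ! $root ⟪ sub ⟫ lit 1) ⨾
     if query₁ indegree (! $cur) then skip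
     else′ (emit (! $cur) ⨾ ($idx ≔ lit 0 ⨾ $run ≔ lit 1) ⨾ traverse dec xch))

module Stores (𝕀 : Input) where

  open Input 𝕀
  open Digraph G
  open Search G
  open Semantics 𝕀
  open Hoare 𝕀

  -- A decrement that finds 0 makes its vertex active, so it happens at most once per vertex and may
  -- cost as much as a whole walk. Any other decrement costs one `unit`, amortised by `credit`.
  data Outcome (unit : ℕ) (credit : Fin n → ℕ → ℕ) (φ φ′ : Fin n → ℕ) (v : Fin n) (cost z : ℕ) : Set where
    was-0   : φ v ≡ 0 → z ≡ 1 → cost ≤ unit * suc (indeg v) → Outcome unit credit φ φ′ v cost z
    was-suc : φ v ≡ suc (φ′ v) → z ≡ 0 → cost + credit v (φ′ v) ≤ credit v (φ v) + unit →
              Outcome unit credit φ φ′ v cost z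

  -- A representation of one number below indeg v for every vertex v with
  -- indeg v > 0.  A decrement of 0 leaves the number undefined.
  record Store : Set₁ where
    field
      decrementˢ exchangeˢ : Stmt
      Rep        : (Fin n → ℕ) → State → Set
      credit     : Fin n → ℕ → ℕ
      unit       : ℕ
      credit≤    : ∀ v x → credit v x ≤ unit * suc (indeg v)
      Rep-frame  : ∀ {s σ σ′ φ} → Frame s σ σ′ → harmless late s ≡ true → Rep φ σ → Rep φ σ′
      decrement-isolated : isolated decrementˢ ≡ true
      exchange-isolated  : isolated exchangeˢ ≡ true

    field
      decrement-runˢ : ∀ {σ φ v} → Rep φ σ → env σ $u ≡ label v → Run decrementˢ σ λ cost σ′ →
        ∃[ φ′ ] Rep φ′ σ′ × (∀ x → x ≢ v → φ′ x ≡ φ x) × Outcome unit credit φ φ′ v cost (env σ′ $z)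
      exchange-runˢ : ∀ {σ φ v J} → Rep φ σ → env σ $u ≡ label v → env σ $j ≡ J → J < indeg v →
        Run exchangeˢ σ λ cost σ′ → ∃[ φ′ ] Rep φ′ σ′ × (∀ x → x ≢ v → φ′ x ≡ φ x) × φ′ v ≡ J ×
          env σ′ $res ≡ φ v × cost ≤ unit * suc (indeg v)

  module Sorting (S : Store) where

    open Store S

    main≡ : ∀ {s σ σ′} → isolated s ≡ true → Frame s σ σ′ → ∀ x → among mains x ≡ true → env σ′ x ≡ env σ x
    main≡ {s} h f x x∈ = var≡ f x (untouched⇒ mains s (∧-left h) x x∈)

    emitted≡ : ∀ {s σ σ′} → isolated s ≡ true → Frame s σ σ′ → emitted σ′ ≡ emitted σ
    emitted≡ {s} h f = out≡ f (not-true (∧-right {untouched mains s} h))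
      where
      not-true : ∀ {b} → not b ≡ true → b ≡ false
      not-true {false} _ = refl

    -- Every out-edge still to be examined, every vertex still to be emitted
    -- and every vertex still to be left pays in advance.
    fee : Fin n → ℕ
    fee v = suc (unit * suc (indeg v))

    -- The three fees of a fresh vertex are for the decrement that finds 0, for the exchange that
    -- stores the return edge, and for the step that leaves the vertex; an active vertex has kept
    -- the last one.
    stake : Status → Fin n → ℕ → ℕ
    stake fresh    v x = credit v x + (fee v + fee v + fee v)
    stake active   v x = fee v
    stake finished v x = 0

    pot : (φ prog : Fin n → ℕ) → (Fin n → Status) → Fin n → ℕ
    pot φ prog status v = suc unit * (outdeg v ∸ prog v) + stake (status v) v (φ v)

    potential : (φ prog : Fin n → ℕ) → (Fin n → Status) → ℕ
    potential φ prog status = sum (pot φ prog status)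

    pot-cong : ∀ {φ φ′ prog prog′ status status′ v} → φ′ v ≡ φ v → prog′ v ≡ prog v → status′ v ≡ status v →
               pot φ′ prog′ status′ v ≡ pot φ prog status v
    pot-cong {v = v} a b c rewrite a | b | c = refl

    restake : ∀ {φ φ′ prog status status′} v {a b} →
      (∀ x → x ≢ v → φ′ x ≡ φ x) → (∀ x → x ≢ v → status′ x ≡ status x) →
      stake (status′ v) v (φ′ v) + a ≡ stake (status v) v (φ v) + b →
      potential φ′ prog status′ + a ≡ potential φ prog status + b
    restake {φ} {φ′} {prog} {status} {status′} v {a} {b} h g eq =
      sum-shift {f = pot φ′ prog status′} {pot φ prog status} v
        (λ x x≢v → pot-cong {φ} {φ′} {prog} {prog} {status} {status′} (h x x≢v) refl (g x x≢v))
        (trans (+-assoc edges _ a) (trans (cong (edges +_) eq) (sym (+-assoc edges _ b))))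
      where
      edges = suc unit * (outdeg v ∸ prog v)

    advance-prog : ∀ {φ prog status} v (i : Fin (outdeg v)) → prog v ≡ toℕ i →
      potential φ (prog [ v ↦ᶠ suc (toℕ i) ]) status + suc unit ≡ potential φ prog status
    advance-prog {φ} {prog} {status} v i at-i = trans (sum-shift {f = pot φ prog′ status} {pot φ prog status} v {suc unit} {0}
        (λ x x≢v → pot-cong {φ} {φ} {prog} {prog′} {status} {status} refl (↦ᶠ-other prog x≢v) refl)
        (trans (cong (λ p → suc unit * (outdeg v ∸ p) + st + suc unit) (↦ᶠ-same prog v))
          (trans (one-less (outdeg v ∸ suc (toℕ i)) st) (cong (λ d → suc unit * d + st + 0) (trans (sym (+-∸-assoc 1 (Fin.toℕ<n i))) (cong (outdeg v ∸_) (sym at-i)))))))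
      (+-identityʳ _)
      where
      prog′ = prog [ v ↦ᶠ suc (toℕ i) ]
      st = stake (status v) v (φ v)
      one-less : ∀ d s → suc unit * d + s + suc unit ≡ suc unit * suc d + s + 0
      one-less = lemma unit
        where
        lemma : ∀ u d s → suc u * d + s + suc u ≡ suc u * suc d + s + 0
        lemma = solve-∀

    Position : List (Fin n) → (Fin n → ℕ) → State → Set
    Position []      prog σ = env σ $run ≡ 0
    Position (v ∷ _) prog σ = env σ $run ≡ 1 × env σ $cur ≡ label v × env σ $idx ≡ prog v

    -- The sources with a label above roots have been started.
    Sources : ℕ → (Fin n → Status) → Set
    Sources roots status = ∀ x → indeg x ≡ 0 →
      (roots ≤ toℕ x → status x ≢ fresh) × (toℕ x < roots → status x ≡ fresh)

    sources-step : ∀ {roots status v s} → Sources roots status → s ≢ fresh → (indeg v ≡ 0 → status v ≢ fresh) →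
                   Sources roots (status [ v ↦ᶠ s ])
    sources-step {v = v} h s≢ v≢ x d with x Fin.≟ v
    ... | yes refl = (λ _ → s≢) , λ x< → ⊥-elim (v≢ d (proj₂ (h x d) x<))
    ... | no  _    = h x d

    record Live (roots : ℕ) (p : ℕ) (σ : State) : Set where
      constructor live
      field
        {φ prog}   : Fin n → ℕ
        {status}   : Fin n → Status
        {vs stack} : List (Fin n)
        core       : Core φ prog status vs stack
        rep        : Rep φ σ
        out        : emitted σ ≡ trace vs
        pot≡       : p ≡ potential φ prog status
        root≡      : env σ $root ≡ roots
        sources    : Sources roots status
        position   : Position stack prog σ

    examine-run : ∀ {roots p σ φ prog status vs v stack} (c : Core φ prog status vs (v ∷ stack)) →
      Rep φ σ → emitted σ ≡ trace vs → p ≡ potential φ prog status →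
      env σ $root ≡ roots → Sources roots status → Position (v ∷ stack) prog σ → prog v < outdeg v →
      Run (examine decrementˢ exchangeˢ) σ λ cost σ′ → ∃[ p′ ] Live roots p′ σ′ × suc (cost + p′) ≤ p
    examine-run {roots} {p} {σ} {φ} {prog} {status} {vs} {v} {stack} c rep out pot≡ root≡ sources (run≡ , cur≡ , idx≡) prog< =
      set₂ (outNbr⇓ {v = v} {j = i} (var⇓ cur≡) (var⇓ (trans idx≡ at-i))) (var⇓ refl) ▸ λ { f (refl , refl) →
      decrement-runˢ {v = u} (Rep-frame f refl rep) refl ▸ λ { {c₁} {σ₁} g (φ₁ , rep₁ , same₁ , dec) →
      let m : ∀ x → among mains x ≡ true → env σ₁ x ≡ _
          m = main≡ decrement-isolated g
          out₁ : emitted σ₁ ≡ trace vs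
          out₁ = trans (emitted≡ decrement-isolated g) (trans (out≡ f refl) out)
      in decide g rep₁ same₁ dec (trans (m $root refl) root≡) (trans (m $run refl) run≡) (trans (m $cur refl) cur≡)
           (trans (m $idx refl) (trans idx≡ at-i)) (m $nbr refl) out₁ } }
      where
      i : Fin (outdeg v)
      i = fromℕ< prog<
      at-i : prog v ≡ toℕ i
      at-i = sym (Fin.toℕ-fromℕ< prog<)
      open Examine c i at-i
      1<2^w : 1 < 2 ^ w
      1<2^w = ≤-<-trans 0<w (n<2^n w)
      idx< : suc (toℕ i) < 2 ^ w
      idx< = ≤-<-trans (≤-trans (Fin.toℕ<n i) (Fin.injective⇒≤ (outNbr-injective v))) n<2^w
      Goal : ℕ → State → Set
      Goal cost σ′ = ∃[ p′ ] Live roots p′ σ′ × suc (cost + p′) ≤ p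
      decide : ∀ {c₁ σ₀ σ₁ φ₁} → Frame decrementˢ σ₀ σ₁ → Rep φ₁ σ₁ → (∀ x → x ≢ u → φ₁ x ≡ φ x) →
        Outcome unit credit φ φ₁ u c₁ (env σ₁ $z) → env σ₁ $root ≡ roots → env σ₁ $run ≡ 1 → env σ₁ $cur ≡ label v → env σ₁ $idx ≡ toℕ i →
        env σ₁ $nbr ≡ label u → emitted σ₁ ≡ trace vs →
        Run (if ! $z then (($u ≔ ! $nbr ⨾ $j ≔ query₂ outMateOf (! $cur) (! $idx)) ⨾ exchangeˢ ⨾ emit (! $nbr) ⨾ ($cur ≔ ! $nbr ⨾ $idx ≔ lit 0))
             else′ ($idx ≔ ! $idx ⟪ add ⟫ lit 1)) σ₁ (λ t → Goal (c₁ + t))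
      decide {c₁} {σ₁ = σ₁} {φ₁} g rep₁ same₁ (was-suc φu z≡ cost≤) root₁ run₁ cur₁ idx₁ nbr₁ out₁ =
        branch (var⇓ z≡) (λ ≢ → ⊥-elim (≢ refl)) λ _ →
        weaken (set₁ (value≡ (+-comm (toℕ i) 1) (add⇓ (var⇓ idx₁) (lit⇓ 1<2^w) (subst (_< 2 ^ w) (+-comm 1 (toℕ i)) idx<))))
          λ { h (refl , refl) → _ , live (miss same₁ φu) (Rep-frame h refl rep₁) out₁ refl root₁ sources
                (run₁ , cur₁ , sym prog′-v) ,
              missed }
        where
        mid = potential φ prog′ status
        missed : suc (c₁ + 0 + potential φ₁ prog′ status) ≤ p
        -- The payment `suc unit` of the edge covers the loop iteration and the amortised cost of
        -- the decrement.
        missed = subst (suc (c₁ + 0 + potential φ₁ prog′ status) ≤_) (trans (advance-prog {φ} {prog} {status} v i at-i) (sym pot≡))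
          (certify 0 (+-mono-≤ cost≤ (≤-reflexive (restake {φ} {φ₁} {prog′} {status} {status} u {credit u (φ u)} {credit u (φ₁ u)}
              same₁ (λ _ _ → refl) staked)))
            (account c₁ (potential φ₁ prog′ status) (credit u (φ₁ u)) (credit u (φ u)) unit mid))
          where
          staked : stake (status u) u (φ₁ u) + credit u (φ u) ≡ stake (status u) u (φ u) + credit u (φ₁ u)
          staked rewrite u-fresh = shuffle (credit u (φ₁ u)) (fee u + fee u + fee u) (credit u (φ u))
            where
            shuffle : ∀ a f b → a + f + b ≡ b + f + a
            shuffle = solve-∀
          account : ∀ c P a b U m → m + suc U + (c + a + (P + b)) ≡ suc (c + 0 + P) + (b + U + (m + a)) + 0
          account = solve-∀
      decide {c₁} {σ₁ = σ₁} {φ₁} g rep₁ same₁ (was-0 φu z≡ cost≤) root₁ run₁ cur₁ idx₁ nbr₁ out₁ =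
        branch (var⇓ z≡) (λ _ →
          set₂ (var⇓ nbr₁) (outMate⇓ {v = v} {j = i} (var⇓ cur₁) (var⇓ idx₁)) ▸ λ { h (refl , refl) →
          exchange-runˢ {v = u} {J = toℕ j} (Rep-frame h refl rep₁) refl refl (Fin.toℕ<n j) ▸
          λ { {c₂} {σ₂} k (φ₂ , rep₂ , same₂ , put , _ , cost₂) →
          let m : ∀ x → among mains x ≡ true → env σ₂ x ≡ _
              m = main≡ exchange-isolated k
              nbr₂ : env σ₂ $nbr ≡ label u
              nbr₂ = trans (m $nbr refl) nbr₁
              same : ∀ x → x ≢ u → φ₂ x ≡ φ x
              same x x≢u = trans (same₂ x x≢u) (same₁ x x≢u)
          in
          print (var⇓ nbr₂) ▸ λ { l (refl , refl) →
          weaken (set₂ (var⇓ nbr₂) (lit⇓ (m^n>0 2 w))) λ { r (refl , refl) →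
            _ , live (hit same φu put) (Rep-frame r refl (Rep-frame l refl rep₂))
                  (cong (_∷ʳ label u) (trans (emitted≡ exchange-isolated k) (trans (out≡ h refl) out₁))) refl
                  (trans (m $root refl) root₁)
                  (sources-step sources (λ ()) (λ d≡0 → ⊥-elim (1+n≰n (subst (1 ≤_) d≡0 d≥1))))
                  (trans (m $run refl) run₁ , refl , sym (trans (prog′-other λ eq → case trans (sym u-fresh) eq of λ ()) (prog-0 c u-fresh))) ,
            hits cost₂ same } } } })
          λ ()
        where
        mid = potential φ prog′ status
        hits : ∀ {c₂ φ₂} → c₂ ≤ unit * suc (indeg u) → (∀ x → x ≢ u → φ₂ x ≡ φ x) →
          suc (c₁ + (c₂ + 0) + potential φ₂ prog′ (status [ u ↦ᶠ active ])) ≤ p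
        hits {c₂} {φ₂} cost₂ same = subst (suc (c₁ + (c₂ + 0) + potential φ₂ prog′ (status [ u ↦ᶠ active ])) ≤_)
          (trans (advance-prog {φ} {prog} {status} v i at-i) (sym pot≡))
          -- The slack is what the payments leave over: the old credit of u, the 1 in each of the
          -- two fees spent, and the `unit` of the edge.
          (certify (credit u (φ u) + 2 + unit) (+-mono-≤ (+-mono-≤ cost≤ cost₂)
              (≤-reflexive (restake {φ} {φ₂} {prog′} {status} {status [ u ↦ᶠ active ]} u {credit u (φ u) + (fee u + fee u)} {0}
                same (λ x → ↦ᶠ-other status) staked)))
            (account c₁ c₂ (potential φ₂ prog′ (status [ u ↦ᶠ active ])) (credit u (φ u)) unit (unit * suc (indeg u)) mid))
          where
          staked : stake ((status [ u ↦ᶠ active ]) u) u (φ₂ u) + (credit u (φ u) + (fee u + fee u)) ≡ stake (status u) u (φ u) + 0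
          staked rewrite ↦ᶠ-same status u {active} | u-fresh = shuffle (fee u) (credit u (φ u))
            where
            shuffle : ∀ f b → f + (b + (f + f)) ≡ b + (f + f + f) + 0
            shuffle = solve-∀
          account : ∀ c₁ c₂ P b U X m → m + suc U + (c₁ + c₂ + (P + (b + (suc X + suc X)))) ≡
                    suc (c₁ + (c₂ + 0) + P) + (X + X + (m + 0)) + (b + 2 + U)
          account = solve-∀

    backtrack-run : ∀ {roots p σ φ prog status vs v stack} (c : Core φ prog status vs (v ∷ stack)) →
      Rep φ σ → emitted σ ≡ trace vs → p ≡ potential φ prog status →
      env σ $root ≡ roots → Sources roots status → Position (v ∷ stack) prog σ → prog v ≡ outdeg v →
      Run (backtrack exchangeˢ) σ λ cost σ′ → ∃[ p′ ] Live roots p′ σ′ × suc (cost + p′) ≤ p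
    backtrack-run {roots} {p} {σ} {φ} {prog} {status} {vs} {v} {stack} c rep out pot≡ root≡ sources (run≡ , cur≡ , idx≡) examined =
      branch (indeg⇓ (var⇓ cur≡)) (non-source c (chain c)) (λ d≡0 → at-source d≡0 c (chain c))
      where
      Goal : ℕ → State → Set
      Goal cost σ′ = ∃[ p′ ] Live roots p′ σ′ × suc (cost + p′) ≤ p
      v-active : status v ≡ active
      v-active = stack⇒ c (Any.here refl)
      sources′ : Sources roots (status [ v ↦ᶠ finished ])
      sources′ = sources-step sources (λ ()) λ _ eq → case trans (sym v-active) eq of λ ()
      paid : ∀ {φ′ cost} → (∀ x → x ≢ v → φ′ x ≡ φ x) → cost ≤ unit * suc (indeg v) →
             suc (cost + potential φ′ prog (status [ v ↦ᶠ finished ])) ≤ p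
      paid {φ′} {cost} same cost≤ = subst (suc (cost + potential φ′ prog (status [ v ↦ᶠ finished ])) ≤_) (sym pot≡)
        (certify 0 (+-mono-≤ cost≤ (≤-reflexive (restake {φ} {φ′} {prog} {status} {status [ v ↦ᶠ finished ]} v {fee v} {0}
            same (λ x → ↦ᶠ-other status) staked)))
          (account cost (potential φ′ prog (status [ v ↦ᶠ finished ])) (unit * suc (indeg v)) (potential φ prog status)))
        where
        staked : stake ((status [ v ↦ᶠ finished ]) v) v (φ′ v) + fee v ≡ stake (status v) v (φ v) + 0
        staked rewrite ↦ᶠ-same status v {finished} | v-active = sym (+-identityʳ (fee v))
        account : ∀ c P X m → m + (c + (P + suc X)) ≡ suc (c + P) + (X + (m + 0)) + 0
        account = solve-∀
      at-source : ∀ {stack} → indeg v ≡ 0 → Core φ prog status vs (v ∷ stack) → Chain φ prog (v ∷ stack) →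
                  Run ($run ≔ lit 0) σ Goal
      at-source d≡0 c (source _)     = weaken (set₁ (lit⇓ (m^n>0 2 w))) λ { f (refl , refl) →
        _ , live (retreat c examined (λ _ _ → refl)) (Rep-frame f refl rep) out refl root≡ sources′ refl ,
        paid (λ _ _ → refl) z≤n }
      at-source d≡0 c (link j _ _ _) = case subst Fin d≡0 j of λ ()
      non-source : ∀ {stack} → Core φ prog status vs (v ∷ stack) → Chain φ prog (v ∷ stack) → indeg v ≢ 0 →
        Run (($u ≔ ! $cur ⨾ $j ≔ lit 0) ⨾ exchangeˢ ⨾
             ($idx ≔ query₂ inMateOf (! $cur) (! $res) ⟪ add ⟫ lit 1 ⨾ $cur ≔ query₂ inNeighbour (! $cur) (! $res))) σ Goal
      non-source c (source d≡0) d≢0 = ⊥-elim (d≢0 d≡0)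
      non-source c (link j φ≡ prog≡ _) d≢0 =
        set₂ (var⇓ cur≡) (lit⇓ (m^n>0 2 w)) ▸ λ { f (refl , refl) →
        exchange-runˢ {v = v} (Rep-frame f refl rep) refl refl (n≢0⇒n>0 d≢0) ▸
        λ { {c₁} {σ₁} g (φ₁ , rep₁ , same , _ , res≡ , cost≤) →
        let m : ∀ x → among mains x ≡ true → env σ₁ x ≡ _
            m = main≡ exchange-isolated g
            cur₁ = trans (m $cur refl) cur≡
            res₁ = trans res≡ φ≡
        in
        weaken (set₂ (value≡ (+-comm _ 1) (add⇓ (inMate⇓ {v = v} {j = j} (var⇓ cur₁) (var⇓ res₁)) (lit⇓ (≤-<-trans 0<w (n<2^n w)))
                  (≤-<-trans (≤-trans (≤-reflexive (+-comm _ 1)) (≤-trans (Fin.toℕ<n (inMate v j)) (Fin.injective⇒≤ (outNbr-injective (inNbr v j))))) n<2^w)))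
                (inNbr⇓ {v = v} {j = j} (var⇓ cur₁) (var⇓ res₁)))
          λ { h (refl , refl) →
            _ , live (retreat c examined same) (Rep-frame h refl rep₁)
                  (trans (emitted≡ exchange-isolated g) (trans (out≡ f refl) out)) refl
                  (trans (m $root refl) root≡) sources′
                  (trans (m $run refl) run≡ , refl , sym prog≡) ,
            paid same (≤-trans (≤-reflexive (+-identityʳ c₁)) cost≤) } } }

    traverse-run : ∀ {roots p σ} → Live roots p σ → Run (traverse decrementˢ exchangeˢ) σ λ cost σ′ →
      ∃[ p′ ] Live roots p′ σ′ × env σ′ $run ≡ 0 × cost + p′ ≤ p
    traverse-run {roots} l = weaken (amortised (Live roots) (λ _ → body) l)
      λ { _ (p′ , l′ , var⇓ run≡ , cost≤) → p′ , l′ , run≡ , cost≤ }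
      where
      body : ∀ {p σ} → Live roots p σ → ∃[ v ] env σ ⊢ ! $run ⇓ v ×
        (v ≢ 0 → Run (if ! $idx ⟪ less ⟫ query₁ outdegree (! $cur) then examine decrementˢ exchangeˢ else′ backtrack exchangeˢ) σ
          λ cost σ′ → ∃[ p′ ] Live roots p′ σ′ × suc (cost + p′) ≤ p)
      body (live {stack = []} _ _ _ _ _ _ run≡) = 0 , var⇓ run≡ , λ ≢ → ⊥-elim (≢ refl)
      body (live {prog = prog} {stack = v ∷ _} c rep out pot≡ root≡ sources pos@(run≡ , cur≡ , idx≡)) =
        1 , var⇓ run≡ , λ _ → branch (less⇓ (var⇓ idx≡) (outdeg⇓ {v = v} (var⇓ cur≡)))
          (λ ≢ → examine-run c rep out pot≡ root≡ sources pos (is-less ≢))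
          (λ ≡0 → backtrack-run c rep out pot≡ root≡ sources pos (≤-antisym (prog≤ c v) (≮⇒≥ λ lt → not-less lt ≡0)))
        where
        is-less : ∀ {a b} → bool→ℕ (a <ᵇ b) ≢ 0 → a < b
        is-less {a} {b} ≢ with a <ᵇ b in lt
        ... | true  = <ᵇ⇒< a b (subst T (sym lt) tt)
        ... | false = ⊥-elim (≢ refl)
        not-less : ∀ {a b} → a < b → bool→ℕ (a <ᵇ b) ≢ 0
        not-less lt rewrite <ᵇ-< lt = λ ()

    record Idle (roots : ℕ) (p : ℕ) (σ : State) : Set where
      constructor idle
      field
        {φ prog} : Fin n → ℕ
        {status} : Fin n → Status
        {vs}     : List (Fin n)
        core     : Core φ prog status vs []
        rep      : Rep φ σ
        out      : emitted σ ≡ trace vs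
        root≡    : env σ $root ≡ roots
        sources  : Sources roots status
        -- The summand `roots` pays for the remaining iterations of the loop over all labels.
        pot≡     : p ≡ roots + potential φ prog status

    sort-run : Acyclic → ∀ {σ} → emitted σ ≡ [] → Rep (λ v → indeg v ∸ 1) σ →
      Run (sortVertices decrementˢ exchangeˢ) σ λ cost σ′ →
        cost ≤ n + potential (λ v → indeg v ∸ 1) (λ _ → 0) (λ _ → fresh) ×
        ∃[ vs ] emitted σ′ ≡ trace vs × Sorted vs × (∀ v → v ∈ vs)
    sort-run acyclic {σ} out rep =
      set₁ vertices⇓ ▸ λ { f (refl , refl) →
      weaken (amortised (λ p σ → ∃[ r ] Idle r p σ × r ≤ n) (λ { _ (r , i , r≤) → body r i r≤ })
        (n , idle initial-core (Rep-frame f refl rep) out refl (λ x _ → (λ n≤x → ⊥-elim (<⇒≱ (Fin.toℕ<n x) n≤x)) , λ _ → refl) refl , ≤-refl))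
        λ { {cost} _ (p′ , (r , idle {vs = vs} c rep out root≡ src _ , _) , var⇓ root≡0 , cost≤) →
          ≤-trans (m≤m+n cost p′) cost≤ , vs , out , sorted c ,
          complete acyclic c λ v d → proj₁ (src v d) (≤-trans (≤-reflexive (trans (sym root≡) root≡0)) z≤n) } }
      where
      body : ∀ {p σ} r → Idle r p σ → r ≤ n → ∃[ v ] env σ ⊢ ! $root ⇓ v ×
        (v ≢ 0 → Run (($cur ≔ ! $root ⨾ $root ≔ ! $root ⟪ sub ⟫ lit 1) ⨾
             if query₁ indegree (! $cur) then skip
             else′ (emit (! $cur) ⨾ ($idx ≔ lit 0 ⨾ $run ≔ lit 1) ⨾ traverse decrementˢ exchangeˢ)) σ
          λ cost σ′ → ∃[ p′ ] (∃[ r′ ] Idle r′ p′ σ′ × r′ ≤ n) × suc (cost + p′) ≤ p)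
      body zero (idle _ _ _ root≡ _ _) _ = 0 , var⇓ root≡ , λ ≢ → ⊥-elim (≢ refl)
      body {p} {σ} (suc r) (idle {φ} {prog} {status} {vs} c rep out root≡ src pot≡) r< = suc r , var⇓ root≡ , λ _ →
        set₂ (var⇓ (trans root≡ x-label)) (sub⇓ (var⇓ root≡) (lit⇓ (≤-<-trans 0<w (n<2^n w))) (s≤s z≤n)) ▸ λ { f (refl , refl) →
        branch (indeg⇓ {v = x} (var⇓ refl))
          (λ d≢0 → nop (_ , (r , idle c (Rep-frame f refl rep) out refl (skip-source d≢0) refl , <⇒≤ r<) ,
            ≤-reflexive (sym pot≡)))
          (λ d≡0 → print (var⇓ refl) ▸ λ { g (refl , refl) →
            set₂ (lit⇓ (m^n>0 2 w)) (lit⇓ (≤-<-trans 0<w (n<2^n w))) ▸ λ { h (refl , refl) →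
            let x-fresh = proj₂ (src x d≡0) (≤-reflexive x-label′) in
            weaken (traverse-run (live (start c x-fresh d≡0) (Rep-frame h refl (Rep-frame g refl (Rep-frame f refl rep)))
                (cong (_∷ʳ label x) out) refl refl (start-source x-fresh) (refl , refl , sym (prog-0 c x-fresh))))
              λ { {cost} _ (p′ , l , run≡0 , cost≤) → done l run≡0 cost≤ (start-pot x-fresh) } } }) }
        where
        x : Fin n
        x = fromℕ< r<
        x-label : suc r ≡ label x
        x-label = cong suc (sym (Fin.toℕ-fromℕ< r<))
        x-label′ : suc (toℕ x) ≡ suc r
        x-label′ = sym x-label
        is-x : ∀ {y} → toℕ y ≡ r → y ≡ x
        is-x eq = Fin.toℕ-injective (trans eq (sym (Fin.toℕ-fromℕ< r<)))
        skip-source : indeg x ≢ 0 → Sources r status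
        skip-source d≢0 y d = (λ r≤ → case toℕ y ≟ r of λ
            { (yes eq) → ⊥-elim (d≢0 (subst (λ z → indeg z ≡ 0) (is-x eq) d))
            ; (no ≢)   → proj₁ (src y d) (≤∧≢⇒< r≤ (≢ ∘ sym)) }) ,
          λ y< → proj₂ (src y d) (m≤n⇒m≤1+n y<)
        start-source : status x ≡ fresh → Sources r (status [ x ↦ᶠ active ])
        start-source x-fresh y d with y Fin.≟ x
        ... | yes refl = (λ _ ()) , λ y< → ⊥-elim (<-irrefl (suc-injective x-label′) y<)
        ... | no  y≢x  = (λ r≤ → proj₁ (src y d) (≤∧≢⇒< r≤ λ eq → y≢x (is-x (sym eq)))) ,
                         λ y< → proj₂ (src y d) (m≤n⇒m≤1+n y<)
        start-pot : status x ≡ fresh → potential φ prog (status [ x ↦ᶠ active ]) ≤ potential φ prog status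
        start-pot x-fresh = ≤-trans (m≤m+n _ _) (≤-reflexive (trans
          (restake {φ} {φ} {prog} {status} {status [ x ↦ᶠ active ]} x {credit x (φ x) + (fee x + fee x)} {0}
             (λ _ _ → refl) (λ y → ↦ᶠ-other status) staked) (+-identityʳ _)))
          where
          staked : stake ((status [ x ↦ᶠ active ]) x) x (φ x) + (credit x (φ x) + (fee x + fee x)) ≡ stake (status x) x (φ x) + 0
          staked rewrite ↦ᶠ-same status x {active} | x-fresh = shuffle (fee x) (credit x (φ x))
            where
            shuffle : ∀ f b → f + (b + (f + f)) ≡ b + (f + f + f) + 0
            shuffle = solve-∀
        done : ∀ {p′ σ′ cost P} → Live r p′ σ′ → env σ′ $run ≡ 0 → cost + p′ ≤ P → P ≤ potential φ prog status →
          ∃[ p′ ] (∃[ r′ ] Idle r′ p′ σ′ × r′ ≤ n) × suc (cost + p′) ≤ p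
        done (live {stack = _ ∷ _} _ _ _ _ _ _ (run≡ , _)) run≡0 _ _ = case trans (sym run≡) run≡0 of λ ()
        done {p′} {cost = cost} (live {stack = []} c rep out refl root≡ src _) _ cost≤ P≤ =
          r + p′ , (r , idle c rep out root≡ src refl , <⇒≤ r<) ,
          subst (suc (cost + (r + p′)) ≤_) (sym pot≡) (certify 0 (≤-trans cost≤ P≤) (account cost r p′ (potential φ prog status)))
          where
          account : ∀ c r p m → suc r + m + (c + p) ≡ suc (c + (r + p)) + m + 0
          account = solve-∀

-- The two representations of the counters

module BitStore (ℙ : Planes) where

  open Planes ℙ
  open Ranking ℙ public
  open Stores 𝕀 using (Store; Outcome; was-0; was-suc)

  quiet-field : ∀ {s σ σ′} → Frame s σ σ′ → quiet s ≡ true → ∀ i → field-of σ′ i ≡ field-of σ i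
  quiet-field f h i = value-cong (len i) 0 λ k _ _ → quiet-cell f h digits (lin (suc k) i)

  len≤indeg : ∀ v → len (toℕ v) ≤ suc (indeg v)
  len≤indeg v = ≤-trans (≤-reflexive (sym (len-toℕ v)))
    (≤-trans (bitlen-id-≤ (indeg v ∸ 1)) (≤-trans (m∸n≤m (indeg v) 1) (n≤1+n _)))

  C-len≤ : ∀ v → C * len (toℕ v) ≤ (C + C) * suc (indeg v)
  C-len≤ v = *-mono-≤ (m≤m+n C C) (len≤indeg v)

  bitStore : Store
  bitStore = record
    { decrementˢ = decrement
    ; exchangeˢ  = exchange
    ; Rep        = λ φ σ → Static σ × (∀ v → φ v ≡ field-of σ (toℕ v))
    ; credit     = λ v x → C * zeros (len (toℕ v)) x
    ; unit       = C + C
    ; credit≤    = λ v x → ≤-trans (*-monoʳ-≤ C (zeros-≤ (len (toℕ v)) x)) (C-len≤ v)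
    ; Rep-frame  = λ {s} f h (st , eq) → quiet-static f h st ,
                     λ v → trans (eq v) (sym (quiet-field f (∧-left {quiet s} h) (toℕ v)))
    ; decrement-isolated = refl
    ; exchange-isolated  = refl
    ; decrement-runˢ = λ {σ} {φ} {v} (st , eq) u≡ → weaken (decrement-run {v = v} st u≡) λ { {cost} {σ′} _ (tch , dec) →
        (λ x → field-of σ′ (toℕ x)) , (static′ tch , λ _ → refl) ,
        (λ x x≢v → trans (others-kept tch (Fin.toℕ<n x) (x≢v ∘ Fin.toℕ-injective)) (sym (eq x))) ,
        outcome {v = v} (eq v) dec }
    ; exchange-runˢ = λ {σ} {φ} {v} {J} (st , eq) u≡ j≡ J< → weaken
        (exchange-run {v = v} st u≡ j≡ (subst (λ l → J < 2 ^ l) (len-toℕ v)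
           (≤-<-trans (∸-monoˡ-≤ 1 J<) (<2^bitlen (indeg v ∸ 1)))))
        λ { {cost} {σ′} _ (tch , val , res , cost≤) →
        (λ x → field-of σ′ (toℕ x)) , (static′ tch , λ _ → refl) ,
        (λ x x≢v → trans (others-kept tch (Fin.toℕ<n x) (x≢v ∘ Fin.toℕ-injective)) (sym (eq x))) ,
        val , trans res (sym (eq v)) , ≤-trans cost≤ (C-len≤ v) } }
    where
    outcome : ∀ {φ : Fin n → ℕ} {v σ σ′ cost z} → φ v ≡ field-of σ (toℕ v) →
      Decremented (len (toℕ v)) (field-of σ (toℕ v)) (field-of σ′ (toℕ v)) cost z →
      Outcome (C + C) (λ v x → C * zeros (len (toℕ v)) x) φ (λ x → field-of σ′ (toℕ x)) v cost z
    outcome {v = v} eq (Walks.was-0 o≡ z≡ c≤)   = was-0 (trans eq o≡) z≡ (≤-trans c≤ (C-len≤ v))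
    outcome {v = v} {σ′ = σ′} {cost} eq (Walks.was-suc o≡ z≡ c≤) = was-suc (trans eq o≡) z≡
      (subst (λ x → cost + C * zeros (len (toℕ v)) (field-of σ′ (toℕ v)) ≤ C * zeros (len (toℕ v)) x + (C + C)) (sym eq) c≤)

directDecrement directExchange directInit : Stmt
directDecrement =
  getSlot $tmp (! $u ⟪ sub ⟫ lit 1) ⨾
  if ! $tmp then (setSlot (! $u ⟪ sub ⟫ lit 1) (! $tmp ⟪ sub ⟫ lit 1) ⨾ $z ≔ lit 0)
  else′ ($z ≔ lit 1)
directExchange = getSlot $res (! $u ⟪ sub ⟫ lit 1) ⨾ setSlot (! $u ⟪ sub ⟫ lit 1) (! $j)
directInit =
  ($q ≔ lit 1 ⨾ $β ≔ wordLen) ⨾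
  $v ≔ lit 0 ⨾
  while ! $v ⟪ less ⟫ vertices loop
    (($u ≔ ! $v ⟪ add ⟫ lit 1 ⨾ $j ≔ degreeMinus1 $u) ⨾
     setSlot (! $v) (! $j) ⨾
     $v ≔ ! $v ⟪ add ⟫ lit 1)

-- For words of bounded length, one word per vertex is good enough.
module DirectStore (𝕀 : Input)
                   (n≤ : Input.n 𝕀 ≤ suc (Input.M 𝕀) * 1) where

  open Input 𝕀
  open Digraph G
  open Degrees G using (degree; degree-toℕ; degree-≤)
  open Semantics 𝕀
  open Hoare 𝕀
  open Slots 𝕀 1 w n ≤-refl (≤-reflexive (*-identityʳ w)) n≤
  open Stores 𝕀 using (Store; Outcome; was-0; was-suc)

  1⇓ : ∀ {ρ i} → ρ ⊢ lit {i} 1 ⇓ 1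
  1⇓ = lit⇓ 1<2^w

  0⇓ : ∀ {ρ i} → ρ ⊢ lit {i} 0 ⇓ 0
  0⇓ = lit⇓ (m^n>0 2 w)

  u-1⇓ : ∀ {ρ} {v : Fin n} {i : Fin 7} → ρ $u ≡ label v → ρ ⊢ _⟪_⟫_ {i} (! $u) sub (lit 1) ⇓ toℕ v
  u-1⇓ u≡ = sub⇓ (var⇓ u≡) 1⇓ (s≤s z≤n)

  Rep : (Fin n → ℕ) → State → Set
  Rep φ σ = VM σ × (∀ v → φ v ≡ slot σ (toℕ v))

  Rep-frame : ∀ {s σ σ′ φ} → Frame s σ σ′ → quiet s ≡ true → Rep φ σ → Rep φ σ′
  Rep-frame f h (v , eq) = quiet-VM f h v , λ x → trans (eq x) (sym (quiet-slot f h (toℕ x)))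

  Rep-set : ∀ {σ φ v z cost σ′} → Rep φ σ → SetPost σ (toℕ v) z cost σ′ → Rep (φ [ v ↦ᶠ z ]) σ′
  Rep-set {φ = φ} {v} {z} {σ′ = σ′} (_ , eq) p = vm′ p , go
    where
    go : ∀ x → (φ [ v ↦ᶠ z ]) x ≡ slot σ′ (toℕ x)
    go x with x Fin.≟ v
    ... | yes refl = sym (same p)
    ... | no  x≢v  = trans (eq x) (sym (others p (toℕ x) (x≢v ∘ Fin.toℕ-injective)))

  directDecrement-run : ∀ {σ φ v} → Rep φ σ → env σ $u ≡ label v → Run directDecrement σ λ cost σ′ →
    ∃[ φ′ ] Rep φ′ σ′ × (∀ x → x ≢ v → φ′ x ≡ φ x) × Outcome 0 (λ _ _ → 0) φ φ′ v cost (env σ′ $z)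
  directDecrement-run {σ} {φ} {v} r u≡ =
    get-run $tmp (proj₁ r) (u-1⇓ u≡) (Fin.toℕ<n v) ▸ λ { f (refl , tmp≡) →
    let r₁   = Rep-frame f refl r
        u₁   = trans (var≡ f $u refl) u≡
        tmp′ = trans tmp≡ (sym (proj₂ r v)) in
    branch (var⇓ tmp′)
      (λ ≢0 → let y , eq = ≢0⇒suc ≢0 in
        set-run (proj₁ r₁) (sub⇓ (var⇓ tmp′) 1⇓ (n≢0⇒n>0 ≢0)) (u-1⇓ u₁) (Fin.toℕ<n v)
          (≤-<-trans (≤-trans (m∸n≤m (φ v) 1) (≤-reflexive (proj₂ r v))) (slot-< σ (toℕ v)))
        ▸ λ { g p → weaken (set₁ 0⇓) λ { h (refl , refl) →
          φ [ v ↦ᶠ φ v ∸ 1 ] , Rep-frame h refl (Rep-set {φ = φ} r₁ p) , (λ x → ↦ᶠ-other φ) ,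
          was-suc (trans eq (cong suc (sym (trans (↦ᶠ-same φ v) (cong (_∸ 1) eq))))) refl
            (≤-reflexive (trans (+-identityʳ _) (trans (+-identityʳ _) (free p)))) } })
      (λ ≡0 → weaken (set₁ 1⇓) λ { h (refl , refl) →
          φ , Rep-frame h refl r₁ , (λ _ _ → refl) , was-0 ≡0 refl z≤n }) }

  directExchange-run : ∀ {σ φ v J} → Rep φ σ → env σ $u ≡ label v → env σ $j ≡ J → J < indeg v →
    Run directExchange σ λ cost σ′ → ∃[ φ′ ] Rep φ′ σ′ × (∀ x → x ≢ v → φ′ x ≡ φ x) × φ′ v ≡ J ×
      env σ′ $res ≡ φ v × cost ≤ 0
  directExchange-run {σ} {φ} {v} {J} r u≡ j≡ J< =
    get-run $res (proj₁ r) (u-1⇓ u≡) (Fin.toℕ<n v) ▸ λ { f (refl , res≡) →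
    let r₁ = Rep-frame f refl r in
    weaken (set-run (proj₁ r₁) (var⇓ (trans (var≡ f $j refl) j≡)) (u-1⇓ (trans (var≡ f $u refl) u≡)) (Fin.toℕ<n v)
             (<-trans J< (≤-<-trans (Fin.injective⇒≤ (inNbr-injective v)) n<2^w)))
      λ { g p → φ [ v ↦ᶠ J ] , Rep-set {φ = φ} r₁ p , (λ x → ↦ᶠ-other φ) , ↦ᶠ-same φ v ,
          trans (var≡ g $res refl) (trans res≡ (sym (proj₂ r v))) , ≤-reflexive (free p) } }

  directStore : Store
  directStore = record
    { decrementˢ = directDecrement
    ; exchangeˢ  = directExchange
    ; Rep        = Rep
    ; credit     = λ _ _ → 0
    ; unit       = 0
    ; credit≤    = λ _ _ → z≤n
    ; Rep-frame  = λ {s} f h → Rep-frame f (∧-left {quiet s} h)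
    ; decrement-isolated = refl
    ; exchange-isolated  = refl
    ; decrement-runˢ = directDecrement-run
    ; exchange-runˢ  = directExchange-run }

  directInit-run : ∀ {σ} → (∀ j → word σ j < 2 ^ w) → Run directInit σ λ cost σ′ →
    cost ≤ n × Rep (λ v → indeg v ∸ 1) σ′
  directInit-run {σ} words =
    set₂ 1⇓ wordLen⇓ ▸ λ { f (refl , refl) →
    set₁ 0⇓ ▸ λ { g (refl , refl) →
    weaken (counting (λ i σ → env σ $v ≡ i × VM σ × (∀ {k} → k < i → k < n → slot σ k ≡ degree k ∸ 1)) (λ _ → 0) n
      (λ _ (v≡ , _) _ → less⇓ (var⇓ v≡) vertices⇓)
      (λ { {i} _ (v≡ , v , done) i< →
        let x = fromℕ< i<
            x≡ : toℕ x ≡ i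
            x≡ = Fin.toℕ-fromℕ< i< in
        set₂ (value≡ (+-comm i 1) (add⇓ (var⇓ v≡) 1⇓ (≤-<-trans (≤-trans (≤-reflexive (+-comm i 1)) i<) n<2^w)))
             (degreeMinus1⇓ {v = x} (cong suc (sym x≡)))
        ▸ λ { h (refl , refl) →
        set-run (quiet-VM h refl v) (var⇓ refl) (var⇓ v≡) i<
          (≤-<-trans (≤-trans (m∸n≤m (indeg x) 1) (Fin.injective⇒≤ (inNbr-injective x))) n<2^w)
        ▸ λ { k p →
        weaken (set₁ (value≡ (+-comm i 1) (add⇓ (var⇓ (trans (var≡ k $v refl) v≡)) 1⇓
                  (≤-<-trans (≤-trans (≤-reflexive (+-comm i 1)) i<) n<2^w))))
          λ { l (refl , refl) → ≤-reflexive (trans (+-identityʳ _) (free p)) , refl , quiet-VM l refl (vm′ p) ,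
              λ {k} k≤i k< → trans (quiet-slot l refl k) (extended (λ k → quiet-slot h refl k) done p (trans (sym (degree-toℕ x)) (cong degree x≡)) k≤i k<) } } } })
      {0} z≤n (refl , VM-assign $v refl refl refl (vm refl refl λ j → subst (_< 2 ^ w) (sym (trans (word-assign $β refl j) (word-assign $q refl j))) (words j)) , λ ()))
      λ { _ (c≤ , _ , v , done) → ≤-trans c≤ (≤-reflexive (trans (sumBelow-const 1 n) (*-identityʳ n))) , v ,
          λ x → sym (trans (done (Fin.toℕ<n x) (Fin.toℕ<n x)) (cong (_∸ 1) (degree-toℕ x))) } } }
    where
    extended : ∀ {σ σ₁ σ₂ i d cost} → (∀ k → slot σ₁ k ≡ slot σ k) → (∀ {k} → k < i → k < n → slot σ k ≡ degree k ∸ 1) →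
      SetPost σ₁ i (d ∸ 1) cost σ₂ → d ≡ degree i → ∀ {k} → k < suc i → k < n → slot σ₂ k ≡ degree k ∸ 1
    extended {i = i} eq done p d≡ {k} k≤i k< with k ≟ i
    ... | yes refl = trans (same p) (cong (_∸ 1) d≡)
    ... | no  k≢i  = trans (others p k k≢i) (trans (eq k) (done (≤∧≢⇒< (≤-pred k≤i) k≢i) k<))

-- The parameters of the data structure

-- For x = `λ′` this says that six times the r = 1 + 2 * bitlen λ′ rank bits fit into `λ′`, one
-- reason for the summand 128 there. Up to binary length 8 the left side is at most 102; beyond, x
-- grows exponentially in its length.
bitlen-growth : ∀ x → 128 ≤ x → 12 * bitlen x + 6 ≤ x
bitlen-growth x 128≤x with bitlen x ≤? 8
... | yes b≤8 = ≤-trans (+-monoˡ-≤ 6 (*-monoʳ-≤ 12 b≤8)) (≤-trans (≤ᵇ⇒≤ 102 128 tt) 128≤x)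
... | no  b≰8 with k , eq ← m≤n⇒∃[o]m+o≡n (≰⇒> b≰8) = begin
  12 * bitlen x + 6             ≡⟨ cong (λ b → 12 * b + 6) eq ⟨
  12 * (9 + k) + 6              ≤⟨ linear 12 9 6 (2 ^ 8) k (≤ᵇ⇒≤ 114 256 tt) (≤ᵇ⇒≤ 12 256 tt) ⟩
  2 ^ 8 * suc k                 ≤⟨ *-monoʳ-≤ (2 ^ 8) (n<2^n k) ⟩
  2 ^ 8 * 2 ^ k                 ≡⟨ 2^-+ 8 k ⟨
  2 ^ (8 + k)                   ≤⟨ *-cancelˡ-≤ 2 (subst (λ b → 2 ^ b ≤ 2 * x) (sym eq) (2^bitlen≤ x x≢0)) ⟩
  x                             ∎
  where
  open ≤-Reasoning
  x≢0 : x ≢ 0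
  x≢0 refl = case 128≤x of λ ()
  linear : ∀ p q r c k → p * q + r ≤ c → p ≤ c → p * (q + k) + r ≤ c * suc k
  linear p q r c k h p≤c = certify 0 (+-mono-≤ h (*-monoˡ-≤ k p≤c)) (account p q r c k)
    where
    account : ∀ p q r c k → c * suc k + (p * q + r + p * k) ≡ p * (q + k) + r + (c + c * k) + 0
    account = solve-∀

*≤⇒≤/ : ∀ {a b c} .{{_ : NonZero b}} → a * b ≤ c → a ≤ c / b
*≤⇒≤/ {a} {b} {c} h = ≤-trans (≤-reflexive (sym (m*n/n≡m a b))) (/-monoˡ-≤ b h)

<suc/* : ∀ a b .{{_ : NonZero b}} → a < suc (a / b) * b
<suc/* a b = ≤-trans (≤-reflexive (cong suc (m≡m%n+[m/n]*n a b))) (+-monoˡ-< (a / b * b) (m%n<n a b))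

record Sizes : Set where
  field
    n w N : ℕ
    1≤n   : 1 ≤ n
    n<2^w : n < 2 ^ w
    128≤w : 128 ≤ w
    N<2^w : N < 2 ^ w
    N≤    : N ≤ n * suc (bitlen n)
    λ′    : ℕ
    λ′≡   : λ′ ≡ 128 + 2 * bitlen n

module Parameters (𝕊 : Sizes) where

  open Sizes 𝕊

  128≤λ′ : 128 ≤ λ′
  128≤λ′ = ≤-trans (m≤m+n 128 _) (≤-reflexive (sym λ′≡))

  1≤λ′ : 1 ≤ λ′
  1≤λ′ = ≤-trans (≤ᵇ⇒≤ 1 128 tt) 128≤λ′

  private
    instance
      2λ≢0 : NonZero (λ′ + λ′)
      2λ≢0 = >-nonZero (≤-trans 1≤λ′ (m≤m+n λ′ λ′))
      λ≢0 : NonZero λ′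
      λ≢0 = >-nonZero 1≤λ′

  abstract
    -- With this q the slot length w / q lies between `λ′` and twice `λ′`, or is w itself if w is
    -- below twice `λ′`. As `λ′ / 16` is about an eighth of log n, the table has only O(n ^ (1/8))
    -- entries.
    q ρ τ : ℕ
    q = suc (w / (λ′ + λ′))
    ρ = bitlen λ′
    τ = λ′ / 16

    q≡ : q ≡ suc (w / (λ′ + λ′))
    q≡ = refl
    ρ≡ : ρ ≡ bitlen λ′
    ρ≡ = refl
    τ≡ : τ ≡ λ′ / 16
    τ≡ = refl

  1≤q : 1 ≤ q
  1≤q = ≤-trans (s≤s z≤n) (≤-reflexive (sym q≡))

  private
    instance
      q≢0 : NonZero q
      q≢0 = >-nonZero 1≤q

  abstract
    -- A slot is divided into t flags and r bits for the relative rank. The value of r comes from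
    -- `λ′ * t`, with the first factor below 2 ^ ρ and the second below 2 ^ (ρ + 1).
    β r t : ℕ
    β = _/_ w q {{>-nonZero 1≤q}}
    r = suc (2 * ρ)
    t = β ∸ r

    β≡ : β ≡ _/_ w q {{>-nonZero 1≤q}}
    β≡ = refl
    r≡ : r ≡ suc (2 * ρ)
    r≡ = refl
    t≡ : t ≡ β ∸ r
    t≡ = refl

  bitlen≤w : bitlen n ≤ w
  bitlen≤w = bitlen-≤ n<2^w

  λ′≤3w : λ′ ≤ 3 * w
  λ′≤3w = ≤-trans (≤-reflexive λ′≡) (≤-trans (+-mono-≤ 128≤w (*-monoʳ-≤ 2 bitlen≤w)) ≤-refl)

  β<2λ′ : β < λ′ + λ′
  β<2λ′ = subst (_< λ′ + λ′) (sym β≡) (m<n*o⇒m/o<n (≤-trans (<suc/* w (λ′ + λ′))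
    (≤-reflexive (trans (cong (_* (λ′ + λ′)) (sym q≡)) (*-comm q (λ′ + λ′))))))

  -- For q = 1, a slot is a whole word.
  λ′≤β⊎β≡w : λ′ ≤ β ⊎ β ≡ w
  λ′≤β⊎β≡w with w / (λ′ + λ′) in eq
  ... | zero  = inj₂ (trans β≡ (trans (/-congʳ (trans q≡ (cong suc eq))) (n/1≡n w)))
  ... | suc k = inj₁ (≤-trans (*≤⇒≤/ (begin
    λ′ * q                     ≡⟨ cong (λ′ *_) (trans q≡ (cong suc eq)) ⟩
    λ′ * suc (suc k)           ≤⟨ m≤m+n _ (λ′ * k) ⟩
    λ′ * suc (suc k) + λ′ * k  ≡⟨ double λ′ k ⟩
    suc k * (λ′ + λ′)          ≡⟨ cong (_* (λ′ + λ′)) eq ⟨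
    w / (λ′ + λ′) * (λ′ + λ′)  ≤⟨ m/n*n≤m w (λ′ + λ′) ⟩
    w                          ∎)) (≤-reflexive (sym β≡)))
    where
    open ≤-Reasoning
    double : ∀ a k → a * suc (suc k) + a * k ≡ suc k * (a + a)
    double = solve-∀

  λ′≤3β : λ′ ≤ 3 * β
  λ′≤3β with λ′≤β⊎β≡w
  ... | inj₁ λ′≤β = ≤-trans λ′≤β (m≤m+n β _)
  ... | inj₂ β≡w  = ≤-trans λ′≤3w (≤-reflexive (cong (3 *_) (sym β≡w)))

  6r≤λ′ : 6 * r ≤ λ′
  6r≤λ′ = ≤-trans (≤-reflexive (trans (cong (6 *_) r≡) (expand ρ)))
    (subst (λ ρ → 12 * ρ + 6 ≤ λ′) (sym ρ≡) (bitlen-growth λ′ 128≤λ′))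
    where
    expand : ∀ ρ → 6 * suc (2 * ρ) ≡ 12 * ρ + 6
    expand = solve-∀

  r≤β : r ≤ β
  r≤β = *-cancelˡ-≤ 3 (≤-trans (≤-trans (*-monoˡ-≤ r {3} {6} (s≤s (s≤s (s≤s z≤n)))) 6r≤λ′) λ′≤3β)

  t+r : t + r ≡ β
  t+r = trans (cong (_+ r) t≡) (m∸n+n≡m r≤β)

  t≤β : t ≤ β
  t≤β = ≤-trans (≤-reflexive t≡) (m∸n≤m β r)

  -- 6t = 6β - 6r is at least 2λ′ - λ′. So the rank bits take only a constant fraction of a slot,
  -- and t = Ω(log n).
  λ′≤6t : λ′ ≤ 6 * t
  λ′≤6t = certify 0 (+-mono-≤ (+-mono-≤ λ′≤3β λ′≤3β) 6r≤λ′)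
    (trans (account λ′ t r) (cong (λ b → λ′ + (3 * b + 3 * b + λ′) + 0) t+r))
    where
    account : ∀ l t r → 6 * t + (l + l + 6 * r) ≡ l + (3 * (t + r) + 3 * (t + r) + l) + 0
    account = solve-∀

  21≤t : 21 ≤ t
  21≤t = *-cancelˡ-≤ 6 (≤-trans (≤-trans (≤ᵇ⇒≤ 126 128 tt) 128≤λ′) λ′≤6t)

  1≤t : 1 ≤ t
  1≤t = ≤-trans (s≤s z≤n) 21≤t

  private
    instance
      t≢0 : NonZero t
      t≢0 = >-nonZero 1≤t

  abstract
    W : ℕ
    W = suc (_/_ N t {{>-nonZero 1≤t}})
    W≡ : W ≡ suc (_/_ N t {{>-nonZero 1≤t}})
    W≡ = refl

  abstract
    V : ℕ
    V = suc (_/_ W λ′ {{>-nonZero 1≤λ′}})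
    V≡ : V ≡ suc (_/_ W λ′ {{>-nonZero 1≤λ′}})
    V≡ = refl

  cap : ℕ
  cap = sumBelow (regionSize λ′ τ W V) 5

  abstract
    -- One word of slots is in the register, so `cap` slots fit although only `cap ∸ 1` is divided
    -- by q and the quotient rounded down. No fraction of a word is charged, however long the words
    -- are.
    M : ℕ
    M = _/_ (cap ∸ 1) q {{>-nonZero 1≤q}}
    M≡ : M ≡ _/_ (cap ∸ 1) q {{>-nonZero 1≤q}}
    M≡ = refl

  8≤τ : 8 ≤ τ
  8≤τ = ≤-trans (*≤⇒≤/ 128≤λ′) (≤-reflexive (sym τ≡))

  λ′<18τ : λ′ < 18 * τ
  λ′<18τ = ≤-trans (subst (λ τ → λ′ < suc τ * 16) (sym τ≡) (<suc/* λ′ 16)) (≤-trans (≤-reflexive (expand τ)) (certify 0 (+-mono-≤ 8≤τ 8≤τ) (account τ)))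
    where
    expand : ∀ τ → suc τ * 16 ≡ 16 * τ + 16
    expand = solve-∀
    account : ∀ τ → 18 * τ + 16 ≡ 16 * τ + 16 + (τ + τ) + 0
    account = solve-∀

  -- The origin of `chunks = 36`: t ≤ β < 2λ′, and λ′ < 18τ.
  t≤36τ : t ≤ τ * 36
  t≤36τ = ≤-trans t≤β (≤-trans (<⇒≤ β<2λ′) (≤-trans (+-mono-≤ (<⇒≤ λ′<18τ) (<⇒≤ λ′<18τ)) (≤-reflexive (expand τ))))
    where
    expand : ∀ τ → 18 * τ + 18 * τ ≡ τ * 36
    expand = solve-∀

  -- The reason for the summand `2 * bitlen n` in `λ′`: with fields of up to log n bits, the number
  -- of cells may exceed n by a logarithmic factor, and it has to fit into a slot.
  n<2^λ′ : n * suc (bitlen n) < 2 ^ λ′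
  n<2^λ′ = begin-strict
    n * suc b            ≤⟨ *-mono-≤ (<⇒≤ (<2^bitlen n)) (n<2^n b) ⟩
    2 ^ b * 2 ^ b        ≡⟨ 2^-+ b b ⟨
    2 ^ (b + b)          <⟨ ^-monoʳ-< 2 ≤-refl (≤-trans (s≤s (≤-reflexive (cong (b +_) (sym (+-identityʳ b))))) (≤-trans (+-monoˡ-≤ (2 * b) (≤ᵇ⇒≤ 1 128 tt)) (≤-reflexive (sym λ′≡)))) ⟩
    2 ^ λ′               ∎
    where
    open ≤-Reasoning
    b = bitlen n

  N<2^β : N < 2 ^ β
  N<2^β with λ′≤β⊎β≡w
  ... | inj₁ λ′≤β = ≤-<-trans N≤ (≤-trans n<2^λ′ (2^-mono λ′≤β))
  ... | inj₂ β≡w  = subst (λ b → N < 2 ^ b) (sym β≡w) N<2^w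

  λ′t< : λ′ * t < 2 ^ (β ∸ t)
  λ′t< = begin-strict
    λ′ * t                  <⟨ *-monoˡ-< t λ′<2^ρ ⟩
    2 ^ ρ * t               ≤⟨ *-monoʳ-≤ (2 ^ ρ) (≤-trans t≤β (<⇒≤ (≤-trans β<2λ′ (+-mono-≤ (<⇒≤ λ′<2^ρ) (<⇒≤ λ′<2^ρ))))) ⟩
    2 ^ ρ * (2 ^ ρ + 2 ^ ρ) ≡⟨ cong (λ x → 2 ^ ρ * (2 ^ ρ + x)) (+-identityʳ (2 ^ ρ)) ⟨
    2 ^ ρ * 2 ^ suc ρ       ≡⟨ 2^-+ ρ (suc ρ) ⟨
    2 ^ (ρ + suc ρ)         ≡⟨ cong (2 ^_) (trans (+-suc ρ ρ) (trans (cong (λ x → suc (ρ + x)) (sym (+-identityʳ ρ))) (sym r≡))) ⟩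
    2 ^ r                   ≡⟨ cong (2 ^_) (trans (cong (β ∸_) t≡) (m∸[m∸n]≡n r≤β)) ⟨
    2 ^ (β ∸ t)             ∎
    where
    open ≤-Reasoning
    λ′<2^ρ : λ′ < 2 ^ ρ
    λ′<2^ρ = subst (λ ρ → λ′ < 2 ^ ρ) (sym ρ≡) (<2^bitlen λ′)

  τ≤β : τ ≤ β
  τ≤β = *-cancelˡ-≤ 16 (≤-trans (≤-reflexive (trans (*-comm 16 τ) (cong (_* 16) τ≡))) (≤-trans (m/n*n≤m λ′ 16)
    (≤-trans λ′≤3β (*-monoˡ-≤ β {3} {16} (s≤s (s≤s (s≤s z≤n)))))))

  -- With w = 3 + k and X = 2 ^ k, four regions have at most X slots and the ranks at most X + 1,
  -- together fewer than 8X. For the flags and the digits this uses N < 8X and t ≥ 21.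
  cap<2^w : cap < 2 ^ w
  cap<2^w with k , refl ← m≤n⇒∃[o]m+o≡n {3} (≤-trans (≤ᵇ⇒≤ 3 128 tt) 128≤w) = begin-strict
    cap                               ≤⟨ +-mono-≤ (+-mono-≤ (+-mono-≤ (+-mono-≤ λ′≤X (2^-mono τ≤k)) W≤X) W≤X) V≤ ⟩
    X + X + X + X + suc X             <⟨ certify X (+-mono-≤ 1≤X 1≤X) (account X) ⟩
    2 ^ (3 + k)                       ∎
    where
    open ≤-Reasoning
    X = 2 ^ k
    1≤X : 1 ≤ X
    1≤X = m^n>0 2 k
    account : ∀ X → 2 * (2 * (2 * X)) + 2 ≡ suc (X + X + X + X + suc X) + (X + X) + X
    account = solve-∀
    5≤k : 5 ≤ k
    5≤k = +-cancelˡ-≤ 3 5 k (≤-trans (≤ᵇ⇒≤ 8 128 tt) 128≤w)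
    linear : ∀ k → 5 ≤ k → 3 * (3 + k) ≤ 2 ^ k
    linear k 5≤k with l , refl ← m≤n⇒∃[o]m+o≡n 5≤k = ≤-trans (m≤m+n _ (8 + 29 * l))
      (≤-trans (≤-reflexive (expand l)) (≤-trans (*-monoʳ-≤ 32 (n<2^n l)) (≤-reflexive (sym (2^-+ 5 l)))))
      where
      expand : ∀ l → 3 * (3 + (5 + l)) + (8 + 29 * l) ≡ 32 * suc l
      expand = solve-∀
    λ′≤X : λ′ ≤ X
    λ′≤X = ≤-trans λ′≤3w (linear k 5≤k)
    τ≤k : τ ≤ k
    τ≤k = subst (_≤ k) (sym τ≡) (≤-pred (m<n*o⇒m/o<n (≤-<-trans λ′≤3w (certify (6 + 13 * k) (≤-refl {0}) (expand k)))))
      where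
      expand : ∀ k → suc k * 16 + 0 ≡ suc (3 * (3 + k)) + 0 + (6 + 13 * k)
      expand = solve-∀
    W≤X : W ≤ X
    W≤X = subst (_≤ X) (sym W≡) (m<n*o⇒m/o<n (≤-trans N<2^w (≤-trans (≤-reflexive (2^-+ 3 k)) (≤-trans (≤-reflexive (*-comm 8 X))
      (*-monoʳ-≤ X (≤-trans (≤ᵇ⇒≤ 8 21 tt) 21≤t))))))
    V≤ : V ≤ suc X
    V≤ = subst (_≤ suc X) (sym V≡) (s≤s (≤-trans (m/n≤m W λ′) W≤X))

  βq≤w : β * q ≤ w
  βq≤w = subst (λ β → β * q ≤ w) (sym β≡) (m/n*n≤m w q)

  layout : Layout n w M N
  layout = record
    { λ′ = λ′ ; q = q ; β = β ; τ = τ ; t = t ; W = W ; V = V ; chunks = 36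
    ; 1≤λ′ = 1≤λ′ ; 1≤q = 1≤q ; 1≤t = 1≤t ; 1≤τ = ≤-trans (s≤s z≤n) 8≤τ
    ; t≤β = t≤β ; βq≤w = βq≤w
    ; cap≤ = ≤-trans (≤-reflexive (sym (m+[n∸m]≡n 1≤cap))) (subst (λ M → cap ∸ 1 < suc M * q) (sym M≡) (<suc/* (cap ∸ 1) q)) ; cap< = cap<2^w
    ; N< = N<2^β ; W≡ = W≡ ; V> = λ i< → ≤-trans (s≤s (/-monoˡ-≤ λ′ (<⇒≤ i<))) (≤-reflexive (sym V≡)) ; λ′t< = λ′t<
    ; τ< = ≤-<-trans τ≤β (n<2^n β) ; t≤ = t≤36τ }
    where
    1≤cap : 1 ≤ cap
    1≤cap = ≤-trans (≤-trans (s≤s z≤n) (≤-reflexive (sym V≡))) (m≤n+m V _)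

  w<q*[1+β] : w < suc β * q
  w<q*[1+β] = subst (λ β → w < suc β * q) (sym β≡) (<suc/* w q)

  -- Rounding to whole words costs less than one bit per slot.
  memory-bits : M * w ≤ cap * suc β
  memory-bits = begin
    M * w                ≤⟨ *-monoʳ-≤ M (<⇒≤ w<q*[1+β]) ⟩
    M * (suc β * q)      ≡⟨ regroup M (suc β) q ⟩
    M * q * suc β        ≤⟨ *-monoˡ-≤ (suc β) (≤-trans (subst (λ M → M * q ≤ cap ∸ 1) (sym M≡) (m/n*n≤m (cap ∸ 1) q)) (m∸n≤m cap 1)) ⟩
    cap * suc β          ∎
    where
    open ≤-Reasoning
    regroup : ∀ a b c → a * (b * c) ≡ a * c * b
    regroup = solve-∀

-- The summand K * n of the space bound stands for everything of lower order.
-- Unfolding such constants into successors would be expensive.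
abstract
  K : ℕ
  K = (67 * 8 + 512 + 3) * (2 * (67 * 8)) * 8
  K≡ : (67 * 8 + 512 + 3) * (2 * (67 * 8)) * 8 ≡ K
  K≡ = refl

-- The space bound in terms of the number of cells

module Space (𝕊 : Sizes) (4≤n : 4 ≤ Sizes.n 𝕊) (n≤N : Sizes.n 𝕊 ≤ Sizes.N 𝕊) where

  open Sizes 𝕊
  open Parameters 𝕊 public

  private
    l ll : ℕ
    l  = lg n
    ll = lglg n

  bitlen≡ : bitlen n ≡ suc l
  bitlen≡ = go 4≤n
    where
    go : ∀ {m} → 4 ≤ m → bitlen m ≡ suc ⌊log₂ m ⌋
    go {suc m} _ = refl

  2≤l : 2 ≤ l
  2≤l = ⌊log₂⌋-mono-≤ {4} 4≤n

  1≤ll : 1 ≤ ll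
  1≤ll = ⌊log₂⌋-mono-≤ {2} 2≤l

  2^l≤n : 2 ^ l ≤ n
  2^l≤n = *-cancelˡ-≤ 2 (subst (λ b → 2 ^ b ≤ 2 * n) bitlen≡ (2^bitlen≤ n λ { refl → case 4≤n of λ () }))

  λ′≤67l : λ′ ≤ 67 * l
  λ′≤67l = begin
    λ′                  ≡⟨ trans λ′≡ (cong (λ b → 128 + 2 * b) bitlen≡) ⟩
    128 + 2 * suc l     ≡⟨ cong (128 +_) (*-suc 2 l) ⟩
    128 + (2 + 2 * l)   ≡⟨ +-assoc 128 2 (2 * l) ⟨
    65 * 2 + 2 * l      ≤⟨ +-monoˡ-≤ (2 * l) (*-monoʳ-≤ 65 2≤l) ⟩
    65 * l + 2 * l      ≡⟨ *-distribʳ-+ l 65 2 ⟨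
    67 * l              ∎
    where open ≤-Reasoning

  2l≤λ′ : 2 * l ≤ λ′
  2l≤λ′ = ≤-trans (*-monoʳ-≤ 2 (≤-trans (n≤1+n l) (≤-reflexive (sym bitlen≡))))
    (≤-trans (m≤n+m (2 * bitlen n) 128) (≤-reflexive (sym λ′≡)))

  l≤3t : l ≤ 3 * t
  l≤3t = *-cancelˡ-≤ 2 (≤-trans 2l≤λ′ (≤-trans λ′≤6t (≤-reflexive (*-assoc 2 3 t))))

  ρ≤9ll : ρ ≤ 9 * ll
  ρ≤9ll = ≤-trans (≤-reflexive ρ≡) (≤-trans (bitlen-≤ {λ′} {7 + bitlen l} (begin-strict
    λ′                    ≤⟨ λ′≤67l ⟩
    67 * l                ≤⟨ *-monoˡ-≤ l (≤ᵇ⇒≤ 67 128 tt) ⟩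
    128 * l               <⟨ *-monoʳ-< 128 (<2^bitlen l) ⟩
    2 ^ 7 * 2 ^ bitlen l  ≡⟨ 2^-+ 7 (bitlen l) ⟨
    2 ^ (7 + bitlen l)    ∎)) (begin
    7 + bitlen l          ≡⟨ cong (7 +_) (bitlen-l 2≤l) ⟩
    8 * 1 + ll            ≤⟨ +-monoˡ-≤ ll (*-monoʳ-≤ 8 1≤ll) ⟩
    8 * ll + ll           ≡⟨ +-comm (8 * ll) ll ⟩
    9 * ll                ∎))
    where
    open ≤-Reasoning
    bitlen-l : ∀ {m} → 2 ≤ m → bitlen m ≡ suc ⌊log₂ m ⌋
    bitlen-l {suc m} _ = refl

  -- As λ′ = O(log n), its binary length ρ and hence the rank bits of a slot are O(log log n); the
  -- additional 1 is the rounding loss per slot. This yields the leading part of the error term.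
  1+r≤20ll : suc r ≤ 20 * ll
  1+r≤20ll = begin
    suc r                   ≡⟨ cong suc r≡ ⟩
    2 * 1 + 2 * ρ           ≤⟨ +-mono-≤ (*-monoʳ-≤ 2 1≤ll) (*-monoʳ-≤ 2 ρ≤9ll) ⟩
    2 * ll + 2 * (9 * ll)   ≡⟨ expand ll ⟩
    20 * ll                 ∎
    where
    open ≤-Reasoning
    expand : ∀ a → 2 * a + 2 * (9 * a) ≡ 20 * a
    expand = solve-∀

  N/t : ℕ
  N/t = N / t
    where instance _ = >-nonZero 1≤t

  N/t*t≤N : N/t * t ≤ N
  N/t*t≤N = m/n*n≤m N t {{>-nonZero 1≤t}}

  W≡N/t : W ≡ suc N/t
  W≡N/t = W≡

  N/t*l≤3N : N/t * l ≤ 3 * N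
  N/t*l≤3N = begin
    N/t * l          ≤⟨ *-monoʳ-≤ N/t l≤3t ⟩
    N/t * (3 * t)    ≡⟨ regroup N/t t ⟩
    3 * (N/t * t)    ≤⟨ *-monoʳ-≤ 3 N/t*t≤N ⟩
    3 * N            ∎
    where
    open ≤-Reasoning
    regroup : ∀ a t → a * (3 * t) ≡ 3 * (a * t)
    regroup = solve-∀

  1+β : ℕ
  1+β = suc β

  1+β≡ : 1+β ≡ t + suc r
  1+β≡ = trans (cong suc (sym t+r)) (sym (+-suc t r))

  1+β≤2λ′ : 1+β ≤ 2 * λ′
  1+β≤2λ′ = ≤-trans β<2λ′ (≤-reflexive (cong (λ′ +_) (sym (+-identityʳ λ′))))

  -- Of the t + suc r bits charged to a slot, the first t add up to at most N over all slots. The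
  -- others are O(log log n) per slot, and there are N / t = O(N / log n) slots.
  cells-bits : N/t * 1+β * l ≤ N * l + 60 * (N * ll)
  cells-bits = begin
    N/t * 1+β * l                            ≡⟨ cong (λ b → N/t * b * l) 1+β≡ ⟩
    N/t * (t + suc r) * l                    ≡⟨ expand N/t t (suc r) l ⟩
    N/t * t * l + N/t * l * suc r            ≤⟨ +-mono-≤ (*-monoˡ-≤ l N/t*t≤N) (*-mono-≤ N/t*l≤3N 1+r≤20ll) ⟩
    N * l + 3 * N * (20 * ll)                ≡⟨ cong (N * l +_) (regroup N ll) ⟩
    N * l + 60 * (N * ll)                    ∎
    where
    open ≤-Reasoning
    expand : ∀ a t r l → a * (t + r) * l ≡ a * t * l + a * l * r
    expand = solve-∀
    regroup : ∀ n a → 3 * n * (20 * a) ≡ 60 * (n * a)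
    regroup n a = trans (*-assoc 3 n (20 * a)) (trans (cong (3 *_) (trans (sym (*-assoc n 20 a)) (trans (cong (_* a) (*-comm n 20)) (*-assoc 20 n a)))) (sym (*-assoc 3 20 (n * a))))

  W/λ′ : ℕ
  W/λ′ = W / λ′
    where instance _ = >-nonZero 1≤λ′

  V≡W/λ′ : V ≡ suc W/λ′
  V≡W/λ′ = V≡

  -- An absolute rank costs at most 2λ′ bits but serves `λ′` words, which amounts to O(1) bits per
  -- flag word.
  ranks-bits : W/λ′ * 1+β * l ≤ 6 * N + 2 * l
  ranks-bits = begin
    W/λ′ * 1+β * l             ≤⟨ *-monoˡ-≤ l (*-monoʳ-≤ W/λ′ 1+β≤2λ′) ⟩
    W/λ′ * (2 * λ′) * l        ≡⟨ regroup W/λ′ λ′ l ⟩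
    2 * (W/λ′ * λ′ * l)        ≤⟨ *-monoʳ-≤ 2 (*-monoˡ-≤ l (m/n*n≤m W λ′ {{>-nonZero 1≤λ′}})) ⟩
    2 * (W * l)                ≡⟨ cong (λ W → 2 * (W * l)) W≡N/t ⟩
    2 * (l + N/t * l)          ≤⟨ *-monoʳ-≤ 2 (+-monoʳ-≤ l N/t*l≤3N) ⟩
    2 * (l + 3 * N)            ≡⟨ expand l N ⟩
    6 * N + 2 * l              ∎
    where
    open ≤-Reasoning
    regroup : ∀ a b l → a * (2 * b) * l ≡ 2 * (a * b * l)
    regroup = solve-∀
    expand : ∀ l n → 2 * (l + 3 * n) ≡ 6 * n + 2 * l
    expand = solve-∀

  sum≤ : ∀ {a b c Y} c₁ c₂ c₃ → a ≤ c₁ * Y → b ≤ c₂ * Y → c ≤ c₃ * Y → a + b + c ≤ (c₁ + c₂ + c₃) * Y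
  sum≤ {Y = Y} c₁ c₂ c₃ h₁ h₂ h₃ = ≤-trans (+-mono-≤ (+-mono-≤ h₁ h₂) h₃) (≤-reflexive (factor c₁ c₂ c₃ Y))
    where
    factor : ∀ a b c Y → a * Y + b * Y + c * Y ≡ (a + b + c) * Y
    factor = solve-∀

  product≤ : ∀ {a b c Y n} c₁ c₂ c₃ → a ≤ c₁ * Y → b ≤ c₂ * Y → c ≤ c₃ * Y → Y * (Y * Y) ≤ n →
             a * b * c ≤ c₁ * c₂ * c₃ * n
  product≤ {Y = Y} c₁ c₂ c₃ h₁ h₂ h₃ Y³≤n = ≤-trans (*-mono-≤ (*-mono-≤ h₁ h₂) h₃)
    (≤-trans (≤-reflexive (factor c₁ c₂ c₃ Y)) (*-monoʳ-≤ (c₁ * c₂ * c₃) Y³≤n))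
    where
    factor : ∀ a b c Y → a * Y * (b * Y) * (c * Y) ≡ a * b * c * (Y * (Y * Y))
    factor = solve-∀

  -- The eighth part e of l makes all lower-order terms polynomials in 2 ^ e.
  rest-bits : (λ′ + 2 ^ τ + 3) * 1+β * l ≤ K * n
  rest-bits = subst (λ k → (λ′ + 2 ^ τ + 3) * 1+β * l ≤ k * n) K≡
    (product≤ {Y = Y} (67 * 8 + 512 + 3) (2 * (67 * 8)) 8 (sum≤ {Y = Y} (67 * 8) 512 3 λ′≤ τ≤ 3≤) 1+β≤ l≤8Y Y³≤n)
    where
    open ≤-Reasoning
    e Y : ℕ
    e = l / 8
    Y = 2 ^ e
    1≤Y : 1 ≤ Y
    1≤Y = m^n>0 2 e
    l≤8Y : l ≤ 8 * Y
    l≤8Y = ≤-trans (<⇒≤ (<suc/* l 8)) (≤-trans (*-monoˡ-≤ 8 (n<2^n e)) (≤-reflexive (*-comm Y 8)))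
    λ′≤ : λ′ ≤ 67 * 8 * Y
    λ′≤ = ≤-trans λ′≤67l (≤-trans (*-monoʳ-≤ 67 l≤8Y) (≤-reflexive (sym (*-assoc 67 8 Y))))
    1+β≤ : 1+β ≤ 2 * (67 * 8) * Y
    1+β≤ = ≤-trans 1+β≤2λ′ (≤-trans (*-monoʳ-≤ 2 λ′≤) (≤-reflexive (sym (*-assoc 2 (67 * 8) Y))))
    3≤ : 3 ≤ 3 * Y
    3≤ = *-monoʳ-≤ 3 1≤Y
    τ≤9+e : τ ≤ 9 + e
    τ≤9+e = subst (_≤ 9 + e) (sym τ≡) (≤-pred (m<n*o⇒m/o<n (begin-strict
      λ′                     ≡⟨ trans λ′≡ (cong (λ b → 128 + 2 * b) bitlen≡) ⟩
      128 + 2 * suc l        ≤⟨ +-monoʳ-≤ 128 (*-monoʳ-≤ 2 (<suc/* l 8)) ⟩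
      128 + 2 * (suc e * 8)  ≡⟨ cong (128 +_) (trans (cong (2 *_) (*-comm (suc e) 8)) (trans (sym (*-assoc 2 8 (suc e))) (*-comm 16 (suc e)))) ⟩
      8 * 16 + suc e * 16    ≡⟨ *-distribʳ-+ 16 8 (suc e) ⟨
      (8 + suc e) * 16       <⟨ *-monoˡ-< 16 (s≤s (≤-reflexive (+-suc 8 e))) ⟩
      suc (9 + e) * 16       ∎)))
    τ≤ : 2 ^ τ ≤ 512 * Y
    τ≤ = ≤-trans (2^-mono τ≤9+e) (≤-reflexive (2^-+ 9 e))
    Y³≤n : Y * (Y * Y) ≤ n
    Y³≤n = begin
      Y * (Y * Y)           ≡⟨ trans (2^-+ e (e + e)) (cong (Y *_) (2^-+ e e)) ⟨
      2 ^ (e + (e + e))     ≤⟨ 2^-mono (≤-trans (≤-trans (m≤m+n (e + (e + e)) (5 * e)) (≤-reflexive (expand e))) (m/n*n≤m l 8)) ⟩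
      2 ^ l                 ≤⟨ 2^l≤n ⟩
      n                     ∎
      where
      expand : ∀ e → e + (e + e) + 5 * e ≡ e * 8
      expand = solve-∀

  l≤N : l ≤ N
  l≤N = ≤-trans (<⇒≤ (n<2^n l)) (≤-trans 2^l≤n n≤N)

  space : M * w * l ≤ 2 * N * (l + (128 + K) * ll)
  space = begin
    M * w * l                       ≤⟨ *-monoˡ-≤ l memory-bits ⟩
    cap * 1+β * l                   ≡⟨ cong (λ c → c * 1+β * l) cap≡ ⟩
    (λ′ + 2 ^ τ + 3 + (N/t + N/t + W/λ′)) * 1+β * l
      ≡⟨ distribute (λ′ + 2 ^ τ + 3) N/t W/λ′ 1+β l ⟩
    (λ′ + 2 ^ τ + 3) * 1+β * l + (N/t * 1+β * l + N/t * 1+β * l + W/λ′ * 1+β * l)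
      ≤⟨ +-mono-≤ rest-bits (+-mono-≤ (+-mono-≤ cells-bits cells-bits) ranks-bits) ⟩
    K * n + (N * l + 60 * (N * ll) + (N * l + 60 * (N * ll)) + (6 * N + 2 * l))
      ≤⟨ +-mono-≤ Kn≤ (+-monoʳ-≤ (N * l + 60 * (N * ll) + (N * l + 60 * (N * ll))) low≤) ⟩
    K * (N * ll) + (N * l + 60 * (N * ll) + (N * l + 60 * (N * ll)) + 8 * (N * ll))
      ≡⟨ collect K (N * l) (N * ll) ⟩
    2 * (N * l) + (60 + 60 + 8 + K) * (N * ll)
      -- The lower-order part is doubled in order to take out the common factor `2 * N`.
      ≤⟨ +-monoʳ-≤ (2 * (N * l)) (m≤m+n _ _) ⟩
    2 * (N * l) + ((128 + K) * (N * ll) + (128 + K) * (N * ll))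
      ≡⟨ factor N l (128 + K) ll ⟩
    2 * N * (l + (128 + K) * ll)    ∎
    where
    open ≤-Reasoning
    cap≡ : cap ≡ λ′ + 2 ^ τ + 3 + (N/t + N/t + W/λ′)
    cap≡ = trans (cong₂ (λ a b → λ′ + 2 ^ τ + a + a + b) W≡N/t V≡W/λ′) (shuffle (λ′ + 2 ^ τ) N/t W/λ′)
      where
      shuffle : ∀ a b c → a + suc b + suc b + suc c ≡ a + 3 + (b + b + c)
      shuffle = solve-∀
    distribute : ∀ a b c d l → (a + (b + b + c)) * d * l ≡ a * d * l + (b * d * l + b * d * l + c * d * l)
    distribute = solve-∀
    N≤Nll : N ≤ N * ll
    N≤Nll = ≤-trans (≤-reflexive (sym (*-identityʳ N))) (*-monoʳ-≤ N 1≤ll)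
    Kn≤ : K * n ≤ K * (N * ll)
    Kn≤ = *-monoʳ-≤ K (≤-trans n≤N N≤Nll)
    low≤ : 6 * N + 2 * l ≤ 8 * (N * ll)
    low≤ = ≤-trans (+-mono-≤ (*-monoʳ-≤ 6 N≤Nll) (*-monoʳ-≤ 2 (≤-trans l≤N N≤Nll))) (≤-reflexive (sym (*-distribʳ-+ (N * ll) 6 2)))
    collect : ∀ K a b → K * b + (a + 60 * b + (a + 60 * b) + 8 * b) ≡ 2 * a + (60 + 60 + 8 + K) * b
    collect K a b = trans (gather (K * b) a (60 * b) (8 * b)) (cong (2 * a +_)
      (trans (cong (_+ K * b) (trans (cong (_+ 8 * b) (sym (*-distribʳ-+ b 60 60))) (sym (*-distribʳ-+ b 120 8)))) (sym (*-distribʳ-+ b 128 K))))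
      where
      gather : ∀ k a b c → k + (a + b + (a + b) + c) ≡ 2 * a + (b + b + c + k)
      gather = solve-∀
    factor : ∀ N l c ll → 2 * (N * l) + (c * (N * ll) + c * (N * ll)) ≡ 2 * N * (l + c * ll)
    factor = solve-∀

-- Computing the parameters at run time

countDigits chooseParameters : Stmt
-- Counting in steps of 2 serves both `λ′` = 128 + 2 * bitlen n and r = 1 + 2 * bitlen λ′; the two
-- calls differ in the initial value of `$k`.
countDigits = while ! $x loop ($x ≔ ! $x ⟪ shr ⟫ lit 1 ⨾ $k ≔ ! $k ⟪ add ⟫ lit 2)
chooseParameters =
  ($k ≔ lit 128 ⨾ $x ≔ vertices) ⨾
  countDigits ⨾
  $λ ≔ ! $k ⨾
  ($q ≔ wordLen ⟪ div ⟫ (! $λ ⟪ add ⟫ ! $λ) ⟪ add ⟫ lit 1 ⨾ $β ≔ wordLen ⟪ div ⟫ ! $q) ⨾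
  ($k ≔ lit 1 ⨾ $x ≔ ! $λ) ⨾
  countDigits ⨾
  ($t ≔ ! $β ⟪ sub ⟫ ! $k ⨾ $τ ≔ ! $λ ⟪ div ⟫ lit 16) ⨾
  ($2τ ≔ lit 1 ⟪ shl ⟫ ! $τ ⨾ $bT ≔ ! $λ)

module Setup (𝕊 : Sizes) (G : Digraph (Sizes.n 𝕊)) (0<w : 0 < Sizes.w 𝕊)
             (len< : ∀ {v} → v < Sizes.n 𝕊 → Degrees.len G v < Sizes.λ′ 𝕊)
             (N≡ : Sizes.N 𝕊 ≡ Levels.first (Sizes.n 𝕊) (Degrees.len G) (Sizes.λ′ 𝕊)) where

  open Sizes 𝕊
  open Parameters 𝕊

  𝕀 : Input
  𝕀 = input G w M 0<w n<2^w

  planes : Planes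
  planes = record { 𝕀 = 𝕀 ; L = layout ; 1≤n = 1≤n ; len< = len< ; N≡ = N≡ }

  open Regions planes using (Context; _,ᶜ_; knows; learn)
  open Semantics 𝕀
  open Hoare 𝕀

  private
    ≤w⇒<2^w : ∀ {a} → a ≤ w → a < 2 ^ w
    ≤w⇒<2^w a≤ = ≤-<-trans a≤ (n<2^n w)

    lit-≤128⇓ : ∀ {ρ i} c → T (c ≤ᵇ 128) → ρ ⊢ lit {i} c ⇓ c
    lit-≤128⇓ c c≤ = lit⇓ (≤w⇒<2^w (≤-trans (≤ᵇ⇒≤ c 128 c≤) 128≤w))

    instance
      q≢0 : NonZero q
      q≢0 = >-nonZero 1≤q
      λ+λ≢0 : NonZero (λ′ + λ′)
      λ+λ≢0 = >-nonZero (≤-trans 1≤λ′ (m≤m+n λ′ λ′))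

  countDigits-run : ∀ y b {σ} → env σ $x ≡ y → env σ $k ≡ b → b + 2 * bitlen y < 2 ^ w →
    Run countDigits σ λ cost σ′ → cost ≤ bitlen y × env σ′ $k ≡ b + 2 * bitlen y
  countDigits-run = bitlen-induction
    (λ y m → ∀ b {σ} → env σ $x ≡ y → env σ $k ≡ b → b + 2 * m < 2 ^ w →
      Run countDigits σ λ cost σ′ → cost ≤ m × env σ′ $k ≡ b + 2 * m)
    (λ b x≡ k≡ _ → stop-loop (var⇓ x≡) (z≤n , trans k≡ (sym (+-identityʳ b))))
    λ y m y≢0 _ ih b x≡ k≡ b< →
      step-loop (var⇓ x≡) y≢0
        (set₂ (shr⇓ (var⇓ x≡) (lit-≤128⇓ 1 tt))
              (add⇓ (var⇓ k≡) (lit-≤128⇓ 2 tt) (≤-<-trans (+-monoʳ-≤ b (*-monoʳ-≤ 2 (s≤s z≤n))) b<)))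
        λ { _ (refl , refl) →
          weaken (ih (b + 2) refl refl (subst (_< 2 ^ w) (shift b m) b<))
            λ _ (cost≤ , k≡) → s≤s cost≤ , trans k≡ (sym (shift b m)) }
    where
    shift : ∀ b m → b + 2 * suc m ≡ b + 2 + 2 * m
    shift = solve-∀

  β≤w : β ≤ w
  β≤w = ≤-trans (m≤m*n β q) βq≤w

  λ+λ<2^w : λ′ + λ′ < 2 ^ w
  λ+λ<2^w = begin-strict
    λ′ + λ′         ≡⟨ cong (λ′ +_) (+-identityʳ λ′) ⟨
    2 * λ′          ≡⟨ *-comm 2 λ′ ⟩
    λ′ * 2          ≤⟨ *-monoʳ-≤ λ′ (≤-trans (≤ᵇ⇒≤ 2 21 tt) 21≤t) ⟩
    λ′ * t          <⟨ λ′t< ⟩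
    2 ^ (β ∸ t)     ≤⟨ 2^-mono (≤-trans (m∸n≤m β t) β≤w) ⟩
    2 ^ w           ∎
    where open ≤-Reasoning

  λ′<2^w : λ′ < 2 ^ w
  λ′<2^w = ≤-<-trans (m≤m+n λ′ λ′) λ+λ<2^w

  q≤w : q ≤ w
  q≤w = ≤-trans (m≤n*m q β {{>-nonZero (≤-trans 1≤t t≤β)}}) βq≤w

  2^τ<2^w : 2 ^ τ < 2 ^ w
  2^τ<2^w = ≤-<-trans (≤-trans (m≤n+m (2 ^ τ) λ′) (≤-trans (m≤m+n _ W) (≤-trans (m≤m+n _ W) (m≤m+n _ V)))) cap<2^w

  chooseParameters-run : ∀ {σ} → (∀ j → word σ j < 2 ^ w) →
    Run chooseParameters σ λ cost σ′ → cost ≤ bitlen n + ρ × Context early σ′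
  chooseParameters-run {σ} words = weaken values λ f (cost≤ , q₁ , β₁ , λ₁ , τ₁ , 2τ₁ , t₁ , bT₁) → cost≤ ,
    (record { q≡ = q₁ ; β≡ = β₁ ; words< = λ { zero → subst (_< 2 ^ w) (sym (var≡ f $w₀ refl)) (words zero)
                                             ; (suc j) → subst (λ μ → μ j < 2 ^ w) (sym (mem≡ f refl)) (words (suc j)) } } ,ᶜ
     learn λ₁ (learn τ₁ (learn 2τ₁ (learn t₁ (learn bT₁ (knows λ _ ()))))))
    where
    values : Run chooseParameters σ λ cost σ′ → cost ≤ bitlen n + ρ × env σ′ $q ≡ q × env σ′ $β ≡ β ×
      env σ′ $λ ≡ λ′ × env σ′ $τ ≡ τ × env σ′ $2τ ≡ 2 ^ τ × env σ′ $t ≡ t × env σ′ $bT ≡ λ′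
    values =
      set₂ (lit-≤128⇓ 128 tt) vertices⇓ ▸ λ { _ (refl , refl) →
      countDigits-run n 128 refl refl (subst (_< 2 ^ w) λ′≡ λ′<2^w) ▸ λ { {c₁} _ (c₁≤ , k≡) →
      set₁ (var⇓ (trans k≡ (sym λ′≡))) ▸ λ { _ (refl , refl) →
      set₂ (value≡ (trans (+-comm _ 1) (sym q≡))
              (add⇓ (div⇓ wordLen⇓ (add⇓ (var⇓ refl) (var⇓ refl) λ+λ<2^w)) (lit-≤128⇓ 1 tt)
                (subst (_< 2 ^ w) (sym (trans (+-comm _ 1) (sym q≡))) (≤w⇒<2^w q≤w))))
           (value≡ (sym β≡) (div⇓ wordLen⇓ (var⇓ refl))) ▸ λ { _ (refl , refl) →
      set₂ (lit-≤128⇓ 1 tt) (var⇓ refl) ▸ λ { _ (refl , refl) →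
      countDigits-run λ′ 1 refl refl (subst (_< 2 ^ w) r₁ (≤w⇒<2^w (≤-trans r≤β β≤w))) ▸ λ { {c₂} f (c₂≤ , k₂≡) →
      set₂ (value≡ (sym t≡) (sub⇓ (var⇓ (var≡ f $β refl)) (var⇓ (trans k₂≡ (sym r₁))) r≤β))
           (value≡ (sym τ≡) (div⇓ (var⇓ (var≡ f $λ refl)) (lit-≤128⇓ 16 tt))) ▸ λ { _ (refl , refl) →
      weaken (set₂ (value≡ (trans (cong (_%2^ w) (*-identityˡ (2 ^ τ))) (<⇒%2^≡ w 2^τ<2^w)) (shl⇓ (lit-≤128⇓ 1 tt) (var⇓ refl)))
                   (var⇓ (var≡ f $λ refl)))
        λ { _ (refl , refl) →
          +-mono-≤ c₁≤ (≤-trans (≤-reflexive (+-identityʳ c₂)) (≤-trans c₂≤ (≤-reflexive (sym ρ≡)))) ,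
          var≡ f $q refl , var≡ f $β refl , var≡ f $λ refl , refl , refl , refl , refl } } } } } } } }
      where
      r₁ : r ≡ 1 + 2 * bitlen λ′
      r₁ = trans r≡ (cong (λ ρ → suc (2 * ρ)) ρ≡)

-- From the number N of cells to the three bounds

-- Bernoulli's inequality without denominators: the power u ^ (k + 1) lies above its tangent at v.
-- The induction step multiplies by u and uses 2uv ≤ u² + v².
bernoulli : ∀ k u v → suc k * (v ^ k * u) ≤ u ^ suc k + k * v ^ suc k
bernoulli zero    u v = ≤-reflexive (base u)
  where
  base : ∀ u → 1 * (1 * u) ≡ u * 1 + 0
  base = solve-∀
bernoulli (suc k) u v = certify 0 (+-mono-≤ (*-monoˡ-≤ u (bernoulli k u v)) (*-monoʳ-≤ (suc k) (*-monoʳ-≤ (v ^ k) square)))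
  (account k u v (u ^ suc k) (v ^ k))
  where
  square : 2 * (u * v) ≤ u * u + v * v
  square = ≤-trans (≤-reflexive (cong (u * v +_) (+-identityʳ (u * v)))) (mixed u v)
    where
    mixed : ∀ u v → u * v + u * v ≤ u * u + v * v
    mixed u v with ≤-total u v
    ... | inj₁ u≤v with d , refl ← m≤n⇒∃[o]m+o≡n u≤v = ≤-trans (m≤m+n _ (d * d)) (≤-reflexive (expand u d))
      where
      expand : ∀ u d → u * (u + d) + u * (u + d) + d * d ≡ u * u + (u + d) * (u + d)
      expand = solve-∀
    ... | inj₂ v≤u with d , refl ← m≤n⇒∃[o]m+o≡n v≤u = ≤-trans (m≤m+n _ (d * d)) (≤-reflexive (expand v d))
      where
      expand : ∀ v d → (v + d) * v + (v + d) * v + d * d ≡ (v + d) * (v + d) + v * v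
      expand = solve-∀
  account : ∀ k u v p q →
    u * p + suc k * (v * (v * q)) + (suc k * (q * u) * u + suc k * (q * (2 * (u * v)))) ≡
    suc (suc k) * (v * q * u) + ((p + k * (v * q)) * u + suc k * (q * (u * u + v * v))) + 0
  account = solve-∀

^-distribʳ-* : ∀ n a b → (a * b) ^ n ≡ a ^ n * b ^ n
^-distribʳ-* zero    a b = refl
^-distribʳ-* (suc n) a b = trans (cong (a * b *_) (^-distribʳ-* n a b)) (swap a b (a ^ n) (b ^ n))
  where
  swap : ∀ a b c d → a * b * (c * d) ≡ a * c * (b * d)
  swap = solve-∀

-- Weighted AM-GM for k copies of S / k and one copy of a.
am-gm-step : ∀ k S a .{{_ : NonZero k}} → suc k ^ suc k * (S ^ k * a) ≤ k ^ k * (S + a) ^ suc k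
am-gm-step k S a = *-cancelˡ-≤ k (+-cancelʳ-≤ (k * (suc k * S) ^ suc k) _ _ (begin
  k * (suc k ^ suc k * (S ^ k * a)) + k * (suc k * S) ^ suc k
    ≡⟨ cong (λ p → k * (suc k ^ suc k * (S ^ k * a)) + k * p) (^-distribʳ-* (suc k) (suc k) S) ⟩
  k * (suc k ^ suc k * (S ^ k * a)) + k * (suc k ^ suc k * S ^ suc k)
    ≡⟨ left k (suc k) (suc k ^ k) (S ^ k) S a ⟩
  suc k * (suc k ^ k * S ^ k * (k * (S + a)))
    ≡⟨ cong (λ p → suc k * (p * (k * (S + a)))) (^-distribʳ-* k (suc k) S) ⟨
  suc k * ((suc k * S) ^ k * (k * (S + a)))
    -- The two arguments are in the ratio of the mean (S + a) / (k + 1) to the mean S / k, cleared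
    -- of denominators.
    ≤⟨ bernoulli k (k * (S + a)) (suc k * S) ⟩
  (k * (S + a)) ^ suc k + k * (suc k * S) ^ suc k
    ≡⟨ cong (_+ k * (suc k * S) ^ suc k) (trans (^-distribʳ-* (suc k) k (S + a)) (*-assoc k (k ^ k) _)) ⟩
  k * (k ^ k * (S + a) ^ suc k) + k * (suc k * S) ^ suc k ∎))
  where
  open ≤-Reasoning
  left : ∀ k k′ p s S a → k * (k′ * p * (s * a)) + k * (k′ * p * (S * s)) ≡ k′ * (p * s * (k * (S + a)))
  left = solve-∀

product : ∀ {n} → (Fin n → ℕ) → ℕ
product {zero}  f = 1
product {suc n} f = f zero * product (f ∘ suc)

am-gm : ∀ {n} (f : Fin n → ℕ) → n ^ n * product f ≤ sum f ^ n
am-gm {zero}        f = ≤-refl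
am-gm {suc zero}    f = ≤-reflexive (base (f zero))
  where
  base : ∀ a → 1 * 1 * (a * 1) ≡ (a + 0) * 1
  base = solve-∀
am-gm {suc k@(suc _)} f = *-cancelˡ-≤ (k ^ k) {{m^n≢0 k k}} (begin
  k ^ k * (suc k ^ suc k * (f zero * product g))   ≡⟨ regroup (k ^ k) (suc k ^ suc k) (f zero) (product g) ⟩
  suc k ^ suc k * (k ^ k * product g * f zero)     ≤⟨ *-monoʳ-≤ (suc k ^ suc k) (*-monoˡ-≤ (f zero) (am-gm g)) ⟩
  suc k ^ suc k * (sum g ^ k * f zero)             ≤⟨ am-gm-step k (sum g) (f zero) ⟩
  k ^ k * (sum g + f zero) ^ suc k                 ≡⟨ cong (λ s → k ^ k * s ^ suc k) (+-comm (sum g) (f zero)) ⟩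
  k ^ k * sum f ^ suc k                            ∎)
  where
  open ≤-Reasoning
  g = f ∘ suc
  regroup : ∀ a b c d → a * (b * (c * d)) ≡ b * (a * d * c)
  regroup = solve-∀

product-mono : ∀ {n} {f g : Fin n → ℕ} → (∀ i → f i ≤ g i) → product f ≤ product g
product-mono {zero}  h = ≤-refl
product-mono {suc n} h = *-mono-≤ (h zero) (product-mono (h ∘ suc))

2^-sum : ∀ {n} (f : Fin n → ℕ) → 2 ^ sum f ≡ product λ i → 2 ^ f i
2^-sum {zero}  f = refl
2^-sum {suc n} f = trans (2^-+ (f zero) _) (cong (2 ^ f zero *_) (2^-sum (f ∘ suc)))

3b≤2^b+2 : ∀ b → 3 * b ≤ 2 ^ b + 2
3b≤2^b+2 0 = z≤n
3b≤2^b+2 1 = s≤s (s≤s (s≤s z≤n))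
3b≤2^b+2 (suc (suc b)) = begin
  3 * suc (suc b)       ≡⟨ expand b ⟩
  3 * b + 4 + 2         ≤⟨ +-monoˡ-≤ 2 (≤-trans (+-monoˡ-≤ 4 (*-monoˡ-≤ b {3} {4} (s≤s (s≤s (s≤s z≤n))))) (≤-reflexive (sym (trans (*-suc 4 b) (+-comm 4 (4 * b)))))) ⟩
  4 * suc b + 2         ≤⟨ +-monoˡ-≤ 2 (*-monoʳ-≤ 4 (n<2^n b)) ⟩
  4 * 2 ^ b + 2         ≡⟨ cong (_+ 2) (2^-+ 2 b) ⟨
  2 ^ suc (suc b) + 2   ∎
  where
  open ≤-Reasoning
  expand : ∀ b → 3 * suc (suc b) ≡ 3 * b + 4 + 2
  expand = solve-∀

fieldLength : ℕ → ℕ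
fieldLength d = bitlen (d ∸ 1)

-- Equality holds at d = 3, where two bits are needed. This ratio 2/3, doubled because each digit
-- comes with a flag, is the constant 4/3 of (b).
3-fieldLength≤ : ∀ d → 3 * fieldLength d ≤ 2 * d
3-fieldLength≤ zero          = z≤n
3-fieldLength≤ (suc zero)    = z≤n
3-fieldLength≤ d@(suc (suc e)) = begin
  3 * bitlen (suc e)            ≤⟨ 3b≤2^b+2 (bitlen (suc e)) ⟩
  2 ^ bitlen (suc e) + 2        ≤⟨ +-monoˡ-≤ 2 (2^bitlen≤ (suc e) λ ()) ⟩
  2 * suc e + 2                 ≡⟨ +-comm (2 * suc e) 2 ⟩
  2 + 2 * suc e                 ≡⟨ *-suc 2 (suc e) ⟨
  2 * d                         ∎
  where open ≤-Reasoning

2^[1+fieldLength]≤ : ∀ d → 2 ^ suc (fieldLength d) ≤ 2 + 4 * d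
2^[1+fieldLength]≤ zero            = ≤-refl
2^[1+fieldLength]≤ (suc zero)      = s≤s (s≤s z≤n)
2^[1+fieldLength]≤ d@(suc (suc e)) = begin
  2 * 2 ^ bitlen (suc e)        ≤⟨ *-monoʳ-≤ 2 (2^bitlen≤ (suc e) λ ()) ⟩
  2 * (2 * suc e)               ≡⟨ *-assoc 2 2 (suc e) ⟨
  4 * suc e                     ≤⟨ *-monoʳ-≤ 4 (n≤1+n (suc e)) ⟩
  4 * d                         ≤⟨ m≤n+m (4 * d) 2 ⟩
  2 + 4 * d                     ∎
  where open ≤-Reasoning

⌈log₂1+2^⌉ : ∀ k → suc k ≤ ⌈log₂ suc (2 ^ k) ⌉
⌈log₂1+2^⌉ zero    = ≤-refl
⌈log₂1+2^⌉ (suc k) = ∸1 (≤-trans (⌈log₂1+2^⌉ k) (≤-reflexive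
    (trans (cong ⌈log₂_⌉ (sym half)) (⌈log₂⌈n/2⌉⌉≡⌈log₂n⌉∸1 (suc (2 ^ suc k))))))
  where
  ∸1 : ∀ {a b} → suc a ≤ b ∸ 1 → suc (suc a) ≤ b
  ∸1 {b = suc b} h = s≤s h
  half : ⌈ suc (2 ^ suc k) /2⌉ ≡ suc (2 ^ k)
  half = cong suc (trans (cong (λ x → ⌊ 2 ^ k + x /2⌋) (+-identityʳ (2 ^ k))) (sym (n≡⌊n+n/2⌋ (2 ^ k))))

-- For d ≥ 2 and k = ⌊log₂ (d - 1)⌋ the field has k + 1 bits. Since d is at least 2 ^ k + 1, its
-- logarithm rounded up is at least k + 1.
fieldLength≤⌈log₂⌉ : ∀ d → fieldLength d ≤ (if 2 ≤ᵇ d then ⌈log₂ d ⌉ else 0)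
fieldLength≤⌈log₂⌉ zero            = z≤n
fieldLength≤⌈log₂⌉ (suc zero)      = z≤n
fieldLength≤⌈log₂⌉ d@(suc (suc e)) = ≤-trans (⌈log₂1+2^⌉ ⌊log₂ suc e ⌋)
  (⌈log₂⌉-mono-≤ {suc (2 ^ ⌊log₂ suc e ⌋)} {d} (s≤s (*-cancelˡ-≤ 2 (2^bitlen≤ (suc e) λ ()))))

module Bounds {n : ℕ} (G : Digraph n) where

  open Digraph G
  open Edges G using (sum-indeg≤edgeCount)

  cells : ℕ
  cells = sum λ v → suc (fieldLength (indeg v))

  cells≡ : cells ≡ n + sum (λ v → fieldLength (indeg v))
  cells≡ = trans (∑-distrib-+ {n} (λ _ → 1) λ v → fieldLength (indeg v)) (cong (_+ sum (λ v → fieldLength (indeg v))) (trans (sum-const n 1) (*-identityʳ n)))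

  CellBound : ℕ → ℕ → Set
  CellBound c s = s * lg n ≤ 2 * cells * (lg n + c * lglg n)

  boundA : ∀ {c s} → CellBound c s → BoundA c G s
  boundA {c} h = ≤-trans h (*-monoˡ-≤ (lg n + c * lglg n) (begin
    2 * cells                                       ≡⟨ cong (2 *_) cells≡ ⟩
    2 * (n + sum (λ v → fieldLength (indeg v)))     ≤⟨ *-monoʳ-≤ 2 (+-monoʳ-≤ n (sum-mono λ v → fieldLength≤⌈log₂⌉ (indeg v))) ⟩
    2 * (n + L₀ⁱⁿ)                                  ≡⟨ *-distribˡ-+ 2 n L₀ⁱⁿ ⟩
    2 * n + 2 * L₀ⁱⁿ                                ∎))
    where open ≤-Reasoning

  boundB : ∀ {c s} → CellBound c s → BoundB c G s
  boundB {c} {s} h = begin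
    3 * (s * lg n)               ≤⟨ *-monoʳ-≤ 3 h ⟩
    3 * (2 * cells * Q)          ≡⟨ regroup cells Q ⟩
    6 * cells * Q                ≤⟨ *-monoˡ-≤ Q 6cells≤ ⟩
    (6 * n + 4 * edgeCount) * Q  ∎
    where
    open ≤-Reasoning
    Q = lg n + c * lglg n
    Λ = sum λ v → fieldLength (indeg v)
    regroup : ∀ a q → 3 * (2 * a * q) ≡ 6 * a * q
    regroup = solve-∀
    6cells≤ : 6 * cells ≤ 6 * n + 4 * edgeCount
    6cells≤ = begin
      6 * cells                                ≡⟨ trans (cong (6 *_) cells≡) (*-distribˡ-+ 6 n Λ) ⟩
      6 * n + 6 * Λ                            ≡⟨ cong (6 * n +_) (*-assoc 2 3 Λ) ⟩
      6 * n + 2 * (3 * Λ)                      ≡⟨ cong (λ x → 6 * n + 2 * x) (sum-*ˡ 3 (λ v → fieldLength (indeg v))) ⟨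
      6 * n + 2 * sum (λ v → 3 * fieldLength (indeg v))  ≤⟨ +-monoʳ-≤ (6 * n) (*-monoʳ-≤ 2 (sum-mono λ v → 3-fieldLength≤ (indeg v))) ⟩
      6 * n + 2 * sum (λ v → 2 * indeg v)      ≡⟨ cong (λ x → 6 * n + 2 * x) (sum-*ˡ 2 indeg) ⟩
      6 * n + 2 * (2 * sum indeg)              ≡⟨ cong (6 * n +_) (*-assoc 2 2 (sum indeg)) ⟨
      6 * n + 4 * sum indeg                    ≤⟨ +-monoʳ-≤ (6 * n) (*-monoʳ-≤ 4 sum-indeg≤edgeCount) ⟩
      6 * n + 4 * edgeCount                    ∎

  -- An integer form of cells ≤ n log₂ ((2n + 4m) / n); `am-gm` takes the place of the concavity of
  -- the logarithm.
  2^cells : 2 ^ cells * n ^ n ≤ (2 * n + 4 * edgeCount) ^ n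
  2^cells = begin
    2 ^ cells * n ^ n                      ≡⟨ trans (*-comm (2 ^ cells) (n ^ n)) (cong (n ^ n *_) (2^-sum λ v → suc (fieldLength (indeg v)))) ⟩
    n ^ n * product (λ v → 2 ^ suc (fieldLength (indeg v)))
                                           ≤⟨ *-monoʳ-≤ (n ^ n) (product-mono λ v → 2^[1+fieldLength]≤ (indeg v)) ⟩
    n ^ n * product (λ v → 2 + 4 * indeg v) ≤⟨ am-gm (λ v → 2 + 4 * indeg v) ⟩
    sum (λ v → 2 + 4 * indeg v) ^ n        ≤⟨ ^-monoˡ-≤ n total ⟩
    (2 * n + 4 * edgeCount) ^ n            ∎
    where
    open ≤-Reasoning
    total : sum (λ v → 2 + 4 * indeg v) ≤ 2 * n + 4 * edgeCount
    total = ≤-trans (≤-reflexive (trans (∑-distrib-+ {n} (λ _ → 2) λ v → 4 * indeg v)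
        (cong₂ _+_ (trans (sum-const n 2) (*-comm n 2)) (sum-*ˡ 4 indeg))))
      (+-monoʳ-≤ (2 * n) (*-monoʳ-≤ 4 sum-indeg≤edgeCount))

  boundC : ∀ {c s} → CellBound c s → BoundC c G s
  boundC {c} {s} h = begin
    2 ^ (s * lg n) * n ^ (2 * n * Q)            ≤⟨ *-monoˡ-≤ (n ^ (2 * n * Q)) (2^-mono h) ⟩
    2 ^ (2 * cells * Q) * n ^ (2 * n * Q)       ≡⟨ cong₂ (λ a b → 2 ^ a * n ^ b) (regroup cells Q) (regroup n Q) ⟩
    2 ^ (cells * (2 * Q)) * n ^ (n * (2 * Q))   ≡⟨ cong₂ _*_ (^-*-assoc 2 cells (2 * Q)) (^-*-assoc n n (2 * Q)) ⟨
    (2 ^ cells) ^ (2 * Q) * (n ^ n) ^ (2 * Q)   ≡⟨ ^-distribʳ-* (2 * Q) (2 ^ cells) (n ^ n) ⟨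
    (2 ^ cells * n ^ n) ^ (2 * Q)               ≤⟨ ^-monoˡ-≤ (2 * Q) 2^cells ⟩
    ((2 * n + 4 * edgeCount) ^ n) ^ (2 * Q)     ≡⟨ trans (^-*-assoc (2 * n + 4 * edgeCount) n (2 * Q)) (cong ((2 * n + 4 * edgeCount) ^_) (sym (regroup n Q))) ⟩
    (2 * n + 4 * edgeCount) ^ (2 * n * Q)       ∎
    where
    open ≤-Reasoning
    Q = lg n + c * lglg n
    regroup : ∀ a q → 2 * a * q ≡ a * (2 * q)
    regroup = solve-∀

-- The whole program, its running time and the choice of the store

topologicalSort : Stmt
topologicalSort =
  -- The literal 128 might not fit into a short word; seven halvings test whether w ≥ 128 with the
  -- literal 1 only.
  if wordLen ⟪ shr ⟫ lit 1 ⟪ shr ⟫ lit 1 ⟪ shr ⟫ lit 1 ⟪ shr ⟫ lit 1 ⟪ shr ⟫ lit 1 ⟪ shr ⟫ lit 1 ⟪ shr ⟫ lit 1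
  then (chooseParameters ⨾ buildFields ⨾ sortVertices decrement exchange)
  else′ (directInit ⨾ sortVertices directDecrement directExchange)

sumBelow-sucˡ : ∀ f n → sumBelow f (suc n) ≡ f 0 + sumBelow (f ∘ suc) n
sumBelow-sucˡ f n = sumBelow-+ f 1 n

sumBelow≡sum : ∀ f n → sumBelow f n ≡ sum {n} (f ∘ toℕ)
sumBelow≡sum f zero    = refl
sumBelow≡sum f (suc n) = trans (sumBelow-sucˡ f n) (cong (f 0 +_) (sumBelow≡sum (f ∘ suc) n))

-- As a record, the inequality lets its parameters be inferred, and the constants of the running
-- time add up along a chain of `_⊹_`.
record Linear (X c a : ℕ) : Set where
  constructor linear
  field bound : a ≤ c * X

open Linear

infixr 6 _⊹_
infixr 7 _≤∘_

_⊹_ : ∀ {a b c d X} → Linear X c a → Linear X d b → Linear X (c + d) (a + b)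
_⊹_ {c = c} {d} {X} (linear h) (linear h′) = linear (≤-trans (+-mono-≤ h h′) (≤-reflexive (sym (*-distribʳ-+ X c d))))

_≤∘_ : ∀ {a b c X} → a ≤ b → Linear X c b → Linear X c a
h ≤∘ linear h′ = linear (≤-trans h h′)

linear₁ : ∀ {a X} → a ≤ X → Linear X 1 a
linear₁ {X = X} h = linear (≤-trans h (≤-reflexive (sym (*-identityˡ X))))

linear-const : ∀ c {X} → 1 ≤ X → Linear X c c
linear-const c h = linear (≤-trans (≤-reflexive (sym (*-identityʳ c))) (*-monoʳ-≤ c h))

linear-* : ∀ {a c X} k → Linear X c a → Linear X (c * k) (a * k)
linear-* {c = c} {X} k (linear h) = linear (≤-trans (*-monoˡ-≤ k h) (≤-reflexive (trans (*-assoc c X k) (trans (cong (c *_) (*-comm X k)) (sym (*-assoc c k X))))))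

abstract
  -- A sum in place of the maximum of the constants for long and for short words. It is opaque
  -- because its value should not be unfolded.
  spaceConstant : ℕ
  spaceConstant = 128 + K + 128 * 128

  128+K≤spaceConstant : 128 + K ≤ spaceConstant
  128+K≤spaceConstant = m≤m+n (128 + K) (128 * 128)

  128*128≤spaceConstant : 128 * 128 ≤ spaceConstant
  128*128≤spaceConstant = m≤n+m (128 * 128) (128 + K)

-- The sums have the shape of the corresponding cost estimates. In them 37 is `suc chunks`, the cost
-- of one step of a walk, and 75 is `suc unit` for the bit store.
shortTime buildTime longTime : ℕ
shortTime = 1 + (1 + (4 * 1 + 1))
buildTime = 256 * 2 + ((128 + 2) + (1 + ((128 + 2) + ((1 + 1) + (1 + ((1 + 1) * 37 + 37))))))
longTime = 1 + (128 + 2) + (buildTime + (1 + (4 * 75 + 75)))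

module Potential (𝕀 : Input) where

  open Input 𝕀
  open Digraph G
  open Edges G using (sum-indeg≤edgeCount)
  open Stores 𝕀

  module _ (S : Store) where

    open Store S
    open Sorting S using (potential; pot; stake; fee)

    initial-potential≤ : potential (λ v → indeg v ∸ 1) (λ _ → 0) (λ _ → fresh) ≤ (4 * suc unit + suc unit) * (n + edgeCount)
    initial-potential≤ = begin
      potential (λ v → indeg v ∸ 1) (λ _ → 0) (λ _ → fresh)
        ≡⟨ ∑-distrib-+ (λ v → suc unit * outdeg v) (λ v → stake fresh v (indeg v ∸ 1)) ⟩
      sum (λ v → suc unit * outdeg v) + sum (λ v → stake fresh v (indeg v ∸ 1))
        ≤⟨ +-mono-≤ (≤-reflexive (sum-*ˡ (suc unit) outdeg)) (sum-mono stake≤) ⟩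
      suc unit * edgeCount + sum (λ v → 4 * suc unit * suc (indeg v))
        ≡⟨ cong (suc unit * edgeCount +_) (trans (sum-*ˡ (4 * suc unit) (suc ∘ indeg))
             (cong (4 * suc unit *_) (trans (∑-distrib-+ {n} (λ _ → 1) indeg) (cong (_+ sum indeg) (trans (sum-const n 1) (*-identityʳ n)))))) ⟩
      suc unit * edgeCount + 4 * suc unit * (n + sum indeg)
        ≤⟨ +-mono-≤ (*-monoʳ-≤ (suc unit) (m≤n+m edgeCount n)) (*-monoʳ-≤ (4 * suc unit) (+-monoʳ-≤ n sum-indeg≤edgeCount)) ⟩
      suc unit * (n + edgeCount) + 4 * suc unit * (n + edgeCount)
        ≡⟨ trans (+-comm _ (4 * suc unit * (n + edgeCount))) (sym (*-distribʳ-+ (n + edgeCount) (4 * suc unit) (suc unit))) ⟩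
      (4 * suc unit + suc unit) * (n + edgeCount) ∎
      where
      open ≤-Reasoning
      stake≤ : ∀ v → stake fresh v (indeg v ∸ 1) ≤ 4 * suc unit * suc (indeg v)
      stake≤ v = ≤-trans (+-monoˡ-≤ (fee v + fee v + fee v) (credit≤ v (indeg v ∸ 1)))
        (certify (suc (4 * indeg v)) (≤-refl {0}) (account unit (indeg v)))
        where
        account : ∀ u d → 4 * suc u * suc d + 0 ≡ u * suc d + (suc (u * suc d) + suc (u * suc d) + suc (u * suc d)) + 0 + suc (4 * d)
        account = solve-∀

module Correctness {n : ℕ} (G : Digraph n) (1≤n : 1 ≤ n) (acyclic : Digraph.Acyclic G) (w : ℕ)
                   (n+m<2^w : n + Digraph.edgeCount G < 2 ^ w) where

  open Digraph G
  open Degrees G using (len; degree; degree-≤; degree-toℕ)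
  open Edges G using (trace; Sorted; sorted⇒order)
  open Bounds G using (cells; cells≡; CellBound)
  module L = Levels n len

  X : ℕ
  X = n + edgeCount

  n<2^w : n < 2 ^ w
  n<2^w = ≤-<-trans (m≤m+n n edgeCount) n+m<2^w

  0<w : 0 < w
  0<w = n≢0⇒n>0 λ w≡0 → <⇒≱ (subst (λ w → n < 2 ^ w) w≡0 n<2^w) 1≤n

  1≤X : 1 ≤ X
  1≤X = ≤-trans 1≤n (m≤m+n n edgeCount)

  n≤ : Linear X 1 n
  n≤ = linear₁ (m≤m+n n edgeCount)

  len≤ : ∀ v → len v ≤ bitlen n
  len≤ v = bitlen-mono (≤-trans (m∸n≤m (degree v) 1) (degree-≤ v))

  λ′ N : ℕ
  λ′ = 128 + 2 * bitlen n
  N  = L.first λ′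

  total : sumBelow (suc ∘ len) n ≡ cells
  total = trans (sumBelow≡sum (suc ∘ len) n) (sum-cong λ v → cong (λ d → suc (fieldLength d)) (degree-toℕ v))

  cells≤X : cells ≤ X
  cells≤X = ≤-trans (≤-reflexive cells≡) (+-monoʳ-≤ n (≤-trans
    (sum-mono λ v → ≤-trans (bitlen-id-≤ (indeg v ∸ 1)) (m∸n≤m (indeg v) 1)) (Edges.sum-indeg≤edgeCount G)))

  N≤cells : N ≤ cells
  N≤cells = ≤-trans (L.first-total λ′) (≤-reflexive total)

  N<2^w : N < 2 ^ w
  N<2^w = ≤-<-trans (≤-trans N≤cells cells≤X) n+m<2^w

  N≤ : N ≤ n * suc (bitlen n)
  N≤ = ≤-trans (L.first-total λ′) (≤-trans (sumBelow-mono n λ v _ → s≤s (len≤ v)) (≤-reflexive (sumBelow-const (suc (bitlen n)) n)))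

  n≤N : n ≤ N
  n≤N = ≤-trans (≤-reflexive (sym (L.before-0 n))) (L.first-≤ {1} {λ′} (s≤s z≤n))

  len<λ′ : ∀ {v} → v < n → len v < λ′
  len<λ′ {v} _ = ≤-<-trans (len≤ v) (s≤s (≤-trans (m≤m+n (bitlen n) _) (m≤n+m (2 * bitlen n) 127)))

  bitlen≤ : Linear X 1 (bitlen n)
  bitlen≤ = bitlen-id-≤ n ≤∘ n≤

  λ′≤ : Linear X (128 + 2) λ′
  λ′≤ = linear-const 128 1≤X ⊹ linear {X} {2} {2 * bitlen n} (*-monoʳ-≤ 2 (≤-trans (bitlen-id-≤ n) (m≤m+n n edgeCount)))

  𝕀 : ℕ → Input
  𝕀 M = input G w M 0<w n<2^w

  Sorts : ℕ → ℕ → Set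
  Sorts M T = ∀ {σ} → (∀ j → word σ j < 2 ^ w) → emitted σ ≡ [] →
    Hoare.Run (𝕀 M) topologicalSort σ λ cost σ′ →
      Linear X T cost × ∃[ vs ] emitted σ′ ≡ trace vs × Sorted vs × (∀ v → v ∈ vs)

  test : ∀ {M ρ} → Semantics._⊢_⇓_ (𝕀 M) ρ {suc top}
    (wordLen ⟪ shr ⟫ lit 1 ⟪ shr ⟫ lit 1 ⟪ shr ⟫ lit 1 ⟪ shr ⟫ lit 1 ⟪ shr ⟫ lit 1 ⟪ shr ⟫ lit 1 ⟪ shr ⟫ lit 1) (w / 128)
  test {M} = value≡ halved (shr⇓ (shr⇓ (shr⇓ (shr⇓ (shr⇓ (shr⇓ (shr⇓ wordLen⇓ 1⇓) 1⇓) 1⇓) 1⇓) 1⇓) 1⇓) 1⇓)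
    where
    open Semantics (𝕀 M)
    1⇓ : ∀ {ρ i} → ρ ⊢ lit {i} 1 ⇓ 1
    1⇓ = lit⇓ (≤-<-trans 0<w (n<2^n w))
    halved : w / 2 / 2 / 2 / 2 / 2 / 2 / 2 ≡ w / 128
    halved =
      trans (m/n/o≡m/[n*o] (w / 2 / 2 / 2 / 2 / 2) 2 2) (
      trans (m/n/o≡m/[n*o] (w / 2 / 2 / 2 / 2) 2 4) (
      trans (m/n/o≡m/[n*o] (w / 2 / 2 / 2) 2 8) (
      trans (m/n/o≡m/[n*o] (w / 2 / 2) 2 16) (
      trans (m/n/o≡m/[n*o] (w / 2) 2 32) (m/n/o≡m/[n*o] w 2 64)))))

  module Short (w<128 : w < 128) where

    M : ℕ
    M = n ∸ 1

    open Hoare (𝕀 M)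
    open DirectStore (𝕀 M) (≤-trans (≤-reflexive (sym (m+[n∸m]≡n 1≤n))) (≤-reflexive (sym (*-identityʳ (suc M)))))
    open Stores (𝕀 M)
    open Sorting directStore using (sort-run)

    sorts : Sorts M shortTime
    sorts words out = branch test (λ w/128≢0 → ⊥-elim (w/128≢0 (m<n⇒m/n≡0 w<128)))
      λ _ → directInit-run words ▸ λ { f (c₁≤ , rep) →
        weaken (sort-run acyclic (trans (out≡ f refl) out) rep) λ { _ (c₂≤ , result) →
          c₁≤ ≤∘ n≤ ⊹ c₂≤ ≤∘ (n≤ ⊹ linear (Potential.initial-potential≤ (𝕀 M) directStore)) ,
          result } }

    -- For w < 128 also lg n is below 128. Then lglg n / lg n is bounded from below by a constant,
    -- and the error term absorbs a whole word per vertex.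
    cellBound : 4 ≤ n → CellBound spaceConstant (M * w)
    cellBound 4≤n = begin
      M * w * lg n                      ≤⟨ *-mono-≤ (*-mono-≤ (m∸n≤m n 1) (<⇒≤ w<128)) (≤-trans lg≤w (<⇒≤ w<128)) ⟩
      n * 128 * 128                     ≡⟨ *-assoc n 128 128 ⟩
      n * (128 * 128)                   ≤⟨ *-mono-≤ (≤-trans n≤N (≤-trans N≤cells (m≤m+n cells _))) 128*128≤spaceConstant ⟩
      2 * cells * c                     ≤⟨ *-monoʳ-≤ (2 * cells) (≤-trans (≤-reflexive (sym (*-identityʳ c))) (*-monoʳ-≤ c 1≤lglg)) ⟩
      2 * cells * (c * lglg n)          ≤⟨ *-monoʳ-≤ (2 * cells) (m≤n+m (c * lglg n) (lg n)) ⟩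
      2 * cells * (lg n + c * lglg n)   ∎
      where
      open ≤-Reasoning
      c = spaceConstant
      lg≤bitlen : ∀ m → lg m ≤ bitlen m
      lg≤bitlen zero    = z≤n
      lg≤bitlen (suc m) = n≤1+n _
      lg≤w : lg n ≤ w
      lg≤w = ≤-trans (lg≤bitlen n) (bitlen-≤ n<2^w)
      1≤lglg : 1 ≤ lglg n
      1≤lglg = ⌊log₂⌋-mono-≤ {2} (⌊log₂⌋-mono-≤ {4} 4≤n)

  module Long (128≤w : 128 ≤ w) where

    𝕊 : Sizes
    𝕊 = record { n = n ; w = w ; N = N ; 1≤n = 1≤n ; n<2^w = n<2^w ; 128≤w = 128≤w ; N<2^w = N<2^w ; N≤ = N≤ ; λ′ = λ′ ; λ′≡ = refl }

    open Parameters 𝕊 using (M; ρ; τ; W; ρ≡; τ≡; W≡; 1≤t) renaming (t to flagBits)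
    open Setup 𝕊 G 0<w len<λ′ refl using (planes; chooseParameters-run)
    open BitStore planes using (bitStore; build-run; buildCost)
    open Hoare (𝕀 M)
    open Stores (𝕀 M)
    open Sorting bitStore using (sort-run)

    ρ≤ : Linear X (128 + 2) ρ
    ρ≤ = ≤-trans (≤-reflexive ρ≡) (bitlen-id-≤ λ′) ≤∘ λ′≤

    τ≤ : τ ≤ 8 + bitlen n
    τ≤ = ≤-trans (≤-reflexive τ≡) (≤-pred (m<n*o⇒m/o<n {λ′} {suc (8 + bitlen n)} {16} (begin-strict
      λ′                        ≤⟨ +-monoʳ-≤ 128 (*-monoˡ-≤ (bitlen n) (≤ᵇ⇒≤ 2 16 tt)) ⟩
      16 * 8 + 16 * bitlen n    ≡⟨ *-distribˡ-+ 16 8 (bitlen n) ⟨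
      16 * (8 + bitlen n)       ≡⟨ *-comm 16 (8 + bitlen n) ⟩
      (8 + bitlen n) * 16       <⟨ *-monoˡ-< 16 (n<1+n (8 + bitlen n)) ⟩
      suc (8 + bitlen n) * 16   ∎)))
      where open ≤-Reasoning

    2^τ≤ : Linear X (256 * 2) (2 ^ τ)
    2^τ≤ = linear (begin
      2 ^ τ                   ≤⟨ 2^-mono τ≤ ⟩
      2 ^ (8 + bitlen n)      ≡⟨ 2^-+ 8 (bitlen n) ⟩
      256 * 2 ^ bitlen n      ≤⟨ *-monoʳ-≤ 256 (2^bitlen≤ n (m<n⇒n≢0 1≤n)) ⟩
      256 * (2 * n)           ≡⟨ *-assoc 256 2 n ⟨
      256 * 2 * n             ≤⟨ *-monoʳ-≤ (256 * 2) (m≤m+n n edgeCount) ⟩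
      256 * 2 * X             ∎)
      where open ≤-Reasoning

    cells≤ : Linear X 1 (sumBelow (suc ∘ len) n)
    cells≤ = linear₁ (≤-trans (≤-reflexive total) cells≤X)

    W≤ : Linear X (1 + 1) W
    W≤ = ≤-reflexive W≡ ≤∘ (linear-const 1 1≤X ⊹ linear₁ (≤-trans (m/n≤m N flagBits {{>-nonZero 1≤t}}) (≤-trans N≤cells cells≤X)))

    buildCost≤ : Linear X buildTime buildCost
    buildCost≤ = 2^τ≤ ⊹ λ′≤ ⊹ cells≤ ⊹ λ′≤ ⊹ W≤ ⊹ cells≤ ⊹ linear-* 37 W≤ ⊹ fields≤
      where
      fields≤ : Linear X 37 (sumBelow (λ v → suc (37 * len v)) n)
      fields≤ = linear (begin
        sumBelow (λ v → suc (37 * len v)) n   ≤⟨ sumBelow-mono n (λ v _ → ≤-trans (+-monoˡ-≤ (37 * len v) (≤ᵇ⇒≤ 1 37 tt)) (≤-reflexive (sym (*-suc 37 (len v))))) ⟩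
        sumBelow (λ v → 37 * suc (len v)) n   ≡⟨ trans (sumBelow≡sum (λ v → 37 * suc (len v)) n) (sum-*ˡ 37 (λ (v : Fin n) → suc (len (toℕ v)))) ⟩
        37 * sum {n} (λ v → suc (len (toℕ v)))    ≡⟨ cong (37 *_) (sumBelow≡sum (suc ∘ len) n) ⟨
        37 * sumBelow (suc ∘ len) n           ≤⟨ *-monoʳ-≤ 37 (≤-trans (≤-reflexive total) cells≤X) ⟩
        37 * X                                ∎)
        where open ≤-Reasoning

    sorts : Sorts M longTime
    sorts words out = branch test (λ _ →
        chooseParameters-run words ▸ λ { f (c₁≤ , context) →
        build-run context ▸ λ { g (c₂≤ , st , fields) →
        weaken (sort-run acyclic (trans (out≡ g refl) (trans (out≡ f refl) out))
                  (st , λ v → sym (trans (fields (Fin.toℕ<n v)) (cong (_∸ 1) (degree-toℕ v)))))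
          λ { _ (c₃≤ , result) →
            c₁≤ ≤∘ (bitlen≤ ⊹ ρ≤) ⊹ c₂≤ ≤∘ buildCost≤ ⊹
              c₃≤ ≤∘ (n≤ ⊹ linear (Potential.initial-potential≤ (𝕀 M) bitStore)) ,
            result } } })
      λ w/128≡0 → ⊥-elim (<⇒≱ (m/n≡0⇒m<n w/128≡0) 128≤w)

    cellBound : 4 ≤ n → CellBound spaceConstant (M * w)
    cellBound 4≤n = ≤-trans (Space.space 𝕊 4≤n n≤N)
      (*-mono-≤ (*-monoʳ-≤ 2 N≤cells) (+-monoʳ-≤ (lg n) (*-monoˡ-≤ (lglg n) 128+K≤spaceConstant)))

  halts : ∀ {M} T → Sorts M T → (r : Vec (Word w) #regs) (μ : Vec (Word w) M) →
    ∃[ t ] ∃[ o ] ∃[ π ] Halts {w = w} G (compile 0 topologicalSort) (config 0 r μ []) t o ×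
      t ≤ weight topologicalSort * suc T * X ×
      List.map toℕ o ≡ List.tabulate (λ i → label (π ⟨$⟩ʳ i)) × IsTopologicalOrder π
  halts {M} T sorts r μ =
    let Hoare.run exec (cost≤ , vs , out , sorted , all) = sorts {initial r μ} words refl
        t , o , halted , t≤ , o≡ = compile-correct r μ exec
        π , vs≡ , order = sorted⇒order sorted all
    in t , o , π , halted ,
       ≤-trans t≤ (≤-trans (*-monoʳ-≤ (weight topologicalSort) (+-mono-≤ 1≤X (bound cost≤))) (≤-reflexive (sym (*-assoc (weight topologicalSort) (suc T) X)))) ,
       trans o≡ (trans out vs≡) , order
    where
    open Semantics (𝕀 M)
    words : ∀ j → word (initial r μ) j < 2 ^ w
    words zero    = Fin.toℕ<n (lookup r (reg $w₀))
    words (suc j) = readCell-< μ j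

  weaken-time : ∀ {M T T′} → T ≤ T′ → Sorts M T → Sorts M T′
  weaken-time {M} T≤ sorts words out = weaken (sorts words out) λ _ (cost≤ , result) → linear (≤-trans (bound cost≤) (*-monoˡ-≤ X T≤)) , result
    where open Hoare (𝕀 M)

  solution : ∃[ M ] (4 ≤ n → CellBound spaceConstant (M * w)) × Sorts M (shortTime + longTime)
  solution with w <? 128
  ... | yes w<128 = Short.M w<128 , Short.cellBound w<128 , weaken-time (m≤m+n shortTime longTime) (Short.sorts w<128)
  ... | no  w≮128 = let 128≤w = ≮⇒≥ w≮128 in
    _ , (λ 4≤n → Long.cellBound 128≤w 4≤n) , weaken-time (m≤n+m longTime shortTime) (Long.sorts 128≤w)

topologicalSortingIn : (B : Bound) → (∀ c {n} (G : Digraph n) {s} → Bounds.CellBound G c s → B c G s) → TopologicalSortingIn B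
topologicalSortingIn B bound =
  #regs , compile 0 topologicalSort , spaceConstant , weight topologicalSort * suc (shortTime + longTime) ,
  λ n 1≤n G acyclic w n+m<2^w →
    let open Correctness G 1≤n acyclic w n+m<2^w
        M , cellBound , sorts = solution
    in M , (λ 4≤n → bound _ G (cellBound 4≤n)) , halts (shortTime + longTime) sorts

theorem4p7 : TopologicalSortingIn BoundA ×
    TopologicalSortingIn BoundB ×
    TopologicalSortingIn BoundC
theorem4p7 =
  topologicalSortingIn BoundA (λ c G {s} → Bounds.boundA G {c} {s}) ,
  topologicalSortingIn BoundB (λ c G {s} → Bounds.boundB G {c} {s}) ,
  topologicalSortingIn BoundC (λ c G {s} → Bounds.boundC G {c} {s})
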